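{- Let $q>2$ and let $\chi$ be a primitive Dirichlet character mod $q$. Let $\rho'=\beta'+i\gamma'$ run over the critical points of the Riemann zeta function (points with $\zeta'(\rho')=0$) satisfying $\beta'>1$. Then $$\limsup_{\gamma'\to\infty}\frac{|L(\rho',\chi)|}{\log\log\gamma'}\geq e^{C_0}\frac{\phi(q)}{q}.$$
   Context: $\zeta$ is the Riemann zeta function, $L(s,\chi)$ is the Dirichlet $L$-function of $\chi$, $\phi$ is Euler's totient function, and $C_0$ is Euler's constant. The limsup is taken over the critical points $\rho'=\beta'+i\gamma'$ of $\zeta$ with $\beta'>1$ as $\gamma'\to+\infty$, with $q$ and $\chi$ fixed. The statement is unconditional. -}

module Defs where

open import Data.Nat as ℕ using (ℕ; zero; suc; _!)
import Data.Nat.Properties as ℕ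
import Data.Nat.Coprimality as ℕ
import Data.Nat.Divisibility as ℕ
open import Algebra.Bundles using (CommutativeMonoid)
open import Data.Integer as ℤ using (ℤ; +_)
open import Data.Integer.Coprimality using (Coprime)
open import Data.Rational as ℚ using (ℚ; 0ℚ; 1ℚ; ½; _+_; _*_; -_; _-_; 1/_; ∣_∣; _<_; _≤_; Positive)
open import Data.Rational.Properties as ℚ using (module ≤-Reasoning)
open import Algebra.Properties.CommutativeSemigroup
  (CommutativeMonoid.commutativeSemigroup ℚ.+-0-commutativeMonoid) using (interchange)
open import Data.List using (length; filter; map; upTo)
open import Data.Product using (Σ-syntax; ∃-syntax; _×_; _,_)
open import Data.Unit using (⊤)
open import Data.Empty using (⊥)
open import Relation.Nullary using (¬_)
open import Relation.Binary.PropositionalEquality using (_≡_; refl; sym; cong; cong₂; subst)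

------------------------------------------------------------------------
-- Real numbers: Cauchy sequences of rationals, compared up to _≈_

Cauchy : (ℕ → ℚ) → Set
Cauchy x = ∀ ε → 0ℚ < ε → ∃[ N ] ∀ m n → N ℕ.≤ m → N ℕ.≤ n → ∣ x m - x n ∣ < ε

record ℝ : Set where
  constructor mkℝ
  field
    seq    : ℕ → ℚ
    cauchy : Cauchy seq
open ℝ public

private
  split : ∀ a b → a ≡ (a - b) + b
  split a b = begin-equality
    a              ≡⟨ sym (ℚ.+-identityʳ a) ⟩
    a + 0ℚ         ≡⟨ cong (λ c → a + c) (sym (ℚ.+-inverseˡ b)) ⟩
    a + (- b + b)  ≡⟨ sym (ℚ.+-assoc a (- b) b) ⟩
    (a - b) + b    ∎
    where open ≤-Reasoning

  +-rearrange : ∀ a b c d → (a + b) - (c + d) ≡ (a - c) + (b - d)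
  +-rearrange a b c d = begin-equality
    (a + b) + - (c + d)      ≡⟨ cong (λ e → (a + b) + e) (ℚ.neg-distrib-+ c d) ⟩
    (a + b) + (- c + - d)    ≡⟨ interchange a b (- c) (- d) ⟩
    (a + - c) + (b + - d)    ∎
    where open ≤-Reasoning

  *-rearrange : ∀ a b c d → a * b - c * d ≡ a * (b - d) + d * (a - c)
  *-rearrange a b c d = begin-equality
    a * b - c * d                        ≡⟨ cong (λ e → e - c * d) (split (a * b) (a * d)) ⟩
    ((a * b - a * d) + a * d) - c * d    ≡⟨ ℚ.+-assoc (a * b - a * d) (a * d) (- (c * d)) ⟩
    (a * b - a * d) + (a * d - c * d)    ≡⟨ cong₂ (λ e f → (a * b - a * d) + (e - f)) (ℚ.*-comm a d) (ℚ.*-comm c d) ⟩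
    (a * b - a * d) + (d * a - d * c)    ≡⟨ cong₂ _+_ (sym (distrib a b d)) (sym (distrib d a c)) ⟩
    a * (b - d) + d * (a - c)            ∎
    where
    open ≤-Reasoning
    distrib : ∀ p q r → p * (q - r) ≡ p * q - p * r
    distrib p q r = begin-equality
      p * (q - r)        ≡⟨ ℚ.*-distribˡ-+ p q (- r) ⟩
      p * q + p * - r    ≡⟨ cong (λ e → p * q + e) (sym (ℚ.neg-distribʳ-* p r)) ⟩
      p * q - p * r      ∎

  half : ∀ {ε} → 0ℚ < ε → 0ℚ < ½ * ε
  half {ε} 0<ε = subst (_< ½ * ε) (ℚ.*-zeroʳ ½) (ℚ.*-monoʳ-<-pos ½ 0<ε)

  ½ε+½ε : ∀ ε → ½ * ε + ½ * ε ≡ ε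
  ½ε+½ε ε = begin-equality
    ½ * ε + ½ * ε  ≡⟨ sym (ℚ.*-distribʳ-+ ε ½ ½) ⟩
    1ℚ * ε         ≡⟨ ℚ.*-identityˡ ε ⟩
    ε              ∎
    where open ≤-Reasoning

  shrink : ∀ B ε → .{{Positive B}} → 0ℚ < ε → ∃[ δ ] 0ℚ < δ × B * δ ≡ ε
  shrink B ε 0<ε = B⁻¹ * ε , subst (_< B⁻¹ * ε) (ℚ.*-zeroʳ B⁻¹) (ℚ.*-monoʳ-<-pos B⁻¹ 0<ε) , eq
    where
    instance
      B≢0 : ℚ.NonZero B
      B≢0 = ℚ.pos⇒nonZero B
    B⁻¹ : ℚ
    B⁻¹ = 1/ B
    instance
      B⁻¹>0 : Positive B⁻¹
      B⁻¹>0 = ℚ.1/pos⇒pos B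
    open ≤-Reasoning
    eq : B * (B⁻¹ * ε) ≡ ε
    eq = begin-equality
      B * (B⁻¹ * ε)  ≡⟨ sym (ℚ.*-assoc B B⁻¹ ε) ⟩
      B * B⁻¹ * ε    ≡⟨ cong (_* ε) (ℚ.*-inverseʳ B) ⟩
      1ℚ * ε         ≡⟨ ℚ.*-identityˡ ε ⟩
      ε              ∎

  eventuallyBounded : ∀ x → Cauchy x →
    ∃[ B ] Positive B × ∃[ N ] ∀ n → N ℕ.≤ n → ∣ x n ∣ ≤ B
  eventuallyBounded x cx with cx 1ℚ (ℚ.positive⁻¹ 1ℚ)
  ... | N , close = 1ℚ + ∣ x N ∣ , ℚ.positive 0<B , N , bound
    where
    open ≤-Reasoning
    0<B : 0ℚ < 1ℚ + ∣ x N ∣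
    0<B = ℚ.+-mono-<-≤ (ℚ.positive⁻¹ 1ℚ) (ℚ.0≤∣p∣ (x N))
    bound : ∀ n → N ℕ.≤ n → ∣ x n ∣ ≤ 1ℚ + ∣ x N ∣
    bound n N≤n = begin
      ∣ x n ∣                    ≡⟨ cong ∣_∣ (split (x n) (x N)) ⟩
      ∣ (x n - x N) + x N ∣      ≤⟨ ℚ.∣p+q∣≤∣p∣+∣q∣ (x n - x N) (x N) ⟩
      ∣ x n - x N ∣ + ∣ x N ∣    ≤⟨ ℚ.+-monoˡ-≤ ∣ x N ∣ (ℚ.<⇒≤ (close n N N≤n ℕ.≤-refl)) ⟩
      1ℚ + ∣ x N ∣               ∎

  const-cauchy : ∀ p → Cauchy (λ _ → p)
  const-cauchy p ε 0<ε = 0 , λ _ _ _ _ → subst (λ d → ∣ d ∣ < ε) (sym (ℚ.+-inverseʳ p)) 0<ε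

  neg-cauchy : ∀ x → Cauchy x → Cauchy (λ n → - x n)
  neg-cauchy x cx ε 0<ε with cx ε 0<ε
  ... | N , close = N , λ m n N≤m N≤n → begin-strict
    ∣ - x m - - x n ∣    ≡⟨ cong ∣_∣ (sym (ℚ.neg-distrib-+ (x m) (- x n))) ⟩
    ∣ - (x m - x n) ∣    ≡⟨ ℚ.∣-p∣≡∣p∣ (x m - x n) ⟩
    ∣ x m - x n ∣        <⟨ close m n N≤m N≤n ⟩
    ε                    ∎
    where open ≤-Reasoning

  +-cauchy : ∀ x y → Cauchy x → Cauchy y → Cauchy (λ n → x n + y n)
  +-cauchy x y cx cy ε 0<ε with cx (½ * ε) (half 0<ε) | cy (½ * ε) (half 0<ε)
  ... | M , closeˣ | N , closeʸ = M ℕ.⊔ N , λ m n ≤m ≤n → begin-strict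
    ∣ (x m + y m) - (x n + y n) ∣      ≡⟨ cong ∣_∣ (+-rearrange (x m) (y m) (x n) (y n)) ⟩
    ∣ (x m - x n) + (y m - y n) ∣      ≤⟨ ℚ.∣p+q∣≤∣p∣+∣q∣ (x m - x n) (y m - y n) ⟩
    ∣ x m - x n ∣ + ∣ y m - y n ∣      <⟨ ℚ.+-mono-<
      (closeˣ m n (ℕ.m⊔n≤o⇒m≤o M N ≤m) (ℕ.m⊔n≤o⇒m≤o M N ≤n))
      (closeʸ m n (ℕ.m⊔n≤o⇒n≤o M N ≤m) (ℕ.m⊔n≤o⇒n≤o M N ≤n)) ⟩
    ½ * ε + ½ * ε                      ≡⟨ ½ε+½ε ε ⟩
    ε                                  ∎
    where
    open ≤-Reasoning

  bound* : ∀ a b {B δ} → .{{Positive B}} → ∣ a ∣ ≤ B → ∣ b ∣ < δ → ∣ a * b ∣ < B * δ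
  bound* a b {B} {δ} a≤B b<δ = begin-strict
    ∣ a * b ∣        ≡⟨ ℚ.∣p*q∣≡∣p∣*∣q∣ a b ⟩
    ∣ a ∣ * ∣ b ∣    ≤⟨ ℚ.*-monoʳ-≤-nonNeg ∣ b ∣ {{ℚ.nonNegative (ℚ.0≤∣p∣ b)}} a≤B ⟩
    B * ∣ b ∣        <⟨ ℚ.*-monoʳ-<-pos B b<δ ⟩
    B * δ            ∎
    where open ≤-Reasoning

  *-cauchy : ∀ x y → Cauchy x → Cauchy y → Cauchy (λ n → x n * y n)
  *-cauchy x y cx cy ε 0<ε
    with eventuallyBounded x cx | eventuallyBounded y cy
  ... | A , A>0 , K , x≤A | B , B>0 , L , y≤B
    with shrink A (½ * ε) {{A>0}} (half 0<ε) | shrink B (½ * ε) {{B>0}} (half 0<ε)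
  ... | α , 0<α , Aα≡ | β , 0<β , Bβ≡
    with cx β 0<β | cy α 0<α
  ... | M , closeˣ | N , closeʸ = (K ℕ.⊔ L) ℕ.⊔ (M ℕ.⊔ N) , λ m n ≤m ≤n → begin-strict
    ∣ x m * y m - x n * y n ∣
      ≡⟨ cong ∣_∣ (*-rearrange (x m) (y m) (x n) (y n)) ⟩
    ∣ x m * (y m - y n) + y n * (x m - x n) ∣
      ≤⟨ ℚ.∣p+q∣≤∣p∣+∣q∣ (x m * (y m - y n)) (y n * (x m - x n)) ⟩
    ∣ x m * (y m - y n) ∣ + ∣ y n * (x m - x n) ∣
      <⟨ ℚ.+-mono-<
           (bound* (x m) (y m - y n) {{A>0}} (x≤A m (K≤ ≤m)) (closeʸ m n (N≤ ≤m) (N≤ ≤n)))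
           (bound* (y n) (x m - x n) {{B>0}} (y≤B n (L≤ ≤n)) (closeˣ m n (M≤ ≤m) (M≤ ≤n))) ⟩
    A * α + B * β
      ≡⟨ cong (_+ B * β) Aα≡ ⟩
    ½ * ε + B * β
      ≡⟨ cong (λ b → ½ * ε + b) Bβ≡ ⟩
    ½ * ε + ½ * ε
      ≡⟨ ½ε+½ε ε ⟩
    ε ∎
    where
    open ≤-Reasoning
    K≤ : ∀ {n} → (K ℕ.⊔ L) ℕ.⊔ (M ℕ.⊔ N) ℕ.≤ n → K ℕ.≤ n
    K≤ p = ℕ.m⊔n≤o⇒m≤o K L (ℕ.m⊔n≤o⇒m≤o (K ℕ.⊔ L) (M ℕ.⊔ N) p)
    L≤ : ∀ {n} → (K ℕ.⊔ L) ℕ.⊔ (M ℕ.⊔ N) ℕ.≤ n → L ℕ.≤ n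
    L≤ p = ℕ.m⊔n≤o⇒n≤o K L (ℕ.m⊔n≤o⇒m≤o (K ℕ.⊔ L) (M ℕ.⊔ N) p)
    M≤ : ∀ {n} → (K ℕ.⊔ L) ℕ.⊔ (M ℕ.⊔ N) ℕ.≤ n → M ℕ.≤ n
    M≤ p = ℕ.m⊔n≤o⇒m≤o M N (ℕ.m⊔n≤o⇒n≤o (K ℕ.⊔ L) (M ℕ.⊔ N) p)
    N≤ : ∀ {n} → (K ℕ.⊔ L) ℕ.⊔ (M ℕ.⊔ N) ℕ.≤ n → N ℕ.≤ n
    N≤ p = ℕ.m⊔n≤o⇒n≤o M N (ℕ.m⊔n≤o⇒n≤o (K ℕ.⊔ L) (M ℕ.⊔ N) p)

infixl 6 _+ʳ_ _-ʳ_
infixl 7 _*ʳ_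
infix  8 -ʳ_
infix  4 _<ʳ_ _≤ʳ_ _≈ʳ_

ι : ℚ → ℝ
ι p = mkℝ (λ _ → p) (const-cauchy p)

-ʳ_ : ℝ → ℝ
-ʳ x = mkℝ (λ n → - seq x n) (neg-cauchy (seq x) (cauchy x))

_+ʳ_ _-ʳ_ _*ʳ_ : ℝ → ℝ → ℝ
x +ʳ y = mkℝ (λ n → seq x n + seq y n) (+-cauchy (seq x) (seq y) (cauchy x) (cauchy y))
x -ʳ y = x +ʳ (-ʳ y)
x *ʳ y = mkℝ (λ n → seq x n * seq y n) (*-cauchy (seq x) (seq y) (cauchy x) (cauchy y))

0ʳ 1ʳ : ℝ
0ʳ = ι 0ℚ
1ʳ = ι 1ℚ

fromℕʳ : ℕ → ℝ
fromℕʳ n = ι (+ n ℚ./ 1)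

_≈ʳ_ _<ʳ_ _≤ʳ_ : ℝ → ℝ → Set
x ≈ʳ y = ∀ ε → 0ℚ < ε → ∃[ N ] ∀ n → N ℕ.≤ n → ∣ seq x n - seq y n ∣ < ε
x <ʳ y = ∃[ ε ] 0ℚ < ε × ∃[ N ] ∀ n → N ℕ.≤ n → seq x n + ε ≤ seq y n
x ≤ʳ y = ¬ (y <ʳ x)

------------------------------------------------------------------------

infixl 6 _+ᶜ_ _-ᶜ_
infixl 7 _*ᶜ_
infix  8 -ᶜ_
infixr 8 _^ᶜ_
infix  4 _≈ᶜ_

record ℂ : Set where
  constructor _+i_
  field
    re im : ℝ
open ℂ public

ofℝ : ℝ → ℂ
ofℝ x = x +i 0ʳ

-ᶜ_ : ℂ → ℂ
-ᶜ z = (-ʳ re z) +i (-ʳ im z)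

_+ᶜ_ _-ᶜ_ _*ᶜ_ : ℂ → ℂ → ℂ
z +ᶜ w = (re z +ʳ re w) +i (im z +ʳ im w)
z -ᶜ w = z +ᶜ (-ᶜ w)
z *ᶜ w = (re z *ʳ re w -ʳ im z *ʳ im w) +i (re z *ʳ im w +ʳ im z *ʳ re w)

0ᶜ 1ᶜ : ℂ
0ᶜ = ofℝ 0ʳ
1ᶜ = ofℝ 1ʳ

_^ᶜ_ : ℂ → ℕ → ℂ
z ^ᶜ zero  = 1ᶜ
z ^ᶜ suc n = z *ᶜ z ^ᶜ n

_≈ᶜ_ : ℂ → ℂ → Set
z ≈ᶜ w = re z ≈ʳ re w × im z ≈ʳ im w

∣_∣² : ℂ → ℝ
∣ z ∣² = re z *ʳ re z +ʳ im z *ʳ im z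

IsModulus : ℂ → ℝ → Set
IsModulus z r = 0ʳ ≤ʳ r × r *ʳ r ≈ʳ ∣ z ∣²

------------------------------------------------------------------------
-- Limits and series.  Inequalities |z| < ε between nonnegative quantities
-- are written with both sides squared.  Analytic functions are given by
-- their graphs: `F z w` reads "F is defined at z with value w".

_⟶_ : (ℕ → ℂ) → ℂ → Set
z ⟶ w = ∀ ε → 0ʳ <ʳ ε → ∃[ N ] ∀ n → N ℕ.≤ n → ∣ z n -ᶜ w ∣² <ʳ ε *ʳ ε

partialSum : (ℕ → ℂ) → ℕ → ℂ
partialSum a zero    = 0ᶜ
partialSum a (suc n) = partialSum a n +ᶜ a n

HasSum : (ℕ → ℂ) → ℂ → Set
HasSum a s = partialSum a ⟶ s

invFactorial : ℕ → ℝ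
invFactorial n = ι (ℚ._/_ (+ 1) (n !) {{n ℕ.!≢0}})

IsExp : ℂ → ℂ → Set
IsExp z w = HasSum (λ n → z ^ᶜ n *ᶜ ofℝ (invFactorial n)) w

IsExpʳ : ℝ → ℝ → Set
IsExpʳ x y = IsExp (ofℝ x) (ofℝ y)

IsLog : ℝ → ℝ → Set
IsLog x y = IsExpʳ y x

HasDerivAt : (ℂ → ℂ → Set) → ℂ → ℂ → Set
HasDerivAt F s d = ∃[ v ] F s v ×
  (∀ ε → 0ʳ <ʳ ε → ∃[ δ ] 0ʳ <ʳ δ × (∀ h → ∣ h ∣² <ʳ δ *ʳ δ →
    ∃[ w ] F (s +ᶜ h) w × ∣ (w -ᶜ v) -ᶜ d *ᶜ h ∣² ≤ʳ (ε *ʳ ε) *ʳ ∣ h ∣²))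

harmonic : ℕ → ℝ
harmonic zero    = 0ʳ
harmonic (suc n) = harmonic n +ʳ ι (+ 1 ℚ./ suc n)

IsEulerConstant : ℝ → Set
IsEulerConstant C = Σ[ ℓ ∈ (ℕ → ℝ) ] (∀ n → IsLog (fromℕʳ (suc n)) (ℓ n)) ×
  ((λ n → ofℝ (harmonic (suc n) -ʳ ℓ n)) ⟶ ofℝ C)

------------------------------------------------------------------------
-- ζ and L(·,χ) are only needed for Re s > 1, where they equal their
-- Dirichlet series.

-- w = n^{-s} = exp (- s log n)
IsNegPow : ℕ → ℂ → ℂ → Set
IsNegPow n s w = ∃[ ℓ ] IsLog (fromℕʳ n) ℓ × IsExp (-ᶜ (s *ᶜ ofℝ ℓ)) w

-- v = ∑_{n ≥ 1} a(n) n^{-s}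
IsDirichletSum : (ℕ → ℂ) → ℂ → ℂ → Set
IsDirichletSum a s v = Σ[ p ∈ (ℕ → ℂ) ] (∀ n → IsNegPow (suc n) s (p n)) ×
  HasSum (λ n → a (suc n) *ᶜ p n) v

Zeta : ℂ → ℂ → Set
Zeta s v = 1ʳ <ʳ re s × IsDirichletSum (λ _ → 1ᶜ) s v

record DirichletCharacter (q : ℕ) : Set where
  field
    χ        : ℤ → ℂ
    periodic : ∀ n → χ (n ℤ.+ + q) ≈ᶜ χ n
    mult     : ∀ m n → χ (m ℤ.* n) ≈ᶜ χ m *ᶜ χ n
    one      : χ (+ 1) ≈ᶜ 1ᶜ
    vanish   : ∀ n → ¬ Coprime n (+ q) → χ n ≈ᶜ 0ᶜ
open DirichletCharacter public

InducedBy : ∀ {q d} → DirichletCharacter q → DirichletCharacter d → Set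
InducedBy {q} X Y = ∀ n → Coprime n (+ q) → χ X n ≈ᶜ χ Y n

Primitive : ∀ {q} → DirichletCharacter q → Set
Primitive {q} X = ∀ d → d ℕ.∣ q → d ℕ.< q → (Y : DirichletCharacter d) → ¬ InducedBy X Y

LFunction : ∀ {q} → DirichletCharacter q → ℂ → ℂ → Set
LFunction X s v = 1ʳ <ʳ re s × IsDirichletSum (λ n → χ X (+ n)) s v

φ : ℕ → ℕ
φ n = length (filter (λ k → ℕ.coprime? k n) (map suc (upTo n)))

------------------------------------------------------------------------
-- Limit superior, with values in the extended reals

data ℝ̄ : Set where
  -∞ +∞ : ℝ̄
  fin   : ℝ → ℝ̄

infix 4 _≤̄_

_≤̄_ : ℝ̄ → ℝ̄ → Set
-∞    ≤̄ _     = ⊤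
fin _ ≤̄ -∞    = ⊥
fin x ≤̄ fin y = x ≤ʳ y
fin _ ≤̄ +∞    = ⊤
+∞    ≤̄ +∞    = ⊤
+∞    ≤̄ -∞    = ⊥
+∞    ≤̄ fin _ = ⊥

-- `V t y` reads "the quantity takes the value y at some point of height t"
EventualUpperBound : (ℝ → ℝ → Set) → ℝ̄ → Set
EventualUpperBound V u = ∃[ T ] ∀ t y → T <ʳ t → V t y → fin y ≤̄ u

-- lim sup as t → ∞: the infimum of the eventual upper bounds
IsLimsup : (ℝ → ℝ → Set) → ℝ̄ → Set
IsLimsup V L =
  (∀ u → EventualUpperBound V u → L ≤̄ u) ×
  (∀ l → (∀ u → EventualUpperBound V u → l ≤̄ u) → l ≤̄ L)

CriticalPoint : ℂ → Set
CriticalPoint ρ = HasDerivAt Zeta ρ 0ᶜ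

-- y = |L(ρ,χ)| / log log (im ρ)
IsRatio : ∀ {q} → DirichletCharacter q → ℂ → ℝ → Set
IsRatio X ρ y = ∃[ v ] ∃[ r ] ∃[ ℓ ] ∃[ ℓℓ ]
  LFunction X ρ v × IsModulus v r ×
  IsLog (im ρ) ℓ × IsLog ℓ ℓℓ × ¬ (ℓℓ ≈ʳ 0ʳ) × y *ʳ ℓℓ ≈ʳ r

CriticalRatio : ∀ {q} → DirichletCharacter q → ℝ → ℝ → Set
CriticalRatio X t y = ∃[ ρ ] CriticalPoint ρ × 1ʳ <ʳ re ρ × im ρ ≈ʳ t × IsRatio X ρ y

{-# OPTIONS --safe #-}
module Submission where

-- Near s = 1 + 5δ + it the phases p^{-it} of all primes p ≤ N can be prescribed by a resonance argument with a
-- nonnegative Dirichlet polynomial, at a height t of size exp(N^{1+o(1)}).  With p^{-it} close to the conjugate of χ(p) for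
-- p ≤ Y, Mertens' product makes |L| at least (1 - o(1)) e^{C₀} (φ(q)/q) log Y.  The phases of the primes in (Y, Y^{1+ε}]
-- are used to make ζ'/ζ nearly vanish at s while ζ''/ζ stays away from 0, so that Newton's iteration reaches a zero of ζ'
-- without changing L noticeably.  This needs ∑ χ(p) (log p)/p over p ≤ Y to be bounded, that is L(1,χ) ≠ 0.

open import Algebra.Bundles using (CommutativeRing)
open import Algebra.Structures using (IsCommutativeRing)
open import Axiom.ExcludedMiddle using (ExcludedMiddle)
open import Data.Empty using (⊥) renaming (⊥-elim to absurd)
open import Data.Integer as Z using (ℤ)
import Data.Integer.Coprimality as Z
import Data.Integer.Properties as Z
open import Data.List using (List; []; _∷_; _++_; map; concatMap; filter; upTo; applyUpTo; length)
open import Data.List.Membership.Propositional using (_∈_; find)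
open import Data.List.Properties using (map-upTo)
open import Data.List.Relation.Unary.All as All using (All; []; _∷_)
open import Data.List.Relation.Unary.All.Properties as All using (¬Any⇒All¬)
open import Data.List.Relation.Unary.AllPairs as AllPairs using (AllPairs; []; _∷_)
open import Data.List.Relation.Unary.AllPairs.Properties as AllPairs using ()
open import Data.List.Relation.Unary.Any as Any using (Any; here; there)
open import Data.Nat as N using (ℕ; zero; suc; _!; s≤s; z≤n) renaming (NonZero to Nz)
open import Data.Nat.Coprimality as N using (Coprime; coprime?; coprime-Bézout; coprime-divisor)
open import Data.Nat.Divisibility as N using (_∣_; _∣?_)
open import Data.Nat.DivMod as N using (m≡m%n+[m/n]*n; m%n<n; m*n/n≡m; n/n≡1; /-monoˡ-≤; m<n⇒m/n≡0; m/n*n≤m)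
open import Data.Nat.GCD using (module Bézout)
open import Data.Nat.Induction using (<-wellFounded; Acc; acc)
open import Data.Nat.Primality using (Prime; prime?; euclidsLemma; prime⇒irreducible) renaming (prime⇒nonZero to pr≢0; prime⇒nonTrivial to nt)
open import Data.Nat.Primality.Factorisation using (factorise)
open import Data.Nat.Properties as N using (n≤1+n; m≤m+n) renaming (≤-trans to trN; ≤-refl to rfN; ≤ᵇ⇒≤ to bN; m≤n⇒m≤1+n to m≤1+n; m≤n⇒∃[o]m+o≡n to m+o≡n)
open import Data.Product using (Σ; ∃; _×_; _,_) renaming (proj₁ to fst; proj₂ to snd)
import Data.Rational as Q
import Data.Rational.Properties as Q
import Data.Rational.Unnormalised as Qu
import Data.Rational.Unnormalised.Properties as Qu
open import Data.Sum using (_⊎_; [_,_]′) renaming (inj₁ to inl; inj₂ to inr)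
open import Data.Unit using (tt)
import Defs as D
open import Level using (0ℓ)
open import Relation.Binary.Definitions using (tri<; tri≈; tri>)
open import Relation.Binary.PropositionalEquality as E using (_≡_)
open import Relation.Nullary using (¬_; Dec; yes; no)
open import Relation.Nullary.Decidable using (from-no)

module RingSolver where
 open import Data.Bool using (Bool; true; false; _∧_; T; if_then_else_)
 open import Data.Char as Char using (Char)
 open import Data.List using (foldr)
 open import Data.Maybe using (Maybe; just; nothing)
 open import Data.Nat using (_≡ᵇ_; _≤ᵇ_)
 open import Data.String as String using (String)
 open import Function.Strict using (force-≡) renaming (force′ to force)

 infixl 6 _⊕_ _⊖_
 infixl 7 _⊗_
 infix  8 ⊝_

 data Expr : Set where
  v n#    : ℕ -> Expr
  e0 e1   : Expr
  _⊕_ _⊖_ _⊗_ : Expr -> Expr -> Expr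
  ⊝_      : Expr -> Expr

 -- A coefficient (a , b) stands for a - b.
 Mono Poly : Set
 Mono = List ℕ
 Poly = List((ℕ × ℕ)× Mono)

 eqMono : Mono -> Mono -> Bool
 eqMono []      []       = true
 eqMono(i ∷ m)(j ∷ m')=(i ≡ᵇ j)∧ eqMono m m'
 eqMono _       _        = false

 insV : ℕ -> Mono -> Mono
 insV i []      = i ∷ []
 insV i(j ∷ m)= if i ≤ᵇ j then i ∷ j ∷ m else j ∷ insV i m

 mulM : Mono -> Mono -> Mono
 mulM m m' = foldr insV m' m

 addT :(ℕ × ℕ)× Mono -> Poly -> Poly
 addT t [] = t ∷ []
 addT((a , b), m)(((a' , b'), m')∷ p)=
  if eqMono m m' then((a N.+ a' , b N.+ b'), m)∷ p
  else((a' , b'), m')∷ addT((a , b), m)p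

 addP : Poly -> Poly -> Poly
 addP p q = foldr addT q p

 mulT :(ℕ × ℕ)× Mono -> Poly -> Poly
 mulT _ [] = []
 mulT((a , b), m)(((a' , b'), m')∷ p)=
  ((a N.* a' N.+ b N.* b' , a N.* b' N.+ b N.* a'), mulM m m')∷ mulT((a , b), m)p

 mulP : Poly -> Poly -> Poly
 mulP []      q = []
 mulP(t ∷ p)q = addP(mulT t q)(mulP p q)

 norm : Expr -> Poly
 norm(v i)   =((1 , 0), i ∷ [])∷ []
 norm(n# n)  =((n , 0), [])∷ []
 norm e0      = []
 norm e1      =((1 , 0), [])∷ []
 norm(e ⊕ f)= addP(norm e)(norm f)
 norm(e ⊖ f)= addP(norm e)(mulT((0 , 1), [])(norm f))
 norm(e ⊗ f)= mulP(norm e)(norm f)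
 norm(⊝ e)   = mulT((0 , 1), [])(norm e)

 isZero : Poly -> Bool
 isZero [] = true
 isZero(((a , b), _)∷ p)=(a ≡ᵇ b)∧ isZero p

 module Parser where
  -- Identities are written as strings: letters are atoms, juxtaposition is multiplication, and # precedes the numerals fromℕ 0 and fromℕ 1.
  data Token : Set where
   atom num         : ℕ -> Token
   plus minus lp rp eq hash : Token

  tokens : List Char -> List(ℕ × Token)
  tokens = foldr next []
   where
   digit : ℕ -> List(ℕ × Token)-> List(ℕ × Token)
   digit d((suc w , num n)∷ ts)=(suc(suc w), num(d N.* 10 N.^ suc w N.+ n))∷ ts
   digit d ts                     =(1 , num d)∷ ts
   next : Char -> List(ℕ × Token)-> List(ℕ × Token)
   next c ts = if k ≡ᵇ 43 then(0 , plus)∷ ts else if k ≡ᵇ 45 then(0 , minus)∷ ts else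
    if k ≡ᵇ 40 then(0 , lp)∷ ts else if k ≡ᵇ 41 then(0 , rp)∷ ts else
    if k ≡ᵇ 61 then(0 , eq)∷ ts else if k ≡ᵇ 35 then(0 , hash)∷ ts else
    if k ≤ᵇ 57 then digit(k N.∸ 48)ts else(0 , atom(if 97 ≤ᵇ k then k N.∸ 97 else k N.∸ 39))∷ ts
    where
    k : ℕ
    k = Char.toℕ c

  -- Strict constructors, so that the parsed expressions are not evaluated again and again.
  plus! minus! times! : Expr -> Expr -> Expr
  plus!  e f = force e \e -> force f \f -> e ⊕ f
  minus! e f = force e \e -> force f \f -> e ⊖ f
  times! e f = force e \e -> force f \f -> e ⊗ f

  neg! : Expr -> Expr
  neg! e = force e \e -> ⊝ e

  -- A partially read sum: the previous terms and the sign after them, the factors of the current term, and its pending signs.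
  data Sum : Set where
   none     : Sum
   adds subs : Expr -> Sum
  Frame : Set
  Frame = Sum × Maybe Expr × ℕ

  start : Frame
  start = none , nothing , 0

  negate : ℕ -> Expr -> Expr
  negate zero    t = t
  negate(suc k)t = neg!(negate k t)

  factor : Expr -> Frame -> Frame
  factor t(s , nothing , k)= force(negate k t)\t -> s , just t , 0
  factor t(s , just u , _)  = force(times! u t)\t -> s , just t , 0

  close : Frame -> Expr
  close(none   , just t , _)  = t
  close(adds s , just t , _)  = plus! s t
  close(subs s , just t , _)  = minus! s t
  close(_ , nothing , _)= e0

  mutual
   parse : List(ℕ × Token)-> Frame -> List Frame -> Maybe Expr -> Expr × Expr
   parse []                           f _        (just l)= force(close f)\r -> l , r
   parse []                           f _        nothing  = e0 , e1
   parse((_ , atom i)∷ ts)          f fs       l        = next ts(factor(v i)f)fs l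
   parse((_ , hash)∷(_ , num n)∷ ts)f fs    l        = next ts(factor(n# n)f)fs l
   parse((_ , num 0)∷ ts)           f fs       l        = next ts(factor e0 f)fs l
   parse((_ , num 1)∷ ts)           f fs       l        = next ts(factor e1 f)fs l
   parse((_ , num n)∷ ts)           f fs       l        = next ts(factor(n# n)f)fs l
   parse((_ , plus)∷ ts)            f fs       l        = force(close f)\s -> parse ts(adds s , nothing , 0)fs l
   parse((_ , minus)∷ ts)  (s , nothing , k)fs l       = parse ts(s , nothing , suc k)fs l
   parse((_ , minus)∷ ts)           f fs       l        = force(close f)\s -> parse ts(subs s , nothing , 0)fs l
   parse((_ , lp)∷ ts)              f fs       l        = parse ts start(f ∷ fs)l
   parse((_ , rp)∷ ts)              f(g ∷ fs)l        = next ts(factor(close f)g)fs l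
   parse((_ , eq)∷ ts)              f fs       l        = force(close f)\t -> parse ts start [](just t)
   parse(_ ∷ ts)                     f fs       l        = parse ts f fs l
   next : List(ℕ × Token)-> Frame -> List Frame -> Maybe Expr -> Expr × Expr
   next ts f fs l = force f \f -> parse ts f fs l

  lhs rhs : String -> Expr
  lhs s = fst(parse(tokens(String.toList s))start [] nothing)
  rhs s = snd(parse(tokens(String.toList s))start [] nothing)

  max! : ℕ -> ℕ -> ℕ
  max! m n = force m \m -> force n \n -> if m ≤ᵇ n then n else m

  atoms : Expr -> ℕ
  atoms(v i)   = force i \i -> 1 N.+ i
  atoms(e ⊕ f)= max!(atoms e)(atoms f)
  atoms(e ⊖ f)= max!(atoms e)(atoms f)
  atoms(e ⊗ f)= max!(atoms e)(atoms f)
  atoms(⊝ e)   = atoms e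
  atoms _       = 0

 pattern x0 = v 0
 pattern x1 = v 1
 pattern x2 = v 2
 pattern x3 = v 3
 pattern x4 = v 4
 pattern x5 = v 5
 pattern x6 = v 6
 pattern x7 = v 7
 pattern x8 = v 8
 pattern x9 = v 9

 module Solver (R : CommutativeRing 0ℓ 0ℓ) where
  open CommutativeRing R
  open import Algebra.Properties.Ring ring using (-‿distribˡ-*; -‿distribʳ-*; -‿involutive; -0#≈0#; -‿+-comm)
  open import Algebra.Properties.CommutativeSemigroup +-commutativeSemigroup using () renaming (interchange to +-interchange)
  open import Algebra.Properties.CommutativeSemigroup *-commutativeSemigroup using () renaming (interchange to *-interchange; x∙yz≈y∙xz to *-swap)
  open import Algebra.Properties.Semiring.Mult semiring renaming (_×_ to _·_; ×-homo-+ to ·-homo-+; ×1-homo-* to ·1-homo-*) using ()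
  open import Relation.Binary.Reasoning.Setoid setoid

  fromℕ : ℕ -> Carrier
  fromℕ n = n · 1#

  lookup : List Carrier -> ℕ -> Carrier
  lookup []      _       = 0#
  lookup(x ∷ ρ)zero    = x
  lookup(x ∷ ρ)(suc i)= lookup ρ i

  ⟦_⟧ : Expr -> List Carrier -> Carrier
  ⟦ v i ⟧   ρ = lookup ρ i
  ⟦ n# n ⟧  ρ = fromℕ n
  ⟦ e0 ⟧    ρ = 0#
  ⟦ e1 ⟧    ρ = 1#
  ⟦ e ⊕ f ⟧ ρ = ⟦ e ⟧ ρ + ⟦ f ⟧ ρ
  ⟦ e ⊖ f ⟧ ρ = ⟦ e ⟧ ρ - ⟦ f ⟧ ρ
  ⟦ e ⊗ f ⟧ ρ = ⟦ e ⟧ ρ * ⟦ f ⟧ ρ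
  ⟦ ⊝ e ⟧   ρ = - ⟦ e ⟧ ρ

  private
   module _ (ρ : List Carrier) where
    ⟦_⟧c : ℕ × ℕ -> Carrier
    ⟦ a , b ⟧c = fromℕ a - fromℕ b
    ⟦_⟧m : Mono -> Carrier
    ⟦ [] ⟧m    = 1#
    ⟦ i ∷ m ⟧m = lookup ρ i * ⟦ m ⟧m
    ⟦_⟧t :(ℕ × ℕ)× Mono -> Carrier
    ⟦ c , m ⟧t = ⟦ c ⟧c * ⟦ m ⟧m
    ⟦_⟧p : Poly -> Carrier
    ⟦ [] ⟧p    = 0#
    ⟦ t ∷ p ⟧p = ⟦ t ⟧t + ⟦ p ⟧p
    c-+ : ∀ a b a' b' -> ⟦ a N.+ a' , b N.+ b' ⟧c ≈ ⟦ a , b ⟧c + ⟦ a' , b' ⟧c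
    c-+ a b a' b' = begin
     fromℕ(a N.+ a')- fromℕ(b N.+ b')
      ≈⟨ +-cong(·-homo-+ 1# a a')(-‿cong(·-homo-+ 1# b b'))⟩
     (fromℕ a + fromℕ a')-(fromℕ b + fromℕ b')
      ≈⟨ +-congˡ(sym(-‿+-comm _ _))⟩
     (fromℕ a + fromℕ a')+(- fromℕ b + - fromℕ b')
      ≈⟨ +-interchange _ _ _ _ ⟩
     ⟦ a , b ⟧c + ⟦ a' , b' ⟧c ∎
    c-* : ∀ a b a' b' -> ⟦ a N.* a' N.+ b N.* b' , a N.* b' N.+ b N.* a' ⟧c ≈ ⟦ a , b ⟧c * ⟦ a' , b' ⟧c
    c-* a b a' b' = begin
     ⟦ a N.* a' N.+ b N.* b' , a N.* b' N.+ b N.* a' ⟧c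
      ≈⟨ c-+(a N.* a')(a N.* b')(b N.* b')(b N.* a')⟩
     (fromℕ(a N.* a')- fromℕ(a N.* b'))+(fromℕ(b N.* b')- fromℕ(b N.* a'))
      ≈⟨ +-cong(+-cong(·1-homo-* a a')(-‿cong(·1-homo-* a b')))
       (+-cong(·1-homo-* b b')(-‿cong(·1-homo-* b a')))⟩
     (A * A' - A * B')+(B * B' - B * A')
      ≈⟨ +-cong(+-congˡ(-‿distribʳ-* A B'))(trans(+-congʳ(sym(-‿involutive _)))(trans(+-congʳ(-‿cong(-‿distribʳ-* B B')))(trans(+-congˡ(-‿distribˡ-* B A'))(trans(+-congʳ(-‿distribˡ-* B(- B')))(+-comm _ _)))))⟩
     (A * A' + A * - B')+(- B * A' + - B * - B')
      ≈⟨ +-cong(distribˡ A A'(- B'))(distribˡ(- B)A'(- B'))⟨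
     A *(A' - B')+ - B *(A' - B')
      ≈⟨ distribʳ(A' - B')A(- B)⟨
     (A - B)*(A' - B')∎
     where
     A = fromℕ a ; B = fromℕ b ; A' = fromℕ a' ; B' = fromℕ b'
    eqMono-sound : ∀ m m' -> T(eqMono m m')-> m ≡ m'
    eqMono-sound []      []       _ = E.refl
    eqMono-sound(i ∷ m)(j ∷ m')t with i ≡ᵇ j in eq
    ... | true = E.cong₂ _∷_(N.≡ᵇ⇒≡ i j(E.subst T(E.sym eq)tt))(eqMono-sound m m' t)
    insV-sound : ∀ i m -> ⟦ insV i m ⟧m ≈ lookup ρ i * ⟦ m ⟧m
    insV-sound i []      = refl
    insV-sound i(j ∷ m)with i ≤ᵇ j
    ... | true  = refl
    ... | false = trans(*-congˡ(insV-sound i m))(*-swap _ _ _)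
    mulM-sound : ∀ m m' -> ⟦ mulM m m' ⟧m ≈ ⟦ m ⟧m * ⟦ m' ⟧m
    mulM-sound []      m' = sym(*-identityˡ _)
    mulM-sound(i ∷ m)m' = trans(insV-sound i(mulM m m'))(trans(*-congˡ(mulM-sound m m'))(sym(*-assoc _ _ _)))
    addT-sound : ∀ t p -> ⟦ addT t p ⟧p ≈ ⟦ t ⟧t + ⟦ p ⟧p
    addT-sound t [] = refl
    addT-sound((a , b), m)(((a' , b'), m')∷ p)with eqMono m m' in eq
    ... | true with E.refl ← eqMono-sound m m'(E.subst T(E.sym eq)tt)=
     trans(+-congʳ(trans(*-congʳ(c-+ a b a' b'))(distribʳ _ _ _)))(+-assoc _ _ _)
    ... | false = trans(+-congˡ(addT-sound _ p))(trans(sym(+-assoc _ _ _))(trans(+-congʳ(+-comm _ _))(+-assoc _ _ _)))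
    addP-sound : ∀ p q -> ⟦ addP p q ⟧p ≈ ⟦ p ⟧p + ⟦ q ⟧p
    addP-sound []      q = sym(+-identityˡ _)
    addP-sound(t ∷ p)q = trans(addT-sound t(addP p q))(trans(+-congˡ(addP-sound p q))(sym(+-assoc _ _ _)))
    mulT-sound : ∀ t p -> ⟦ mulT t p ⟧p ≈ ⟦ t ⟧t * ⟦ p ⟧p
    mulT-sound t [] = sym(zeroʳ _)
    mulT-sound((a , b), m)(((a' , b'), m')∷ p)= trans
     (+-cong(trans(*-cong(c-* a b a' b')(mulM-sound m m'))(*-interchange _ _ _ _))(mulT-sound _ p))
     (sym(distribˡ _ _ _))
    mulP-sound : ∀ p q -> ⟦ mulP p q ⟧p ≈ ⟦ p ⟧p * ⟦ q ⟧p
    mulP-sound []      q = sym(zeroˡ _)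
    mulP-sound(t ∷ p)q = trans(addP-sound(mulT t q)(mulP p q))
     (trans(+-cong(mulT-sound t q)(mulP-sound p q))(sym(distribʳ _ _ _)))
    c-n : ∀ n -> ⟦ n , 0 ⟧c ≈ fromℕ n
    c-n n = trans(+-congˡ -0#≈0#)(+-identityʳ _)
    neg-sound : ∀ p -> ⟦ mulT((0 , 1), [])p ⟧p ≈ - ⟦ p ⟧p
    neg-sound p = trans(mulT-sound _ p)(trans(*-congʳ(trans(*-identityʳ _)(trans(+-identityˡ _)(-‿cong(+-identityʳ _)))))
     (trans(sym(-‿distribˡ-* 1# _))(-‿cong(*-identityˡ _))))
    norm-sound : ∀ e -> ⟦ norm e ⟧p ≈ ⟦ e ⟧ ρ
    norm-sound(v i)   = trans(+-identityʳ _)(trans(*-cong(trans(c-n 1)(+-identityʳ _))(*-identityʳ _))(*-identityˡ _))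
    norm-sound(n# n)  = trans(+-identityʳ _)(trans(*-identityʳ _)(c-n n))
    norm-sound e0      = refl
    norm-sound e1      = trans(+-identityʳ _)(trans(*-identityʳ _)(trans(c-n 1)(+-identityʳ _)))
    norm-sound(e ⊕ f)= trans(addP-sound(norm e)(norm f))(+-cong(norm-sound e)(norm-sound f))
    norm-sound(e ⊖ f)= trans(addP-sound(norm e)_)(+-cong(norm-sound e)(trans(neg-sound(norm f))(-‿cong(norm-sound f))))
    norm-sound(e ⊗ f)= trans(mulP-sound(norm e)(norm f))(*-cong(norm-sound e)(norm-sound f))
    norm-sound(⊝ e)   = trans(neg-sound(norm e))(-‿cong(norm-sound e))
    isZero-sound : ∀ p -> T(isZero p)-> ⟦ p ⟧p ≈ 0#
    isZero-sound [] _ = refl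
    isZero-sound(((a , b), m)∷ p)t with a ≡ᵇ b in eq
    ... | true with E.refl ← N.≡ᵇ⇒≡ a b(E.subst T(E.sym eq)tt)=
     trans(+-cong(trans(*-congʳ(-‿inverseʳ _))(zeroˡ _))(isZero-sound p t))(+-identityʳ _)

  opaque
   solve : ∀ ρ e f ->{T(isZero(norm(e ⊖ f)))} -> ⟦ e ⟧ ρ ≈ ⟦ f ⟧ ρ
   solve ρ e f{t} = begin
    ⟦ e ⟧ ρ                          ≈⟨ +-identityʳ _ ⟨
    ⟦ e ⟧ ρ + 0#                     ≈⟨ +-congˡ(-‿inverseˡ _)⟨
    ⟦ e ⟧ ρ +(- ⟦ f ⟧ ρ + ⟦ f ⟧ ρ)  ≈⟨ +-assoc _ _ _ ⟨
    (⟦ e ⟧ ρ - ⟦ f ⟧ ρ)+ ⟦ f ⟧ ρ    ≈⟨ +-congʳ(trans(sym(norm-sound ρ(e ⊖ f)))(isZero-sound ρ(norm(e ⊖ f))t))⟩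
    0# + ⟦ f ⟧ ρ                     ≈⟨ +-identityˡ _ ⟩
    ⟦ f ⟧ ρ ∎

  open Parser using (lhs; rhs; atoms)

  Implicitly Explicitly : ℕ ->(List Carrier -> Set)-> Set
  Implicitly zero    P = P []
  Implicitly(suc n)P ={x : Carrier} -> Implicitly n(\ρ -> P(x ∷ ρ))
  Explicitly zero    P = P []
  Explicitly(suc n)P =(x : Carrier)-> Explicitly n(\ρ -> P(x ∷ ρ))

  implicitly : ∀ n{P} ->(∀ ρ -> P ρ)-> Implicitly n P
  implicitly zero    f = f []
  implicitly(suc n)f = implicitly n(\ρ -> f(_ ∷ ρ))

  explicitly : ∀ n{P} ->(∀ ρ -> P ρ)-> Explicitly n P
  explicitly zero    f = f []
  explicitly(suc n)f x = explicitly n(\ρ -> f(x ∷ ρ))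

  Identity :(ℕ ->(List Carrier -> Set)-> Set)-> Expr -> Expr -> Set
  Identity Q l r = force l \l -> force r \r -> force(atoms(l ⊖ r))\n -> Q n(\ρ -> ⟦ l ⟧ ρ ≈ ⟦ r ⟧ ρ)

  Identity-≡ : ∀ Q l r -> Identity Q l r ≡ Q(atoms(l ⊖ r))(\ρ -> ⟦ l ⟧ ρ ≈ ⟦ r ⟧ ρ)
  Identity-≡ Q l r = E.trans(force-≡ l _)(E.trans(force-≡ r _)(force-≡(atoms(l ⊖ r))_))

  alg : ∀ s ->{T(isZero(norm(lhs s ⊖ rhs s)))} -> Identity Implicitly(lhs s)(rhs s)
  alg s{t} = E.subst(\A -> A)(E.sym(Identity-≡ Implicitly(lhs s)(rhs s)))(implicitly(atoms(lhs s ⊖ rhs s))\ρ -> solve ρ(lhs s)(rhs s){t})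

  alg! : ∀ s ->{T(isZero(norm(lhs s ⊖ rhs s)))} -> Identity Explicitly(lhs s)(rhs s)
  alg! s{t} = E.subst(\A -> A)(E.sym(Identity-≡ Explicitly(lhs s)(rhs s)))(explicitly(atoms(lhs s ⊖ rhs s))\ρ -> solve ρ(lhs s)(rhs s){t})

open RingSolver

record Reals : Set₁ where
 infix 4 _≤_ _<_
 field
  em   : ExcludedMiddle 0ℓ
  ring : CommutativeRing 0ℓ 0ℓ
 open CommutativeRing ring public
  using(_≈_; _+_; _*_; -_; _-_; 0#; 1#; refl; sym; trans; setoid)
  renaming(Carrier to R; +-cong to +₂; +-congˡ to +ˡ; +-congʳ to +ʳ; *-cong to *₂; *-congˡ to *ˡ; *-congʳ to *ʳ; -‿cong to -₁; reflexive to rfx)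
 open Solver ring public
 field
  _≤_ : R -> R -> Set
 _<_ : R -> R -> Set
 x < y = ¬(y ≤ x)
 field
  e≤ : ∀ {x y} -> x ≈ y -> x ≤ y
  ≤t     : ∀ {x y z} -> x ≤ y -> y ≤ z -> x ≤ z
  ≤-antisym   : ∀ {x y} -> x ≤ y -> y ≤ x -> x ≈ y
  ≤-total     : ∀ x y -> x ≤ y ⊎ y ≤ x
  +-monoʳ     : ∀ {x y} z -> x ≤ y -> x + z ≤ y + z
  0≤*    : ∀ {x y} -> 0# ≤ x -> 0# ≤ y -> 0# ≤ x * y
  1≰0         : ¬(1# ≤ 0#)
  inverse     : ∀ x -> ¬(x ≈ 0#)-> ∃ \y -> x * y ≈ 1#
  archimedean : ∀ x -> ∃ \n -> x ≤ fromℕ n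
  complete    : ∀ (f : ℕ -> R)->
   (∀ ε -> 0# < ε -> ∃ \N -> ∀ m n -> N N.≤ m -> N N.≤ n -> f m - f n ≤ ε)->
   ∃ \l -> ∀ ε -> 0# < ε -> ∃ \N -> ∀ n -> N N.≤ n -> f n - l ≤ ε × l - f n ≤ ε

module FiniteSums (C : CommutativeRing 0ℓ 0ℓ) where
 open CommutativeRing C
 open Solver C

 ∑ : ℕ ->(ℕ -> Carrier)-> Carrier
 ∑ zero    f = 0#
 ∑(suc n)f = ∑ n f + f n

 ∑-cong : ∀ n{f g} ->(∀ i -> i N.< n -> f i ≈ g i)-> ∑ n f ≈ ∑ n g
 ∑-cong zero    e = refl
 ∑-cong(suc n)e = +-cong(∑-cong n(\i p -> e i(m≤1+n p)))(e n rfN)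

 ∑-ext : ∀ n{f g} ->(∀ i -> f i ≈ g i)-> ∑ n f ≈ ∑ n g
 ∑-ext n e = ∑-cong n(\i _ -> e i)

 ∑-+ : ∀ n f g -> ∑ n(\i -> f i + g i)≈ ∑ n f + ∑ n g
 ∑-+ zero    f g =(alg "0=0+0")
 ∑-+(suc n)f g = trans(+-congʳ(∑-+ n f g))(alg "a+b+(c+d)=a+c+(b+d)")

 ∑-* : ∀ n c f -> ∑ n(\i -> c * f i)≈ c * ∑ n f
 ∑-* zero    c f =(alg "0=a0")
 ∑-*(suc n)c f = trans(+-congʳ(∑-* n c f))(alg "ab+ac=a(b+c)")

 ∑-neg : ∀ n f -> ∑ n(\i -> - f i)≈ - ∑ n f
 ∑-neg zero    f =(alg "0=-0")
 ∑-neg(suc n)f = trans(+-congʳ(∑-neg n f))(alg "-a+-b=-(a+b)")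

 ∑-- : ∀ n f g -> ∑ n(\i -> f i - g i)≈ ∑ n f - ∑ n g
 ∑-- n f g = trans(∑-+ n f(\i -> - g i))(+-congˡ(∑-neg n g))

 ∑-0 : ∀ n{f} ->(∀ i -> i N.< n -> f i ≈ 0#)-> ∑ n f ≈ 0#
 ∑-0 zero    e = refl
 ∑-0(suc n)e = trans(+-cong(∑-0 n(\i p -> e i(m≤1+n p)))(e n rfN))(alg "0+0=0")

 ∑-const : ∀ n c -> ∑ n(\_ -> c)≈ fromℕ n * c
 ∑-const zero    c =(alg "0=0a")
 ∑-const(suc n)c = trans(+-congʳ(∑-const n c))(alg "ab+b=(1+a)b")

 ∑-swap : ∀ m n(f : ℕ -> ℕ -> Carrier)-> ∑ m(\i -> ∑ n(f i))≈ ∑ n(\j -> ∑ m(\i -> f i j))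
 ∑-swap zero    n f = sym(∑-0 n(\_ _ -> refl))
 ∑-swap(suc m)n f = trans(+-congʳ(∑-swap m n f))(sym(∑-+ n _ _))

 ∑-split : ∀ m n f -> ∑(m N.+ n)f ≈ ∑ m f + ∑ n(\i -> f(m N.+ i))
 ∑-split m zero    f = trans(reflexive(E.cong(\k -> ∑ k f)(N.+-identityʳ m)))(alg "a=a+0")
 ∑-split m(suc n)f = trans(reflexive(E.cong(\k -> ∑ k f)(N.+-suc m n)))
  (trans(+-congʳ(∑-split m n f))(alg "a+b+c=a+(b+c)"))

 ∑-tele : ∀ n(f : ℕ -> Carrier)-> ∑ n(\i -> f(suc i)- f i)≈ f n - f 0
 ∑-tele zero    f =(alg "0=a-a")
 ∑-tele(suc n)f = trans(+-congʳ(∑-tele n f))(alg "a-b+(c-a)=c-b")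

 ∑-first : ∀ n f -> ∑(suc n)f ≈ f 0 + ∑ n(\i -> f(suc i))
 ∑-first n f = trans(∑-split 1 n f)(alg "0+a+b=a+b")

 ∑-single : ∀ n k f -> k N.< n ->(∀ i -> i N.< n -> ¬(i ≡ k)-> f i ≈ 0#)-> ∑ n f ≈ f k
 ∑-single(suc n)k f k<n z with k N.≟ n
 ... | yes E.refl = trans(+-congʳ(∑-0 n(\i p -> z i(m≤1+n p)(N.<⇒≢ p))))(alg "0+a=a")
 ... | no k≢n = trans(+-cong(∑-single n k f(N.≤∧≢⇒<(N.s≤s⁻¹ k<n)k≢n)(\i p -> z i(m≤1+n p)))
  (z n rfN(\e -> k≢n(E.sym e))))(alg "a+0=a")

 ∑-pad : ∀ {m n} f -> m N.≤ n ->(∀ i -> m N.≤ i -> i N.< n -> f i ≈ 0#)-> ∑ n f ≈ ∑ m f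
 ∑-pad{m}{n} f m≤n z with m+o≡n m≤n
 ... | k , E.refl = trans(∑-split m k f)(trans(+-congˡ(∑-0 k(\i p -> z(m N.+ i)(m≤m+n m i)(N.+-monoʳ-< m p))))
  (alg "a+0=a"))

module Multiples (C : CommutativeRing 0ℓ 0ℓ) where
 open CommutativeRing C
 open Solver C
 open FiniteSums C

 keep :{P : Set} -> Dec P -> Carrier -> Carrier
 keep(yes _)x = x
 keep(no _)  x = 0#

 keep-yes : ∀ {P x}(d : Dec P)-> P -> keep d x ≈ x
 keep-yes(yes _)p = refl
 keep-yes(no n)  p = absurd(n p)

 keep-no : ∀ {P x}(d : Dec P)-> ¬ P -> keep d x ≈ 0#
 keep-no(yes p)n = absurd(n p)
 keep-no(no _)  n = refl

 keep-cong : ∀ {P x y}(d : Dec P)->(P -> x ≈ y)-> keep d x ≈ keep d y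
 keep-cong(yes p)f = f p
 keep-cong(no _)  f = refl

 ∑-multiples : ∀ p .{{_ : Nz p}} N(f : ℕ -> Carrier)-> ∑(N N.* p)(\n -> keep(p ∣? n)(f n))≈ ∑ N(\m -> f(p N.* m))
 ∑-multiples p zero    f = refl
 ∑-multiples p(suc N)f = trans(reflexive(E.cong(\k -> ∑ k g)(N.+-comm p(N N.* p))))
  (trans(∑-split(N N.* p)p g)(+-cong(∑-multiples p N f)(trans(∑-single p 0 _(N.>-nonZero⁻¹ p)off)at0)))
  where
  g : ℕ -> Carrier
  g n = keep(p ∣? n)(f n)
  off : ∀ i -> i N.< p -> ¬(i ≡ 0)-> g(N N.* p N.+ i)≈ 0#
  off zero    _   n = absurd(n E.refl)
  off(suc i)i<p _ = keep-no(p ∣? _)\d -> N.>⇒∤ i<p(N.∣m+n∣m⇒∣n d(N.n∣m*n N))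
  at0 : g(N N.* p N.+ 0)≈ f(p N.* N)
  at0 = trans(reflexive(E.cong g(E.trans(N.+-identityʳ(N N.* p))(N.*-comm N p))))(keep-yes(p ∣? _)(N.m∣m*n N))

prime-factor : ∀ n -> 1 N.< n -> ∃ \p -> Prime p × p ∣ n
prime-factor n 1<n with factorise n{{N.>-nonZero(N.<-trans(s≤s z≤n)1<n)}}
... | record{ factors = [] ; isFactorisation = q } = absurd(N.<⇒≢ 1<n(E.sym q))
... | record{ factors = p ∷ ps ; isFactorisation = q ; factorsPrime = pp ∷ _ } = p , pp , E.subst(p ∣_)(E.sym q)(N.m∣m*n _)

n<2^n : ∀ n -> n N.< 2 N.^ n
n<2^n zero    = s≤s z≤n
n<2^n(suc n)= N.+-mono-≤(N.m^n>0 2 n)(E.subst(suc n N.≤_)(E.sym(N.+-identityʳ(2 N.^ n)))(n<2^n n))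

module LogSum (C : CommutativeRing 0ℓ 0ℓ) (ℓ : ℕ -> CommutativeRing.Carrier C)
 (ℓ-1 : CommutativeRing._≈_ C(ℓ 1)(CommutativeRing.0# C))
 (ℓ-* : ∀ m n .{{_ : Nz m}} .{{_ : Nz n}} -> CommutativeRing._≈_ C(ℓ(m N.* n))(CommutativeRing._+_ C(ℓ m)(ℓ n)))where
 open CommutativeRing C
 open Solver C
 open FiniteSums C
 open Multiples C

 mult : ℕ -> ℕ -> ℕ -> Carrier
 mult X p n = ∑ X(\k -> keep(p N.^ suc k ∣? n)1#)

 keep-iff : ∀ {P Q : Set}(d : Dec P)(d' : Dec Q){x} ->(P -> Q)->(Q -> P)-> keep d x ≈ keep d' x
 keep-iff(yes p)d' f g = sym(keep-yes d'(f p))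
 keep-iff(no n)  d' f g = sym(keep-no d'(\q -> n(g q)))

 mult-1 : ∀ X p -> Prime p -> mult X p 1 ≈ 0#
 mult-1 X p pp = ∑-0 X \k _ -> keep-no(p N.^ suc k ∣? 1)\d -> N.nonTrivial⇒≢1{{nt pp}}(N.∣1⇒≡1(N.∣-trans(N.m∣m*n(p N.^ k))d))

 mult-same : ∀ X p m .{{_ : Nz m}} -> Prime p -> m N.≤ X -> mult X p(p N.* m)≈ 1# + mult X p m
 mult-same zero    p(suc m)pp()
 mult-same(suc X)p m pp m≤X = trans(∑-ext(suc X)\k -> keep-iff(p N.^ suc k ∣?(p N.* m))(p N.^ k ∣? m)(N.*-cancelˡ-∣ p)(N.*-monoʳ-∣ p))
  (trans(∑-first X _)(+-cong(keep-yes(p N.^ 0 ∣? m)(N.1∣ m))(sym(trans(+-congˡ(keep-no(p N.^ suc X ∣? m)big))(alg "a+0=a")))))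
  where
  instance
   _ : Nz p
   _ = pr≢0 pp
  big : ¬(p N.^ suc X ∣ m)
  big d = N.<⇒≱(N.<-≤-trans(n<2^n(suc X))(trN(N.^-monoˡ-≤(suc X)(prime>1 pp))(N.∣⇒≤ d)))m≤X
   where
   prime>1 : ∀ {p} -> Prime p -> 1 N.< p
   prime>1{p} pp = N.nonTrivial⇒n>1 p{{nt pp}}

 mult-other : ∀ X p q m -> Prime p -> Prime q -> ¬(p ≡ q)-> mult X p(q N.* m)≈ mult X p m
 mult-other X p q m pp pq n = ∑-ext X \k -> keep-iff(p N.^ suc k ∣?(q N.* m))(p N.^ suc k ∣? m)(strip(suc k)m)(N.∣n⇒∣m*n q)
  where
  instance
   _ : Nz p
   _ = pr≢0 pp
  strip : ∀ k m -> p N.^ k ∣ q N.* m -> p N.^ k ∣ m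
  strip zero    m d = N.1∣ m
  strip(suc k)m d with euclidsLemma q m pp(N.∣-trans(N.m∣m*n(p N.^ k))d)
  ... | inl p∣q with prime⇒irreducible pq p∣q
  ...   | inl p≡1 = absurd(N.nonTrivial⇒≢1{{nt pp}} p≡1)
  ...   | inr p≡q = absurd(n p≡q)
  strip(suc k)m d | inr(N.divides m' E.refl)= E.subst(p N.^ suc k ∣_)(N.*-comm p m')(N.*-monoʳ-∣ p(strip k m'(N.*-cancelˡ-∣ p
   (E.subst(p N.^ suc k ∣_)(E.trans(E.sym(N.*-assoc q m' p))(N.*-comm(q N.* m')p))d))))

 log-expand : ∀ X n .{{_ : Nz n}} -> n N.≤ X -> ℓ n ≈ ∑(suc X)(\p -> keep(prime? p)(ℓ p * mult X p n))
 log-expand X n = go n(<-wellFounded n)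
  where
  go : ∀ n -> Acc N._<_ n -> .{{_ : Nz n}} -> n N.≤ X -> ℓ n ≈ ∑(suc X)(\p -> keep(prime? p)(ℓ p * mult X p n))
  go(suc zero)_ _ = trans ℓ-1(sym(∑-0(suc X)\p _ -> zero-term p))
   where
   zero-term : ∀ p -> keep(prime? p)(ℓ p * mult X p 1)≈ 0#
   zero-term p with prime? p
   ... | yes pp = trans(*-congˡ(mult-1 X p pp))(alg "a0=0")
   ... | no _   = refl
  go n@(suc(suc _))(acc rec)n≤X with prime-factor n(s≤s(s≤s z≤n))
  ... | q , pq , N.divides m eq = trans(reflexive(E.cong ℓ n≡))(trans(ℓ-* q m)(trans(+-congˡ(go m(rec m<n)(trN(N.<⇒≤ m<n)n≤X)))
   (sym(trans(reflexive(E.cong(\k -> ∑(suc X)(\p -> keep(prime? p)(ℓ p * mult X p k)))n≡))(trans(∑-ext(suc X)split)(trans(∑-+(suc X)_ _)(+-congʳ(trans(∑-single(suc X)q _(s≤s(trN(E.subst(q N.≤_)(E.sym eq)(N.m≤n*m q m))n≤X))\p _ p≢q -> keep-no(p N.≟ q)p≢q)(keep-yes(q N.≟ q)E.refl)))))))))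
   where
   instance
    q≢0 : Nz q
    q≢0 = pr≢0 pq
    m≢0 : Nz m
    m≢0 = N.≢-nonZero λ { E.refl -> N.1+n≢0 eq }
   n≡ : n ≡ q N.* m
   n≡ = E.trans eq(N.*-comm m q)
   m<n : m N.< n
   m<n = E.subst(m N.<_)(E.sym eq)(N.m<m*n m q(N.nonTrivial⇒n>1 q{{nt pq}}))
   split : ∀ p -> keep(prime? p)(ℓ p * mult X p(q N.* m))≈ keep(p N.≟ q)(ℓ p)+ keep(prime? p)(ℓ p * mult X p m)
   split p with prime? p | p N.≟ q
   ... | yes pp | yes E.refl = trans(*-congˡ(mult-same X p m pp(trN(N.<⇒≤ m<n)n≤X)))(alg "a(1+b)=a+ab")
   ... | yes pp | no n = trans(*-congˡ(mult-other X p q m pp pq n))(alg "ab=0+ab")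
   ... | no np | yes E.refl = absurd(np pq)
   ... | no _ | no _ =(alg "0=0+0")

 ∑-divisible : ∀ d .{{_ : Nz d}} N(F : ℕ -> Carrier)-> ∑(suc N)(\n -> keep(d ∣? n)(F n))≈ ∑(suc(N N./ d))(\m -> F(d N.* m))
 ∑-divisible d N F = trans(sym(∑-pad _ N<Md off))(∑-multiples d(suc(N N./ d))F)
  where
  N<Md : N N.< suc(N N./ d)N.* d
  N<Md = E.subst(N._< suc(N N./ d)N.* d)(E.sym(m≡m%n+[m/n]*n N d))(N.+-monoˡ-<(N N./ d N.* d)(m%n<n N d))
  off : ∀ i -> suc N N.≤ i -> i N.< suc(N N./ d)N.* d -> keep(d ∣? i)(F i)≈ 0#
  off i N<i i< = keep-no(d ∣? i)λ { (N.divides j E.refl)-> N.<⇒≱ N<i(trN(N.*-monoˡ-≤ d(N.s≤s⁻¹(N.*-cancelʳ-< d j(suc(N N./ d))i<)))(m/n*n≤m N d)) }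

 log-sum : ∀ {N X}(F : ℕ -> Carrier)-> N N.≤ X -> F 0 ≈ 0# -> ∑(suc N)(\n -> ℓ n * F n)≈
  ∑(suc X)(\p -> keep(prime? p)(ℓ p * ∑ X(\k -> ∑(suc N)(\n -> keep(p N.^ suc k ∣? n)(F n)))))
 log-sum{N}{X} F N≤X F0 = trans(∑-cong(suc N)each)(trans(∑-swap(suc N)(suc X)_)(∑-ext(suc X)collect))
  where
  pull : ∀ {P : Set}(d : Dec P)x y -> keep d x * y ≈ keep d(x * y)
  pull(yes _)x y = refl
  pull(no _)  x y =(alg "0a=0")
  each : ∀ n -> n N.< suc N -> ℓ n * F n ≈ ∑(suc X)(\p -> keep(prime? p)(ℓ p * mult X p n)* F n)
  each zero    _ = trans(*-congˡ F0)(trans(alg "a0=0")(sym(∑-0(suc X)\p _ -> trans(*-congˡ F0)(alg "a0=0"))))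
  each n@(suc _)n< = trans(*-congʳ(log-expand X n(trN(N.s≤s⁻¹ n<)N≤X)))(trans(alg "ab=ba")
   (trans(sym(∑-*(suc X)(F n)_))(∑-ext(suc X)\p ->(alg "ab=ba"))))
  collect : ∀ p -> ∑(suc N)(\n -> keep(prime? p)(ℓ p * mult X p n)* F n)≈ keep(prime? p)(ℓ p * ∑ X(\k -> ∑(suc N)(\n -> keep(p N.^ suc k ∣? n)(F n))))
  collect p with prime? p
  ... | no _  = ∑-0(suc N)\n _ ->(alg "0a=0")
  ... | yes _ = trans(∑-ext(suc N)\n ->(alg "abc=a(cb)"))(trans(∑-*(suc N)(ℓ p)_)(*-congˡ
   (trans(∑-ext(suc N)\n -> trans(sym(∑-* X(F n)_))(∑-ext X \k -> trans(alg "ab=ba")(trans(pull(p N.^ suc k ∣? n)1#(F n))(keep-cong(p N.^ suc k ∣? n)\_ ->(alg "1a=a")))))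
    (∑-swap(suc N)X _))))

split-power : ∀ p -> Prime p -> ∀ n .{{_ : Nz n}} -> ∃ \k -> ∃ \m -> n ≡ p N.^ k N.* m × ¬(p ∣ m)× Nz m × m N.≤ n
split-power p pp n = go n(<-wellFounded n)
 where
 go : ∀ n -> Acc N._<_ n -> .{{_ : Nz n}} -> ∃ \k -> ∃ \m -> n ≡ p N.^ k N.* m × ¬(p ∣ m)× Nz m × m N.≤ n
 go n@(suc _)(acc rec)with p ∣? n
 ... | no ¬d = 0 , n , E.sym(N.*-identityˡ n), ¬d , _ , rfN
 ... | yes(N.divides m eq)with go m(rec m<n){{m≢0}}
  where
  m≢0 : Nz m
  m≢0 = N.≢-nonZero λ { E.refl -> N.1+n≢0 eq }
  m<n : m N.< n
  m<n = E.subst(m N.<_)(E.sym eq)(N.m<m*n m p{{m≢0}}(N.nonTrivial⇒n>1 p{{nt pp}}))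
 ...   | k , m' , e , nd , nz , m'≤ = suc k , m' , E.trans eq(E.trans(N.*-comm m p)(E.trans(E.cong(p N.*_)e)(E.sym(N.*-assoc p(p N.^ k)m')))), nd , nz ,
  trN m'≤(E.subst(m N.≤_)(E.sym eq)(N.m≤m*n m p{{pr≢0 pp}}))

module Theory (𝓡 : Reals) where
 open Reals 𝓡
 infixr 5 _⨾_ _∙_ _⊙_
 _⨾_ : ∀ {x y z} -> x ≤ y -> y ≤ z -> x ≤ z
 _⨾_ = ≤t
 _∙_ : ∀ {x y z} -> x ≈ y -> y ≈ z -> x ≈ z
 _∙_ = trans

 infix 9 #_
 #_ : ℕ -> R
 # n = fromℕ n

 ≤r : ∀ {x} -> x ≤ x
 ≤r = e≤ refl

 rs≤ : ∀ {x x' y} -> x ≈ x' -> x ≤ y -> x' ≤ y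
 rs≤ e = ≤t(e≤(sym e))

 ≤rs : ∀ {x y y'} -> y ≈ y' -> x ≤ y -> x ≤ y'
 ≤rs e p = ≤t p(e≤ e)

 opaque
  lin : ∀ {a b c d} -> a ≤ b -> d - c ≈ b - a -> c ≤ d
  lin{a}{b}{c}{d} p e = rs≤(alg "a+(b-a)=b")
   (≤rs(alg "a+(b-c)=a-c+b" ∙ +ʳ(sym e)∙ alg "a-b+b=a")(+-monoʳ(c - a)p))

  lin< : ∀ {a b c d} -> a < b -> d - c ≈ b - a -> c < d
  lin<{a}{b}{c}{d} p e q = p(lin q(alg "a-b=-(b-a)" ∙ -₁(sym e)∙ alg "-(a-b)=b-a"))

  lin≈ : ∀ {a b c d} -> a ≈ b -> d - c ≈ b - a -> c ≈ d
  lin≈{a}{b}{c}{d} p e = trans(alg "a=b-b+a")(+ʳ(+ˡ(-₁(sym p)))∙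
   +ʳ(sym e)∙ alg "a-b+b=a")

 infixl 6 _⊹_ _⊹<_
 _⊹_ : ∀ {a b c d} -> a ≤ b -> c ≤ d -> a + c ≤ b + d
 _⊹_{a}{b}{c}{d} p q = ≤t(+-monoʳ c p)(lin q(alg "a+b-(a+c)=b-c"))

 <≤ : ∀ {x y} -> x < y -> x ≤ y
 <≤{x}{y} p with ≤-total x y
 ... | inl q = q
 ... | inr q = absurd(p q)

 <≤tr : ∀ {x y z} -> x < y -> y ≤ z -> x < z
 <≤tr p q r = p(q ⨾ r)

 ≤<tr : ∀ {x y z} -> x ≤ y -> y < z -> x < z
 ≤<tr p q r = q(r ⨾ p)

 <-respʳ : ∀ {x y y'} -> y ≈ y' -> x < y -> x < y'
 <-respʳ e p = <≤tr p(e≤ e)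

 <-respˡ : ∀ {x x' y} -> x ≈ x' -> x < y -> x' < y
 <-respˡ e p = ≤<tr(e≤(sym e))p

 _⊹<_ : ∀ {a b c d} -> a < b -> c ≤ d -> a + c < b + d
 _⊹<_{a}{b}{c}{d} p q r = p(lin(r ⊹ q)(alg "a-b=a+c+d-(b+d+c)"))

 ≤∨< : ∀ x y -> x ≤ y ⊎ y < x
 ≤∨< x y with em{x ≤ y}
 ... | yes p = inl p
 ... | no p  = inr p

 ≮⇒≥ : ∀ {x y} -> ¬(x < y)-> y ≤ x
 ≮⇒≥{x}{y} p with ≤∨< y x
 ... | inl q = q
 ... | inr q = absurd(p q)

 <-irrefl : ∀ {x y} -> x ≈ y -> ¬(x < y)
 <-irrefl e p = p(e≤(sym e))

 <⇒≉ : ∀ {x} -> 0# < x -> ¬(x ≈ 0#)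
 <⇒≉ p e = p(e≤ e)

 ≤-neg : ∀ {x y} -> x ≤ y -> - y ≤ - x
 ≤-neg{x}{y} p = lin p(alg "-a--b=b-a")

 0≤-by : ∀ {x y} -> x ≤ y -> 0# ≤ y - x
 0≤-by{x}{y} p = lin p(alg "a-b-0=a-b")

 0<-by : ∀ {x y} -> x < y -> 0# < y - x
 0<-by{x}{y} p = lin< p(alg "a-b-0=a-b")

 *-mono : ∀ {a b c d} -> 0# ≤ a -> 0# ≤ d -> a ≤ b -> c ≤ d -> a * c ≤ b * d
 *-mono{a}{b}{c}{d} p q r s = lin(0≤* p(0≤-by s)⊹ 0≤* q(0≤-by r))
  (alg "ab-cd=c(b-d)+b(a-c)-(0+0)")

 *≤ : ∀ {k a b} -> 0# ≤ k -> a ≤ b -> k * a ≤ k * b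
 *≤{k}{a}{b} p q = lin(0≤* p(0≤-by q))(alg "ab-ac=a(b-c)-0")

 ≤* : ∀ {k a b} -> 0# ≤ k -> a ≤ b -> a * k ≤ b * k
 ≤*{k}{a}{b} p q = lin(0≤* p(0≤-by q))(alg "ab-cb=b(a-c)-0")

 0≤+ : ∀ {x y} -> 0# ≤ x -> 0# ≤ y -> 0# ≤ x + y
 0≤+{x}{y} p q = lin(p ⊹ q)(alg "a+b-0=a+b-(0+0)")

 0≤sq : ∀ x -> 0# ≤ x * x
 0≤sq x with ≤-total 0# x
 ... | inl p = 0≤* p p
 ... | inr p = lin(0≤* n n)(alg "aa-0=-a(-a)-0")
  where n = lin p(alg "-a-0=0-a")

 0≤1 : 0# ≤ 1#
 0≤1 = ≤rs(alg "1(1)=1")(0≤sq 1#)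

 0<1 : 0# < 1#
 0<1 = 1≰0

 0≤# : ∀ n -> 0# ≤ # n
 0≤# zero    = ≤r
 0≤#(suc n)= 0≤+ 0≤1(0≤# n)

 0<#s : ∀ n -> 0# < # suc n
 0<#s n = <-respʳ refl(<≤tr 0<1(lin(0≤# n)(alg "1+a-1=a-0")))

 #-mono : ∀ {m n} -> m N.≤ n -> # m ≤ # n
 #-mono{n = n} z≤n = 0≤# n
 #-mono(s≤s p)= ≤r ⊹ #-mono p

 open import Algebra.Properties.Semiring.Mult (CommutativeRing.semiring ring) using (×-homo-+; ×1-homo-*)

 #-+ : ∀ m n -> #(m N.+ n)≈ # m + # n
 #-+ m n = ×-homo-+ 1# m n

 #-* : ∀ m n -> #(m N.* n)≈ # m * # n
 #-* m n = ×1-homo-* m n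

 #-cancel-≤ : ∀ {m n} -> # m ≤ # n -> m N.≤ n
 #-cancel-≤{m}{n} p with m N.≤? n
 ... | yes q = q
 ... | no q  = absurd(0<1(lin(p ⊹ #-mono(N.≰⇒> q))(alg "0-1=a+b-(b+(1+a))")))

 *-pos : ∀ {x y} -> 0# < x -> 0# < y -> 0# < x * y
 *-pos{x}{y} p q r with inverse x(<⇒≉ p)
 ... | z , e with ≤-total 0# z
 ... | inl 0≤z = q(lin(0≤* 0≤z(lin r(alg "-(ab)-0=0-ab")))
  (alg "0-a=-(1a)" ∙ -₁(*ʳ(sym e))∙ alg "-(abc)=b(-(ac))-0"))
 ... | inr z≤0 = 1≰0(lin(0≤*(<≤ p)(lin z≤0(alg "-a-0=0-a")))
  (alg "0-1=-1" ∙ -₁(sym e)∙ alg "-(ab)=a(-b)-0"))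

 +-pos : ∀ {x y} -> 0# < x -> 0# ≤ y -> 0# < x + y
 +-pos{x}{y} p q = lin<(p ⊹< q)(alg "a+b-0=a+b-(0+0)")

 cancel : ∀ {c a b} -> 0# < c -> c * a ≤ c * b -> a ≤ b
 cancel{c}{a}{b} p q with ≤∨< a b
 ... | inl r = r
 ... | inr r = absurd(*-pos p(0<-by r)(lin q(alg "0-a(b-c)=ac-ab")))

 inv : R -> R
 inv x with em{x ≈ 0#}
 ... | yes _ = 0#
 ... | no p  = fst(inverse x p)

 inv-r± : ∀ {x} -> ¬(x ≈ 0#)-> x * inv x ≈ 1#
 inv-r±{x} n with em{x ≈ 0#}
 ... | yes p = absurd(n p)
 ... | no p  = snd(inverse x p)

 inv-r : ∀ {x} -> 0# < x -> x * inv x ≈ 1#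
 inv-r p = inv-r±(<⇒≉ p)

 inv-uniq : ∀ {x y} -> x * y ≈ 1# -> y ≈ inv x
 inv-uniq{x}{y} e = alg "a=1a" ∙ *ʳ(sym(inv-r± x≉0))∙
  alg "abc=acb" ∙ *ʳ e ∙ alg "1a=a"
  where
  x≉0 : ¬(x ≈ 0#)
  x≉0 z = 1≰0(e≤(sym e ∙ *ʳ z ∙ alg "0a=0"))

 inv⁺ : ∀ {x} -> 0# < x -> 0# < inv x
 inv⁺{x} p q = 1≰0(lin(0≤*(<≤ p)(lin q(alg "-a-0=0-a")))
  (alg "0-1=-1" ∙ -₁(sym(inv-r p))∙ alg "-(ab)=a(-b)-0"))

 infixl 7 _/_
 _/_ : R -> R -> R
 x / y = x * inv y

 /-≤ : ∀ {a b c} -> 0# < c -> a ≤ b * c -> a / c ≤ b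
 /-≤{a}{b}{c} p q = ≤rs(alg "abc=a(bc)" ∙ *ˡ(inv-r p)∙ alg "a1=a")
  (≤*(<≤(inv⁺ p))q)

 ≤-/ : ∀ {a b c} -> 0# < c -> a * c ≤ b -> a ≤ b / c
 ≤-/{a}{b}{c} p q = rs≤(alg "abc=a(bc)" ∙ *ˡ(inv-r p)∙ alg "a1=a")
  (≤*(<≤(inv⁺ p))q)

 /-* : ∀ {a c} -> 0# < c -> a / c * c ≈ a
 /-*{a}{c} p = trans(alg "abc=a(cb)")(*ˡ(inv-r p)∙ alg "a1=a")

 *-/ : ∀ {a c} -> 0# < c -> c *(a / c)≈ a
 *-/{a}{c} p = trans(alg "ab=ba")(/-* p)

 /-pos : ∀ {a c} -> 0# < a -> 0# < c -> 0# < a / c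
 /-pos p q = *-pos p(inv⁺ q)

 inv-anti : ∀ {x y} -> 0# < x -> x ≤ y -> inv y ≤ inv x
 inv-anti{x}{y} p q = rs≤(alg "1a=a")(/-≤(<≤tr p q)
  (rs≤(inv-r p)(≤rs(alg "ab=ba")(≤*(<≤(inv⁺ p))q))))

 2# : R
 2# = # 2

 half : R -> R
 half x = x / 2#

 h+h : ∀ x -> half x + half x ≈ x
 h+h x = trans(alg "a+a=a2")(/-*(0<#s 1))

 half-pos : ∀ {x} -> 0# < x -> 0# < half x
 half-pos p = /-pos p(0<#s 1)

 half≤ : ∀ {x} -> 0# ≤ x -> half x ≤ x
 half≤{x} p = lin(0≤* p(<≤(inv⁺(0<#s 1))))(+ʳ(sym(h+h x))∙ alg "a+a-a=a-0")

 ≤-by-ε : ∀ {x y} ->(∀ ε -> 0# < ε -> x ≤ y + ε)-> x ≤ y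
 ≤-by-ε{x}{y} f with ≤∨< x y
 ... | inl p = p
 ... | inr p = absurd(half-pos(0<-by p)(lin(f _(half-pos(0<-by p))⊹ e≤(h+h(x - y)))
  (alg "0-a=b+a+(c-b)-(c+(a+a))")))

 abs : R -> R
 abs x with ≤-total 0# x
 ... | inl _ = x
 ... | inr _ = - x

 abs-ge : ∀ x -> x ≤ abs x
 abs-ge x with ≤-total 0# x
 ... | inl _ = ≤r
 ... | inr p = lin(p ⊹ p)(alg "-a-a=0+0-(a+a)")

 abs-ge⁻ : ∀ x -> - x ≤ abs x
 abs-ge⁻ x with ≤-total 0# x
 ... | inl p = lin(p ⊹ p)(alg "a--a=a+a-(0+0)")
 ... | inr _ = ≤r

 abs-≤ : ∀ {x b} -> x ≤ b -> - x ≤ b -> abs x ≤ b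
 abs-≤{x} p q with ≤-total 0# x
 ... | inl _ = p
 ... | inr _ = q

 0≤abs : ∀ x -> 0# ≤ abs x
 0≤abs x with ≤-total 0# x
 ... | inl p = p
 ... | inr p = lin p(alg "-a-0=0-a")

 abs-0≤ : ∀ {x} -> 0# ≤ x -> abs x ≈ x
 abs-0≤{x} p = ≤-antisym(abs-≤ ≤r(lin(p ⊹ p)(alg "a--a=a+a-(0+0)")))(abs-ge x)

 abs-sq : ∀ x -> abs x * abs x ≈ x * x
 abs-sq x with ≤-total 0# x
 ... | inl _ = refl
 ... | inr _ =(alg "-a(-a)=aa")



 min⁺ : ∀ {x y} -> 0# < x -> 0# < y -> ∃ \z -> 0# < z × z ≤ x × z ≤ y
 min⁺{x}{y} p q with ≤-total x y
 ... | inl r = x , p , ≤r , r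
 ... | inr r = y , q , r , ≤r

 sq-≤ : ∀ {x y} -> 0# ≤ y -> x * x ≤ y * y -> x ≤ y
 sq-≤{x}{y} p q with ≤∨< x y
 ... | inl r = r
 ... | inr r = absurd(*-pos(≤<tr p r)(0<-by r)
  (lin(q ⊹ 0≤* p(0≤-by(<≤ r)))(alg "0-a(a-b)=bb+b(a-b)-(aa+0)")))

 sq-cancel : ∀ {x y} -> 0# ≤ x -> 0# ≤ y -> x * x ≈ y * y -> x ≈ y
 sq-cancel p q e = ≤-antisym(sq-≤ q(e≤ e))(sq-≤ p(e≤(sym e)))

 abs-* : ∀ x y -> abs(x * y)≈ abs x * abs y
 abs-* x y = sq-cancel(0≤abs _)(0≤*(0≤abs x)(0≤abs y))(abs-sq(x * y)∙ sym(alg "ab(ab)=aa(bb)" ∙ *₂(abs-sq x)(abs-sq y)∙ alg "aa(bb)=ab(ab)"))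

 abs-cong : ∀ {x y} -> x ≈ y -> abs x ≈ abs y
 abs-cong{x}{y} e = ≤-antisym(abs-≤(rs≤(sym e)(abs-ge y))(rs≤(-₁(sym e))(abs-ge⁻ y)))
  (abs-≤(rs≤ e(abs-ge x))(rs≤(-₁ e)(abs-ge⁻ x)))

 abs-+ : ∀ x y -> abs(x + y)≤ abs x + abs y
 abs-+ x y = abs-≤(abs-ge x ⊹ abs-ge y)(lin(abs-ge⁻ x ⊹ abs-ge⁻ y)(alg "a+b--(c+d)=a+b-(-c+-d)"))

 open FiniteSums ring public

 ∑-mono : ∀ n{f g} ->(∀ i -> i N.< n -> f i ≤ g i)-> ∑ n f ≤ ∑ n g
 ∑-mono zero    p = ≤r
 ∑-mono(suc n)p = ∑-mono n(\i q -> p i(m≤1+n q))⊹ p n rfN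

 ∑-nonneg : ∀ n{f} ->(∀ i -> i N.< n -> 0# ≤ f i)-> 0# ≤ ∑ n f
 ∑-nonneg n p = rs≤(∑-0 n(\_ _ -> refl))(∑-mono n p)

 ∑-incl : ∀ {m n} f -> m N.≤ n ->(∀ i -> 0# ≤ f i)-> ∑ m f ≤ ∑ n f
 ∑-incl{m} f m≤n p with m+o≡n m≤n
 ... | k , E.refl = ≤rs(sym(∑-split m k f))
  (lin(∑-nonneg k(\i _ -> p(m N.+ i)))(alg "a+b-a=b-0"))

 term≤∑ : ∀ n f k -> k N.< n ->(∀ i -> 0# ≤ f i)-> f k ≤ ∑ n f
 term≤∑ n f k k<n p = ≤t(lin(∑-nonneg k(\i _ -> p i))(alg "a+b-b=a-0"))(∑-incl f k<n p)

 arch : ∀ c ε -> 0# < ε -> ∃ \N -> c ≤ # N * ε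
 arch c ε p with archimedean(c / ε)
 ... | N , q = N , rs≤(/-* p)(≤*(<≤ p)q)

 Lim :(ℕ -> R)-> R -> Set
 Lim f l = ∀ ε -> 0# < ε -> ∃ \N -> ∀ n -> N N.≤ n -> abs(f n - l)≤ ε

 UpperBound :(R -> Set)-> R -> Set
 UpperBound P u = ∀ x -> P x -> x ≤ u

 IsSup :(R -> Set)-> R -> Set
 IsSup P s = UpperBound P s ×(∀ u -> UpperBound P u -> s ≤ u)

 h : R
 h = inv 2#

 2h : # 2 * h ≈ 1#
 2h = inv-r(0<#s 1)

 0≤h : 0# ≤ h
 0≤h = <≤(inv⁺(0<#s 1))

 mid : R -> R -> R
 mid l u = l +(u - l)* h

 module _ (P : R -> Set) (a b : R) (Pa : P a) (ub : UpperBound P b) where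
  private
   Reached : R -> Set
   Reached l = ∃ \x -> P x × l ≤ x
   State : Set
   State = Σ R \l -> Σ R \u -> Reached l × UpperBound P u
   low high : State -> R
   low s  = fst s
   high s = fst(snd s)
   bisect : State -> State
   bisect(l , u , r , q)with em{UpperBound P(mid l u)}
   ... | yes q' = l , mid l u , r , q'
   ... | no ¬q with em{Reached(mid l u)}
   ...   | yes r' = mid l u , u , r' , q
   ...   | no ¬r = absurd(¬q \x Px -> <≤ \le -> ¬r(x , Px , le))
   opaque
    st : ℕ -> State
    st zero    = a , b ,(a , Pa , ≤r), ub
    st(suc n)= bisect(st n)
    lo hi : ℕ -> R
    lo n = low(st n)
    hi n = high(st n)
    low≤high : ∀ s -> low s ≤ high s
    low≤high(l , u ,(x , Px , p), q)= ≤t p(q x Px)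
    lo0≤ : ∀ n -> lo n ≤ hi n
    lo0≤ n = low≤high(st n)
    reached : ∀ n -> Reached(lo n)
    reached n = fst(snd(snd(st n)))
    bound : ∀ n -> UpperBound P(hi n)
    bound n = snd(snd(snd(st n)))
    step : ∀ s -> low s ≤ low(bisect s)× high(bisect s)≤ high s ×
     high(bisect s)- low(bisect s)≈(high s - low s)* h
    step s@(l , u , r , q)with em{UpperBound P(mid l u)}
    ... | yes q' = ≤r ,
     lin(0≤*(0≤-by(low≤high s))0≤h ⊹ e≤(*ˡ{u - l} 2h))
      (alg "a-(b+(a-b)c)=(a-b)c+(a-b)1-(0+(a-b)(2c))"),
     (alg "a+(b-a)c-a=(b-a)c")
    ... | no ¬q with em{Reached(mid l u)}
    ...   | yes r' = lin(0≤*(0≤-by(low≤high s))0≤h)(alg "a+(b-a)c-a=(b-a)c-0"), ≤r ,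
     lin≈(*ˡ{u - l}(sym 2h))(alg "(a-b)c-(a-(b+(a-b)c))=(a-b)(2c)-(a-b)1")
    ...   | no ¬r = absurd(¬q \x Px -> <≤ \le -> ¬r(x , Px , le))
    lo-mono : ∀ {m n} -> m N.≤ n -> lo m ≤ lo n
    lo-mono p = mono(N.≤⇒≤′ p)where
     mono : ∀ {m n} -> m N.≤′ n -> lo m ≤ lo n
     mono N.≤′-refl     = ≤r
     mono{n = suc n}(N.≤′-step p)= ≤t(mono p)(fst(step(st n)))
    hi-anti : ∀ {m n} -> m N.≤ n -> hi n ≤ hi m
    hi-anti p = anti(N.≤⇒≤′ p)where
     anti : ∀ {m n} -> m N.≤′ n -> hi n ≤ hi m
     anti N.≤′-refl     = ≤r
     anti{n = suc n}(N.≤′-step p)= ≤t(fst(snd(step(st n))))(anti p)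
    width : ∀ n -> #(suc n)*(hi n - lo n)≤ b - a
    width zero    = e≤(alg "(1+0)(a-b)=a-b")
    width(suc n)= ≤t(rs≤(*ˡ(sym(snd(snd(step(st n))))))
     (lin(0≤*(0≤# n)(0≤*(0≤-by(low≤high(st n)))0≤h)⊹ e≤(*ˡ{#(suc n)*(hi n - lo n)} 2h))
      (alg "(1+a)(b-c)-(1+(1+a))((b-c)d)=a((b-c)d)+(1+a)(b-c)1-(0+(1+a)(b-c)(2d))")))(width n)
   small : ∀ ε -> 0# < ε -> ∃ \N -> hi N - lo N ≤ ε
   small ε p with arch(b - a)ε p
   ... | N , q = N , cancel(0<#s N)(width N ⨾ q ⨾ ≤*(<≤ p)(#-mono(n≤1+n N)))
   lo≤hi : ∀ m n -> lo m ≤ hi n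
   lo≤hi m n with N.≤-total m n
   ... | inl p = ≤t(lo-mono p)(lo0≤ n)
   ... | inr p = ≤t(lo0≤ m)(hi-anti p)
   limit : ∃ \l -> ∀ ε -> 0# < ε -> ∃ \N -> ∀ n -> N N.≤ n -> lo n - l ≤ ε × l - lo n ≤ ε
   limit = complete lo \ε p -> let (N , w)= small ε p in
    N , \m n Nm Nn -> lin(w ⊹ lo≤hi m N ⊹ lo-mono Nn)(alg "a-(b-c)=a+d+c-(d-e+b+e)")

  opaque
   supremum : ∃(IsSup P)
   supremum with limit
   ... | s , lim = s , upper , least
    where
    upper : UpperBound P s
    upper x Px = ≤-by-ε \ε p ->
     let N , f = lim(half ε)(half-pos p); M , w = small(half ε)(half-pos p)
     in lin(bound(N N.⊔ M)x Px ⊹ hi-anti(N.m≤n⊔m N M)⊹ w ⊹ lo-mono(N.m≤n⊔m N M)⊹ fst(f(N N.⊔ M)(N.m≤m⊔n N M))⊹ e≤(h+h ε))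
      (alg "a+b-c=d+e+f+g+f+b-(c+d+(e-h)+h+(g-a)+(f+f))")
    least : ∀ u -> UpperBound P u -> s ≤ u
    least u q = ≤-by-ε \ε p -> let N , f = lim ε p ; x , Px , r = reached N
     in lin(snd(f N rfN)⊹ r ⊹ q x Px)(alg "a+b-c=b+d+a-(c-e+e+d)")

 Monotone :(ℕ -> R)-> Set
 Monotone f = ∀ n -> f n ≤ f(suc n)

 mono-≤ : ∀ {f} -> Monotone f -> ∀ {m n} -> m N.≤ n -> f m ≤ f n
 mono-≤{f} mf p = go(N.≤⇒≤′ p)where
  go : ∀ {m n} -> m N.≤′ n -> f m ≤ f n
  go N.≤′-refl     = ≤r
  go(N.≤′-step p)= ≤t(go p)(mf _)

 opaque
  monotone-lim : ∀ f b -> Monotone f ->(∀ n -> f n ≤ b)-> ∃ \l ->(∀ n -> f n ≤ l)× l ≤ b × Lim f l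
  monotone-lim f b mf fb with supremum(\x -> ∃ \n -> x ≤ f n)(f 0)b(0 , ≤r)(λ { x(n , p)-> p ⨾ fb n })
  ... | l , u , m = l ,(\n -> u(f n)(n , ≤r)), m b(λ { x(n , p)-> p ⨾ fb n }), lim
   where
   lim : Lim f l
   lim ε p with em{∃ \N -> l - ε ≤ f N}
   ... | yes(N , q)= N , \n Nn -> abs-≤
    (lin(u(f n)(n , ≤r)⊹ <≤ p)(alg "a-(b-c)=c+a-(b+0)"))
    (lin(q ⊹ mono-≤ mf Nn)(alg "a--(b-c)=d+b-(c-a+d)"))
   ... | no nq = absurd(p(lin(m(l - ε)(λ { x(n , r)-> r ⨾ <≤ \s -> nq(n , s) }))(alg "0-a=b-a-b")))

 Continuous :(R -> R)-> Set
 Continuous f = ∀ x ε -> 0# < ε -> ∃ \δ -> 0# < δ ×(∀ y -> abs(y - x)≤ δ -> abs(f y - f x)≤ ε)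

 opaque
  intermediate : ∀ f -> Continuous f -> ∀ a b c -> a ≤ b -> f a ≤ c -> c ≤ f b -> ∃ \x -> a ≤ x × x ≤ b × f x ≈ c
  intermediate f cont a b c a≤b fa fb
   with supremum(\x -> x ≤ b × f x ≤ c)a b(a≤b , fa)(\_ -> fst)
  ... | s , u , m = s , u a(a≤b , fa), s≤b , ≤-antisym(≤-by-ε below)(≤-by-ε above)
   where
   s≤b : s ≤ b
   s≤b = m b(\_ -> fst)
   below : ∀ ε -> 0# < ε -> f s ≤ c + ε
   below ε p with cont s ε p
   ... | δ , δ>0 , near with em{∃ \x ->(x ≤ b × f x ≤ c)× s - δ ≤ x}
   ... | yes(x ,(xb , fx), q)= lin(abs-ge⁻(f x - f s)⊹ near x(abs-≤(lin(u x(xb , fx)⊹ <≤ δ>0)(alg "a-(b-c)=c+a-(b+0)"))(lin q(alg "a--(b-c)=b-(c-a)")))⊹ fx)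
    (alg "a+b-c=d+b+a-(-(e-c)+d+e)")
   ... | no nq = absurd(δ>0(lin(m(s - δ)(\x Px -> <≤ \r -> nq(x , Px , r)))(alg "0-a=b-a-b")))
   above : ∀ ε -> 0# < ε -> c ≤ f s + ε
   above ε p with cont s ε p
   ... | δ , δ>0 , near with ≤-total b(s + δ)
   ... | inl q = lin(fb ⊹ abs-ge(f b - f s)⊹ near b(abs-≤(lin q(alg "a-(b-c)=c+a-b"))(lin(s≤b ⊹ <≤ δ>0)(alg "a--(b-c)=b+a-(c+0)"))))
    (alg "a+b-c=d+e+b-(c+(d-a)+e)")
   ... | inr q with ≤∨<(f(s + δ))c
   ...   | inl r = absurd(δ>0(lin(u(s + δ)(q , r))(alg "0-a=b-(b+a)")))
   ...   | inr r = lin(<≤ r ⊹ abs-ge(f(s + δ)- f s)⊹ near(s + δ)(abs-≤(e≤(alg "a+b-a=b"))(lin(<≤ δ>0 ⊹ <≤ δ>0)(alg "a--(b+a-b)=a+a-(0+0)"))))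
    (alg "a+b-c=d+e+b-(c+(d-a)+e)")

 private
  square-cont : Continuous(\x -> x * x)
  square-cont x ε p with min⁺ 0<1(/-pos p(+-pos 0<1(0≤+(0≤abs x)(0≤abs x))))
  ... | δ , δ>0 , δ≤1 , δ≤ = δ , δ>0 , \y q -> ≤t
   (rs≤(sym(abs-*(y - x)(y - x +(x + x)))∙ abs-cong(alg "(a-b)(a-b+(b+b))=aa-bb"))
    (*-mono(0≤abs _)(0≤+ 0≤1(0≤+(0≤abs x)(0≤abs x)))(q ⨾ δ≤)
     (abs-+(y - x)(x + x)⨾ ≤t q δ≤1 ⊹ abs-+ x x)))
   (e≤(/-*(+-pos 0<1(0≤+(0≤abs x)(0≤abs x)))))

 opaque
  sqrt-exists : ∀ a -> 0# ≤ a -> ∃ \r -> 0# ≤ r × r * r ≈ a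
  sqrt-exists a p with intermediate(\x -> x * x)square-cont 0#(a + 1#)a(0≤+ p 0≤1)
   (rs≤(alg "0=0(0)")p)
   (lin(0≤* p p ⊹ p ⊹ 0≤1)(alg "(a+1)(a+1)-a=aa+a+1-(0+0+0)"))
  ... | r , 0≤r , _ , e = r , 0≤r , e

 sqrt : R -> R
 sqrt a with em{0# ≤ a}
 ... | yes p = fst(sqrt-exists a p)
 ... | no _  = 0#

 0≤sqrt : ∀ a -> 0# ≤ sqrt a
 0≤sqrt a with em{0# ≤ a}
 ... | yes p = fst(snd(sqrt-exists a p))
 ... | no _  = ≤r

 sqrt-sq : ∀ {a} -> 0# ≤ a -> sqrt a * sqrt a ≈ a
 sqrt-sq{a} q with em{0# ≤ a}
 ... | yes p = snd(snd(sqrt-exists a p))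
 ... | no n  = absurd(n q)

 infixl 6 _+c_
 infixl 7 _*c_
 infix  8 -c_
 infix  4 _~_

 record ℂ : Set where
  no-eta-equality
  constructor mk
  field
   re im : R
 open ℂ public

 record _~_(z w : ℂ): Set where
  constructor mk≈
  field
   re≈ : re z ≈ re w
   im≈ : im z ≈ im w
 open _~_ public

 _+c_ _*c_ : ℂ -> ℂ -> ℂ
 re(z +c w)= re z + re w
 im(z +c w)= im z + im w
 re(z *c w)= re z * re w - im z * im w
 im(z *c w)= re z * im w + im z * re w

 -c_ conj : ℂ -> ℂ
 re(-c z)= - re z
 im(-c z)= - im z
 re(conj z)= re z
 im(conj z)= - im z

 cx : R -> ℂ
 re(cx x)= x
 im(cx x)= 0#

 0c 1c : ℂ
 0c = cx 0#
 1c = cx 1#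

 opaque
  ℂ-isCommutativeRing : IsCommutativeRing _~_ _+c_ _*c_ -c_ 0c 1c
  ℂ-isCommutativeRing = record
   { isRing = record
    { +-isAbelianGroup = record
     { isGroup = record
      { isMonoid = record
       { isSemigroup = record
        { isMagma = record
         { isEquivalence = record
          { refl = mk≈ refl refl
          ; sym = \(mk≈ p q)-> mk≈(sym p)(sym q)
          ; trans = \(mk≈ p q)(mk≈ r s)-> mk≈(p ∙ r)(q ∙ s) }
         ; ∙-cong = \(mk≈ p q)(mk≈ r s)-> mk≈(+₂ p r)(+₂ q s) }
        ; assoc = \x y z -> mk≈(alg "a+b+c=a+(b+c)")(alg "a+b+c=a+(b+c)") }
       ; identity =(\x -> mk≈(alg "0+a=a")(alg "0+a=a")),(\x -> mk≈(alg "a+0=a")(alg "a+0=a")) }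
      ; inverse =(\x -> mk≈(alg "-a+a=0")(alg "-a+a=0")),(\x -> mk≈(alg "a+-a=0")(alg "a+-a=0"))
      ; ⁻¹-cong = \(mk≈ p q)-> mk≈(-₁ p)(-₁ q) }
     ; comm = \x y -> mk≈(alg "a+b=b+a")(alg "a+b=b+a") }
    ; *-cong = \(mk≈ p q)(mk≈ r s)-> mk≈(+₂(*₂ p r)(-₁(*₂ q s)))(+₂(*₂ p s)(*₂ q r))
    ; *-assoc = \x y z -> mk≈
     (alg "(ab-cd)e-(ad+cb)f=a(be-df)-c(bf+de)")
     (alg "(ab-cd)e+(ad+cb)f=a(be+df)+c(bf-de)")
    ; *-identity =(\x -> mk≈(alg "1a-0b=a")(alg "1a+0b=a")),
     (\x -> mk≈(alg "a1-b0=a")(alg "a0+b1=b"))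
    ; distrib =(\x y z -> mk≈
     (alg "a(b+c)-d(e+f)=ab-de+(ac-df)")
     (alg "a(b+c)+d(e+f)=ab+de+(ac+df)")),
     (\x y z -> mk≈
      (alg "(a+b)c-(d+e)f=ac-df+(bc-ef)")
      (alg "(a+b)c+(d+e)f=ac+df+(bc+ef)")) }
   ; *-comm = \x y -> mk≈(alg "ab-cd=ba-dc")(alg "ab+cd=dc+ba") }

 ℂ-ring : CommutativeRing 0ℓ 0ℓ
 ℂ-ring = record{ isCommutativeRing = ℂ-isCommutativeRing }

 infixl 6 _-c_
 _-c_ : ℂ -> ℂ -> ℂ
 z -c w = z +c -c w

 open CommutativeRing ℂ-ring public using () renaming
  (refl to reflc; sym to symc; trans to trc; reflexive to ≡c;
   +-cong to +₂c; +-congˡ to +ˡc; +-congʳ to +ʳc;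
   *-cong to *₂c; *-congˡ to *ˡc; *-congʳ to *ʳc; -‿cong to -₁c)
 _⊙_ : ∀ {x y z} -> x ~ y -> y ~ z -> x ~ z
 _⊙_ = trc

 open Solver ℂ-ring public using () renaming (solve to solvec; alg to algc; alg! to alg!c; fromℕ to #c_)
 open FiniteSums ℂ-ring public using () renaming
  (∑ to ∑ᶜ; ∑-cong to ∑c-cong; ∑-ext to ∑c-ext; ∑-+ to ∑c-+; ∑-* to ∑c-*; ∑-neg to ∑c-neg; ∑-- to ∑c--;
   ∑-0 to ∑c-0; ∑-const to ∑c-const; ∑-swap to ∑c-swap; ∑-split to ∑c-split; ∑-tele to ∑c-tele;
   ∑-first to ∑c-1st; ∑-single to ∑c-single; ∑-pad to ∑c-pad)

 lin≈c : ∀ {a b c d} -> a ~ b -> d -c c ~ b -c a -> c ~ d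
 lin≈c{a}{b}{c}{d} p e = trc(algc "a=b-b+a")(+ʳc(+ˡc(-₁c(symc p)))⊙
  +ʳc(symc e)⊙ algc "a-b+b=a")

 of-cong : ∀ {x y} -> x ≈ y -> cx x ~ cx y
 of-cong e = mk≈ e refl

 of-+ : ∀ x y -> cx(x + y)~ cx x +c cx y
 of-+ x y = mk≈ refl(alg "0=0+0")

 of-* : ∀ x y -> cx(x * y)~ cx x *c cx y
 of-* x y = mk≈(alg "ab=ab-0(0)")(alg "0=a0+0b")

 of-neg : ∀ x -> cx(- x)~ -c cx x
 of-neg x = mk≈ refl(alg "0=-0")

 of-∑ : ∀ n f -> cx(∑ n f)~ ∑ᶜ n(\i -> cx(f i))
 of-∑ zero    f = reflc
 of-∑(suc n)f = trc(of-+(∑ n f)(f n))(+ʳc(of-∑ n f))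

 of-# : ∀ n -> cx(# n)~ #c n
 of-# zero    = reflc
 of-#(suc n)= trc(of-+ 1#(# n))(+ˡc(of-# n))

 re-∑ : ∀ n f -> re(∑ᶜ n f)≈ ∑ n(\i -> re(f i))
 re-∑ zero    f = refl
 re-∑(suc n)f = +ʳ(re-∑ n f)

 conj-+ : ∀ z w -> conj(z +c w)~ conj z +c conj w
 conj-+ z w = mk≈ refl(alg "-(a+b)=-a+-b")

 conj-* : ∀ z w -> conj(z *c w)~ conj z *c conj w
 conj-* z w = mk≈(alg "ab-cd=ab--c(-d)")
  (alg "-(ab+cd)=a(-b)+-cd")

 conj-conj : ∀ z -> conj(conj z)~ z
 conj-conj z = mk≈ refl(alg "--a=a")

 conj-cong : ∀ {z w} -> z ~ w -> conj z ~ conj w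
 conj-cong(mk≈ p q)= mk≈ p(-₁ q)

 conj-of : ∀ x -> conj(cx x)~ cx x
 conj-of x = mk≈ refl(alg "-0=0")

 conj-∑ : ∀ n f -> conj(∑ᶜ n f)~ ∑ᶜ n(\i -> conj(f i))
 conj-∑ zero    f = conj-of 0#
 conj-∑(suc n)f = trc(conj-+(∑ᶜ n f)(f n))(+ʳc(conj-∑ n f))

 nsq : ℂ -> R
 nsq z = re z * re z + im z * im z

 0≤nsq : ∀ z -> 0# ≤ nsq z
 0≤nsq z = 0≤+(0≤sq _)(0≤sq _)

 *-conj : ∀ z -> z *c conj z ~ cx(nsq z)
 *-conj z = mk≈(alg "aa-b(-b)=aa+bb")(alg "a(-b)+ba=0")

 nsq-* : ∀ z w -> nsq(z *c w)≈ nsq z * nsq w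
 nsq-* z w =(alg "(ab-cd)(ab-cd)+(ad+cb)(ad+cb)=(aa+cc)(bb+dd)")

 nsq-cong : ∀ {z w} -> z ~ w -> nsq z ≈ nsq w
 nsq-cong(mk≈ p q)= +₂(*₂ p p)(*₂ q q)

 infix 10 ∥_∥
 opaque
  ∥_∥ : ℂ -> R
  ∥ z ∥ = sqrt(nsq z)

  0≤∥ : ∀ z -> 0# ≤ ∥ z ∥
  0≤∥ z = 0≤sqrt(nsq z)

  ∥-sq : ∀ z -> ∥ z ∥ * ∥ z ∥ ≈ nsq z
  ∥-sq z = sqrt-sq(0≤nsq z)

 ∥-unique : ∀ {z r} -> 0# ≤ r -> r * r ≈ nsq z -> ∥ z ∥ ≈ r
 ∥-unique{z} p e = sq-cancel(0≤∥ z)p(∥-sq z ∙ sym e)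

 ∥-cg : ∀ {z w} -> z ~ w -> ∥ z ∥ ≈ ∥ w ∥
 ∥-cg{z}{w} e = ∥-unique(0≤∥ w)(∥-sq w ∙ sym(nsq-cong e))

 ∥-* : ∀ z w -> ∥ z *c w ∥ ≈ ∥ z ∥ * ∥ w ∥
 ∥-* z w = ∥-unique(0≤*(0≤∥ z)(0≤∥ w))(alg "ab(ab)=aa(bb)" ∙
  *₂(∥-sq z)(∥-sq w)∙ sym(nsq-* z w))

 ∥-of± : ∀ x -> ∥ cx x ∥ ≈ abs x
 ∥-of± x = ∥-unique(0≤abs x)(abs-sq x ∙ alg "aa=aa+0(0)")

 ∥-of : ∀ {x} -> 0# ≤ x -> ∥ cx x ∥ ≈ x
 ∥-of p = trans(∥-of± _)(abs-0≤ p)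

 ∥-neg : ∀ z -> ∥ -c z ∥ ≈ ∥ z ∥
 ∥-neg z = ∥-unique(0≤∥ z)(∥-sq z ∙ alg "aa+bb=-a(-a)+-b(-b)")

 ∥-conj : ∀ z -> ∥ conj z ∥ ≈ ∥ z ∥
 ∥-conj z = ∥-unique(0≤∥ z)(∥-sq z ∙ alg "aa+bb=aa+-b(-b)")

 ∥-1 : ∥ 1c ∥ ≈ 1#
 ∥-1 = ∥-of 0≤1

 ∥-0 : ∥ 0c ∥ ≈ 0#
 ∥-0 = ∥-of ≤r

 ∥-sw : ∀ z w -> ∥ z -c w ∥ ≈ ∥ w -c z ∥
 ∥-sw z w = trans(∥-cg(algc "a-b=-(b-a)"))(∥-neg _)

 opaque
  ∥-+ : ∀ z w -> ∥ z +c w ∥ ≤ ∥ z ∥ + ∥ w ∥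
  ∥-+ z w = sq-≤(0≤+(0≤∥ z)(0≤∥ w))(lin(cs ⊹ cs ⊹ e≤(∥-sq(z +c w))⊹ e≤(sym(∥-sq z))⊹ e≤(sym(∥-sq w)))
   (alg "(a+b)(a+b)-cc=ab+ab+((d+e)(d+e)+(f+g)(f+g))+aa+bb-(de+fg+(de+fg)+cc+(dd+ff)+(ee+gg))"))
   where
   cs : re z * re w + im z * im w ≤ ∥ z ∥ * ∥ w ∥
   cs = sq-≤(0≤*(0≤∥ z)(0≤∥ w))(lin(0≤sq(re z * im w - im z * re w)⊹ e≤(*₂(sym(∥-sq z))(sym(∥-sq w))))
    (alg "ab(ab)-(cd+ef)(cd+ef)=(cf-ed)(cf-ed)+aa(bb)-(0+(cc+ee)(dd+ff))"))

  ∥-- : ∀ z w -> ∥ z -c w ∥ ≤ ∥ z ∥ + ∥ w ∥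
  ∥-- z w = ≤rs(+ˡ(∥-neg w))(∥-+ z(-c w))

  ∥-rev : ∀ z w -> ∥ z ∥ ≤ ∥ w ∥ + ∥ z -c w ∥
  ∥-rev z w = rs≤(∥-cg(algc "a+(b-a)=b"))(∥-+ w(z -c w))

  ∥∥-tri : ∀ x y z -> ∥ x -c z ∥ ≤ ∥ x -c y ∥ + ∥ y -c z ∥
  ∥∥-tri x y z = rs≤(∥-cg(algc "a-b+(b-c)=a-c"))(∥-+ _ _)

  re≤∥ : ∀ z -> re z ≤ ∥ z ∥
  re≤∥ z = sq-≤(0≤∥ z)(≤rs(sym(∥-sq z))(lin(0≤sq(im z))(alg "aa+bb-aa=bb-0")))

  abs-re≤ : ∀ z -> abs(re z)≤ ∥ z ∥
  abs-re≤ z = abs-≤(re≤∥ z)(≤rs(∥-neg z)(re≤∥(-c z)))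

  abs-im≤ : ∀ z -> abs(im z)≤ ∥ z ∥
  abs-im≤ z = sq-≤(0≤∥ z)(rs≤(sym(abs-sq(im z)))(≤rs(sym(∥-sq z))(lin(0≤sq(re z))(alg "aa+bb-bb=aa-0"))))

  ∥∥≤re+im : ∀ z -> ∥ z ∥ ≤ abs(re z)+ abs(im z)
  ∥∥≤re+im z = sq-≤(0≤+(0≤abs _)(0≤abs _))(rs≤(sym(∥-sq z))(lin(0≤*(0≤abs(re z))(0≤abs(im z))⊹ 0≤*(0≤abs(re z))(0≤abs(im z))⊹ e≤(+₂(sym(abs-sq(re z)))(sym(abs-sq(im z)))))
   (alg "(a+b)(a+b)-(cc+dd)=ab+ab+(aa+bb)-(0+0+(cc+dd))")))

  ∥∥-≤0 : ∀ {z} -> ∥ z ∥ ≤ 0# -> z ~ 0c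
  ∥∥-≤0{z} p = mk≈(≤-antisym(re≤∥ z ⨾ p)(lin((abs-ge⁻(re z)⨾ abs-re≤ z)⨾ p)(alg "a-0=0--a")))
   (≤-antisym((abs-ge(im z)⨾ abs-im≤ z)⨾ p)(lin((abs-ge⁻(im z)⨾ abs-im≤ z)⨾ p)(alg "a-0=0--a")))

  ∥-∑ : ∀ n f -> ∥ ∑ᶜ n f ∥ ≤ ∑ n(\i -> ∥ f i ∥)
  ∥-∑ zero    f = e≤ ∥-0
  ∥-∑(suc n)f = ≤t(∥-+ _ _)(∥-∑ n f ⊹ ≤r)

 ∥∥-pos : ∀ {z} -> ¬(z ~ 0c)-> 0# < ∥ z ∥
 ∥∥-pos n p = n(∥∥-≤0 p)

 invc : ℂ -> ℂ
 invc z = conj z *c cx(inv(nsq z))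

 invc-r : ∀ {z} -> ¬(z ~ 0c)-> z *c invc z ~ 1c
 invc-r{z} n = trc(algc "a(bc)=abc")
  (*ʳc(*-conj z)⊙ symc(of-*(nsq z)(inv(nsq z)))⊙ of-cong(inv-r
   (<-respʳ(∥-sq z)(*-pos(∥∥-pos n)(∥∥-pos n)))))

 record Limc(f : ℕ -> ℂ)(l : ℂ): Set where
  constructor tends
  field evt : ∀ ε -> 0# < ε -> ∃ \N -> ∀ n -> N N.≤ n -> ∥ f n -c l ∥ ≤ ε
 open Limc public

 opaque
  Lim-un : ∀ {f l l'} -> Limc f l -> Limc f l' -> l ~ l'
  Lim-un{f}{l}{l'} p q = lin≈c(∥∥-≤0(≤-by-ε \ε ε>0 ->
   let N , a = evt p(half ε)(half-pos ε>0); M , b = evt q(half ε)(half-pos ε>0); k = N N.⊔ M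
   in ∥∥-tri l(f k)l' ⨾ lin(e≤(∥-sw l(f k))⊹ a k(N.m≤m⊔n N M)⊹ b k(N.m≤n⊔m N M)⊹ e≤(h+h ε))
    (alg "0+a-(b+c)=d+e+e+a-(b+d+c+(e+e))")))
   (algc "a-b=0-(b-a)")

  Limc-ext : ∀ {f g l} ->(∀ n -> f n ~ g n)-> Limc f l -> Limc g l
  Limc-ext e p = tends \ε ε>0 -> let N , a = evt p ε ε>0 in N , \n q -> rs≤(∥-cg(+ʳc(e n)))(a n q)

  Limc-resp : ∀ {f l l'} -> l ~ l' -> Limc f l -> Limc f l'
  Limc-resp e p = tends \ε ε>0 -> let N , a = evt p ε ε>0 in N , \n q -> rs≤(∥-cg(+ˡc(-₁c e)))(a n q)

  Limc-const : ∀ z -> Limc(\_ -> z)z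
  Limc-const z = tends \ε ε>0 -> 0 , \_ _ -> rs≤(sym ∥-0 ∙ ∥-cg(algc "0=a-a"))(<≤ ε>0)

  -- Bounds up to a constant factor suffice for convergence.
  Limc-scale : ∀ {f l} c ->(∀ ε -> 0# < ε -> ∃ \N -> ∀ n -> N N.≤ n -> ∥ f n -c l ∥ ≤ c * ε)-> Limc f l
  Limc-scale{f}{l} c p = tends \ε ε>0 -> let N , a = p(ε /(1# + abs c))(/-pos ε>0 c+)in
   N , \n q -> a n q ⨾ ≤*(<≤(/-pos ε>0 c+))(abs-ge c ⨾ lin 0≤1(alg "1+a-a=1-0"))⨾
    e≤(*-/ c+)
   where
   c+ : 0# < 1# + abs c
   c+ = +-pos 0<1(0≤abs c)

  Limc-+ : ∀ {f g l m} -> Limc f l -> Limc g m -> Limc(\n -> f n +c g n)(l +c m)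
  Limc-+{f}{g}{l}{m} p q = Limc-scale 2# \ε ε>0 -> let N , a = evt p ε ε>0 ; M , b = evt q ε ε>0 in
   N N.⊔ M , \n r -> rs≤(∥-cg(algc "a-b+(c-d)=a+c-(b+d)"))
    (∥-+ _ _ ⨾ ≤rs(alg "a+a=2a")(a n(trN(N.m≤m⊔n N M)r)⊹ b n(trN(N.m≤n⊔m N M)r)))

  Limc-c* : ∀ {f l} c -> Limc f l -> Limc(\n -> c *c f n)(c *c l)
  Limc-c*{f}{l} c p = Limc-scale ∥ c ∥ \ε ε>0 -> let N , a = evt p ε ε>0 in
   N , \n r -> rs≤(sym(∥-* c(f n -c l))∙ ∥-cg(algc "a(b-c)=ab-ac"))(*≤(0≤∥ c)(a n r))

  Limc-neg : ∀ {f l} -> Limc f l -> Limc(\n -> -c f n)(-c l)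
  Limc-neg{f}{l} p = tends \ε ε>0 -> let N , a = evt p ε ε>0 in
   N , \n r -> rs≤(sym(∥-neg _)∙ ∥-cg(algc "-(a-b)=-a--b"))(a n r)

  Limc-sub : ∀ {f l}(k : ℕ -> ℕ)->(∀ n -> n N.≤ k n)-> Limc f l -> Limc(\n -> f(k n))l
  Limc-sub k p q = tends \ε ε>0 -> let N , a = evt q ε ε>0 in N , \n r -> a(k n)(trN r(p n))

  Limc-norm : ∀ {f l b} -> Limc f l ->(∃ \N -> ∀ n -> N N.≤ n -> ∥ f n ∥ ≤ b)-> ∥ l ∥ ≤ b
  Limc-norm{f}{l}{b} p(M , q)= ≤-by-ε \ε ε>0 -> let N , a = evt p ε ε>0 ; k = N N.⊔ M in
   ≤t(∥-rev l(f k))(q k(N.m≤n⊔m N M)⊹ rs≤(∥-sw(f k)l)(a k(N.m≤m⊔n N M)))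

  Limc-complete : ∀ f ->(∀ ε -> 0# < ε -> ∃ \N -> ∀ m n -> N N.≤ m -> N N.≤ n -> ∥ f m -c f n ∥ ≤ ε)-> ∃(Limc f)
  Limc-complete f c
   with complete(\n -> re(f n))(\ε p -> let N , a = c ε p in N , \m n r s -> re≤∥(f m -c f n)⨾ a m n r s)
    | complete(\n -> im(f n))(\ε p -> let N , a = c ε p in N , \m n r s ->(abs-ge _ ⨾ abs-im≤(f m -c f n))⨾ a m n r s)
  ... | x , p | y , q = mk x y , Limc-scale 2# \ε ε>0 -> let N , a = p ε ε>0 ; M , b = q ε ε>0 in
   N N.⊔ M , \n r -> let a1 , a2 = a n(trN(N.m≤m⊔n N M)r); b1 , b2 = b n(trN(N.m≤n⊔m N M)r)in
    ≤t(∥∥≤re+im _)(≤rs(alg "a+a=2a")(abs-≤ a1(rs≤(alg "a-b=-(b-a)")a2)⊹ abs-≤ b1(rs≤(alg "a-b=-(b-a)")b2)))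

 opaque
  limc :(ℕ -> ℂ)-> ℂ
  limc f with em{∃(Limc f)}
  ... | yes(l , _)= l
  ... | no _        = 0c

  limc-lim : ∀ {f} -> ∃(Limc f)-> Limc f(limc f)
  limc-lim{f} c with em{∃(Limc f)}
  ... | yes(_ , p)= p
  ... | no n        = absurd(n c)

 series :(ℕ -> ℂ)-> ℂ
 series f = limc(\n -> ∑ᶜ n f)

 AbsBound :(ℕ -> ℂ)-> R -> Set
 AbsBound f B = ∀ n -> ∑ n(\i -> ∥ f i ∥)≤ B

 Sums :(ℕ -> ℂ)-> ℂ -> Set
 Sums f s = Limc(\n -> ∑ᶜ n f)s

 opaque
  ∑-tail : ∀ f{m n} -> m N.≤ n -> ∥ ∑ᶜ n f -c ∑ᶜ m f ∥ ≤ ∑ n(\i -> ∥ f i ∥)- ∑ m(\i -> ∥ f i ∥)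
  ∑-tail f{m}{n} p with m+o≡n p
  ... | k , E.refl = rs≤(∥-cg(lin≈c(symc(∑c-split m k f))(algc "a-b-c=a-(b+c)")))
   (∥-∑ k _ ⨾ e≤(lin≈(sym(∑-split m k(\i -> ∥ f i ∥)))(alg "a-b-c=a-(b+c)")))

  sums : ∀ {f B} -> AbsBound f B -> Sums f(series f)
  sums{f}{B} b = limc-lim(Limc-complete _ \ε p -> let N , a =(snd(snd(snd M)))(half ε)(half-pos p)in
   N , \m n r s -> ∥∥-tri(∑ᶜ m f)(∑ᶜ N f)(∑ᶜ n f)⨾
    lin(∑-tail f r ⊹ rs≤(∥-sw _ _)(∑-tail f s)⊹ up m ⊹ up n ⊹ abs-ge⁻(F N - l)⊹ a N rfN ⊹ abs-ge⁻(F N - l)⊹ a N rfN ⊹ e≤(h+h ε))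
     (alg "a-(b+c)=d-e+(f-e)+g+g+h+i+h+i+a-(b+c+d+f+-(e-g)+h+-(e-g)+h+(i+i))"))
   where
   F : ℕ -> R
   F n = ∑ n(\i -> ∥ f i ∥)
   M : ∃ \l ->(∀ n -> F n ≤ l)× l ≤ B × Lim F l
   M = monotone-lim F B(\n -> lin(0≤∥(f n))(alg "a+b-a=b-0"))b
   l : R
   l = fst M
   up : ∀ n -> F n ≤ l
   up = fst(snd M)

  series-bound : ∀ {f B} -> AbsBound f B -> ∥ series f ∥ ≤ B
  series-bound{f} b = Limc-norm(sums b)(0 , \n _ -> ∥-∑ n f ⨾ b n)

  series-tail : ∀ {f B} N{t} -> AbsBound f B ->(∀ n -> N N.≤ n -> ∑ n(\i -> ∥ f i ∥)- ∑ N(\i -> ∥ f i ∥)≤ t)-> ∥ series f -c ∑ᶜ N f ∥ ≤ t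
  series-tail{f} N b t = Limc-norm(Limc-+(sums b)(Limc-const(-c ∑ᶜ N f)))(N , \n r -> ∑-tail f r ⨾ t n r)

 conv :(ℕ -> ℂ)->(ℕ -> ℂ)-> ℕ -> ℂ
 conv a b zero    = a 0 *c b 0
 conv a b(suc n)= a 0 *c b(suc n)+c conv(\i -> a(suc i))b n

 opaque
  conv-cong : ∀ {a a' b b'} n ->(∀ i -> a i ~ a' i)->(∀ i -> b i ~ b' i)-> conv a b n ~ conv a' b' n
  conv-cong zero    p q = *₂c(p 0)(q 0)
  conv-cong(suc n)p q = +₂c(*₂c(p 0)(q(suc n)))(conv-cong n(\i -> p(suc i))q)

  conv-last : ∀ a b n -> conv a b(suc n)~ conv a(\j -> b(suc j))n +c a(suc n)*c b 0
  conv-last a b zero    = reflc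
  conv-last a b(suc n)= trc(+ˡc(conv-last(\i -> a(suc i))b n))
   (algc "ab+(c+de)=ab+c+de")

  conv-* : ∀ c a b n -> conv(\i -> c *c a i)b n ~ c *c conv a b n
  conv-* c a b zero    =(algc "abc=a(bc)")
  conv-* c a b(suc n)= trc(+ˡc(conv-* c(\i -> a(suc i))b n))
   (algc "abc+ad=a(bc+d)")

  conv-*ʳ : ∀ c a b n -> conv a(\i -> c *c b i)n ~ c *c conv a b n
  conv-*ʳ c a b zero    =(algc "a(bc)=b(ac)")
  conv-*ʳ c a b(suc n)= trc(+ˡc(conv-*ʳ c(\i -> a(suc i))b n))
   (algc "a(bc)+bd=b(ac+d)")

  conv-+ : ∀ a a' b n -> conv(\i -> a i +c a' i)b n ~ conv a b n +c conv a' b n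
  conv-+ a a' b zero    =(algc "(a+b)c=ac+bc")
  conv-+ a a' b(suc n)= trc(+ˡc(conv-+(\i -> a(suc i))(\i -> a'(suc i))b n))
   (algc "(a+b)c+(d+e)=ac+d+(bc+e)")

  conv-weight : ∀ a b n -> conv(\i -> #c i *c a i)b n +c conv a(\j -> #c j *c b j)n ~ #c n *c conv a b n
  conv-weight a b zero    =(algc "0ab+a(0b)=0(ab)")
  conv-weight a b(suc n)= trc(+ʳc(+ˡc(conv-cong n(\i ->(algc "(1+a)b=b+ab"))(\_ -> reflc)⊙
   conv-+(\i -> a(suc i))(\i -> #c i *c a(suc i))b n)))
   (lin≈c(conv-weight(\i -> a(suc i))b n)
    (algc "(1+a)(bc+d)-(0bc+(d+e)+(b((1+a)c)+f))=ad-(e+f)"))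

  conv-leibniz : ∀ a b n -> #c(suc n)*c conv a b(suc n)~
   conv(\i -> #c(suc i)*c a(suc i))b n +c conv a(\j -> #c(suc j)*c b(suc j))n
  conv-leibniz a b n = trc(symc(conv-weight a b(suc n)))(+ˡc(conv-last a(\j -> #c j *c b j)n)⊙
   algc "0ab+c+(d+e(0f))=c+d")

  ∑-conv : ∀ a b n -> ∑ᶜ(suc n)(conv a b)~ a 0 *c ∑ᶜ(suc n)b +c ∑ᶜ n(conv(\i -> a(suc i))b)
  ∑-conv a b zero    =(algc "0+ab=a(0+b)+0")
  ∑-conv a b(suc n)= trc(+ʳc(∑-conv a b n))
   (algc "ab+c+(ad+e)=a(b+d)+(c+e)")

  cauchy-error : ∀ (b : ℕ -> ℂ)s T ε M -> 0# ≤ T ->(∀ n -> ∥ s -c ∑ᶜ n b ∥ ≤ T)->(∀ n -> M N.≤ n -> ∥ s -c ∑ᶜ n b ∥ ≤ ε)->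
   ∀ n a -> ∥ ∑ᶜ(n N.+ M)a *c s -c ∑ᶜ(n N.+ M)(conv a b)∥ ≤
    ε * ∑ n(\i -> ∥ a i ∥)+ T *(∑(n N.+ M)(\i -> ∥ a i ∥)- ∑ n(\i -> ∥ a i ∥))
  cauchy-error b s T ε M 0≤T bT bε = go
   where
   unroll : ∀ n a -> ∥ ∑ᶜ(suc n)a *c s -c ∑ᶜ(suc n)(conv a b)∥ ≤
    ∥ a 0 ∥ * ∥ s -c ∑ᶜ(suc n)b ∥ + ∥ ∑ᶜ n(\i -> a(suc i))*c s -c ∑ᶜ n(conv(\i -> a(suc i))b)∥
   unroll n a = ≤t(e≤(∥-cg(+₂c(*ʳc(∑c-1st n a))(-₁c(∑-conv a b n))⊙
    algc "(a+b)c-(ad+e)=a(c-d)+(bc-e)")))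
    (∥-+ _ _ ⨾ e≤(∥-* _ _)⊹ ≤r)
   base : ∀ n a -> ∥ ∑ᶜ n a *c s -c ∑ᶜ n(conv a b)∥ ≤ T * ∑ n(\i -> ∥ a i ∥)
   base zero    a = e≤((∥-cg(algc "0a-0=0")∙ ∥-0)∙ alg "0=a0")
   base(suc n)a = ≤t(unroll n a)(*≤(0≤∥(a 0))(bT(suc n))⊹ base n(\i -> a(suc i))⨾
    e≤(alg "ab+bc=b(a+c)" ∙ *ˡ(sym(∑-first n(\i -> ∥ a i ∥)))))
   go : ∀ n a -> ∥ ∑ᶜ(n N.+ M)a *c s -c ∑ᶜ(n N.+ M)(conv a b)∥ ≤
    ε * ∑ n(\i -> ∥ a i ∥)+ T *(∑(n N.+ M)(\i -> ∥ a i ∥)- ∑ n(\i -> ∥ a i ∥))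
   go zero    a = ≤t(base M a)(e≤(alg "ab=c0+a(b-0)"))
   go(suc n)a = ≤t(unroll(n N.+ M)a)
    (*≤(0≤∥(a 0))(bε(suc n N.+ M)(N.m≤n+m M(suc n)))⊹ go n(\i -> a(suc i))⨾
    e≤(alg "ab+(bc+d(e-c))=b(a+c)+d(a+e-(a+c))" ∙
     sym(+₂(*ˡ(∑-first n(\i -> ∥ a i ∥)))(*ˡ(+₂(∑-first(n N.+ M)(\i -> ∥ a i ∥))(-₁(∑-first n(\i -> ∥ a i ∥))))))))

  absTail : ∀ {f B} -> AbsBound f B -> ∀ ε -> 0# < ε -> ∃ \N -> ∀ m n -> N N.≤ m -> N N.≤ n -> ∑ n(\i -> ∥ f i ∥)- ∑ m(\i -> ∥ f i ∥)≤ ε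
  absTail{f}{B} b ε p with monotone-lim(\n -> ∑ n(\i -> ∥ f i ∥))B(\n -> lin(0≤∥(f n))(alg "a+b-a=b-0"))b
  ... | l , up , _ , lim with lim ε p
  ... | N , a = N , \m n r s -> lin(up n ⊹ abs-ge⁻(∑ m(\i -> ∥ f i ∥)- l)⊹ a m r)
   (alg "a-(b-c)=d+e+a-(b+-(c-d)+e)")

  cauchy-product : ∀ {a b A B} -> AbsBound a A -> AbsBound b B -> Sums(conv a b)(series a *c series b)
  cauchy-product{a}{b}{A}{B} bA bB = Limc-scale(∥ series b ∥ + A +(B + B))\ε ε>0 ->
   let N , p = evt(sums bA)ε ε>0 ; M , q = evt(sums bB)ε ε>0 ; K , r = absTail bA ε ε>0 ; L = N N.⊔ K
   in L N.+ M , \n n≥ -> let k , e = m+o≡n n≥ in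
    main ε(<≤ ε>0)M q(L N.+ k)n(E.trans(E.trans(N.+-assoc L k M)(E.trans(E.cong(L N.+_)(N.+-comm k M))(E.sym(N.+-assoc L M k))))e)
     (p n(trN(N.m≤m⊔n N K)(trN(m≤m+n L M)n≥)))
     (r(L N.+ k)n(trN(N.m≤n⊔m N K)(m≤m+n L k))(trN(N.m≤n⊔m N K)(trN(m≤m+n L M)n≥)))
   where
   0≤B : 0# ≤ B
   0≤B = bB 0
   main : ∀ ε -> 0# ≤ ε -> ∀ M ->(∀ n -> M N.≤ n -> ∥ ∑ᶜ n b -c series b ∥ ≤ ε)-> ∀ j n -> j N.+ M ≡ n -> ∥ ∑ᶜ n a -c series a ∥ ≤ ε ->
    ∑ n(\i -> ∥ a i ∥)- ∑ j(\i -> ∥ a i ∥)≤ ε -> ∥ ∑ᶜ n(conv a b)-c series a *c series b ∥ ≤(∥ series b ∥ + A +(B + B))* ε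
   main ε 0≤ε M q j n E.refl p r = ≤t(e≤(∥-cg
    (algc "a-bc=(d-b)c-(dc-a)"))⨾ ∥-- _ _)
    (≤t(e≤(∥-* _ _))(≤*(0≤∥ _)p)⊹ cauchy-error b(series b)(B + B)ε M(0≤+ 0≤B 0≤B)
     (\k -> ∥-- _ _ ⨾ series-bound bB ⊹ ≤t(∥-∑ k b)(bB k))(\k r -> rs≤(∥-sw _ _)(q k r))j a ⨾
     lin(*≤ 0≤ε(bA j)⊹ *≤(0≤+ 0≤B 0≤B)r)
      (alg "(a+b+(c+c))d-(da+(de+(c+c)(f-e)))=db+(c+c)d-(de+(c+c)(f-e))"))

  halving-bound : ∀ (a : ℕ -> R)M ->(∀ i -> 0# ≤ a i)->(∀ i -> M N.≤ i -> # 2 * a(suc i)≤ a i)-> ∀ n -> ∑ n a ≤ ∑ M a + # 2 * a M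
  halving-bound a M p q n = ∑-incl a(N.m≤n+m n M)p ⨾ lin(go n ⊹ 0≤*(0≤# 2)(p(M N.+ n)))
   (alg "a+2b-c=a+2b+2d-(c+2d+0)")
   where
   go : ∀ k -> ∑(M N.+ k)a + # 2 * a(M N.+ k)≤ ∑ M a + # 2 * a M
   go zero    rewrite N.+-identityʳ M = ≤r
   go(suc k)rewrite N.+-suc M k = ≤t(lin(q(M N.+ k)(m≤m+n M k))
    (alg "a+2b-(a+b+2c)=b-2c"))(go k)

 eterm : ℂ -> ℕ -> ℂ
 eterm z zero    = 1c
 eterm z(suc n)= eterm z n *c(z *c cx(inv(#(suc n))))

 rterm : R -> ℕ -> R
 rterm r zero    = 1#
 rterm r(suc n)= rterm r n *(r * inv(#(suc n)))

 opaque
  eterm-cong : ∀ {z w} n -> z ~ w -> eterm z n ~ eterm w n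
  eterm-cong zero    e = reflc
  eterm-cong(suc n)e = *₂c(eterm-cong n e)(*ʳc e)

  #*inv : ∀ n -> # suc n * inv(#(suc n))≈ 1#
  #*inv n = inv-r(0<#s n)

  0≤inv# : ∀ n -> 0# ≤ inv(#(suc n))
  0≤inv# n = <≤(inv⁺(0<#s n))

  eterm-D : ∀ z n -> #c(suc n)*c eterm z(suc n)~ z *c eterm z n
  eterm-D z n = trc(algc "(1+a)(b(cd))=(1+a)d(cb)")
   (*ʳc(*ʳc(symc(of-#(suc n)))⊙ symc(of-*(#(suc n))(inv(#(suc n))))⊙ of-cong(#*inv n))⊙ algc "1(ab)=ab")

  ∥eterm∥ : ∀ z n -> ∥ eterm z n ∥ ≈ rterm ∥ z ∥ n
  ∥eterm∥ z zero    = ∥-1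
  ∥eterm∥ z(suc n)= trans(∥-* _ _)(*₂(∥eterm∥ z n)(∥-* _ _ ∙ *ˡ(∥-of(0≤inv# n))))

  rterm-nonneg : ∀ {r} n -> 0# ≤ r -> 0# ≤ rterm r n
  rterm-nonneg zero    p = 0≤1
  rterm-nonneg(suc n)p = 0≤*(rterm-nonneg n p)(0≤* p(0≤inv# n))

  rterm-bounded : ∀ r -> 0# ≤ r -> ∃ \B -> ∀ n -> ∑ n(rterm r)≤ B
  rterm-bounded r p with archimedean r
  ... | K , r≤K = _ , halving-bound(rterm r)(K N.+ K)(\i -> rterm-nonneg i p)\i i≥ ->
   ≤rs(alg "a1=a")(rs≤(alg "a(2(bc))=2(a(bc))")(*≤(rterm-nonneg i p)
    (rs≤(alg "2ab=2(ab)")(/-≤(0<#s i)(lin(r≤K ⊹ r≤K ⊹ e≤(sym(#-+ K K))⊹ #-mono i≥ ⊹ 0≤1)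
     (alg "1(1+a)-2b=c+c+d+a+1-(b+b+(c+c)+d+0)"))))))

  eterm-bounded : ∀ z -> ∃ \B -> AbsBound(eterm z)B
  eterm-bounded z with rterm-bounded ∥ z ∥(0≤∥ z)
  ... | B , b = B , \n -> rs≤(∑-ext n(\i -> sym(∥eterm∥ z i)))(b n)

  eterm-conv : ∀ z w n -> eterm(z +c w)n ~ conv(eterm z)(eterm w)n
  eterm-conv z w zero    =(algc "1=1(1)")
  eterm-conv z w(suc n)= cancelc(eterm-D(z +c w)n ⊙ *ˡc(eterm-conv z w n)⊙ symc
   (conv-leibniz(eterm z)(eterm w)n ⊙ +₂c
    (conv-cong n(eterm-D z)(\_ -> reflc)⊙ conv-* z(eterm z)(eterm w)n)
    (conv-cong n(\_ -> reflc)(eterm-D w)⊙ conv-*ʳ w(eterm z)(eterm w)n)⊙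
    algc "ab+cb=(a+c)b"))
   where
   unit :(cx(inv(#(suc n))))*c #c(suc n)~ 1c
   unit = trc(algc "a(1+b)=(1+b)a")(*ʳc(symc(of-#(suc n)))⊙ symc(of-*(#(suc n))(inv(#(suc n))))⊙ of-cong(#*inv n))
   cancelc : ∀ {x y} -> #c(suc n)*c x ~ #c(suc n)*c y -> x ~ y
   cancelc{x}{y} e = trc(algc "a=1a")(*ʳc(symc unit)⊙ algc "a(1+b)c=a((1+b)c)" ⊙
    *ˡc e ⊙ algc "a((1+b)c)=a(1+b)c" ⊙ *ʳc unit ⊙ algc "1a=a")

 opaque
  exp : ℂ -> ℂ
  exp z = series(eterm z)

  exp-sums : ∀ z -> Sums(eterm z)(exp z)
  exp-sums z = sums(snd(eterm-bounded z))

  exp-cong : ∀ {z w} -> z ~ w -> exp z ~ exp w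
  exp-cong{z}{w} e = Lim-un(exp-sums z)(Limc-ext(\n -> ∑c-ext n(\i -> eterm-cong i(symc e)))(exp-sums w))

  exp-+ : ∀ z w -> exp(z +c w)~ exp z *c exp w
  exp-+ z w = Lim-un(exp-sums(z +c w))(Limc-ext(\n -> ∑c-ext n(\i -> symc(eterm-conv z w i)))
   (cauchy-product(snd(eterm-bounded z))(snd(eterm-bounded w))))

  exp-conj : ∀ z -> exp(conj z)~ conj(exp z)
  exp-conj z = Lim-un(exp-sums(conj z))(Limc-ext(\n -> conj-∑ n(eterm z)⊙ ∑c-ext n(term))(tends \ε p ->
   let N , a = evt(exp-sums z)ε p in N , \n q -> rs≤(sym(∥-conj _)∙ ∥-cg(conj-+ _ _ ⊙ +ˡc(mk≈ refl refl)))(a n q)))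
   where
   term : ∀ i -> conj(eterm z i)~ eterm(conj z)i
   term zero    = conj-of 1#
   term(suc i)= trc(conj-* _ _)(*₂c(term i)(conj-* _ _ ⊙ *ˡc(conj-of _)))

  exp-0 : exp 0c ~ 1c
  exp-0 = Lim-un(exp-sums 0c)(tends \ε p -> 1 , λ { (suc n)_ -> e≤(∥-cg(+ʳc(∑c-1st n(eterm 0c)⊙ +ˡc(∑c-0 n(\i _ -> z i)))⊙ algc "1+0-1=0")∙ ∥-0)⨾ <≤ p })
   where
   z : ∀ i -> eterm 0c(suc i)~ 0c
   z i =(algc "a(0b)=0")

 opaque
  Limc-≥ : ∀ {f l x} -> Limc f l ->(∃ \N -> ∀ n -> N N.≤ n -> x ≤ re(f n))-> x ≤ re l
  Limc-≥{f}{l}{x} p(M , q)= ≤-by-ε \ε ε>0 -> let N , a = evt p ε ε>0 ; k = N N.⊔ M in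
   lin(q k(N.m≤n⊔m N M)⊹ re≤∥(f k -c l)⊹ a k(N.m≤m⊔n N M))
    (alg "a+b-c=d+e+b-(c+(d-a)+e)")

  eterm-of : ∀ x n -> eterm(cx x)n ~ cx(rterm x n)
  eterm-of x zero    = reflc
  eterm-of x(suc n)= trc(*₂c(eterm-of x n)(symc(of-* x _)))(symc(of-* _ _))

  ∑-eterm-of : ∀ x n -> re(∑ᶜ n(eterm(cx x)))≈ ∑ n(rterm x)
  ∑-eterm-of x n = trans(re-∑ n _)(∑-ext n(\i -> re≈(eterm-of x i)))

 opaque
  e : R -> R
  e x = re(exp(cx x))

  exp-of : ∀ x -> exp(cx x)~ cx(e x)
  exp-of x = mk≈ refl(cancel2(im≈(symc(exp-conj(cx x))⊙ exp-cong(conj-of x))))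
   where
   cancel2 : ∀ {y} -> - y ≈ y -> y ≈ 0#
   cancel2{y} q = ≤-antisym(cancel{2#}(0<#s 1)(lin(e≤(sym q))(alg "2(0)-2a=-a-a")))
    (cancel{2#}(0<#s 1)(lin(e≤ q)(alg "2a-2(0)=a--a")))

  e-cong : ∀ {x y} -> x ≈ y -> e x ≈ e y
  e-cong q = re≈(exp-cong(of-cong q))

  e-+ : ∀ x y -> e(x + y)≈ e x * e y
  e-+ x y = re≈(exp-cong(of-+ x y)⊙ exp-+(cx x)(cx y)⊙ *₂c(exp-of x)(exp-of y)⊙ symc(of-*(e x)(e y)))

  e-0 : e 0# ≈ 1#
  e-0 = re≈ exp-0

  ∑rterm≤e : ∀ {r} -> 0# ≤ r -> ∀ n -> ∑ n(rterm r)≤ e r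
  ∑rterm≤e{r} p n = Limc-≥(exp-sums(cx r))(n , \m q -> ≤rs(sym(∑-eterm-of r m))(∑-incl(rterm r)q(\i -> rterm-nonneg i p)))

  private
   dbl : ℕ -> ℕ
   dbl zero    = 0
   dbl(suc n)= suc(suc(dbl n))
   n≤dbl : ∀ n -> n N.≤ dbl n
   n≤dbl zero    = z≤n
   n≤dbl(suc n)= s≤s(m≤1+n(n≤dbl n))
   even : ∀ x n -> 0# ≤ rterm x(dbl n)
   even x zero    = 0≤1
   even x(suc n)= ≤rs(alg "a(bc(dd))=a(db)(dc)")
    (0≤*(even x n)(0≤*(0≤*(0≤inv#(dbl n))(0≤inv#(suc(dbl n))))(0≤sq x)))
   inv#≤1 : ∀ n -> inv(#(suc n))≤ 1#
   inv#≤1 n = rs≤(alg "1a=a")(/-≤(0<#s n)(lin(0≤# n)(alg "1(1+a)-1=a-0")))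
   pairs : ∀ x -> 0# ≤ 1# + x -> ∀ n -> 1# + x ≤ ∑(dbl(suc n))(rterm x)
   pairs x p zero    = e≤(lin≈(*ˡ{x}(inv-uniq{# 1}{1#}(alg "(1+0)1=1")))(alg "0+1+1(ab)-(1+a)=ab-a1"))
   pairs x p(suc n)= ≤t(pairs x p n)(lin(0≤*(even x(suc n))(0≤+(0≤* p(0≤inv#(dbl(suc n))))(0≤-by(inv#≤1(dbl(suc n))))))
    (alg "a+b+b(cd)-a=b((1+c)d+(1-d))-0"))

  e-inv : ∀ x -> e x * e(- x)≈ 1#
  e-inv x = trans(sym(e-+ x(- x)))(e-cong(alg "a+-a=0")∙ e-0)

  0<e : ∀ x -> 0# < e x
  0<e x q = 1≰0(rs≤(e-inv x)(≤rs(alg "0a=0")(≤*(nonneg(- x))q)))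
   where
   nonneg : ∀ y -> 0# ≤ e y
   nonneg y = ≤rs(sym(e-+(half y)(half y))∙ e-cong(h+h y))(0≤sq(e(half y)))

  1+x≤e : ∀ x -> 1# + x ≤ e x
  1+x≤e x with ≤-total 0#(1# + x)
  ... | inr q = ≤t q(<≤(0<e x))
  ... | inl q = Limc-≥(Limc-sub(\n -> dbl(suc n))(\n -> trN(n≤1+n n)(n≤dbl(suc n)))(exp-sums(cx x)))
   (0 , \n _ -> ≤rs(sym(∑-eterm-of x(dbl(suc n))))(pairs x q n))

  e-mono : ∀ {x y} -> x ≤ y -> e x ≤ e y
  e-mono{x}{y} q = rs≤(alg "a1=a")(≤rs(sym(e-+ x(y - x))∙ e-cong(alg "a+(b-a)=b"))
   (*≤(<≤(0<e x))(lin(0≤-by q)(alg "1+(a-b)-1=a-b-0")⨾ 1+x≤e(y - x))))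

  e-mono< : ∀ {x y} -> x < y -> e x < e y
  e-mono<{x}{y} q = lin<(<≤tr(*-pos(0<e x)(0<-by q))(lin(*≤(<≤(0<e x))(1+x≤e(y - x))⊹ e≤(sym(e-+ x(y - x))∙ e-cong(alg "a+(b-a)=b")))
   (alg "a-b-b(c-d)=be+a-(b(1+(c-d))+be)")))(alg "a-b=a-b-0")

  e-cancel : ∀ {x y} -> e x ≤ e y -> x ≤ y
  e-cancel q = ≮⇒≥ \r -> e-mono< r q

  e-≤ : ∀ {x} -> x < 1# -> e x ≤ inv(1# - x)
  e-≤{x} q = rs≤(alg "1a=a")(≤rs(alg "1a=a")(≤-/(0<-by q)
   (≤rs(e-inv x)(rs≤(alg "a(1+-b)=1a(1-b)")(*≤(<≤(0<e x))(1+x≤e(- x)))))))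

  ∥exp∥ : ∀ z -> ∥ exp z ∥ ≈ e(re z)
  ∥exp∥ z = ∥-unique(<≤(0<e(re z)))(sym(e-+(re z)(re z))∙ re≈(exp-cong{w = z +c conj z}(mk≈ refl(alg "0=a+-a"))⊙
   exp-+ z(conj z)⊙ *ˡc(exp-conj z)⊙ *-conj(exp z)))

  private
   rterm-step : ∀ {r} -> 0# ≤ r -> ∀ i -> rterm r(suc i)≤ r * rterm r i
   rterm-step{r} p i = lin(0≤*(0≤*(rterm-nonneg i p)p)(0≤-by(inv#≤1 i)))
    (alg "ab-b(ac)=ba(1-c)-0")

  ∥exp-1∥ : ∀ z -> ∥ exp z -c 1c ∥ ≤ ∥ z ∥ * e ∥ z ∥
  ∥exp-1∥ z = Limc-norm(Limc-+(exp-sums z)(Limc-const(-c 1c)))(1 , λ { (suc n)_ ->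
   e≤(∥-cg(+ʳc(∑c-1st n(eterm z))⊙ algc "1+a-1=a"))⨾
   ∥-∑ n _ ⨾ ∑-mono n(\i _ -> rs≤(sym(∥eterm∥ z(suc i)))(rterm-step(0≤∥ z)i))⨾ rs≤(sym(∑-* n ∥ z ∥(rterm ∥ z ∥)))(*≤(0≤∥ z)(∑rterm≤e(0≤∥ z)n)) })

  ∥exp-1-z∥ : ∀ z -> ∥ exp z -c 1c -c z ∥ ≤ ∥ z ∥ * ∥ z ∥ * e ∥ z ∥
  ∥exp-1-z∥ z = Limc-norm(Limc-+(Limc-+(exp-sums z)(Limc-const(-c 1c)))(Limc-const(-c z)))(2 , λ { (suc zero)(s≤s());(suc(suc n))_ ->
   e≤(∥-cg(+ʳc(+ʳc(∑c-1st(suc n)(eterm z)⊙ +ˡc(∑c-1st n(\i -> eterm z(suc i))⊙ +ʳc(*ˡc(*ˡc(of-cong(sym(inv-uniq{# 1}{1#}(alg "(1+0)1=1")))))⊙ algc "1(a1)=a"))))⊙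
    algc "1+(a+b)-1-a=b"))⨾
   ∥-∑ n _ ⨾ ∑-mono n(\i _ -> rs≤(sym(∥eterm∥ z(suc(suc i))))(rterm-step(0≤∥ z)(suc i)⨾ ≤rs(alg "a(ab)=aab")(*≤(0≤∥ z)(rterm-step(0≤∥ z)i))))⨾
    rs≤(sym(∑-* n(∥ z ∥ * ∥ z ∥)(rterm ∥ z ∥)))(*≤(0≤*(0≤∥ z)(0≤∥ z))(∑rterm≤e(0≤∥ z)n)) })

  abs-e-1 : ∀ d -> abs(e d - 1#)≤ abs d * e(abs d)
  abs-e-1 d = rs≤(∥-cg(+₂c(exp-of d)(symc(of-neg 1#))⊙ symc(of-+(e d)(- 1#)))∙ ∥-of± _)
   (≤rs(*₂(∥-of± d)(e-cong(∥-of± d)))(∥exp-1∥(cx d)))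

  e-split : ∀ x y -> e y ≈ e x * e(y - x)
  e-split x y = trans(e-cong(alg "a=b+(a-b)"))(e-+ x(y - x))

  e-cont : Continuous e
  e-cont x ε p with min⁺ 0<1(/-pos p(*-pos(0<e x)(0<e 1#)))
  ... | δ , δ>0 , δ≤1 , δ≤ = δ , δ>0 , \y q ->
   ≤t(e≤(abs-cong(lin≈(e-split x y)(alg "a(b-1)-(c-a)=ab-c"))∙ abs-*(e x)(e(y - x)- 1#)∙ *ʳ(abs-0≤(<≤(0<e x)))))
   (*≤(<≤(0<e x))(abs-e-1(y - x)⨾ *-mono(0≤abs _)(<≤(0<e 1#))(q ⨾ δ≤)(e-mono(q ⨾ δ≤1)))⨾
   e≤(alg "a(bc)=b(ac)" ∙ /-*(*-pos(0<e x)(0<e 1#))))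

  log-exists : ∀ {c} -> 0# < c -> ∃ \x -> e x ≈ c
  log-exists{c} p = fst x , snd(snd(snd x))
   where
   x : ∃ \x -> - inv c ≤ x × x ≤ c × e x ≈ c
   x = intermediate e e-cont(- inv c)c c(lin(<≤(inv⁺ p)⊹ <≤ p)(alg "a--b=b+a-(0+0)"))
    (cancel(inv⁺ p)(≤rs(e-inv(inv c)∙ sym(inv-r p)∙ alg "ab=ba")
     (≤*(<≤(0<e _))(lin 0≤1(alg "1+a-a=1-0")⨾ 1+x≤e(inv c)))))
    (lin 0≤1(alg "1+a-a=1-0")⨾ 1+x≤e c)

 opaque
  log : R -> R
  log c with em{0# < c}
  ... | yes p = fst(log-exists p)
  ... | no _  = 0#

  log-0 : log 0# ≈ 0#
  log-0 with em{0# < 0#}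
  ... | yes p = absurd(p ≤r)
  ... | no _  = refl

  e-log : ∀ {c} -> 0# < c -> e(log c)≈ c
  e-log{c} q with em{0# < c}
  ... | yes p = snd(log-exists p)
  ... | no n  = absurd(n q)

  e-inj : ∀ {x y} -> e x ≈ e y -> x ≈ y
  e-inj q = ≤-antisym(e-cancel(e≤ q))(e-cancel(e≤(sym q)))

  log-e : ∀ x -> log(e x)≈ x
  log-e x = e-inj(e-log(0<e x))

  log-cong : ∀ {x y} -> 0# < x -> x ≈ y -> log x ≈ log y
  log-cong p q = e-inj(e-log p ∙ q ∙ sym(e-log(<-respʳ q p)))

  log-1 : log 1# ≈ 0#
  log-1 = e-inj(e-log 0<1 ∙ sym e-0)

  log-* : ∀ {x y} -> 0# < x -> 0# < y -> log(x * y)≈ log x + log y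
  log-* p q = e-inj(e-log(*-pos p q)∙ sym(e-+ _ _ ∙ *₂(e-log p)(e-log q)))

  log-inv : ∀ {x} -> 0# < x -> log(inv x)≈ - log x
  log-inv{x} p = e-inj(e-log(inv⁺ p)∙ sym(inv-uniq(*ʳ(sym(e-log p))∙ e-inv(log x))))

  log-mono : ∀ {x y} -> 0# < x -> x ≤ y -> log x ≤ log y
  log-mono p q = e-cancel(rs≤(sym(e-log p))(≤rs(sym(e-log(<≤tr p q)))q))

  log-≤ : ∀ {x b} -> 0# < x -> x ≤ e b -> log x ≤ b
  log-≤ p q = e-cancel(rs≤(sym(e-log p))q)

  ≤-log : ∀ {x b} -> 0# < x -> e b ≤ x -> b ≤ log x
  ≤-log p q = e-cancel(≤rs(sym(e-log p))q)

  log≤x-1 : ∀ {x} -> 0# < x -> log x ≤ x - 1#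
  log≤x-1{x} p = log-≤ p(rs≤(alg "1+(a-1)=a")(1+x≤e(x - 1#)))

  log-0≤ : ∀ {x} -> 1# ≤ x -> 0# ≤ log x
  log-0≤ p = rs≤ log-1(log-mono 0<1 p)

 infixr 8 _^_
 _^_ : R -> ℕ -> R
 x ^ zero  = 1#
 x ^ suc k = x * x ^ k

 lg : ℕ -> R
 lg n = log(# n)

 opaque
  0≤^ : ∀ {x} k -> 0# ≤ x -> 0# ≤ x ^ k
  0≤^ zero    p = 0≤1
  0≤^(suc k)p = 0≤* p(0≤^ k p)

  ^-mono : ∀ {x y} k -> 0# ≤ x -> x ≤ y -> x ^ k ≤ y ^ k
  ^-mono zero    p q = ≤r
  ^-mono(suc k)p q = *-mono p(0≤^ k(p ⨾ q))q(^-mono k p q)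

  ^-cong : ∀ {x y} k -> x ≈ y -> x ^ k ≈ y ^ k
  ^-cong zero    q = refl
  ^-cong(suc k)q = *₂ q(^-cong k q)

  0≤lg : ∀ n -> 0# ≤ lg n
  0≤lg zero    = e≤(sym log-0)
  0≤lg(suc n)= log-0≤(#-mono(s≤s(z≤n{n}))⊹1)
   where
   _⊹1 : # 1 ≤ # suc n -> 1# ≤ # suc n
   _⊹1 = rs≤(alg "1+0=1")

  lg-1 : lg 1 ≈ 0#
  lg-1 = trans(log-cong(0<#s 0)(alg "1+0=1"))log-1

  e-lg : ∀ n -> e(lg(suc n))≈ # suc n
  e-lg n = e-log(0<#s n)

  0<# : ∀ n .{{_ : Nz n}} -> 0# < # n
  0<#(suc n)= 0<#s n

  lg-* : ∀ m n .{{_ : Nz m}} .{{_ : Nz n}} -> lg(m N.* n)≈ lg m + lg n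
  lg-* m n = trans(log-cong(0<#(m N.* n){{N.m*n≢0 m n}})(#-* m n))(log-*(0<# m)(0<# n))

  lg-mono : ∀ {m n} .{{_ : Nz m}} -> m N.≤ n -> lg m ≤ lg n
  lg-mono{m} p = log-mono(0<# m)(#-mono p)

  lg-mono< : ∀ {m n} .{{_ : Nz m}} -> m N.< n -> lg m < lg n
  lg-mono<{m}{n} p q = N.<⇒≱ p(#-cancel-≤(rs≤(e-log(<≤tr(0<# m)(#-mono(N.<⇒≤ p))))(≤rs(e-log(0<# m))(e-mono q))))

  lg-step≤ : ∀ n .{{_ : Nz n}} -> lg(suc n)≤ lg n + inv(# n)
  lg-step≤ n = log-≤(0<#s n)(≤rs(sym(e-+(lg n)(inv(# n))∙ *ʳ(e-log(0<# n))))
   (lin(*≤(0≤# n)(1+x≤e(inv(# n)))⊹ e≤(sym(inv-r(0<# n))))(alg "ab-(1+a)=ab+ac-(a(1+c)+1)")))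

  lg-step≥ : ∀ n .{{_ : Nz n}} -> lg n + inv(# suc n)≤ lg(suc n)
  lg-step≥ n = lin(log-≤{b = lg(suc n)- inv(# suc n)}(0<# n)(≤rs(sym(e-+(lg(suc n))(- inv(# suc n))∙ *ʳ(e-lg n)))
   (lin(*≤(0≤#(suc n))(1+x≤e(- inv(# suc n)))⊹ e≤(inv-r(0<#s n)))
    (alg "(1+a)b-a=(1+a)b+1-((1+a)(1+-c)+(1+a)c)"))))
   (alg "a-(b+c)=a-c-b")

 rp : ℕ -> R -> R
 rp n σ = e(-(σ * lg n))

 pw : ℕ -> ℂ -> ℂ
 pw n s = exp(-c(s *c cx(lg n)))

 opaque
  0<rp : ∀ n σ -> 0# < rp n σ
  0<rp n σ = 0<e _

  rp-cong : ∀ n{σ τ} -> σ ≈ τ -> rp n σ ≈ rp n τ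
  rp-cong n q = e-cong(-₁(*ʳ q))

  rp-+ : ∀ n σ τ -> rp n(σ + τ)≈ rp n σ * rp n τ
  rp-+ n σ τ = trans(e-cong(alg "-((a+b)c)=-(ac)+-(bc)"))(e-+ _ _)

  rp-1 : ∀ n .{{_ : Nz n}} -> rp n 1# ≈ inv(# n)
  rp-1 n = inv-uniq(*ʳ(sym(e-log(0<# n)))∙ *ˡ(e-cong(alg "-(1a)=-a"))∙ e-inv(lg n))

  rp-anti : ∀ n{σ τ} -> σ ≤ τ -> rp n τ ≤ rp n σ
  rp-anti n{σ}{τ} q = e-mono(lin(≤*(0≤lg n)q)(alg "-(ab)--(cb)=cb-ab"))

  rp-mono : ∀ {m n σ} .{{_ : Nz m}} -> 0# ≤ σ -> m N.≤ n -> rp n σ ≤ rp m σ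
  rp-mono{m}{n}{σ} p q = e-mono(≤-neg(*≤ p(lg-mono q)))

  rp≤1 : ∀ n{σ} -> 0# ≤ σ -> rp n σ ≤ 1#
  rp≤1 n{σ} p = ≤rs e-0(e-mono(lin(0≤* p(0≤lg n))(alg "0--(ab)=ab-0")))

  rp1 : ∀ σ -> rp 1 σ ≈ 1#
  rp1 σ = trans(e-cong(-₁(*ˡ lg-1)∙ alg "-(a0)=0"))e-0

  rp-step≤ : ∀ n{δ} .{{_ : Nz n}} -> 0# < δ -> rp(suc n)(1# + δ)≤ inv δ *(rp n δ - rp(suc n)δ)
  rp-step≤ n{δ} p = ≤rs(alg "(a-b)c=c(a-b)")(≤-/ p
   (lin(*≤(<≤(0<rp(suc n)δ))(1+x≤e(δ *(lg(suc n)- lg n)))⊹ *≤(0≤*(<≤(0<rp(suc n)δ))(<≤ p))(lg-step≥ n)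
    ⊹ e≤(sym(e-+ _ _)∙ e-cong(alg "-(ab)+a(b-c)=-(ac)"))⊹ e≤(*ˡ{δ}(rp-+(suc n)1# δ ∙ *ʳ(rp-1(suc n)))))
    (alg "a-b-cd=be+bdf+a+d(gb)-(b(1+d(f-h))+bd(h+g)+be+dc)")))

  rp-step≥ : ∀ n{δ} .{{_ : Nz n}} -> 0# < δ -> inv δ *(rp n δ - rp(suc n)δ)≤ rp n(1# + δ)
  rp-step≥ n{δ} p = rs≤(alg "(a-b)c=c(a-b)")(/-≤ p
   (lin(*≤(<≤(0<rp n δ))(1+x≤e(-(δ *(lg(suc n)- lg n))))⊹ *≤(0≤*(<≤(0<rp n δ))(<≤ p))(lg-step≤ n)
    ⊹ e≤(sym(e-+ _ _)∙ e-cong(alg "-(ab)+-(a(c-b))=-(ac)"))⊹ e≤(*ˡ{δ}(sym(rp-+ n 1# δ ∙ *ʳ(rp-1 n)))))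
    (alg "ab-(c-d)=ce+cb(f+g)+d+ba-(c(1+-(b(h-f)))+cbh+ce+b(gc))")))

  ∥pw∥ : ∀ n s -> ∥ pw n s ∥ ≈ rp n(re s)
  ∥pw∥ n s = trans(∥exp∥ _)(e-cong(alg "-(ab-c0)=-(ab)"))

  pw-cong : ∀ n{s s'} -> s ~ s' -> pw n s ~ pw n s'
  pw-cong n q = exp-cong(-₁c(*ʳc q))

  pw-* : ∀ m n s .{{_ : Nz m}} .{{_ : Nz n}} -> pw(m N.* n)s ~ pw m s *c pw n s
  pw-* m n s = trc(exp-cong(-₁c(*ˡc(of-cong(lg-* m n)⊙ of-+(lg m)(lg n)))⊙
   algc "-(a(b+c))=-(ab)+-(ac)"))(exp-+ _ _)

  pw-+ : ∀ n s h -> pw n(s +c h)~ pw n s *c exp(-c(h *c cx(lg n)))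
  pw-+ n s h = trc(exp-cong(algc "-((a+b)c)=-(ac)+-(bc)"))(exp-+ _ _)

  pw1 : ∀ s -> pw 1 s ~ 1c
  pw1 s = exp-cong(-₁c(*ˡc(of-cong lg-1))⊙ algc "-(a0)=0")⊙ exp-0

 -- The weights (log n)^k n^{-σ}, with value 0 at n = 0.
 W : ℕ -> R -> ℕ -> R
 W k σ zero    = 0#
 W k σ(suc n)= lg(suc n)^ k * rp(suc n)σ

 term : ℕ ->(ℕ -> ℂ)-> ℂ -> ℕ -> ℂ
 term k a s zero    = 0c
 term k a s(suc n)= a(suc n)*c cx(lg(suc n)^ k)*c pw(suc n)s

 wB : ℕ -> R -> R
 wB k δ = inv δ ^ k *(1# + inv δ)

 opaque
  0≤W : ∀ k σ n -> 0# ≤ W k σ n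
  0≤W k σ zero    = ≤r
  0≤W k σ(suc n)= 0≤*(0≤^ k(0≤lg(suc n)))(<≤(0<rp(suc n)σ))

  W-anti : ∀ k{σ τ} n -> σ ≤ τ -> W k τ n ≤ W k σ n
  W-anti k zero    q = ≤r
  W-anti k(suc n)q = *≤(0≤^ k(0≤lg(suc n)))(rp-anti(suc n)q)

  ∥term∥ : ∀ k{a} s ->(∀ n -> ∥ a n ∥ ≤ 1#)-> ∀ n -> ∥ term k a s n ∥ ≤ W k(re s)n
  ∥term∥ k     s b zero    = e≤ ∥-0
  ∥term∥ k{a} s b(suc n)= e≤(∥-* _ _ ∙ *₂(∥-* _ _ ∙ *ˡ(∥-of L≥0))(∥pw∥(suc n)s))⨾
   ≤*(<≤(0<rp(suc n)(re s)))(≤rs(alg "1a=a")(≤* L≥0(b(suc n))))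
   where
   L≥0 : 0# ≤ lg(suc n)^ k
   L≥0 = 0≤^ k(0≤lg(suc n))

  ∑W0 : ∀ {δ} -> 0# < δ -> ∀ N -> ∑(suc(suc N))(W 0(1# + δ))≤ 1# + inv δ *(1# - rp(suc N)δ)
  ∑W0{δ} p zero = e≤(+ˡ(*ˡ(rp1(1# + δ)))∙ alg "0+0+1(1)=1+a(1-1)" ∙ +ˡ(*ˡ(+ˡ(-₁(sym(rp1 δ))))))
  ∑W0{δ} p(suc N)= lin(∑W0 p N ⊹ rp-step≤(suc N)p)
   (alg "1+a(1-b)-(c+1d)=1+a(1-e)+a(e-b)-(c+d)")

  ∑W0≥ : ∀ {δ} -> 0# < δ -> ∀ N -> inv δ *(1# - rp(suc N)δ)≤ ∑(suc N)(W 0(1# + δ))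
  ∑W0≥{δ} p zero = e≤(*ˡ(+ˡ(-₁(rp1 δ)))∙ alg "a(1-1)=0+0")
  ∑W0≥{δ} p(suc N)= lin(∑W0≥ p N ⊹ rp-step≥(suc N)p)
   (alg "a+1b-c(1-d)=a+b-(c(1-e)+c(e-d))")

  power-bound : ∀ {x δ} k -> 0# ≤ x -> 0# < δ -> x ^ k * e(-(# k * δ * x))≤ inv δ ^ k
  power-bound{x}{δ} zero    p q = e≤(*ˡ(e-cong(alg "-(0ab)=0")∙ e-0)∙ alg "1(1)=1")
  power-bound{x}{δ}(suc k)p q = rs≤(alg "ab(cd)=ac(bd)" ∙
   *ˡ(sym(e-+ _ _)∙ e-cong(alg "-(ab)+-(cab)=-((1+c)ab)")))
   (*-mono(0≤* p(<≤(0<e _)))(0≤^ k(<≤(inv⁺ q)))(≤rs(alg "1a=a")(≤-/ q(≤rs(e-inv(δ * x))(rs≤(alg "abc=bca")(≤*(<≤(0<e _))(lin 0≤1(alg "1+ab-ab=1-0")⨾ 1+x≤e(δ * x)))))))(power-bound k p q))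

  W-power : ∀ k{δ} -> 0# < δ -> ∀ n -> W k(1# + #(suc k)* δ)n ≤ inv δ ^ k * W 0(1# + δ)n
  W-power k{δ} q zero    = e≤(alg "0=a0")
  W-power k{δ} q(suc n)= rs≤(alg "abc=a(bc)" ∙
   *ˡ(sym(e-+ _ _)∙ e-cong(alg "-(abc)+-((1+b)c)=-((1+(1+a)b)c)")))
   (≤rs(alg "ab=a(1b)")(≤*(<≤(0<rp(suc n)_))(power-bound k(0≤lg(suc n))q)))

  ∑W0≤ : ∀ {δ} -> 0# < δ -> ∀ N -> ∑ N(W 0(1# + δ))≤ 1# + inv δ
  ∑W0≤{δ} q N = ≤t(∑-incl(W 0(1# + δ))(trN(n≤1+n N)(n≤1+n(suc N)))(0≤W 0 _))(∑W0 q N ⨾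
   lin(0≤*(<≤(inv⁺ q))(<≤(0<rp(suc N)δ)))(alg "1+a-(1+a(1-b))=ab-0"))

  ∑W≤ : ∀ k{δ σ} -> 0# < δ -> 1# + #(suc k)* δ ≤ σ -> ∀ N -> ∑ N(W k σ)≤ wB k δ
  ∑W≤ k{δ} q r N =(∑-mono N \n _ -> W-anti k n r ⨾ W-power k q n)⨾
   rs≤(sym(∑-* N _ _))(*≤(0≤^ k(<≤(inv⁺ q)))(∑W0≤ q N))

  -- Any fixed power of log n is absorbed, so the tail past N decays like N^{-δ}.
  ∑W-tail : ∀ k{δ σ} -> 0# < δ -> 1# + #(suc(suc k))* δ ≤ σ -> ∀ M N .{{_ : Nz M}} -> M N.≤ N -> ∑ N(W k σ)- ∑ M(W k σ)≤ rp M δ * wB k δ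
  ∑W-tail k{δ}{σ} q r M N M≤N with m+o≡n M≤N
  ... | j , E.refl = e≤(lin≈(∑-split M j(W k σ))(alg "a-(b-c)=c+a-b"))⨾
   (∑-mono j \i _ -> each(M N.+ i)(m≤m+n M i))⨾ rs≤(sym(∑-* j _ _))(*≤(<≤(0<rp M δ))
    (lin(∑-nonneg M(\i _ -> 0≤W k τ i))(alg "a+b-b=a-0")⨾
     rs≤(∑-split M j(W k τ))(∑W≤ k q ≤r(M N.+ j))))
   where
   τ : R
   τ = 1# + #(suc k)* δ
   each : ∀ n -> M N.≤ n -> W k σ n ≤ rp M δ * W k τ n
   each zero    _ = e≤(alg "0=a0")
   each(suc n)l = ≤t(W-anti k(suc n)r)(rs≤(alg "abc=a(cb)" ∙
    *ˡ(sym(rp-+(suc n)δ τ)∙ rp-cong(suc n)(alg "a+(1+(1+b)a)=1+(1+(1+b))a")))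
    (≤rs(alg "ab=ba")(*≤(0≤W k τ(suc n))(rp-mono(<≤ q)l))))

  term-bound : ∀ k{a δ s} ->(∀ n -> ∥ a n ∥ ≤ 1#)-> 0# < δ -> 1# + #(suc k)* δ ≤ re s -> AbsBound(term k a s)(wB k δ)
  term-bound k{s = s} b q r N = ≤t(∑-mono N(\n _ -> ∥term∥ k s b n))(∑W≤ k q r N)

 open Multiples ring public using (keep; keep-yes; keep-no; ∑-multiples)
 open Multiples ℂ-ring public using () renaming (keep to keepc; keep-yes to keepc-yes; keep-no to keepc-no; keep-cong to keepc-cong; ∑-multiples to ∑c-multiples)

 opaque
  series-cong : ∀ {F G B} -> AbsBound F B ->(∀ n -> F n ~ G n)-> series F ~ series G
  series-cong b q = Lim-un(Limc-ext(\n -> ∑c-ext n q)(sums b))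
   (sums(\n -> rs≤(∑-ext n(\i -> ∥-cg(q i)))(b n)))

  series-+ : ∀ {F G A B} -> AbsBound F A -> AbsBound G B -> series(\n -> F n +c G n)~ series F +c series G
  series-+{F}{G} a b = Lim-un(sums(\n -> ∑-mono n(\i _ -> ∥-+(F i)(G i))⨾ rs≤(sym(∑-+ n _ _))(a n ⊹ b n)))
   (Limc-ext(\n -> symc(∑c-+ n F G))(Limc-+(sums a)(sums b)))

  series-* : ∀ {F B} c -> AbsBound F B -> series(\n -> c *c F n)~ c *c series F
  series-*{F} c b = Lim-un(sums(\n -> rs≤(sym(∑-* n ∥ c ∥ _)∙ ∑-ext n(\i -> sym(∥-* c(F i))))(*≤(0≤∥ c)(b n))))
   (Limc-ext(\n -> symc(∑c-* n c F))(Limc-c* c(sums b)))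

  dominated : ∀ {F G B} ->(∀ n -> ∥ F n ∥ ≤ ∥ G n ∥)-> AbsBound G B -> AbsBound F B
  dominated p b N = ≤t(∑-mono N(\n _ -> p n))(b N)

  scale-bound : ∀ {F B} c -> AbsBound F B -> AbsBound(\n -> c *c F n)(∥ c ∥ * B)
  scale-bound{F} c b n = rs≤(sym(∑-* n ∥ c ∥ _)∙ ∑-ext n(\i -> sym(∥-* c(F i))))(*≤(0≤∥ c)(b n))

 drop :{P : Set} -> Dec P -> ℂ -> ℂ
 drop(yes _)x = 0c
 drop(no _)  x = x

 opaque
  drop-yes : ∀ {P x}(d : Dec P)-> P -> drop d x ~ 0c
  drop-yes(yes _)p = reflc
  drop-yes(no n)  p = absurd(n p)

  drop-no : ∀ {P x}(d : Dec P)-> ¬ P -> drop d x ~ x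
  drop-no(yes p)n = absurd(n p)
  drop-no(no _)  n = reflc

  drop-∥∥ : ∀ {P} x(d : Dec P)-> ∥ drop d x ∥ ≤ ∥ x ∥
  drop-∥∥ x(yes _)= rs≤(sym ∥-0)(0≤∥ x)
  drop-∥∥ x(no _)  = ≤r

  drop-keep : ∀ {P} x(d : Dec P)-> drop d x ~ x -c keepc d x
  drop-keep x(yes _)=(algc "0=a-a")
  drop-keep x(no _)  =(algc "a=a-0")

  keep-∥∥ : ∀ {P} x(d : Dec P)-> keep d ∥ x ∥ ≤ ∥ x ∥
  keep-∥∥ x(yes _)= ≤r
  keep-∥∥ x(no _)  = 0≤∥ x

  multiples-bound : ∀ {F B} p .{{_ : Nz p}} -> AbsBound F B -> AbsBound(\m -> F(p N.* m))B
  multiples-bound{F} p b N = rs≤(∑-multiples p N(\n -> ∥ F n ∥))(∑-mono(N N.* p)(\n _ -> keep-∥∥(F n)(p ∣? n))⨾ b(N N.* p))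

  series-drop : ∀ {F B} p .{{_ : Nz p}} -> AbsBound F B -> series(\n -> drop(p ∣? n)(F n))~ series F -c series(\m -> F(p N.* m))
  series-drop{F} p b = Lim-un
   (Limc-sub(N._* p)(\n -> N.m≤m*n n p)(sums(dominated(\n -> drop-∥∥(F n)(p ∣? n))b)))
   (Limc-ext(\N -> symc(∑c-ext(N N.* p)(\n -> drop-keep(F n)(p ∣? n))⊙ ∑c--(N N.* p)F _ ⊙ +ˡc(-₁c(∑c-multiples p N F))))
    (Limc-+(Limc-sub(N._* p)(\n -> N.m≤m*n n p)(sums b))(Limc-neg(sums(multiples-bound p b)))))

 record Mult : Set where
  field
   fn   : ℕ -> ℂ
   mult : ∀ m n -> fn(m N.* n)~ fn m *c fn n
   unit : fn 1 ~ 1c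
   bdd  : ∀ n -> ∥ fn n ∥ ≤ 1#

 one : Mult
 one = record{ fn = \_ -> 1c ; mult = \_ _ ->(algc "1=1(1)"); unit = reflc ; bdd = \_ -> e≤ ∥-1 }

 sift : List ℕ ->(ℕ -> ℂ)-> ℕ -> ℂ
 sift []      g n = g n
 sift(p ∷ S)g n = drop(p ∣? n)(sift S g n)

 data DPrimes : List ℕ -> Set where
  []  : DPrimes []
  _∷_ : ∀ {p S} -> Prime p × All(\q -> ¬(q ≡ p))S -> DPrimes S -> DPrimes(p ∷ S)

 prime∤prime : ∀ {p q} -> Prime p -> Prime q -> ¬(q ≡ p)-> ¬(q ∣ p)
 prime∤prime pp pq n d with prime⇒irreducible pp d
 ... | inl q≡1 = N.nonTrivial⇒≢1{{nt pq}} q≡1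
 ... | inr q≡p = n q≡p

 -- E = ∏ (1 - x), S₁ = ∑ log p · x/(1-x), S₂ = ∑ log² p · x/(1-x)² with x = x_p.
 module Local (x : ℕ -> ℂ) where
  u : ℕ -> ℂ
  u p = x p *c invc(1c -c x p)

  E S₁ S₂ : List ℕ -> ℂ
  E  []      = 1c
  E  (p ∷ S)=(1c -c x p)*c E S
  S₁ []      = 0c
  S₁(p ∷ S)= S₁ S +c cx(lg p)*c u p
  S₂ []      = 0c
  S₂(p ∷ S)= S₂ S +c cx(lg p)*c cx(lg p)*c(u p *c(1c +c u p))

  opaque
   u-eq : ∀ p -> ∥ x p ∥ < 1# ->(1c -c x p)*c u p ~ x p
   u-eq p q = trc(algc "(1-a)(ab)=(1-a)ba")
    (*ʳc(invc-r \z -> q(e≤(sym ∥-1 ∙ ∥-cg(lin≈c z(algc "a-1=0-(1-a)")))))⊙ algc "1a=a")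

 module Sifted (g : Mult) (s : ℂ) (δ : R) (0<δ : 0# < δ) (σ≥ : 1# + # 3 * δ ≤ re s) where
  open Mult g
  open Local (\p -> fn p *c pw p s) public

  opaque
   sift-bdd : ∀ S n -> ∥ sift S fn n ∥ ≤ 1#
   sift-bdd []      n = bdd n
   sift-bdd(p ∷ S)n = ≤t(drop-∥∥(sift S fn n)(p ∣? n))(sift-bdd S n)
   sift-mult : ∀ {S} p -> Prime p -> DPrimes S -> All(\q -> ¬(q ≡ p))S -> ∀ m -> sift S fn(p N.* m)~ fn p *c sift S fn m
   sift-mult p pp [] [] m = mult p m
   sift-mult{q ∷ S} p pp((pq , _)∷ dS)(q≢p ∷ nS)m with q ∣?(p N.* m)| q ∣? m
   ... | yes _ | yes _ =(algc "0=a0")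
   ... | no _  | no _  = sift-mult p pp dS nS m
   ... | no n  | yes d = absurd(n(N.∣n⇒∣m*n p d))
   ... | yes d | no n with euclidsLemma p m pq d
   ...   | inl d' = absurd(prime∤prime pp pq q≢p d')
   ...   | inr d' = absurd(n d')

  T : ℕ -> List ℕ -> ℕ -> ℂ
  T k S = term k(sift S fn)s

  A : ℕ -> List ℕ -> ℂ
  A k S = series(T k S)

  Z : ℕ -> ℂ
  Z k = A k []

  opaque
   T-bound : ∀ k S -> k N.≤ 2 -> AbsBound(T k S)(wB k δ)
   T-bound k S k≤2 = term-bound k{s = s}(sift-bdd S)0<δ(≤r ⊹ ≤*(<≤ 0<δ)(#-mono(s≤s k≤2))⨾ σ≥)
   drop-term : ∀ k p S n -> T k(p ∷ S)n ~ drop(p ∣? n)(T k S n)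
   drop-term k p S zero with p ∣? zero
   ... | yes _ = reflc
   ... | no _  = reflc
   drop-term k p S(suc n)with p ∣? suc n
   ... | yes _ =(algc "0ab=0")
   ... | no _  = reflc
   term-* : ∀ k{S} p -> Prime p -> DPrimes S -> All(\q -> ¬(q ≡ p))S -> ∀ m ->
    T k S(p N.* suc m)~ fn p *c pw p s *c(sift S fn(suc m)*c cx((lg p + lg(suc m))^ k)*c pw(suc m)s)
   term-* k{S} p pp dS nS m = nonzero(p N.* suc m){{N.m*n≢0 p(suc m)}} ⊙ *₂c(*₂c(sift-mult p pp dS nS(suc m))(of-cong(^-cong k(lg-* p(suc m)))))(pw-* p(suc m)s)⊙
    algc "abc(de)=ad(bce)"
    where
    instance
     _ : Nz p
     _ = pr≢0 pp
    nonzero : ∀ n .{{_ : Nz n}} -> T k S n ~ sift S fn n *c cx(lg n ^ k)*c pw n s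
    nonzero(suc n)= reflc
   T-0 : ∀ k S p -> T k S(p N.* zero)~ 0c
   T-0 k S p rewrite N.*-zeroʳ p = reflc

  module _ {p S} (pp : Prime p) (dS : DPrimes S) (nS : All (\q -> ¬ (q ≡ p)) S) where
   private
    x l : ℂ
    x = fn p *c pw p s
    l = cx(lg p)
    instance
     _ : Nz p
     _ = pr≢0 pp
    step : ∀ k -> k N.≤ 2 -> A k(p ∷ S)~ A k S -c series(\m -> T k S(p N.* m))
    step k k≤2 = trc(series-cong(T-bound k(p ∷ S)k≤2)(drop-term k p S))(series-drop p(T-bound k S k≤2))
    mb : ∀ k -> k N.≤ 2 -> AbsBound(\m -> T k S(p N.* m))(wB k δ)
    mb k k≤2 = multiples-bound p(T-bound k S k≤2)
    0≤2 : 0 N.≤ 2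
    0≤2 = z≤n
    1≤2 : 1 N.≤ 2
    1≤2 = s≤s z≤n
    2≤2 : 2 N.≤ 2
    2≤2 = rfN
   sieve₀ : A 0(p ∷ S)~(1c -c x)*c A 0 S
   sieve₀ = step 0 0≤2 ⊙ +ˡc(-₁c(series-cong(mb 0 0≤2)eq ⊙ series-* x(T-bound 0 S 0≤2)))⊙
    algc "a-ba=(1-b)a"
    where
    eq : ∀ m -> T 0 S(p N.* m)~ x *c T 0 S m
    eq zero    = trc(T-0 0 S p)(algc "0=a0")
    eq(suc m)= term-* 0 p pp dS nS m
   sieve₁ : A 1(p ∷ S)~(1c -c x)*c A 1 S -c x *c l *c A 0 S
   sieve₁ = step 1 1≤2 ⊙ +ˡc(-₁c(series-cong(mb 1 1≤2)eq ⊙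
    series-+(scale-bound x(T-bound 1 S 1≤2))(scale-bound(x *c l)(T-bound 0 S 0≤2))⊙ +₂c(series-* x(T-bound 1 S 1≤2))(series-*(x *c l)(T-bound 0 S 0≤2))))⊙
    algc "a-(ba+bcd)=(1-b)a-bcd"
    where
    eq : ∀ m -> T 1 S(p N.* m)~ x *c T 1 S m +c x *c l *c T 0 S m
    eq zero    = trc(T-0 1 S p)(algc "0=a0+ab0")
    eq(suc m)= trc(term-* 1 p pp dS nS m)(*ˡc(*ʳc(*ˡc(of-cong(alg "(a+b)1=a+b1")⊙ of-+(lg p)(lg(suc m)* 1#))))⊙
     algc "a(b(c+d)e)=a(bde)+ac(b1e)")
   sieve₂ : A 2(p ∷ S)~(1c -c x)*c A 2 S -c(x *c(#c 2 *c l)*c A 1 S +c x *c(l *c l)*c A 0 S)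
   sieve₂ = step 2 2≤2 ⊙ +ˡc(-₁c(series-cong(mb 2 2≤2)eq ⊙
    series-+(scale-bound x(T-bound 2 S 2≤2))bound ⊙ +₂c(series-* x(T-bound 2 S 2≤2))(series-+(scale-bound c(T-bound 1 S 1≤2))(scale-bound d(T-bound 0 S 0≤2))⊙ +₂c(series-* c(T-bound 1 S 1≤2))(series-* d(T-bound 0 S 0≤2)))))⊙
    algc "a-(ba+(cd+ef))=(1-b)a-(cd+ef)"
    where
    c d : ℂ
    c = x *c(#c 2 *c l)
    d = x *c(l *c l)
    bound : AbsBound(\m -> c *c T 1 S m +c d *c T 0 S m)(∥ c ∥ * wB 1 δ + ∥ d ∥ * wB 0 δ)
    bound n = ≤t(∑-mono n(\i _ -> ∥-+ _ _))(rs≤(sym(∑-+ n _ _))(scale-bound c(T-bound 1 S 1≤2)n ⊹ scale-bound d(T-bound 0 S 0≤2)n))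
    eq : ∀ m -> T 2 S(p N.* m)~ x *c T 2 S m +c(c *c T 1 S m +c d *c T 0 S m)
    eq zero    = trc(T-0 2 S p)(algc "0=a0+(b0+c0)")
    eq(suc m)= term-* 2 p pp dS nS m ⊙ trc(*ˡc(*ʳc(*ˡc(of-*(lg p + lg(suc m))_ ⊙ *₂c(of-+(lg p)(lg(suc m)))(of-*(lg p + lg(suc m))1# ⊙ *ʳc(of-+(lg p)(lg(suc m))))⊙ algc "(a+b)((a+b)1)=b(b1)+2a(b1)+aa"))))
     (algc "a(b(c(c1)+2d(c1)+dd)e)=a(b(c(c1))e)+(a(2d)(b(c1)e)+a(dd)(b1e))")
      `then` symc(+₂c(*ˡc(*ʳc(*ˡc(of-*(lg(suc m))_ ⊙ *ˡc of1))))(+ʳc(*ˡc(*ʳc(*ˡc of1)))))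
     where
     infixr 2 _`then`_
     _`then`_ : ∀ {a b c} -> a ~ b -> b ~ c -> a ~ c
     _`then`_ = trc
     of1 : cx(lg(suc m)^ 1)~(cx(lg(suc m)))*c 1c
     of1 = of-*(lg(suc m))1#

  opaque
   x<1 : ∀ p -> Prime p -> ∥ fn p *c pw p s ∥ < 1#
   x<1 p pp = ≤<tr(e≤(∥-* _ _ ∙ *ˡ(∥pw∥ p s))⨾ *-mono(0≤∥ _)(<≤(0<rp p 1#))(bdd p)(rp-anti p(lin(0≤*(0≤# 3)(<≤ 0<δ))(alg "1+3a-1=3a-0")⨾ σ≥))⨾ e≤(alg "1a=a"))
    (<-respʳ e-0(e-mono<(lin<(lg-mono<{1}{p}(N.nonTrivial⇒n>1 p{{nt pp}})`by` lg-1)(alg "0--(1a)=a-0"))))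
    where
    _`by`_ : ∀ {a b c} -> a < b -> a ≈ c -> c < b
    p `by` q = <-respˡ q p
   sieved₀ : ∀ {S} -> DPrimes S -> A 0 S ~ E S *c Z 0
   sieved₀ [] =(algc "a=1a")
   sieved₀{p ∷ S}((pp , nS)∷ dS)= sieve₀ pp dS nS ⊙ *ˡc(sieved₀ dS)⊙ algc "(1-a)(bc)=(1-a)bc"
    where
    x : ℂ
    x = fn p *c pw p s
   sieved₁ : ∀ {S} -> DPrimes S -> A 1 S ~ E S *c(Z 1 -c S₁ S *c Z 0)
   sieved₁ [] =(algc "a=1(a-0b)")
   sieved₁{p ∷ S}((pp , nS)∷ dS)= sieve₁ pp dS nS ⊙ +₂c(*ˡc(sieved₁ dS))(-₁c(*₂c(*ʳc(symc(u-eq p(x<1 p pp))))(sieved₀ dS)))⊙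
    algc "(1-a)(b(c-de))-(1-a)fg(be)=(1-a)b(c-(d+gf)e)"
    where
    x l : ℂ
    x = fn p *c pw p s
    l = cx(lg p)
   sieved₂ : ∀ {S} -> DPrimes S -> A 2 S ~ E S *c(Z 2 -c #c 2 *c S₁ S *c Z 1 +c(S₁ S *c S₁ S -c S₂ S)*c Z 0)
   sieved₂ [] =(algc "a=1(a-2(0)b+(0(0)-0)c)")
   sieved₂{p ∷ S}((pp , nS)∷ dS)= sieve₂ pp dS nS ⊙ +₂c(*ˡc(sieved₂ dS))(-₁c(+₂c(*₂c(*ʳc x≈)(sieved₁ dS))(*₂c(*ʳc x≈)(sieved₀ dS))))⊙
    algc "(1-a)(b(c-2de+(dd-f)g))-((1-a)h(2i)(b(e-dg))+(1-a)h(ii)(bg))=(1-a)b(c-2(d+ih)e+((d+ih)(d+ih)-(f+ii(h(1+h))))g)"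
    where
    x l : ℂ
    x = fn p *c pw p s
    l = cx(lg p)
    x≈ : x ~(1c -c x)*c u p
    x≈ = symc(u-eq p(x<1 p pp))

 opaque
  exp-diff : ∀ {a b ρ} -> ∥ a ∥ ≤ ρ -> ∥ b ∥ ≤ ρ -> ∥ exp a -c exp b -c(a -c b)∥ ≤ # 3 * ρ * e(# 3 * ρ)* ∥ a -c b ∥
  exp-diff{a}{b}{ρ} p q = e≤(∥-cg(+ʳc(+ʳc(exp-cong(algc "a=b+(a-b)")⊙ exp-+ b(a -c b)))⊙
   algc "ab-a-(c-d)=a(b-1-(c-d))+(a-1)(c-d)"))⨾
   ∥-+ _ _ ⨾ ≤t(e≤(∥-* _ _))(*-mono(0≤∥ _)(0≤*(0≤*(0≤∥ _)0≤2ρ)(0≤e _))(rs≤(sym(∥exp∥ b))(e-mono(re≤∥ b ⨾ q)))(∥exp-1-z∥(a -c b)⨾ *-mono(0≤*(0≤∥ _)(0≤∥ _))(0≤e _)(*≤(0≤∥ _)d≤)(e-mono d≤)))⊹ ≤t(e≤(∥-* _ _))(≤*(0≤∥ _)(∥exp-1∥ b ⨾ *-mono(0≤∥ b)(0≤e _)q(e-mono(q ⨾ lin(0≤2ρ)(alg "3a-a=a+a-0")))))⨾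
    e≤(alg "a(b(c+c)d)+ceb=ad(b(c+c))+ceb" ∙
     +ʳ(*ʳ(sym(e-+ ρ(ρ + ρ))∙ e-cong(alg "a+(a+a)=3a")))∙
      alg "a(b(c+c))+cab=3cab")
   where
   0≤e : ∀ x -> 0# ≤ e x
   0≤e x = <≤(0<e x)
   0≤ρ : 0# ≤ ρ
   0≤ρ = ≤t(0≤∥ a)p
   0≤2ρ : 0# ≤ ρ + ρ
   0≤2ρ = 0≤+ 0≤ρ 0≤ρ
   d≤ : ∥ a -c b ∥ ≤ ρ + ρ
   d≤ = ≤t(∥-- a b)(p ⊹ q)

 module _ (a : ℕ -> ℂ) (bdd : ∀ n -> ∥ a n ∥ ≤ 1#) where
  D : ℕ -> ℂ -> ℂ
  D k s = series(term k a s)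

  opaque
   term-diff : ∀ k{c s s' ρ} -> ∥ s -c c ∥ ≤ ρ -> ∥ s' -c c ∥ ≤ ρ -> ∀ n ->
    ∥ term k a s n -c term k a s' n +c(s -c s')*c term(suc k)a c n ∥ ≤ # 3 * ρ * ∥ s -c s' ∥ * W(suc(suc k))(re c - # 3 * ρ)n
   term-diff k{c}{s}{s'}{ρ} p q zero = e≤((∥-cg(algc "0-0+(a-b)0=0")∙ ∥-0)∙ alg "0=3ab0")
   term-diff k{c}{s}{s'}{ρ} p q n@(suc _)= e≤(∥-cg(+₂c(+₂c(*ˡc(shift s))(-₁c(*ˡc(shift s'))))(*ˡc(*ʳc(*ˡc(of-* L(L ^ k)))))⊙
    algc "ab(cd)-ab(ce)+(f-g)(a(hb)c)=abc(d-e-(-((f-i)h)--((g-i)h)))")∙ ∥-* _ _)⨾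
    *-mono(0≤∥ _)(0≤*(0≤*(0≤*(0≤# 3)(0≤*(0≤∥ _ ⨾ p)(0≤lg n)))(<≤(0<e _)))(0≤∥ _))(∥term∥ k c bdd n)(exp-diff(small s p)(small s' q))⨾
    e≤(*ˡ(*ˡ(∥-cg(algc "-((a-b)c)--((d-b)c)=-((a-d)c)")∙ ∥-neg _ ∙ ∥-* _ _ ∙ *ˡ(∥-of(0≤lg n))))∙
     alg "ab(3(cd)e(fd))=3cf(d(da)(be))" ∙
      *ˡ(*ˡ(sym(e-+ _ _)∙ e-cong(alg "-(ab)+3(cb)=-((a-3c)b)"))))
    where
    L : R
    L = lg n
    shift : ∀ s -> pw n s ~ pw n c *c exp(-c((s -c c)*c cx L))
    shift s = trc(pw-cong n(algc "a=b+(a-b)"))(pw-+ n c(s -c c))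
    small : ∀ s -> ∥ s -c c ∥ ≤ ρ -> ∥ -c((s -c c)*c cx L)∥ ≤ ρ * L
    small s p = rs≤(sym(∥-neg _ ∙ ∥-* _ _ ∙ *ˡ(∥-of(0≤lg n))))(≤*(0≤lg n)p)
   series-diff : ∀ k{c s s' ρ δ} -> 0# < δ -> 1# + #(suc(suc(suc k)))* δ ≤ re c - # 3 * ρ -> ∥ s -c c ∥ ≤ ρ -> ∥ s' -c c ∥ ≤ ρ ->
    ∥ D k s -c D k s' +c(s -c s')*c D(suc k)c ∥ ≤ # 3 * ρ * ∥ s -c s' ∥ * wB(suc(suc k))δ
   series-diff k{c}{s}{s'}{ρ}{δ} 0<δ r p q = e≤(∥-cg(symc(series-+ both(scale-bound _ bc)⊙ +₂c
    (series-+ bs bs'' ⊙ +ˡc(series-cong bs''(\n ->(algc "-a=-1a"))⊙ series-*(-c 1c)bs' ⊙ algc "-1a=-a"))(series-* _ bc))))⨾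
    series-bound \N -> ∑-mono N(\n _ -> term-diff k p q n)⨾ rs≤(sym(∑-* N _ _))(*≤(0≤*(0≤*(0≤# 3)0≤ρ)(0≤∥ _))(∑W≤(suc(suc k))0<δ r N))
    where
    0≤ρ : 0# ≤ ρ
    0≤ρ = ≤t(0≤∥ _)p
    0≤δ : 0# ≤ δ
    0≤δ = <≤ 0<δ
    inside : ∀ {s} -> ∥ s -c c ∥ ≤ ρ -> 1# + #(suc k)* δ ≤ re s
    inside{s} p = lin(r ⊹ re≤∥(c -c s)⊹ e≤(∥-sw c s)⊹ p ⊹ 0≤δ ⊹ 0≤δ ⊹ 0≤ρ ⊹ 0≤ρ)
     (alg "a-(1+(1+b)c)=d-3e+f+g+e+c+c+e+e-(1+(1+(1+(1+b)))c+(d-a)+f+g+0+0+0+0)")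
    bs : AbsBound(term k a s)(wB k δ)
    bs = term-bound k{s = s} bdd 0<δ(inside p)
    bs' : AbsBound(term k a s')(wB k δ)
    bs' = term-bound k{s = s'} bdd 0<δ(inside q)
    bs'' : AbsBound(\n -> -c term k a s' n)(wB k δ)
    bs'' = dominated(\n -> e≤(∥-neg _))bs'
    bc : AbsBound(term(suc k)a c)(wB(suc k)δ)
    bc = term-bound(suc k){s = c} bdd 0<δ(lin(r ⊹ 0≤δ ⊹ 0≤ρ ⊹ 0≤ρ ⊹ 0≤ρ)(alg "a-(1+(1+(1+b))c)=a-3d+c+d+d+d-(1+(1+(1+(1+b)))c+0+0+0+0)"))
    both : AbsBound(\n -> term k a s n +c -c term k a s' n)(wB k δ + wB k δ)
    both n = ∑-mono n(\i _ -> ∥-+ _ _)⨾ rs≤(sym(∑-+ n _ _))(bs n ⊹ bs'' n)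

 -- The iteration s ↦ s - f(s)/d halves the residual at every step.
 module _ (f : ℂ -> ℂ) (c d : ℂ) (r : R) (d≉0 : ¬ (d ~ 0c))
  (near : ∀ s s' -> ∥ s -c c ∥ ≤ r -> ∥ s' -c c ∥ ≤ r -> ∥ f s -c f s' -c d *c(s -c s')∥ ≤ half(∥ d ∥ * ∥ s -c s' ∥))
  (start : ∥ f c ∥ ≤ ∥ d ∥ * half r)where
  private
   d>0 : 0# < ∥ d ∥
   d>0 = ∥∥-pos d≉0
   Δ : ℂ -> ℂ
   Δ s = -c(f s *c invc d)
   seq : ℕ -> ℂ
   seq zero    = c
   seq(suc n)= seq n +c Δ(seq n)
   tol : ℕ -> R
   tol zero    = half r
   tol(suc n)= half(tol n)
   opaque
    dΔ : ∀ s -> d *c Δ s ~ -c f s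
    dΔ s = trc(algc "a(-(bc))=-(acb)")(-₁c(*ʳc(invc-r d≉0))⊙ algc "-(1a)=-a")
    ∥Δ∥ : ∀ {s t} -> ∥ f s ∥ ≤ ∥ d ∥ * t -> ∥ Δ s ∥ ≤ t
    ∥Δ∥{s} p = cancel d>0(rs≤(sym(∥-neg _)∙ ∥-cg(symc(dΔ s))∙ ∥-* _ _)p)
    0≤tol : ∀ n -> 0# ≤ tol n
    0≤tol zero    = cancel d>0(rs≤(alg "0=a0")(0≤∥(f c)⨾ start))
    0≤tol(suc n)= 0≤*(0≤tol n)0≤h
    invariant : ∀ n -> ∥ f(seq n)∥ ≤ ∥ d ∥ * tol n × ∥ seq n -c c ∥ +(tol n + tol n)≤ r
    invariant zero    = start , e≤(+₂(∥-cg(algc "a-a=0")∙ ∥-0)(h+h r)∙ alg "0+a=a")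
    invariant(suc n)with invariant n
    ... | p , q = e≤(∥-cg(lin≈c(dΔ(seq n))(algc "a-b-c(d+e-d)-a=-b-ce")))⨾
     near(seq(suc n))(seq n)(lin(moved ⊹ 0≤tol n)(alg "a+(b+b)-c=a+b+b-(c+0)")⨾ q)(lin(0≤tol n ⊹ 0≤tol n)(alg "a+(b+b)-a=b+b-(0+0)")⨾ q)⨾ ≤* 0≤h(*≤(0≤∥ d)(rs≤(∥-cg(algc "a=b+a-b"))(∥Δ∥ p)))⨾ e≤(alg "abc=a(bc)")
     , lin moved(alg "a+b+(c+c)-(d+(c+c))=a+b-d")⨾
      rs≤(alg "a+(b+b)=a+b+b" ∙ +ˡ(sym(h+h(tol n))))q
     where
     moved : ∥ seq(suc n)-c c ∥ ≤ ∥ seq n -c c ∥ + tol n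
     moved = ≤t(e≤(∥-cg(algc "a+b-c=a-c+b")))(∥-+ _ _ ⨾ ≤r ⊹ ∥Δ∥ p)
    ∑tol : ∀ n -> ∑ n tol +(tol n + tol n)≤ r
    ∑tol zero    = e≤(+ˡ(h+h r)∙ alg "0+a=a")
    ∑tol(suc n)= rs≤(alg "a+(b+b)=a+b+b" ∙ +ˡ(sym(h+h(tol n))))(∑tol n)
    steps : AbsBound(\n -> Δ(seq n))r
    steps n = ≤t(∑-mono n(\i _ -> ∥Δ∥(fst(invariant i))))(lin(0≤tol n ⊹ 0≤tol n)(alg "a+(b+b)-a=b+b-(0+0)")⨾ ∑tol n)
    seq-sum : ∀ n -> seq n ~ c +c ∑ᶜ n(\i -> Δ(seq i))
    seq-sum zero    =(algc "a=a+0")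
    seq-sum(suc n)= trc(+ʳc(seq-sum n))(algc "a+b+c=a+(b+c)")
    tol→0 : ∀ ε -> 0# < ε -> ∃ \N -> ∀ n -> N N.≤ n -> tol n ≤ ε
    tol→0 ε p with arch(half r)ε p
    ... | N , q = suc N , \n Nn -> cancel(<≤tr(0<#s N)(#-mono Nn))(go n ⨾ q ⨾ ≤*(<≤ p)(#-mono(trN(n≤1+n N)Nn)))
     where
     go : ∀ n -> # n * tol n ≤ half r
     go zero    = rs≤(alg "0=0a")(0≤tol 0)
     go(suc zero)= lin(0≤tol 1 ⊹ e≤(h+h(half r)))(alg "a-(1+0)b=b+a-(0+(b+b))")
     go(suc(suc n))= ≤t(lin(0≤*(0≤# n)(0≤tol(suc(suc n)))⊹ e≤(*ˡ{# suc n}(h+h(tol(suc n)))))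
      (alg "(1+a)b-(1+(1+a))c=ac+(1+a)b-(0+(1+a)(c+c))"))(go(suc n))
   ρ : ℂ
   ρ = c +c series(\n -> Δ(seq n))

  opaque
   newton : ∃ \ρ -> ∥ ρ -c c ∥ ≤ r × f ρ ~ 0c
   newton = ρ , ρ-c , ∥∥-≤0(≤-by-ε \ε p -> close(ε /(# 3 * ∥ d ∥))(/-pos p 3d>0)⨾ e≤(*-/ 3d>0 ∙ alg "a=0+a"))
    where
    3d>0 : 0# < # 3 * ∥ d ∥
    3d>0 = *-pos(0<#s 2)d>0
    ρ-c : ∥ ρ -c c ∥ ≤ r
    ρ-c = rs≤(∥-cg(algc "a=b+a-b"))(series-bound steps)
    in-disc : ∀ n -> ∥ seq n -c c ∥ ≤ r
    in-disc n = ≤t(lin(0≤tol n ⊹ 0≤tol n)(alg "a+(b+b)-a=b+b-(0+0)"))(snd(invariant n))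
    close : ∀ ε -> 0# < ε -> ∥ f ρ ∥ ≤ # 3 * ∥ d ∥ * ε
    close ε p with tol→0 ε p | evt(Limc-ext(\n -> symc(seq-sum n))(Limc-+(Limc-const c)(sums steps)))ε p
    ... | M , a | N , b = e≤(∥-cg(algc "a=a-b-c(d-e)+(c(d-e)+b)"))⨾ ∥-+ _ _ ⨾
     ≤t(near ρ(seq n)ρ-c(in-disc n))(half≤(0≤*(0≤∥ d)(0≤∥ _)))⊹ ≤t(∥-+ _ _)(e≤(∥-* _ _)⊹ ≤t(fst(invariant n))(*≤(0≤∥ d)(a n(N.m≤m⊔n M N))))⨾
      lin(twice ⊹ twice)(alg "3ab-(ac+(ac+ab))=ab+ab-(ac+ac)")
     where
     n : ℕ
     n = M N.⊔ N
     twice : ∥ d ∥ * ∥ ρ -c seq n ∥ ≤ ∥ d ∥ * ε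
     twice = *≤(0≤∥ d)(rs≤(∥-sw _ _)(b n(N.m≤n⊔m M N)))

 infixr 8 _^c_
 _^c_ : ℂ -> ℕ -> ℂ
 z ^c zero  = 1c
 z ^c suc n = z *c z ^c n

 χ : ℕ -> R -> ℂ
 χ n t = pw n(mk 0# t)

 Poly' : Set
 Poly' = List(ℕ × ℂ)

 val : Poly' -> R -> ℂ
 val []            t = 0c
 val((n , c)∷ P)t = c *c χ n t +c val P t

 ℓ₁ ℓ₂ : Poly' -> R
 ℓ₁ []            = 0#
 ℓ₁((n , c)∷ P)= ∥ c ∥ + ℓ₁ P
 ℓ₂ []            = 0#
 ℓ₂((n , c)∷ P)= nsq c + ℓ₂ P

 Within : ℕ -> Poly' -> Set
 Within X = All(\x -> Nz(fst x)× fst x N.≤ X)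

 Distinct : Poly' -> Set
 Distinct = AllPairs(\x y -> ¬(fst x ≡ fst y))

 opaque

  ^c-unit : ∀ {z} -> ∥ z ∥ ≈ 1# -> ∀ a -> ∥ z ^c a ∥ ≈ 1#
  ^c-unit q zero    = ∥-1
  ^c-unit q(suc a)= trans(∥-* _ _)(*₂ q(^c-unit q a)∙ alg "1(1)=1")

  ^c-* : ∀ z w a ->(z *c w)^c a ~ z ^c a *c w ^c a
  ^c-* z w zero    =(algc "1=1(1)")
  ^c-* z w(suc a)= trc(*ˡc(^c-* z w a))(algc "ab(cd)=ac(bd)")

  geometric : ∀ z J ->(1c -c z)*c ∑ᶜ J(z ^c_)~ 1c -c z ^c J
  geometric z zero    =(algc "(1-a)0=1-1")
  geometric z(suc J)= lin≈c(geometric z J)(algc "1-ab-(1-a)(c+b)=1-b-(1-a)c")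

  ∥χ∥ : ∀ n t -> ∥ χ n t ∥ ≈ 1#
  ∥χ∥ n t = trans(∥pw∥ n(mk 0# t))(e-cong(alg "-(0a)=0")∙ e-0)

  χ-+ : ∀ n t u -> χ n(t + u)~ χ n t *c χ n u
  χ-+ n t u = trc(pw-cong n(mk≈(alg "0=0+0")refl))(pw-+ n(mk 0# t)(mk 0# u))

  χ-step : ∀ n t u j -> χ n(t + # j * u)~ χ n t *c χ n u ^c j
  χ-step n t u zero    = trc(pw-cong n(mk≈ refl(alg "a+0b=a")))(algc "a=a1")
  χ-step n t u(suc j)= trc(pw-cong n(mk≈ refl(alg "a+(1+b)c=a+bc+c"))⊙ χ-+ n(t + # j * u)u)
   (*ʳc(χ-step n t u j)⊙ algc "abc=a(cb)")

  χ-* : ∀ m n t .{{_ : Nz m}} .{{_ : Nz n}} -> χ(m N.* n)t ~ χ m t *c χ n t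
  χ-* m n t = pw-* m n(mk 0# t)

  χ-1 : ∀ t -> χ 1 t ~ 1c
  χ-1 t = pw1(mk 0# t)

  nsq-+ : ∀ a b -> nsq(a +c b)≈ nsq a + nsq b +(re(a *c conj b)+ re(a *c conj b))
  nsq-+ a b =(alg "(a+b)(a+b)+(c+d)(c+d)=aa+cc+(bb+dd)+(ab-c(-d)+(ab-c(-d)))")

  nsq-unit : ∀ {z} -> ∥ z ∥ ≈ 1# -> nsq z ≈ 1#
  nsq-unit{z} q = sym(∥-sq z)∙ *₂ q q ∙ alg "1(1)=1"

  -- 1 - exp(iα) is at least α/2 in absolute value for |α| ≤ 1/4.
  gap : ∀ u -> ∥ u ∥ ≤ inv(# 4)-> half ∥ u ∥ ≤ ∥ 1c -c exp u ∥
  gap u q = lin((rs≤(∥-neg u)(∥-rev(-c u)(1c -c exp u)⨾ ≤r ⊹ ≤t(e≤(∥-cg(algc "-a-(1-b)=b-1-a")))(∥exp-1-z∥ u ⨾ rs≤(alg "a(ab)=aab")(*≤(0≤∥ u)(*-mono(0≤∥ u)(0≤# 2)q(e-mono q ⨾ e-≤ q4<1 ⨾ rs≤(alg "1a=a")(/-≤(0<-by q4<1)(lin(0≤q4 ⊹ 0≤q4 ⊹ e≤ f4)(alg "2(1-a)-1=a+a+1-(0+0+4a)"))))⨾ cancel{2#}(0<#s 1)(lin(e≤ f4 ⊹ e≤(sym 2h))(alg "2a-2(b2)=1+2a-(4b+1)")))))))⊹ e≤(h+h ∥ u ∥))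
   (alg "a-b=a+b+c-(c+(b+b))")
   where
   q4 : R
   q4 = inv(# 4)
   f4 : # 4 * q4 ≈ 1#
   f4 = inv-r(0<#s 3)
   0<q4 : 0# < q4
   0<q4 = inv⁺(0<#s 3)
   0≤q4 : 0# ≤ q4
   0≤q4 = <≤ 0<q4
   q4<1 : q4 < 1#
   q4<1 = <-respʳ f4(lin<(*-pos(0<#s 2)0<q4)(alg "4a-a=3a-0"))

 module _ (η : R) (0<η : 0# < η) (X : ℕ) (fine : η * lg X ≤ inv (# 4)) (t₀ : R) (J : ℕ) where
  sample : ℕ -> R
  sample j = t₀ + # j * η

  Γ : R
  Γ = # 4 * # X * inv η

  opaque
   correlation : ∀ {m n} .{{_ : Nz m}} -> m N.< n -> n N.≤ X -> ∥ ∑ᶜ J(\j -> χ n(sample j)*c conj(χ m(sample j)))∥ ≤ Γ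
   correlation{m}{n} m<n n≤X = cancel(half-pos(*-pos 0<η(inv⁺(0<# X))))((≤*(0≤∥ _)(≤* 0≤h(≤rs(sym ∥u∥)(*≤(<≤ 0<η)Δ≥)))⨾ ≤*(0≤∥ _)(gap u(rs≤(sym ∥u∥)(*≤(<≤ 0<η)(lin(lg-mono{{N.>-nonZero(N.≤-<-trans z≤n m<n)}} n≤X ⊹ 0≤lg m)(alg "a-(b-c)=a+c-(b+0)"))⨾ fine))))⨾
    e≤(sym(∥-* _ _)∙ ∥-cg(*ˡc(∑c-ext J summand ⊙ ∑c-* J w(exp u ^c_))⊙ algc "(1-a)(bc)=b((1-a)c)" ⊙ *ˡc(geometric(exp u)J)))⨾ e≤(∥-* _ _)⨾ rs≤(*ʳ(sym(unit t₀)))(e≤(alg "1a=a")⨾ ∥-- _ _ ⨾ e≤(+₂ ∥-1(^c-unit(∥-cg(symc z≈)∙ unit η)J)))⨾ e≤(sym(alg "abc(4de)=2c2(ae)(db)" ∙ *₂(*₂(*ʳ 2h)(inv-r 0<η))(inv-r(0<# X))∙ alg "1(2)1(1)=1+1")))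
    where
    instance
     _ : Nz X
     _ = N.>-nonZero(N.<-≤-trans(N.≤-<-trans z≤n m<n)n≤X)
    w u : ℂ
    w = χ n t₀ *c conj(χ m t₀)
    u = -c(mk 0# η *c cx(lg n - lg m))
    Δ≥ : inv(# X)≤ lg n - lg m
    Δ≥ = lin(inv-anti(0<#s m)(#-mono(trN m<n n≤X))⊹ lg-step≥ m ⊹ lg-mono m<n)
     (alg "a-b-c=d+e+a-(c+(b+d)+e)")
    ∥u∥ : ∥ u ∥ ≈ η *(lg n - lg m)
    ∥u∥ = trans(∥-neg _)(∥-* _ _ ∙ *₂(∥-unique(<≤ 0<η)(alg "aa=0(0)+aa"))(∥-of(<≤(inv⁺(0<# X))⨾ Δ≥)))
    z≈ : χ n η *c conj(χ m η)~ exp u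
    z≈ = trc(*ˡc(symc(exp-conj _)))(symc(exp-+ _ _)⊙ exp-cong(mk≈
     (alg "-(0a-b0)+-(0c-b0)=-(0(a-c)-b0)")
     (alg "-(0(0)+ab)+--(0(0)+ac)=-(0(0)+a(b-c))")))
    unit : ∀ s -> ∥ χ n s *c conj(χ m s)∥ ≈ 1#
    unit s = trans(∥-* _ _)(*₂(∥χ∥ n s)(∥-conj _ ∙ ∥χ∥ m s)∙ alg "1(1)=1")
    conj-^ : ∀ z j -> conj(z ^c j)~ conj z ^c j
    conj-^ z zero    = conj-of 1#
    conj-^ z(suc j)= trc(conj-* z(z ^c j))(*ˡc(conj-^ z j))
    ^-congc : ∀ {a b} -> a ~ b -> ∀ j -> a ^c j ~ b ^c j
    ^-congc q zero    = reflc
    ^-congc q(suc j)= *₂c q(^-congc q j)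
    summand : ∀ j -> χ n(sample j)*c conj(χ m(sample j))~ w *c exp u ^c j
    summand j = trc(*₂c(χ-step n t₀ η j)(conj-cong(χ-step m t₀ η j)⊙ conj-* _ _ ⊙ *ˡc(conj-^(χ m η)j)))
     (algc "ab(cd)=ac(bd)" ⊙
      *ˡc(symc(^c-*(χ n η)(conj(χ m η))j)⊙ ^-congc z≈ j))
   correlation' : ∀ {m n} .{{_ : Nz m}} .{{_ : Nz n}} -> m N.≤ X -> n N.≤ X -> ¬(m ≡ n)-> ∥ ∑ᶜ J(\j -> χ n(sample j)*c conj(χ m(sample j)))∥ ≤ Γ
   correlation'{m}{n} m≤X n≤X m≢n with N.<-cmp m n
   ... | tri< m<n _ _ = correlation m<n n≤X
   ... | tri≈ _ q _   = absurd(m≢n q)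
   ... | tri> _ _ n<m = rs≤(sym(∥-conj _)∙ ∥-cg(conj-∑ J _ ⊙ ∑c-ext J \j ->
    conj-* _ _ ⊙ *ˡc(conj-conj _)⊙ algc "ab=ba"))(correlation n<m m≤X)
   cross : ∀ n .{{_ : Nz n}} -> n N.≤ X -> ∀ {P} -> Within X P -> All(\y -> ¬(n ≡ fst y))P -> ∥ ∑ᶜ J(\j -> χ n(sample j)*c conj(val P(sample j)))∥ ≤ Γ * ℓ₁ P
   cross n n≤X [] [] = ≤t(e≤(∥-cg(∑c-0 J \j _ -> *ˡc(conj-of 0#)⊙ algc "a0=0")∙ ∥-0))(e≤(alg "0=a0"))
   cross n n≤X{(m , d)∷ P}((m≢0 , m≤X)∷ W)(n≢m ∷ N)= ≤t(e≤(∥-cg(∑c-ext J(\j ->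
    *ˡc(conj-+ _ _ ⊙ +ʳc(conj-* d(χ m(sample j))))⊙ algc "a(bc+d)=b(ac)+ad")⊙
    ∑c-+ J _ _ ⊙ +ʳc(∑c-* J(conj d)_))))(∥-+ _ _ ⨾ ≤t(e≤(∥-* _ _ ∙ *ʳ(∥-conj d)))(*≤(0≤∥ d)(correlation'{{m≢0}} m≤X n≤X(\q -> n≢m(E.sym q))))⊹ cross n n≤X W N ⨾
    e≤(alg "ab+bc=b(a+c)"))
   mean-value : ∀ {P} -> Within X P -> Distinct P -> abs(∑ J(\j -> nsq(val P(sample j)))- # J * ℓ₂ P)≤ Γ *(ℓ₁ P * ℓ₁ P)
   mean-value [] [] = ≤t(e≤(abs-cong(+ʳ(∑-0 J(\_ _ ->(alg "0(0)+0(0)=0")))∙ alg "0-a0=0")∙ abs-0≤ ≤r))(e≤(alg "0=a(0(0))"))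
   mean-value{(n , c)∷ P}((n≢0 , n≤X)∷ W)(N ∷ dP)= e≤(abs-cong split)⨾ abs-+ _ _ ⨾ mean-value W dP ⊹ ≤t(abs-+ _ _)(B≤ ⊹ B≤)⨾
    lin(0≤*(0≤*(0≤*(0≤# 4)(0≤# X))(<≤(inv⁺ 0<η)))(0≤*(0≤∥ c)(0≤∥ c)))(alg "a((b+c)(b+c))-(a(cc)+(b(ac)+b(ac)))=a(bb)-0")
    where
    V : ℕ -> ℂ
    V j = val P(sample j)
    B : R
    B = re(c *c ∑ᶜ J(\j -> χ n(sample j)*c conj(V j)))
    B≤ : abs B ≤ ∥ c ∥ *(Γ * ℓ₁ P)
    B≤ = ≤t(abs-re≤ _)(e≤(∥-* _ _)⨾ *≤(0≤∥ c)(cross n{{n≢0}} n≤X W N))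
    split : ∑ J(\j -> nsq(c *c χ n(sample j)+c V j))- # J *(nsq c + ℓ₂ P)≈(∑ J(\j -> nsq(V j))- # J * ℓ₂ P)+(B + B)
    split = +ʳ(∑-ext J(\j -> nsq-+(c *c χ n(sample j))(V j)∙ +ʳ(+ʳ(nsq-* c(χ n(sample j))∙ *ˡ(nsq-unit(∥χ∥ n(sample j)))∙ alg "a1=a")))∙
     ∑-+ J _ _ ∙ +₂(∑-+ J _ _ ∙ +ʳ(∑-const J(nsq c)))(∑-+ J _ _ ∙ +₂ reB reB))∙
     alg "ab+c+(d+d)-a(b+e)=c-ae+(d+d)"
     where
     reB : ∑ J(\j -> re(c *c χ n(sample j)*c conj(V j)))≈ B
     reB = trans(sym(re-∑ J _))(re≈(∑c-ext J(\j ->(algc "abc=a(bc)"))⊙ ∑c-* J c _))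

 shift : ℕ -> ℂ -> Poly' -> Poly'
 shift n c []            = []
 shift n c((m , d)∷ P)=(n N.* m , c *c d)∷ shift n c P

 times : Poly' -> Poly' -> Poly'
 times []            P = []
 times((n , c)∷ L)P = shift n c P ++ times L P

 NZ : Poly' -> Set
 NZ = All(\x -> Nz(fst x))

 Rough : ℕ -> Poly' -> Set
 Rough p = All(\x -> ¬(p ∣ fst x))

 PowersOf : ℕ -> ℕ -> Poly' -> Set
 PowersOf p K = All(\x -> ∃ \a -> fst x ≡ p N.^ a × a N.≤ K)

 opaque
  val-++ : ∀ P Q t -> val(P ++ Q)t ~ val P t +c val Q t
  val-++ []            Q t =(algc "a=0+a")
  val-++((n , c)∷ P)Q t = trc(+ˡc(val-++ P Q t))(algc "ab+(c+d)=ab+c+d")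

  val-shift : ∀ n c P t .{{_ : Nz n}} -> NZ P -> val(shift n c P)t ~ c *c χ n t *c val P t
  val-shift n c [] t [] =(algc "0=ab0")
  val-shift n c((m , d)∷ P)t{{i}}(nz ∷ N)= trc(+₂c(*ˡc(χ-* n m t{{i}}{{nz}}))(val-shift n c P t N))
   (algc "ab(cd)+ace=ac(bd+e)")

  val-times : ∀ L P t -> NZ L -> NZ P -> val(times L P)t ~ val L t *c val P t
  val-times [] P t [] N =(algc "0=0a")
  val-times((n , c)∷ L)P t(nz ∷ M)N = trc(val-++(shift n c P)_ t)(+₂c(val-shift n c P t{{nz}} N)(val-times L P t M N)⊙
   algc "abc+dc=(ab+d)c")

  ℓ₁-times : ∀ L P -> ℓ₁(times L P)≈ ℓ₁ L * ℓ₁ P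
  ℓ₁-times [] P =(alg "0=0a")
  ℓ₁-times((n , c)∷ L)P = go P ∙ +ˡ(ℓ₁-times L P)∙ alg "ab+cb=(a+c)b"
   where
   go : ∀ P' -> ℓ₁(shift n c P' ++ times L P)≈ ∥ c ∥ * ℓ₁ P' + ℓ₁(times L P)
   go []             =(alg "a=b0+a")
   go((m , d)∷ P')= trans(+₂(∥-* c d)(go P'))(alg "ab+(ac+d)=a(b+c)+d")

  ℓ₂-times : ∀ L P -> ℓ₂(times L P)≈ ℓ₂ L * ℓ₂ P
  ℓ₂-times [] P =(alg "0=0a")
  ℓ₂-times((n , c)∷ L)P = go P ∙ +ˡ(ℓ₂-times L P)∙ alg "ab+cb=(a+c)b"
   where
   go : ∀ P' -> ℓ₂(shift n c P' ++ times L P)≈ nsq c * ℓ₂ P' + ℓ₂(times L P)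
   go []             =(alg "a=b0+a")
   go((m , d)∷ P')= trans(+₂(nsq-* c d)(go P'))(alg "ab+(ac+d)=a(b+c)+d")

  all-shift : ∀ {A B : ℕ -> Set} n c ->(∀ {m} -> B m -> A(n N.* m))-> ∀ {P} -> All(\x -> B(fst x))P -> All(\x -> A(fst x))(shift n c P)
  all-shift n c f []      = []
  all-shift n c f(b ∷ B)= f b ∷ all-shift n c f B

  all-times : ∀ {A B C : ℕ -> Set} ->(∀ {m n} -> C n -> B m -> A(n N.* m))-> ∀ {L P} -> All(\x -> C(fst x))L -> All(\x -> B(fst x))P -> All(\x -> A(fst x))(times L P)
  all-times f [] B = []
  all-times f{(n , c)∷ L}(a ∷ A)B = All.++⁺(all-shift n c(f a)B)(all-times f A B)

  distinct-shift : ∀ n c .{{_ : Nz n}}{P} -> Distinct P -> Distinct(shift n c P)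
  distinct-shift n c [] = []
  distinct-shift n c{(m , d)∷ P}(N ∷ D)= all-shift n c(\q r -> q(N.*-cancelˡ-≡ _ _ n r))N ∷ distinct-shift n c D

  coprime-parts : ∀ p a b{m n} -> 1 N.< p -> ¬(p ∣ m)-> ¬(p ∣ n)-> p N.^ a N.* m ≡ p N.^ b N.* n -> p N.^ a ≡ p N.^ b
  coprime-parts p zero    zero    _ _ _ _ = E.refl
  coprime-parts p zero    (suc b){m}{n} _ pm _ q = absurd(pm(E.subst(p ∣_)(E.trans(E.sym q)(N.*-identityˡ m))(N.∣m⇒∣m*n n(N.m∣m*n(p N.^ b)))))
  coprime-parts p(suc a)zero    {m}{n} _ _ pn q = absurd(pn(E.subst(p ∣_)(E.trans q(N.*-identityˡ n))(N.∣m⇒∣m*n m(N.m∣m*n(p N.^ a)))))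
  coprime-parts p(suc a)(suc b){m}{n} 1<p pm pn q = E.cong(p N.*_)(coprime-parts p a b 1<p pm pn
   (N.*-cancelˡ-≡ _ _ p{{N.>-nonZero(N.<-trans(s≤s z≤n)1<p)}}(E.trans(E.sym(N.*-assoc p(p N.^ a)m))(E.trans q(N.*-assoc p(p N.^ b)n)))))

  distinct-times : ∀ {p K} -> 1 N.< p -> ∀ {L P} -> Distinct L -> PowersOf p K L -> Distinct P -> Rough p P -> Distinct(times L P)
  distinct-times 1<p [] [] D ρ = []
  distinct-times{p} 1<p{(n , c)∷ L}{P}(N ∷ dL)((a , E.refl , _)∷ pL)D ρ = AllPairs.++⁺
   (distinct-shift n c{{N.m^n≢0 p a{{N.>-nonZero(N.<-trans(s≤s z≤n)1<p)}}}} D)(distinct-times 1<p dL pL D ρ)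
   (all-shift n c(λ {m} pm -> all-times{A = \k -> ¬(n N.* m ≡ k)}{C = \n' ->(¬(n ≡ n'))× ∃ \b -> n' ≡ p N.^ b}
    (λ { (n≢ , b , E.refl)pm' q -> n≢(coprime-parts p a b 1<p pm pm' q) })(All.zipWith(λ { (x , b , y , _)-> x , b , y })(N , pL))ρ)ρ)

 tms :(ℕ -> Poly')-> List ℕ -> Poly' -> Poly'
 tms F []      P = P
 tms F(p ∷ S)P = times(F p)(tms F S P)

 height : ℕ -> ℕ -> List ℕ -> ℕ
 height N K []      = N
 height N K(p ∷ S)= p N.^ K N.* height N K S

 prime∤power : ∀ {p q} -> Prime p -> Prime q -> ¬(q ≡ p)-> ∀ a -> ¬(p ∣ q N.^ a)
 prime∤power pp pq n zero    d = N.nonTrivial⇒≢1{{nt pp}}(N.∣1⇒≡1 d)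
 prime∤power{p}{q} pp pq n(suc a)d with euclidsLemma q(q N.^ a)pp d
 ... | inl d' = prime∤prime pq pp(\r -> n(E.sym r))d'
 ... | inr d' = prime∤power pp pq n a d'

 prime>1 : ∀ {p} -> Prime p -> 1 N.< p
 prime>1{p} pp = N.nonTrivial⇒n>1 p{{nt pp}}

 record Factors(F : ℕ -> Poly')(K : ℕ): Set where
  field
   powers   : ∀ p -> PowersOf p K(F p)
   distinct : ∀ p -> 1 N.< p -> Distinct(F p)
 open Factors

 module _ {F K} (φ : Factors F K) {N : ℕ} {P : Poly'} where
  opaque
   nz-factor : ∀ {p} -> Prime p -> NZ(F p)
   nz-factor{p} pp = All.map(λ { (a , E.refl , _)-> N.m^n≢0 p a{{pr≢0 pp}} })(powers φ p)
   within-all : ∀ {S} -> DPrimes S -> Within N P -> Within(height N K S)(tms F S P)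
   within-all [] w = w
   within-all{p ∷ S}((pp , _)∷ dS)w = all-times{C = \n -> Nz n × n N.≤ p N.^ K}
    (λ { {m}{n}(x , x')(y , y')-> N.m*n≢0 n m{{x}}{{y}} , N.*-mono-≤ x' y' })
    (All.zipWith(λ { (x , a , E.refl , a≤K)-> x , N.^-monoʳ-≤ p{{pr≢0 pp}} a≤K })(nz-factor pp , powers φ p))(within-all dS w)
   rough-all : ∀ {S p} -> DPrimes S -> Prime p -> All(\q -> ¬(q ≡ p))S -> Rough p P -> Rough p(tms F S P)
   rough-all [] pp [] r = r
   rough-all{q ∷ S}{p}((pq , _)∷ dS)pp(q≢p ∷ nS)r = all-times{C = \n -> ∃ \a -> n ≡ q N.^ a}
    (λ { {m}{n}(a , E.refl)y d -> [ prime∤power pp pq q≢p a , y ]′(euclidsLemma n m pp d) })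
    (All.map(λ { (a , x , _)-> a , x })(powers φ q))(rough-all dS pp nS r)
   distinct-all : ∀ {S} -> DPrimes S -> Distinct P -> All(\p -> Rough p P)S -> Distinct(tms F S P)
   distinct-all [] d [] = d
   distinct-all{p ∷ S}((pp , nS)∷ dS)d(r ∷ rS)= distinct-times(prime>1 pp)(distinct φ p(prime>1 pp))(powers φ p)(distinct-all dS d rS)(rough-all dS pp nS r)
   nz-all : ∀ {S} -> DPrimes S -> NZ P -> NZ(tms F S P)
   nz-all [] w = w
   nz-all{p ∷ S}((pp , _)∷ dS)w = all-times(λ {m}{n} x y -> N.m*n≢0 n m{{x}}{{y}})(nz-factor pp)(nz-all dS w)
   val-all : ∀ {S} t -> DPrimes S -> NZ P -> val(tms F S P)t ~ val(tms F S((1 , 1c)∷ []))t *c val P t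
   val-all t [] w = trc(algc "a=1a")(*ʳc(symc(+ʳc(*ˡc(χ-1 t))⊙ algc "1(1)+0=1")))
   val-all{p ∷ S} t((pp , _)∷ dS)w = val-times(F p)_ t(nz-factor pp)(nz-all dS w)⊙ *ˡc(val-all t dS w)⊙
    algc "a(bc)=abc" ⊙
     *ʳc(symc(val-times(F p)_ t(nz-factor pp)(nz1 dS)))
    where
    nz1 : ∀ {S} -> DPrimes S -> NZ(tms F S((1 , 1c)∷ []))
    nz1 [] = _ ∷ []
    nz1{p ∷ S}((pp , _)∷ dS)= all-times(λ {m}{n} x y -> N.m*n≢0 n m{{x}}{{y}})(nz-factor pp)(nz1 dS)

 geo : ℕ -> ℂ -> ℕ -> Poly'
 geo p ψ zero    = []
 geo p ψ(suc a)=(p N.^ a , ψ ^c a)∷ geo p ψ a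

 cap : ℕ -> ℂ -> ℕ -> Poly'
 cap p ψ K =(1 , 1c)∷(p N.^ K , -c(ψ ^c K))∷ []

 sumL :{A : Set} -> List A ->(A -> R)-> R
 sumL []      f = 0#
 sumL(x ∷ L)f = f x + sumL L f

 opaque
  sumL-mono : ∀ {A : Set}(L : List A){f g} -> All(\x -> f x ≤ g x)L -> sumL L f ≤ sumL L g
  sumL-mono [] [] = ≤r
  sumL-mono(x ∷ L)(p ∷ ps)= p ⊹ sumL-mono L ps

  sumL-* : ∀ {A : Set}(L : List A)c f -> sumL L(\x -> c * f x)≈ c * sumL L f
  sumL-* []      c f =(alg "0=a0")
  sumL-*(x ∷ L)c f = trans(+ˡ(sumL-* L c f))(alg "ab+ac=a(b+c)")

  sumL-∑ : ∀ {A : Set}(L : List A)n(f : ℕ -> A -> R)-> ∑ n(\j -> sumL L(f j))≈ sumL L(\x -> ∑ n(\j -> f j x))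
  sumL-∑ []      n f = ∑-0 n(\_ _ -> refl)
  sumL-∑(x ∷ L)n f = trans(∑-+ n _ _)(+ˡ(sumL-∑ L n f))

  sumL-nonneg : ∀ {A : Set}(L : List A){f} ->(∀ x -> 0# ≤ f x)-> 0# ≤ sumL L f
  sumL-nonneg []      p = ≤r
  sumL-nonneg(x ∷ L)p = 0≤+(p x)(sumL-nonneg L p)

  geo-powers : ∀ p ψ{a K} -> a N.≤ K -> PowersOf p K(geo p ψ a)
  geo-powers p ψ{zero}  q = []
  geo-powers p ψ{suc a} q =(a , E.refl , trN(n≤1+n a)q)∷ geo-powers p ψ(trN(n≤1+n a)q)

  geo-distinct : ∀ p ψ K -> 1 N.< p -> Distinct(geo p ψ K)
  geo-distinct p ψ zero    _ = []
  geo-distinct p ψ(suc a)q = go a rfN ∷ geo-distinct p ψ a q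
   where
   go : ∀ b -> b N.≤ a -> All(\y -> ¬(p N.^ a ≡ fst y))(geo p ψ b)
   go zero    _ = []
   go(suc b)r =(\x -> N.<⇒≢(N.^-monoʳ-< p q r)(E.sym x))∷ go b(trN(n≤1+n b)r)

  cap-distinct : ∀ p ψ K .{{_ : Nz K}} -> 1 N.< p -> Distinct(cap p ψ K)
  cap-distinct p ψ K q =((\x -> N.<⇒≢(N.^-monoʳ-< p q(N.>-nonZero⁻¹ K))x)∷ [])∷ [] ∷ []

  ℓ₁-geo : ∀ p{ψ} -> ∥ ψ ∥ ≈ 1# -> ∀ a -> ℓ₁(geo p ψ a)≈ # a
  ℓ₁-geo p q zero    = refl
  ℓ₁-geo p q(suc a)= +₂(^c-unit q a)(ℓ₁-geo p q a)

  ℓ₂-geo : ∀ p{ψ} -> ∥ ψ ∥ ≈ 1# -> ∀ a -> ℓ₂(geo p ψ a)≈ # a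
  ℓ₂-geo p q zero    = refl
  ℓ₂-geo p q(suc a)= +₂(nsq-unit(^c-unit q a))(ℓ₂-geo p q a)

  val-geo : ∀ p ψ .{{_ : Nz p}} a t ->(1c -c ψ *c χ p t)*c val(geo p ψ a)t ~ val(cap p ψ a)t
  val-geo p ψ zero    t = trc(algc "(1-ab)0=1c+(-1c+0)")reflc
  val-geo p ψ{{i}}(suc a)t = lin≈c(+₂c(val-geo p ψ a t)(*ˡc{ψ *c ψ ^c a}(χ-* p(p N.^ a)t{{i}}{{N.m^n≢0 p a}})))
   (algc "1a+(-(bc)d+0)-(1-be)(cf+g)=1a+(-cf+0)+bc(ef)-((1-be)g+bcd)")

  ceiling : ∀ x -> 0# ≤ x -> ∃ \n -> x < # n × # n ≤ x + 1#
  ceiling x 0≤x with archimedean x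
  ... | n , q = go(suc n)(<≤tr(≤<tr q(lin< 0<1(alg "1+a-a=1-0")))≤r)
   where
   go : ∀ n -> x < # n -> ∃ \m -> x < # m × # m ≤ x + 1#
   go zero    r = absurd(r 0≤x)
   go(suc n)r with ≤∨<(# n)x
   ... | inl s = suc n , r , lin s(alg "a+1-(1+b)=a-b")
   ... | inr s = go n s

 geoOrCap : ℕ ->(ℕ -> ℂ)-> ℕ -> ℕ -> Poly'
 geoOrCap p₀ ψ K p with p N.≟ p₀
 ... | yes _ = cap p(ψ p)K
 ... | no _  = geo p(ψ p)K

 module _ (ψ : ℕ -> ℂ) (unit : ∀ p -> ∥ ψ p ∥ ≈ 1#) (K : ℕ) .{{K≢0 : Nz K}} where
  private
   F : ℕ -> Poly'
   F p = geo p(ψ p)K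
   F' : ℕ -> ℕ -> Poly'
   F' p₀ = geoOrCap p₀ ψ K
   κ : List ℕ -> R
   κ S = # K ^ length S
   i : R
   i = inv(# K)
   Ki : # K * i ≈ 1#
   Ki = inv-r(0<# K)
   one' : Poly'
   one' =(1 , 1c)∷ []

  opaque
   F-factors : Factors F K
   F-factors = record{ powers = \p -> geo-powers p(ψ p)rfN ; distinct = \p -> geo-distinct p(ψ p)K }
   F'-factors : ∀ p₀ -> Factors(F' p₀)K
   F'-factors p₀ = record{ powers = pw' ; distinct = ds }
    where
    pw' : ∀ p -> PowersOf p K(F' p₀ p)
    pw' p with p N.≟ p₀
    ... | yes _ =(0 , E.refl , z≤n)∷(K , E.refl , rfN)∷ []
    ... | no _  = geo-powers p(ψ p)rfN
    ds : ∀ p -> 1 N.< p -> Distinct(F' p₀ p)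
    ds p with p N.≟ p₀
    ... | yes _ = cap-distinct p(ψ p)K
    ... | no _  = geo-distinct p(ψ p)K
   ℓ₁-F : ∀ S P -> ℓ₁(tms F S P)≈ κ S * ℓ₁ P
   ℓ₁-F []      P =(alg "a=1a")
   ℓ₁-F(p ∷ S)P = trans(ℓ₁-times(F p)_)(*₂(ℓ₁-geo p(unit p)K)(ℓ₁-F S P)∙ alg "a(bc)=abc")
   ℓ₂-F : ∀ S P -> ℓ₂(tms F S P)≈ κ S * ℓ₂ P
   ℓ₂-F []      P =(alg "a=1a")
   ℓ₂-F(p ∷ S)P = trans(ℓ₂-times(F p)_)(*₂(ℓ₂-geo p(unit p)K)(ℓ₂-F S P)∙ alg "a(bc)=abc")
   F'≡F : ∀ {p₀ S} P -> All(\q -> ¬(q ≡ p₀))S -> tms(F' p₀)S P ≡ tms F S P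
   F'≡F P [] = E.refl
   F'≡F{p₀}{p ∷ S} P(n ∷ ns)with p N.≟ p₀
   ... | yes q = absurd(n q)
   ... | no _  = E.cong(times(F p))(F'≡F P ns)
   -- Each of ℓ₁, ℓ₂ is multiplicative and equals K on geo and 2 on cap.
   capped :(ℓ : Poly' -> R)->(∀ L P -> ℓ(times L P)≈ ℓ L * ℓ P)->(∀ p -> ℓ(geo p(ψ p)K)≈ # K)->(∀ p -> ℓ(cap p(ψ p)K)≈ # 2)-> ℓ one' ≈ 1# ->
    (∀ S -> ℓ(tms F S one')≈ κ S * ℓ one')-> ∀ {p₀ S} -> DPrimes S -> p₀ ∈ S -> ℓ(tms(F' p₀)S one')≈ # 2 * κ S * i
   capped ℓ ℓ× ℓg ℓc ℓ1 ℓF{p₀}{p ∷ S}((_ , nS)∷ dS)m with p N.≟ p₀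
   ... | yes E.refl = trans(ℓ×(cap p(ψ p)K)_)(*₂(ℓc p)(rfx(E.cong ℓ(F'≡F one' nS))∙ ℓF S ∙ *ˡ ℓ1 ∙ alg "a1=1a")∙
    *ˡ(*ʳ(sym Ki))∙ alg "2(abc)=2(ac)b")
   ... | no n with m
   ...   | here q  = absurd(n(E.sym q))
   ...   | there m = trans(ℓ×(F p)_)(*₂(ℓg p)(capped ℓ ℓ× ℓg ℓc ℓ1 ℓF dS m)∙ alg "a(2bc)=2(ab)c")
   val-capped : ∀ {p₀ S} t -> DPrimes S -> p₀ ∈ S -> val(tms(F' p₀)S one')t ~(1c -c ψ p₀ *c χ p₀ t)*c val(tms F S one')t
   val-capped{p₀}{p ∷ S} t((pp , nS)∷ dS)m with p N.≟ p₀
   ... | yes E.refl = trc(val-times(cap p(ψ p)K)_ t((_ ∷(N.m^n≢0 p K{{pr≢0 pp}})∷ []))(nz-all(F'-factors p){1} dS(_ ∷ [])))(*₂c(symc(val-geo p(ψ p){{pr≢0 pp}} K t))(≡c(E.cong(\P -> val P t)(F'≡F one' nS)))⊙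
    algc "(1-ab)cd=(1-ab)(cd)" ⊙
     *ˡc(symc(val-times(F p)_ t(nz-factor F-factors{1}{[]} pp)(nz-all F-factors{1} dS(_ ∷ [])))))
   ... | no n with m
   ...   | here q  = absurd(n(E.sym q))
   ...   | there m = trc(val-times(F p)_ t(nz-factor F-factors{1}{[]} pp)(nz-all(F'-factors p₀){1} dS(_ ∷ [])))(*ˡc(val-capped t dS m)⊙
    algc "a((1-bc)d)=(1-bc)(ad)" ⊙
     *ˡc(symc(val-times(F p)_ t(nz-factor F-factors{1}{[]} pp)(nz-all F-factors{1} dS(_ ∷ [])))))

  module _ {S} (dS : DPrimes S) (c : ℕ -> R) (0≤c : ∀ p -> 0# ≤ c p) (β : R) (0≤β : 0# ≤ β)
   (Rs : List Poly')(N : ℕ).{{N≢0 : Nz N}}(ok : All(\P -> Within N P × Distinct P × All(\p -> Rough p P)S)Rs)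
   (small : # 2 * inv(# K)* sumL S c + β * sumL Rs ℓ₂ ≤ inv 2#)(t₀ : R)where
   bracket : R -> R
   bracket t = sumL S(\p -> c p * nsq(1c -c ψ p *c χ p t))+ β * sumL Rs(\P -> nsq(val P t))
   cost : R
   cost = 1# + # 4 * sumL S c + β * sumL Rs(\P -> ℓ₁ P * ℓ₁ P)
   private
    X : ℕ
    X = height N K S
    k η G B : R
    k = κ S
    η = inv(# 4 *(1# + lg X))
    G = # 4 * # X * inv η
    B = # 2 * G * k * cost
    opaque
     4l>0 : 0# < # 4 *(1# + lg X)
     4l>0 = *-pos(0<#s 3)(+-pos 0<1(0≤lg X))
     0<η : 0# < η
     0<η = inv⁺ 4l>0
     fine : η * lg X ≤ inv(# 4)
     fine = rs≤(alg "ab=ba")(/-≤ 4l>0(lin(0≤1 ⊹ e≤(*ʳ{1# + lg X}(sym(inv-r(0<#s 3)))))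
      (alg "a(4(1+b))-b=1+4a(1+b)-(0+1(1+b))")))
     η≤1 : η ≤ 1#
     η≤1 = rs≤(alg "1a=a")(/-≤ 4l>0(lin(0≤*(0≤# 4)(0≤lg X)⊹ 0≤# 3)(alg "1(4(1+a))-1=4a+3-(0+0)")))
     0<k : 0# < k
     0<k = go S
      where
      go : ∀ S -> 0# < κ S
      go []      = 0<1
      go(_ ∷ S)= *-pos(0<# K)(go S)
     0≤G : 0# ≤ G
     0≤G = 0≤*(0≤*(0≤# 4)(0≤# X))(<≤(inv⁺ 0<η))
     0≤B : 0# ≤ B
     0≤B = 0≤*(0≤*(0≤*(0≤# 2)0≤G)(<≤ 0<k))(0≤+(0≤+ 0≤1(0≤*(0≤# 4)(sumL-nonneg S 0≤c)))(0≤* 0≤β(sumL-nonneg Rs(\P -> 0≤sq(ℓ₁ P)))))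
     i≤1 : i ≤ 1#
     i≤1 = rs≤(alg "1a=a")(/-≤(0<# K)(≤rs(alg "a=1a")(rs≤(alg "1+0=1")(#-mono(N.>-nonZero⁻¹ K)))))
    module _ (J : ℕ) (B<J : B < # J) where
     τ : ℕ -> R
     τ = sample η 0<η X fine t₀ J
     Q : ℕ -> ℂ
     Q j = val(tms F S one')(τ j)
     opaque
      MV : ∀ {P} -> Within X P -> Distinct P -> abs(∑ J(\j -> nsq(val P(τ j)))- # J * ℓ₂ P)≤ G *(ℓ₁ P * ℓ₁ P)
      MV = mean-value η 0<η X fine t₀ J
      within1 : Within N one'
      within1 =(_ , N.>-nonZero⁻¹ N)∷ []
      rough1 : ∀ {S} -> DPrimes S -> All(\p -> Rough p one')S
      rough1 [] = []
      rough1((pp , _)∷ dS)=((\d -> N.nonTrivial⇒≢1{{nt pp}}(N.∣1⇒≡1 d))∷ [])∷ rough1 dS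
      lower : # J * k - G *(k * k)≤ ∑ J(\j -> nsq(Q j))
      lower = lin(abs-ge⁻ _ ⊹ MV(within-all F-factors dS within1)(distinct-all F-factors{N} dS([] ∷ [])(rough1 dS))
       ⊹ e≤(*ˡ{G}(*₂(ℓ₁-F S one')(ℓ₁-F S one')))⊹ e≤(*ˡ{# J}(sym(ℓ₂-F S one')))⊹ e≤(*ˡ{G *(k * k)}(*₂(+ʳ ∥-1)(+ʳ ∥-1)∙ alg "(1+0)(1+0)=1")))
       (alg "a-(bc-d(cc))=e+d(ff)+d(cg(cg))+bh+d(cc)1-(-(a-bh)+e+d(ff)+b(c(1(1)+0(0)+0))+d(cc)(gg))")
      upperP : ∀ {p} -> p ∈ S -> ∑ J(\j -> nsq(1c -c ψ p *c χ p(τ j))* nsq(Q j))≤ # J *(# 2 * k * i)+ # 4 *(G *(k * k))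
      upperP{p} m = e≤(∑-ext J \j -> sym(nsq-*(1c -c ψ p *c χ p(τ j))(Q j))∙ nsq-cong(symc(val-capped(τ j)dS m)))⨾
       lin(abs-ge _ ⊹ MV(within-all(F'-factors p)dS within1)(distinct-all(F'-factors p){N} dS([] ∷ [])(rough1 dS))⊹ e≤(*ˡ{# J}(capped ℓ₂ ℓ₂-times(\q -> ℓ₂-geo q(unit q)K)(\q -> +₂(nsq-unit ∥-1)(+ʳ(nsq-unit(ψK q))))(+ʳ(nsq-unit ∥-1)∙ alg "1+0=1")(\S -> ℓ₂-F S one')dS m))
        ⊹ *≤ 0≤G(*-mono(≤rs(sym ℓ₁≈)(0≤* 0≤2k(<≤(inv⁺(0<# K)))))(0≤*(0≤# 2)(<≤ 0<k))ℓ₁≤ ℓ₁≤))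
        (alg "a(2bc)+4(d(bb))-e=f+d(gg)+a(2bc)+d(2b(2b))-(e-ah+f+ah+d(gg))")
       where
       P : Poly'
       P = tms(F' p)S one'
       ψK : ∀ q -> ∥ -c(ψ q ^c K)∥ ≈ 1#
       ψK q = trans(∥-neg _)(^c-unit(unit q)K)
       ℓ₁≈ : ℓ₁ P ≈ # 2 * k * i
       ℓ₁≈ = capped ℓ₁ ℓ₁-times(\q -> ℓ₁-geo q(unit q)K)(\q -> +₂ ∥-1(+ʳ(ψK q)))(+ʳ ∥-1 ∙ alg "1+0=1")(\S -> ℓ₁-F S one')dS m
       0≤2k : 0# ≤ # 2 * k
       0≤2k = 0≤*(0≤# 2)(<≤ 0<k)
       ℓ₁≤ : ℓ₁ P ≤ # 2 * k
       ℓ₁≤ = rs≤(sym ℓ₁≈)(≤rs(alg "2a1=2a")(*≤ 0≤2k i≤1))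
      upperR : ∀ {P} -> Within N P × Distinct P × All(\p -> Rough p P)S -> ∑ J(\j -> nsq(val P(τ j))* nsq(Q j))≤ # J * k * ℓ₂ P + G *(k * k)*(ℓ₁ P * ℓ₁ P)
      upperR{P}(w , d , r)= ≤t(e≤(∑-ext J \j -> sym(nsq-*(val P(τ j))(Q j))∙ nsq-cong(algc "ab=ba" ⊙ symc(val-all F-factors{N}(τ j)dS(All.map fst w)))))
       (lin(abs-ge _ ⊹ MV(within-all F-factors dS w)(distinct-all F-factors{N} dS d r)⊹ e≤(*ˡ{# J}(ℓ₂-F S P))⊹ e≤(*ˡ{G}(*₂(ℓ₁-F S P)(ℓ₁-F S P))))
        (alg "abc+d(bb)(ee)-f=g+d(hh)+a(bc)+d(be(be))-(f-ai+g+ai+d(hh))"))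
      upper : ∑ J(\j -> bracket(τ j)* nsq(Q j))≤(# J *(# 2 * k * i)+ # 4 *(G *(k * k)))* sumL S c + β *(# J * k * sumL Rs ℓ₂ + G *(k * k)* sumL Rs(\P -> ℓ₁ P * ℓ₁ P))
      upper = e≤((∑-ext J \j -> alg "(a+bc)d=da+b(dc)" ∙
       +₂(sym(sumL-* S _ _))(*ˡ(sym(sumL-* Rs _ _))))∙ ∑-+ J _ _ ∙ +₂(sumL-∑ S J _)(∑-* J β _ ∙ *ˡ(sumL-∑ Rs J _)))⨾
       sumL-mono S{g = \p ->(# J *(# 2 * k * i)+ # 4 *(G *(k * k)))* c p}(All.tabulate λ {p} m -> e≤((∑-ext J \j ->(alg "a(bc)=b(ca)"))∙ ∑-* J(c p)_)⨾
        *≤(0≤c p)(upperP m)⨾ e≤(alg "a(b(2cd)+4(e(cc)))=(b(2cd)+4(e(cc)))a"))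
        ⊹ *≤ 0≤β(sumL-mono Rs{g = \P -> # J * k * ℓ₂ P + G *(k * k)*(ℓ₁ P * ℓ₁ P)}(All.map(λ {P} o -> e≤(∑-ext J \j ->(alg "ab=ba"))⨾ upperR o)ok))`then`
        e≤(+₂(sumL-* S _ c)(*ˡ(sumL-+ Rs _ _ ∙ +₂(sumL-* Rs _ ℓ₂)(sumL-* Rs _ _))))
       where
       infixl 1 _`then`_
       _`then`_ : ∀ {a b c} -> a ≤ b -> b ≤ c -> a ≤ c
       _`then`_ = ≤t
       sumL-+ : ∀ {A : Set}(L : List A)f g -> sumL L(\x -> f x + g x)≈ sumL L f + sumL L g
       sumL-+ []      f g =(alg "0=0+0")
       sumL-+(x ∷ L)f g = trans(+ˡ(sumL-+ L f g))(alg "a+b+(c+d)=a+c+(b+d)")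
      good : ∃ \j -> j N.< J × bracket(τ j)≤ 1#
      good with em{∃ \j -> j N.< J × bracket(τ j)≤ 1#}
      ... | yes p = p
      ... | no np = absurd(B<J(cancel 0<k(lin(lower ⊹ lower ⊹ all ⊹ all ⊹ upper ⊹ upper ⊹ scaled ⊹ scaled ⊹ e≤(*ˡ{# J * k} 2h))
       (alg "a(2ba(1+4c+de))-af=g+g+h+h+((f(2ai)+4(b(aa)))c+d(faj+b(aa)e))+((f(2ai)+4(b(aa)))c+d(faj+b(aa)e))+fak+fak+fa1-(fa-b(aa)+(fa-b(aa))+g+g+h+h+fa(2ic+dj)+fa(2ic+dj)+fa(2k))"))))
       where
       A A' U : R
       A = ∑ J(\j -> nsq(Q j))
       A' = ∑ J(\j -> bracket(τ j)* nsq(Q j))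
       U =(# J *(# 2 * k * i)+ # 4 *(G *(k * k)))* sumL S c + β *(# J * k * sumL Rs ℓ₂ + G *(k * k)* sumL Rs(\P -> ℓ₁ P * ℓ₁ P))
       all : A ≤ A'
       all = ∑-mono J \j j<J -> rs≤(alg "1a=a")(≤*(0≤nsq(Q j))(<≤ \q -> np(j , j<J , q)))
       scaled : # J * k *(# 2 * i * sumL S c + β * sumL Rs ℓ₂)≤ # J * k * h
       scaled = *≤(0≤*(0≤# J)(<≤ 0<k))small
   opaque
    resonance : ∃ \t -> t₀ ≤ t × t ≤ t₀ + 1# + # 8 * # X * k * cost × bracket t ≤ 1#
    resonance with ceiling B 0≤B
    ... | J , B<J , J≤ with good J B<J
    ...   | j , j<J , q = τ J B<J j , lin(0≤*(0≤# j)(<≤ 0<η))(alg "a+bc-a=bc-0"),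
     lin(≤*(<≤ 0<η)(#-mono(N.<⇒≤ j<J)⨾ J≤)⊹ η≤1 ⊹ e≤(*ˡ{# 8 * # X * k * cost}(inv-r 0<η)))
      (alg "a+1+8bcd-(a+ef)=(2(4bg)cd+1)f+1+8bcd1-(ef+f+8bcd(fg))"), q

 private

  opaque
   ofℓ-1 : cx(lg 1)~ 0c
   ofℓ-1 = of-cong lg-1
   ofℓ-* : ∀ m n .{{_ : Nz m}} .{{_ : Nz n}} -> cx(lg(m N.* n))~ cx(lg m)+c cx(lg n)
   ofℓ-* m n = trc(of-cong(lg-* m n))(of-+(lg m)(lg n))
 module LR = LogSum ring lg lg-1 lg-*
 module LC = LogSum ℂ-ring (\n -> cx (lg n)) ofℓ-1 ofℓ-*

 ∑P : ℕ ->(ℕ -> R)-> R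
 ∑P N f = ∑(suc N)(\p -> keep(prime? p)(f p))

 ∑Pc : ℕ ->(ℕ -> ℂ)-> ℂ
 ∑Pc N f = ∑ᶜ(suc N)(\p -> keepc(prime? p)(f p))

 quot : ℕ -> ℕ -> ℕ
 quot N zero    = 0
 quot N(suc d)= N N./ suc d

 ϑ : ℕ -> R
 ϑ N = ∑P N lg

 logfact : ℕ -> R
 logfact N = ∑(suc N)lg

 pos : ℕ -> R
 pos zero    = 0#
 pos(suc n)= 1#

 opaque
  keep-mono : ∀ {P : Set}(d : Dec P){x y} ->(P -> x ≤ y)-> keep d x ≤ keep d y
  keep-mono(yes p)f = f p
  keep-mono(no _)  f = ≤r

  keep-≥0 : ∀ {P : Set}(d : Dec P){x} ->(P -> 0# ≤ x)-> 0# ≤ keep d x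
  keep-≥0(yes p)f = f p
  keep-≥0(no _)  f = ≤r

  ∑P-mono : ∀ N{f g} ->(∀ p -> Prime p -> p N.≤ N -> f p ≤ g p)-> ∑P N f ≤ ∑P N g
  ∑P-mono N q = ∑-mono(suc N)\p p<N -> keep-mono(prime? p)\pp -> q p pp(N.s≤s⁻¹ p<N)

  ∑P-nonneg : ∀ N{f} ->(∀ p -> Prime p -> 0# ≤ f p)-> 0# ≤ ∑P N f
  ∑P-nonneg N q = ∑-nonneg(suc N)\p _ -> keep-≥0(prime? p)(q p)

  ∑P-+ : ∀ N f g -> ∑P N(\p -> f p + g p)≈ ∑P N f + ∑P N g
  ∑P-+ N f g =(∑-ext(suc N)\p -> split(prime? p))∙ ∑-+(suc N)_ _
   where
   split : ∀ {p}(d : Dec(Prime p))-> keep d(f p + g p)≈ keep d(f p)+ keep d(g p)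
   split(yes _)= refl
   split(no _)  =(alg "0=0+0")

  ∑P-* : ∀ N c f -> ∑P N(\p -> c * f p)≈ c * ∑P N f
  ∑P-* N c f =(∑-ext(suc N)\p -> split(prime? p))∙ ∑-*(suc N)c _
   where
   split : ∀ {p}(d : Dec(Prime p))-> keep d(c * f p)≈ c * keep d(f p)
   split(yes _)= refl
   split(no _)  =(alg "0=a0")

  ∑P≤∑ : ∀ N{f g} ->(∀ n -> 0# ≤ g n)->(∀ p -> Prime p -> f p ≤ g p)-> ∑P N f ≤ ∑(suc N)g
  ∑P≤∑ N{f}{g} 0≤g q = ∑-mono(suc N)\p _ -> bound p(prime? p)
   where
   bound : ∀ p(d : Dec(Prime p))-> keep d(f p)≤ g p
   bound p(yes pp)= q p pp
   bound p(no _)   = 0≤g p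

  quot-≤ : ∀ N d .{{_ : Nz d}} -> # quot N d * # d ≤ # N
  quot-≤ N(suc d)= rs≤(#-*(N N./ suc d)(suc d))(#-mono(m/n*n≤m N(suc d)))

  quot-> : ∀ N d .{{_ : Nz d}} -> # N ≤(# quot N d + 1#)* # d
  quot-> N(suc d)= ≤rs(#-*(suc(N N./ suc d))(suc d)∙ alg "(1+a)(1+b)=(a+1)(1+b)")(#-mono(E.subst(N._≤ suc(N N./ suc d)N.* suc d)(E.sym(m≡m%n+[m/n]*n N(suc d)))
   (N.+-monoˡ-≤(N N./ suc d N.* suc d)(N.<⇒≤(m%n<n N(suc d))))))

  quot-double : ∀ N d .{{_ : Nz d}} -> # quot N d + # quot N d ≤ # quot(N N.+ N)d
  quot-double N d@(suc _)= rs≤(#-+(N N./ d)(N N./ d))(#-mono(E.subst(N._≤(N N.+ N)N./ d)(m*n/n≡m(N N./ d N.+ N N./ d)d)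
   (/-monoˡ-≤ d(E.subst(N._≤ N N.+ N)(E.sym(N.*-distribʳ-+ d(N N./ d)(N N./ d)))(N.+-mono-≤(m/n*n≤m N d)(m/n*n≤m N d))))))

  p^≢0 : ∀ {p} -> Prime p -> ∀ k -> Nz(p N.^ k)
  p^≢0 pp k = N.m^n≢0 _ k{{pr≢0 pp}}

  count : ∀ N d .{{_ : Nz d}} -> ∑(suc N)(\n -> keep(d ∣? n)(pos n))≈ # quot N d
  count N d@(suc d')= trans(LR.∑-divisible d N pos)(∑-first(N N./ d)_ ∙ +₂(rfx(E.cong pos(N.*-zeroʳ d)))(∑-ext(N N./ d){g = \_ -> 1#} \m -> refl)∙ +ˡ(∑-const(N N./ d)1#)∙ alg "0+a1=a")

  legendre : ∀ {N X} -> N N.≤ X -> logfact N ≈ ∑P X(\p -> lg p * ∑ X(\k -> # quot N(p N.^ suc k)))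
  legendre{N}{X} N≤X = ∑-ext(suc N)shape ∙ LR.log-sum pos N≤X refl ∙ ∑-ext(suc X)inner
   where
   shape : ∀ n -> lg n ≈ lg n * pos n
   shape zero    = trans log-0(alg "0=a0")
   shape(suc n)=(alg "a=a1")
   inner : ∀ p -> keep(prime? p)(lg p * ∑ X(\k -> ∑(suc N)(\n -> keep(p N.^ suc k ∣? n)(pos n))))≈ keep(prime? p)(lg p * ∑ X(\k -> # quot N(p N.^ suc k)))
   inner p with prime? p
   ... | yes pp = *ˡ(∑-ext X \k -> count N(p N.^ suc k){{p^≢0 pp(suc k)}})
   ... | no _   = refl

  logfact-double : ∀ N -> logfact(N N.+ N)≤ logfact N + logfact N + # N *(lg 2 + lg 2)
  logfact-double zero    = e≤(+ˡ log-0 ∙ alg "0+0=0+0+(0+0)+0(a+a)" ∙ +ʳ(+₂(+ˡ(sym log-0))(+ˡ(sym log-0))))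
  logfact-double(suc N)rewrite N.+-suc N N = lin(logfact-double N ⊹ lg-mono(n≤1+n(suc(N N.+ N)))⊹ even′ ⊹ even′)
   (alg "a+b+(a+b)+(1+c)(d+d)-(e+f+g)=a+a+c(d+d)+g+(d+b)+(d+b)-(e+f+g+g)")
   where
   even′ : lg(suc(suc(N N.+ N)))≤ lg 2 + lg(suc N)
   even′ = e≤(rfx(E.cong lg(E.trans(E.cong suc(E.sym(N.+-suc N N)))(E.cong(suc N N.+_)(E.sym(N.+-identityʳ(suc N))))))∙ lg-* 2(suc N))

  ϑ-double : ∀ N -> ϑ(N N.+ N)≤ ϑ N + # N *(lg 2 + lg 2)
  ϑ-double N = e≤(∑-split(suc N)N f)⨾ lin(≤t(∑-mono N(\i i<N -> window i i<N))(lin(∑-nonneg(suc N){T}(\p _ -> 0≤T p))(alg "a+b-b=a-0")⨾ e≤(sym(∑-split(suc N)N T)))⊹ logfact-double N ⊹ e≤ diff)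
   (alg "a+b(c+c)-(a+d)=e+(f+f+b(c+c))+(g-(f+f))-(d+g+e)")
   where
   f T : ℕ -> R
   f p = keep(prime? p)(lg p)
   U : ℕ -> R
   U p = lg p * ∑(N N.+ N)(\k -> # quot(N N.+ N)(p N.^ suc k)-(# quot N(p N.^ suc k)+ # quot N(p N.^ suc k)))
   T p = keep(prime? p)(U p)
   0≤q : ∀ p -> Prime p -> ∀ k -> 0# ≤ # quot(N N.+ N)(p N.^ suc k)-(# quot N(p N.^ suc k)+ # quot N(p N.^ suc k))
   0≤q p pp k = 0≤-by(quot-double N(p N.^ suc k){{p^≢0 pp(suc k)}})
   0≤T : ∀ p -> 0# ≤ T p
   0≤T p = keep-≥0(prime? p)\pp -> 0≤*(0≤lg p)(∑-nonneg(N N.+ N)\k _ -> 0≤q p pp k)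
   window : ∀ i -> i N.< N -> f(suc N N.+ i)≤ T(suc N N.+ i)
   window i i<N = keep-mono(prime? p)\pp -> rs≤(alg "a1=a")(*≤(0≤lg p)
    (at0 ⨾ term≤∑' pp))
    where
    p : ℕ
    p = suc N N.+ i
    term≤∑' : Prime p -> # quot(N N.+ N)(p N.^ 1)-(# quot N(p N.^ 1)+ # quot N(p N.^ 1))≤ ∑(N N.+ N)(\k -> # quot(N N.+ N)(p N.^ suc k)-(# quot N(p N.^ suc k)+ # quot N(p N.^ suc k)))
    term≤∑' pp = lin(∑-nonneg(N N.+ N){\k -> r(suc k)} \k _ -> 0≤q p pp(suc k))(alg "a+b-a=b-0")⨾
     e≤(sym(∑-first(N N.+ N)r))⨾ lin(e≤(last0(N N.+ N)rfN))(alg "a-(a+b)=0-b")⨾ ≤r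
     where
     r : ℕ -> R
     r k = # quot(N N.+ N)(p N.^ suc k)-(# quot N(p N.^ suc k)+ # quot N(p N.^ suc k))
     zero-quot : ∀ M d -> M N.< d -> quot M d ≡ 0
     zero-quot M(suc d)q = m<n⇒m/n≡0 q
     last0 : ∀ k -> N N.+ N N.≤ k -> r k ≈ 0#
     last0 k q = +₂(rfx(E.cong #_(zero-quot(N N.+ N)_ big)))(-₁(+₂(rfx(E.cong #_(zero-quot N _(N.≤-<-trans(m≤m+n N N)big))))(rfx(E.cong #_(zero-quot N _(N.≤-<-trans(m≤m+n N N)big))))))∙ alg "0-(0+0)=0"
      where
      big : N N.+ N N.< p N.^ suc k
      big = N.≤-<-trans q(N.<-≤-trans(N.<-trans rfN(n<2^n(suc k)))(N.^-monoˡ-≤(suc k)(prime>1 pp)))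
    at0 : 1# ≤ # quot(N N.+ N)(p N.^ 1)-(# quot N(p N.^ 1)+ # quot N(p N.^ 1))
    at0 = E.subst(\d -> 1# ≤ # quot(N N.+ N)d -(# quot N d + # quot N d))(E.sym(N.*-identityʳ p))
     (lin(#-mono{1}(E.subst(N._≤(N N.+ N)N./ p)(n/n≡1 p)(/-monoˡ-≤ p(N.+-monoʳ-< N i<N)))⊹ low ⊹ low)
      (alg "a-(b+b)-1=a+0+0-(1+0+b+b)"))
     where
     low : # quot N p ≤ 0#
     low = e≤(rfx(E.cong #_(m<n⇒m/n≡0{N}{p}(m≤m+n(suc N)i))))
   diff : ∑P(N N.+ N)U ≈ logfact(N N.+ N)-(logfact N + logfact N)
   diff =(∑-ext(suc(N N.+ N))\p -> keep-ext(prime? p)(expand p))∙ ∑P-+(N N.+ N)a(\p -> - # 2 * b p)∙ +₂(sym(legendre{N N.+ N}{N N.+ N} rfN))(∑P-*(N N.+ N)(- # 2)b ∙ *ˡ(sym(legendre{N}{N N.+ N}(m≤m+n N N))))∙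
    alg "a+-2b=a-(b+b)"
    where
    a b : ℕ -> R
    a p = lg p * ∑(N N.+ N)(\k -> # quot(N N.+ N)(p N.^ suc k))
    b p = lg p * ∑(N N.+ N)(\k -> # quot N(p N.^ suc k))
    keep-ext : ∀ {P : Set}(d : Dec P){x y} -> x ≈ y -> keep d x ≈ keep d y
    keep-ext(yes _)q = q
    keep-ext(no _)  q = refl
    expand : ∀ p -> U p ≈ a p + - # 2 * b p
    expand p = trans(*ˡ(∑--(N N.+ N)_ _ ∙ +ˡ(-₁(∑-+(N N.+ N)_ _))))
     (alg "a(b-(c+c))=ab+-2(ac)")

  chebyshev : ∀ N -> ϑ N ≤ # 4 * lg 2 * # N
  chebyshev N = go N(<-wellFounded N)
   where
   0≤l : 0# ≤ lg 2
   0≤l = 0≤lg 2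
   halve : ∀ n -> ∃ \m -> n ≡ m N.+ m ⊎ n ≡ suc(m N.+ m)
   halve zero = 0 , inl E.refl
   halve(suc n)with halve n
   ... | m , inl E.refl = m , inr E.refl
   ... | m , inr E.refl = suc m , inl(E.cong suc(E.sym(N.+-suc m m)))
   go : ∀ n -> Acc N._<_ n -> ϑ n ≤ # 4 * lg 2 * # n
   go n(acc rec)with halve n
   ... | zero , inl E.refl = e≤(alg "0+0=4a0")
   ... | zero , inr E.refl = ≤t(e≤(alg "0+0+0=0"))(0≤*(0≤*(0≤# 4)0≤l)(0≤# 1))
   ... | m@(suc m'), inl E.refl = ≤t(ϑ-double m)(lin(go m(rec(N.m<m+n m(s≤s z≤n)))⊹ 0≤*(0≤# m)0≤l ⊹ 0≤*(0≤# m)0≤l ⊹ e≤(*ˡ{# 4 * lg 2}(sym(#-+ m m))))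
    (alg "4ab-(c+d(a+a))=4ad+da+da+4ab-(c+0+0+4a(d+d))"))
   ... | m@(suc m'), inr E.refl = lin(keep-≥0(prime?(suc m N.+ suc m)){lg(suc m N.+ suc m)} \_ -> 0≤lg(suc m N.+ suc m))(alg "a+b-a=b-0")`at`(ϑ-double(suc m)⨾
    lin(go(suc m)(rec(s≤s(N.m<m+n m(s≤s z≤n))))⊹ 0≤*(0≤# m')0≤l ⊹ 0≤*(0≤# m')0≤l ⊹ e≤(*ˡ{# 4 * lg 2}(sym(#-+ m m))))
    (alg "4a(1+b)-(c+(1+(1+d))(a+a))=4a(1+(1+d))+da+da+4ab-(c+0+0+4a(1+d+(1+d)))"))
    where
    _`at`_ : ϑ(m N.+ suc m)≤ ϑ(suc m N.+ suc m)-> ϑ(suc m N.+ suc m)≤ # 4 * lg 2 * # suc(m N.+ m)-> ϑ(suc(m N.+ m))≤ # 4 * lg 2 * # suc(m N.+ m)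
    p `at` q = rs≤(rfx(E.cong ϑ(N.+-suc m m)))(p ⨾ q)

 ∑lg/p : ℕ -> R
 ∑lg/p N = ∑P N(\p -> lg p * inv(# p))

 c₂ : R
 c₂ = # 2 * wB 1(inv 2#)

 opaque
  W2-bound : ∀ N -> ∑ N(W 1 2#)≤ wB 1(inv 2#)
  W2-bound N = ∑W≤ 1(inv⁺(0<#s 1))(e≤(+ˡ 2h ∙ alg "1+1=2"))N

  W2-term : ∀ n .{{_ : Nz n}} -> lg n *(inv(# n)* inv(# n))≈ W 1 2# n
  W2-term n@(suc _)= *₂(alg "a=a1")(sym(rp-cong n(alg "2=1+1")∙ rp-+ n 1# 1# ∙ *₂(rp-1 n)(rp-1 n)))

  prime-inv : ∀ {p} -> Prime p -> # 2 * inv(# p)≤ 1#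
  prime-inv{p} pp = /-≤(0<# p{{pr≢0 pp}})(≤rs(alg "a=1a")(#-mono(prime>1 pp)))

  geo-≤ : ∀ {r} -> 0# ≤ r -> # 2 * r ≤ 1# -> ∀ K -> ∑ K(\k -> r ^ suc(suc k))≤ # 2 *(r * r)
  geo-≤{r} p q K = lin(0≤*(0≤# 2)(0≤^(suc(suc K))p))(alg "a+2b-a=2b-0")⨾ go K
   where
   go : ∀ K -> ∑ K(\k -> r ^ suc(suc k))+ # 2 * r ^ suc(suc K)≤ # 2 *(r * r)
   go zero    = e≤(alg "0+2(a(a1))=2(aa)")
   go(suc K)= ≤t(lin(≤*(0≤^(suc(suc K))p)q)(alg "a+2b-(a+b+2(cb))=1b-2cb"))(go K)

  inv-p^ : ∀ {p} -> Prime p -> ∀ k -> inv(#(p N.^ k))≈ inv(# p)^ k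
  inv-p^ pp zero    = sym(inv-uniq(alg "#1(1)=1"))
  inv-p^{p} pp(suc k)= sym(inv-uniq(*₂(#-* p(p N.^ k))(*ˡ(sym(inv-p^ pp k)))∙
   alg "ab(cd)=ac(bd)" ∙
    *₂(inv-r(0<# p{{pr≢0 pp}}))(inv-r(0<#(p N.^ k){{p^≢0 pp k}}))∙ alg "1(1)=1"))

  higher : ∀ N K -> ∑P N(\p -> lg p * ∑ K(\k -> inv(# p)^ suc(suc k)))≤ c₂
  higher N K = ≤t(∑P≤∑ N{g = \n -> # 2 * W 1 2# n}(\n -> 0≤*(0≤# 2)(0≤W 1 2# n))\p pp ->
   *≤(0≤lg p)(geo-≤(<≤(inv⁺(0<# p{{pr≢0 pp}})))(prime-inv pp)K)⨾ e≤(alg "a(2(bb))=2(a(bb))" ∙ *ˡ(W2-term p{{pr≢0 pp}})))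
   (rs≤(sym(∑-*(suc N)(# 2)(W 1 2#)))(*≤(0≤# 2)(W2-bound(suc N))))

  logfact-≤ : ∀ N .{{_ : Nz N}} -> logfact N ≤ # N * lg N
  logfact-≤ N = ≤t(e≤(∑-first N lg))((e≤ log-0 ⊹ ∑-mono N \i i<N -> lg-mono i<N)⨾ e≤(+ˡ(∑-const N(lg N))∙ alg "0+ab=ab"))

  logfact-≥ : ∀ N .{{_ : Nz N}} -> # N * lg N ≤ logfact N + # N
  logfact-≥(suc zero)    = lin(e≤(sym log-0)⊹ 0≤1)(alg "0+a+b+#1-#1b=a+1-(0+0)")
  logfact-≥(suc n@(suc _))= lin(logfact-≥ n ⊹ *≤(0≤# n)(lg-step≤ n)⊹ e≤(inv-r(0<# n)))
   (alg "a+b+(1+c)-(1+c)b=a+c+c(d+e)+1-(cd+cb+ce)")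

  private
   quot-p1 : ∀ {N p} -> Prime p -> # N * inv(# p)≤ # quot N p + 1#
   quot-p1{N}{p} pp = /-≤(0<# p{{pr≢0 pp}})(quot-> N p{{pr≢0 pp}})

  mertens-≤ : ∀ N .{{_ : Nz N}} -> ∑lg/p N ≤ lg N + # 4 * lg 2
  mertens-≤ N@(suc N')= cancel(0<# N)(rs≤(∑P-* N(# N)_)((∑P-mono N{g = \p -> lg p * ∑ N(\k -> # quot N(p N.^ suc k))+ lg p} \p pp _ -> each p pp)⨾
   rs≤(sym(∑P-+ N _ lg))(lin(e≤(sym(legendre{N} rfN))⊹ logfact-≤ N ⊹ chebyshev N)
    (alg "a(b+4c)-(d+e)=f+ab+4ca-(d+f+e)"))))
   where
   each : ∀ p -> Prime p -> # N *(lg p * inv(# p))≤ lg p * ∑ N(\k -> # quot N(p N.^ suc k))+ lg p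
   each p pp = ≤t(lin(*≤(0≤lg p)(quot-p1{N} pp))(alg "ab+a-c(ad)=a(b+1)-a(cd)"))
    (*≤(0≤lg p)(rs≤(rfx(E.cong(\d -> # quot N d)(N.*-identityʳ p)))(term≤∑ N(\k -> # quot N(p N.^ suc k))0(s≤s z≤n)\k -> 0≤#(quot N(p N.^ suc k))))⊹ ≤r)

  mertens-≥ : ∀ N .{{_ : Nz N}} -> lg N ≤ ∑lg/p N +(1# + c₂)
  mertens-≥ N@(suc N')= cancel(0<# N)(lin(logfact-≥ N ⊹ e≤(legendre{N} rfN)⊹ ∑P-mono N{g = \p -> # N *(lg p * inv(# p))+ # N *(lg p * ∑ N'(\k -> inv(# p)^ suc(suc k)))}(\p pp _ -> each p pp)
   ⊹ e≤(∑P-+ N _ _ ∙ +₂(∑P-* N(# N)_)(∑P-* N(# N)_))⊹ *≤(0≤# N)(higher N N'))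
   (alg "a(b+(1+c))-ad=e+a+f+g+(ab+ah)+ac-(ad+e+f+g+ah)"))
   where
   B : R
   B = ∑P N(\p -> # N *(lg p * inv(# p))+ # N *(lg p * ∑ N'(\k -> inv(# p)^ suc(suc k))))
   each : ∀ p -> Prime p -> lg p * ∑ N(\k -> # quot N(p N.^ suc k))≤ # N *(lg p * inv(# p))+ # N *(lg p * ∑ N'(\k -> inv(# p)^ suc(suc k)))
   each p pp = ≤t(*≤(0≤lg p)((∑-mono N{g = \k -> # N * inv(# p)^ suc k} \k _ ->
    ≤rs(*ˡ(inv-p^ pp(suc k)))(≤-/(0<#(p N.^ suc k){{p^≢0 pp(suc k)}})(quot-≤ N(p N.^ suc k){{p^≢0 pp(suc k)}})))⨾
    e≤(∑-* N(# N)_ ∙ *ˡ(∑-first N'(\k -> inv(# p)^ suc k)))))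
    (e≤(alg "a(b(c1+d))=b(ac)+b(ad)"))

  abel-varying : ∀ {a : ℕ -> ℂ}{b A : ℕ -> R} n ->(∀ k -> ∥ ∑ᶜ k a ∥ ≤ A k)-> ∥ ∑ᶜ n(\i -> a i *c cx(b i))∥ ≤ A n * abs(b n)+ ∑ n(\i -> A(suc i)* abs(b(suc i)- b i))
  abel-varying{a}{b}{A} n bA = e≤(∥-cg(identity n))⨾ ∥-- _ _ ⨾
   ≤t(e≤(∥-* _ _ ∙ *ˡ(∥-of±(b n))))(≤*(0≤abs(b n))(bA n))⊹ ≤t(∥-∑ n _)
    (∑-mono n \i _ -> e≤(∥-* _ _ ∙ *ˡ(∥-of± _))⨾ ≤*(0≤abs _)(bA(suc i)))
   where
   identity : ∀ n -> ∑ᶜ n(\i -> a i *c cx(b i))~ ∑ᶜ n a *c cx(b n)-c ∑ᶜ n(\i -> ∑ᶜ(suc i)a *c cx(b(suc i)- b i))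
   identity zero    =(algc "0=0a-0")
   identity(suc n)= lin≈c(+₂c(identity n)(*ˡc{∑ᶜ n a +c a n}(of-+(b(suc n))(- b n)⊙ +ˡc(of-neg(b n)))))
    (algc "(a+b)c-(d+(a+b)e)-(f+bg)=ag-d+(a+b)(c+-g)-(f+(a+b)e)")

  abel : ∀ {a : ℕ -> ℂ}{b : ℕ -> R}{A} n ->(∀ k -> ∥ ∑ᶜ k a ∥ ≤ A)-> ∥ ∑ᶜ n(\i -> a i *c cx(b i))∥ ≤ A *(abs(b n)+ ∑ n(\i -> abs(b(suc i)- b i)))
  abel{a}{b}{A} n bA = ≤t(abel-varying{A = \_ -> A} n bA)(e≤(+ˡ(∑-* n A _)∙ alg "ab+ac=a(b+c)"))

  abel-dec : ∀ {a : ℕ -> ℂ}{b : ℕ -> R}{A} n ->(∀ k -> ∥ ∑ᶜ k a ∥ ≤ A)->(∀ i -> 0# ≤ b i)->(∀ i -> b(suc i)≤ b i)-> ∥ ∑ᶜ n(\i -> a i *c cx(b i))∥ ≤ A * b 0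
  abel-dec{a}{b}{A} n bA 0≤b dec = ≤rs(*ˡ(+₂(abs-0≤(0≤b n))(∑-ext n \i -> abs-cong(alg "a-b=-(b-a)")∙ abs-neg(b i - b(suc i))∙ abs-0≤(0≤-by(dec i)))∙
   +ˡ((∑-ext n \i ->(alg "a-b=-b--a"))∙ ∑-tele n(\i -> - b i))∙ alg "a+(-a--b)=b"))(abel n bA)
   where
   abs-neg : ∀ x -> abs(- x)≈ abs x
   abs-neg x = sq-cancel(0≤abs _)(0≤abs _)(abs-sq(- x)∙ alg "-a(-a)=aa" ∙ sym(abs-sq x))

  ∑Pc-norm : ∀ N f -> ∥ ∑Pc N f ∥ ≤ ∑P N(\p -> ∥ f p ∥)
  ∑Pc-norm N f = ∥-∑(suc N)_ ⨾ ∑-mono(suc N)\p _ -> each(prime? p)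
   where
   each : ∀ {p}(d : Dec(Prime p))-> ∥ keepc d(f p)∥ ≤ keep d ∥ f p ∥
   each(yes _)= ≤r
   each(no _)  = e≤ ∥-0

 record Balanced : Set where
  field
   base : Mult
  open Mult base public
  field
   A       : R
   bounded : ∀ n -> ∥ ∑ᶜ n(\i -> fn(suc i))∥ ≤ A

 module AtOne (χ : Balanced) where
  open Balanced χ

  F : ℕ -> ℂ
  F zero    = 0c
  F(suc n)= fn(suc n)*c cx(inv(# suc n))

  H : ℕ -> ℂ
  H N = ∑ᶜ(suc N)F

  opaque
   inv#-dec : ∀ i -> inv(# suc(suc i))≤ inv(# suc i)
   inv#-dec i = inv-anti(0<#s i)(#-mono(n≤1+n(suc i)))
   0≤A : 0# ≤ A
   0≤A = ≤t(0≤∥ _)(bounded 0)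
   H-diff : ∀ M k -> ∥ H(M N.+ k)-c H M ∥ ≤ # 2 * A * inv(# suc M)
   H-diff M k = e≤(∥-cg(lin≈c(∑c-split(suc M)k F)(algc "a-(b-c)=c+a-b")))⨾
    abel-dec k shifted(\i -> <≤(inv⁺(0<#s(M N.+ i))))(\i -> rs≤(rfx(E.cong(\k -> inv(# suc k))(E.sym(N.+-suc M i))))(inv#-dec(M N.+ i)))⨾
     e≤(*ˡ(rfx(E.cong(\k -> inv(# suc k))(N.+-identityʳ M))))
    where
    shifted : ∀ k -> ∥ ∑ᶜ k(\i -> fn(suc(M N.+ i)))∥ ≤ # 2 * A
    shifted k = ≤t(e≤(∥-cg(lin≈c(symc(∑c-split M k(\i -> fn(suc i))))(algc "a-b-c=a-(b+c)"))))
     (∥-- _ _ ⨾ bounded(M N.+ k)⊹ bounded M ⨾ e≤(alg "a+a=2a"))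
   converges : ∃(Limc H)
   converges = Limc-complete H \ε ε>0 -> let N , q = arch(# 2 * A + # 2 * A)ε ε>0 in N , \m n Nm Nn ->
    ∥∥-tri(H m)(H N)(H n)⨾ from N Nm ⊹ rs≤(∥-sw _ _)(from N Nn)⨾
     rs≤(alg "(2a+2a)b=2ab+2ab")(/-≤(0<#s N)(q ⨾ lin(<≤ ε>0)(alg "a(1+b)-ba=a-0")))
    where
    from : ∀ N{m} -> N N.≤ m -> ∥ H m -c H N ∥ ≤ # 2 * A * inv(# suc N)
    from N Nm with m+o≡n Nm
    ... | k , E.refl = H-diff N k

  ℒ : ℂ
  ℒ = fst converges

  opaque
   H-error : ∀ M -> ∥ H M -c ℒ ∥ ≤ # 2 * A * inv(# suc M)
   H-error M = rs≤(∥-sw ℒ(H M))(Limc-norm(Limc-+(snd converges)(Limc-const(-c H M)))(M , \n Mn -> bound(m+o≡n Mn)))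
    where
    bound : ∀ {n} ->(∃ \k -> M N.+ k ≡ n)-> ∥ H n -c H M ∥ ≤ # 2 * A * inv(# suc M)
    bound(k , E.refl)= H-diff M k
   H-bound : ∀ M -> ∥ H M ∥ ≤ A
   H-bound M = ≤t(e≤(∥-cg(∑c-1st M F ⊙ algc "0+a=a")))
    (abel-dec M bounded(\i -> <≤(inv⁺(0<#s i)))inv#-dec ⨾ e≤(*ˡ(sym(inv-uniq{# 1}{1#}(alg "#1(1)=1")))∙ alg "a1=a"))
   F-* : ∀ m n -> F(m N.* n)~ F m *c F n
   F-* zero    n =(algc "0=0a")
   F-*(suc m)zero = trc(≡c(E.cong F(N.*-zeroʳ m)))(algc "0=a0")
   F-*(suc m)(suc n)= trc(*₂c(mult(suc m)(suc n))(of-cong(sym(inv-uniq(*ʳ(#-*(suc m)(suc n))∙ alg "ab(cd)=ac(bd)" ∙ *₂(inv-r(0<#s m))(inv-r(0<#s n))∙ alg "1(1)=1")))⊙ of-*(inv(# suc m))(inv(# suc n))))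
    (algc "ab(cd)=ac(bd)")
   ∥F∥ : ∀ d .{{_ : Nz d}} -> ∥ F d ∥ ≤ inv(# d)
   ∥F∥ d@(suc d')= ≤t(e≤(∥-* _ _ ∙ *ˡ(∥-of(<≤(inv⁺(0<#s d'))))))(≤rs(alg "1a=a")(≤*(<≤(inv⁺(0<#s d')))(bdd d)))

  V : ℕ -> ℂ
  V N = ∑Pc N(\p -> cx(lg p)*c F p)

  Vbound : R
  Vbound = A *(1# +(wB 0 1# + wB 1(inv 2#)))+(# 2 * A *(# 4 * lg 2)+ A * c₂)

  opaque
   F-divisible : ∀ N d .{{_ : Nz d}} -> ∑ᶜ(suc N)(\n -> keepc(d ∣? n)(F n))~ F d *c H(quot N d)
   F-divisible N d@(suc _)= trc(LC.∑-divisible d N F)(∑c-ext(suc(N N./ d))(F-* d)⊙ ∑c-*(suc(N N./ d))(F d)F)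
   ∑lgF : ∀ N .{{_ : Nz N}} -> ∥ ∑ᶜ(suc N)(\n -> cx(lg n)*c F n)∥ ≤ A *(1# +(wB 0 1# + wB 1(inv 2#)))
   ∑lgF N = e≤(∥-cg(∑c-1st N _ ⊙ +ˡc(∑c-ext N \i -> algc "a(bc)=b(ac)" ⊙ *ˡc(symc(of-*(lg(suc i))(inv(# suc i)))))⊙
    algc "a0+b=b"))⨾
    abel N bounded ⨾ *≤ 0≤A((rs≤(sym(abs-0≤(0≤*(0≤lg(suc N))(0≤i N))))(/-≤(0<#s N)(log≤x-1(0<#s N)⨾ lin 0≤1(alg "1(1+a)-(1+a-1)=1-0"))))⊹ ≤t(∑-mono N \i _ -> variation i)(e≤(∑-+ N _ _)⨾ shift′ 0 ⊹ shift′ 1 ⨾(∑W≤ 0 0<1(e≤(alg "1+#1(1)=2"))(suc N))⊹ W2-bound(suc N)))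
    where
    b : ℕ -> R
    b i = lg(suc i)* inv(# suc i)
    0≤i : ∀ i -> 0# ≤ inv(# suc i)
    0≤i i = <≤(inv⁺(0<#s i))
    shift′ : ∀ k -> ∑ N(\i -> W k 2#(suc i))≤ ∑(suc N)(W k 2#)
    shift′ k = e≤(alg "a=0+a" ∙ sym(∑-first N(W k 2#)))
    variation : ∀ i -> abs(b(suc i)- b i)≤ W 0 2#(suc i)+ W 1 2#(suc i)
    variation i = abs-≤
     (lin(≤*(0≤i(suc i))(lg-step≤ n)⊹ *≤(0≤i i)(inv#-dec i)⊹ 0≤*(0≤lg n)(0≤-by(inv#-dec i))⊹ 0≤*(0≤lg n)(0≤*(0≤i i)(0≤i i))⊹ e≤ w0 ⊹ e≤(W2-term n))
      (alg "a+b-(cd-ef)=(e+f)d+ff+e(f-d)+e(ff)+a+b-(cd+fd+0+0+ff+e(ff))"))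
     (lin(≤*(0≤i(suc i))(lg-mono{n}(n≤1+n n))⊹ *≤(0≤*(0≤lg n)(0≤i i))(inv#-dec i)⊹ 0≤*(0≤i i)(0≤i i)⊹ e≤ w0 ⊹ e≤(W2-term n)⊹ e≤(*ˡ{lg n}(lin≈(+₂(*ˡ{v'}(inv-r(0<#s i)))(*ˡ{u}(sym(inv-r(0<#s n)))))(alg "ab-(a-b)=b1+a((1+c)b)-(b(ca)+a1)"))))
      (alg "a+b--(cd-ef)=cd+eff+ff+a+b+e(fd)-(ed+efd+0+ff+e(ff)+e(f-d))"))
     where
     n : ℕ
     n = suc i
     u v' : R
     u = inv(# n)
     v' = inv(# suc n)
     w0 : u * u ≈ W 0 2# n
     w0 = trans(alg "aa=1(aa)")(*ˡ(sym(rp-cong n(alg "2=1+1")∙ rp-+ n 1# 1# ∙ *₂(rp-1 n)(rp-1 n))))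
   V-bound : ∀ N .{{_ : Nz N}} -> ∥ ℒ *c V N ∥ ≤ Vbound
   V-bound N@(suc N')= ∥-rev(ℒ *c V N)(∑Pc N(\p -> cx(lg p)*c G p))⨾
    rs≤(∥-cg(LC.log-sum{N}{N} F rfN reflc ⊙ ∑c-ext(suc N)\p -> keepc-cong(prime? p)\pp -> *ˡc(∑c-ext N \k -> F-divisible N(p N.^ suc k){{p^≢0 pp(suc k)}})))(∑lgF N)⊹ ≤t(e≤(∥-cg difference)⨾ ∑Pc-norm N _)((∑P-mono N{g = \p -> # 2 * A * inv(# N)* lg p + A *(lg p * ∑ N'(\k -> inv(# p)^ suc(suc k)))} \p pp _ -> each p pp)⨾
     rs≤(sym(∑P-+ N _ _ ∙ +₂(∑P-* N _ lg)(∑P-* N A _)))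
      (≤t(*≤(0≤*(0≤*(0≤# 2)0≤A)(<≤(inv⁺(0<# N))))(chebyshev N))(e≤(alg "2ab(4cd)=2a(4c)(db)" ∙ *ˡ(inv-r(0<# N))∙ alg "2a(4b)1=2a(4b)"))⊹ *≤ 0≤A(higher N N')))
    where
    G : ℕ -> ℂ
    G p = ∑ᶜ N(\k -> F(p N.^ suc k)*c H(quot N(p N.^ suc k)))
    difference : ℒ *c V N -c ∑Pc N(\p -> cx(lg p)*c G p)~ ∑Pc N(\p -> cx(lg p)*c(ℒ *c F p -c G p))
    difference = +ʳc(symc(∑c-*(suc N)ℒ _))⊙ symc(∑c--(suc N)_ _)⊙ ∑c-ext(suc N)\p -> one-term(prime? p)
     where
     one-term : ∀ {p}(d : Dec(Prime p))-> ℒ *c keepc d(cx(lg p)*c F p)-c keepc d(cx(lg p)*c G p)~ keepc d(cx(lg p)*c(ℒ *c F p -c G p))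
     one-term{p}(yes _)=(algc "a(bc)-bd=b(ac-d)")
     one-term(no _)  =(algc "a0-0=0")
    each : ∀ p -> Prime p -> ∥ cx(lg p)*c(ℒ *c F p -c G p)∥ ≤ # 2 * A * inv(# N)* lg p + A *(lg p * ∑ N'(\k -> inv(# p)^ suc(suc k)))
    each p pp = e≤(∥-* _ _ ∙ *ʳ(∥-of(0≤lg p)))⨾ *≤(0≤lg p)(e≤(∥-cg(+ˡc(-₁c(∑c-1st N' _ ⊙ +ʳc(≡c(E.cong(\d -> F d *c H(quot N d))(N.*-identityʳ p)))))⊙ algc "ab-(bc+d)=b(a-c)-d"))⨾ ∥-- _ _ ⨾(e≤(∥-* _ _)⨾ *-mono(0≤∥ _)(0≤*(0≤*(0≤# 2)0≤A)(<≤(inv⁺(0<#s(quot N p)))))(∥F∥ p)(rs≤(∥-sw _ _)(H-error(quot N p)))⨾ rs≤(alg "2a(bc)=b(2ac)")(*≤(0≤*(0≤# 2)0≤A)(rs≤(sym(inv-uniq{# p * # suc(quot N p)}(alg "ab(cd)=ac(bd)" ∙ *₂(inv-r(0<# p))(inv-r(0<#s(quot N p)))∙ alg "1(1)=1")))(inv-anti(0<# N)(≤rs(alg "(a+1)b=b(1+a)")(quot-> N p))))))⊹(∥-∑ N' _ ⨾ ≤rs(∑-* N' A _)(∑-mono N' \k _ -> e≤(∥-* _ _)⨾ *-mono(0≤∥ _)0≤A(∥F∥(p N.^ suc(suc k)){{p^≢0 pp(suc(suc k))}})(H-bound(quot N(p N.^ suc(suc k))))⨾ e≤(*ʳ(inv-p^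 pp(suc(suc k)))∙ alg "ab=ba"))))⨾
     e≤(alg "a(2bc+bd)=2bca+b(ad)")
     where
     instance
      _ : Nz p
      _ = pr≢0 pp

 primes : ℕ -> List ℕ
 primes zero    = []
 primes(suc n)with prime?(suc n)
 ... | yes _ = suc n ∷ primes n
 ... | no _  = primes n

 primes-≤ : ∀ n -> All(\p -> Prime p × p N.≤ n)(primes n)
 primes-≤ zero    = []
 primes-≤(suc n)with prime?(suc n)
 ... | yes p =(p , rfN)∷ All.map(\(x , y)-> x , m≤1+n y)(primes-≤ n)
 ... | no _  = All.map(\(x , y)-> x , m≤1+n y)(primes-≤ n)

 primes-dp : ∀ n -> DPrimes(primes n)
 primes-dp zero    = []
 primes-dp(suc n)with prime?(suc n)
 ... | yes p =(p , All.map(λ { (_ , y)E.refl -> N.<⇒≱ rfN y })(primes-≤ n))∷ primes-dp n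
 ... | no _  = primes-dp n

 primes-∈ : ∀ {p n} -> Prime p -> p N.≤ n -> p ∈ primes n
 primes-∈{n = zero}  pp z≤n = absurd(N.<⇒≢(N.≤-<-trans z≤n(prime>1 pp))E.refl)
 primes-∈{p}{suc n} pp q with prime?(suc n)| p N.≟ suc n
 ... | yes _  | yes E.refl = here E.refl
 ... | no np  | yes E.refl = absurd(np pp)
 ... | yes _  | no r = there(primes-∈ pp(N.s≤s⁻¹(N.≤∧≢⇒< q r)))
 ... | no _   | no r = primes-∈ pp(N.s≤s⁻¹(N.≤∧≢⇒< q r))

 opaque
  sumL-pr : ∀ n f -> sumL(primes n)f ≈ ∑P n f
  sumL-pr zero    f =(alg "0=0+0")
  sumL-pr(suc n)f with prime?(suc n)
  ... | yes _ = trans(+ˡ(sumL-pr n f))(alg "a+b=b+a")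
  ... | no _  = trans(sumL-pr n f)(alg "a=a+0")

  sift-0 : ∀ {S g p n} -> p ∈ S -> p ∣ n -> sift S g n ~ 0c
  sift-0{p ∷ S}{n = n}(here E.refl)d = drop-yes(p ∣? n)d
  sift-0{q ∷ S}{g}{p}{n}(there m)d with q ∣? n
  ... | yes _ = reflc
  ... | no _  = sift-0 m d

  sift-1 : ∀ {S} g -> DPrimes S -> sift S g 1 ~ g 1
  sift-1 g [] = reflc
  sift-1{p ∷ S} g((pp , _)∷ dS)= trc(drop-no(p ∣? 1)\d -> N.<⇒≢(prime>1 pp)(E.sym(N.∣1⇒≡1 d)))(sift-1 g dS)

 Covers : ℕ -> List ℕ -> Set
 Covers M S = ∀ n -> 1 N.< n -> n N.< M -> ∃ \p -> p ∈ S × p ∣ n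

 primes-cover : ∀ N -> Covers(suc N)(primes N)
 primes-cover N n 1<n n<N with prime-factor n 1<n
 ... | p , pp , d = p , primes-∈ pp(trN(N.∣⇒≤{{N.>-nonZero(N.<-trans(s≤s z≤n)1<n)}} d)(N.s≤s⁻¹ n<N)), d

 unitAt : ℕ -> ℂ
 unitAt zero    = 1c
 unitAt(suc k)= 0c

 module _ (g : Mult) (s : ℂ) (δ : R) (0<δ : 0# < δ) (σ≥ : 1# + # 3 * δ ≤ re s) where
  open Mult g
  open Sifted g s δ 0<δ σ≥

  opaque
   head-sum : ∀ k{S} M -> DPrimes S -> 2 N.≤ M -> Covers M S -> ∑ᶜ M(T k S)~ unitAt k
   head-sum k{S} M dS 2≤M cov = ∑c-single M 1(T k S)2≤M off ⊙ *₂c(*₂c(sift-1 fn dS ⊙ unit)(at1 k))(pw1 s)⊙ algc "1a1=a"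
    where
    at1 : ∀ k -> cx(lg 1 ^ k)~ unitAt k
    at1 zero    = reflc
    at1(suc k)= of-cong(*ʳ lg-1 ∙ alg "0a=0")
    off : ∀ i -> i N.< M -> ¬(i ≡ 1)-> T k S i ~ 0c
    off zero _ _ = reflc
    off(suc zero)_ n = absurd(n E.refl)
    off i@(suc(suc _))i<M _ with cov i(s≤s(s≤s z≤n))i<M
    ... | p , m , d = trc(*ʳc(*ʳc(sift-0{S}{fn} m d)))(algc "0ab=0")
   T≤W : ∀ k S n -> ∥ T k S n ∥ ≤ W k(re s)n
   T≤W k S = ∥term∥ k s(sift-bdd S)
   tail-bound : ∀ k S M .{{_ : Nz M}} -> k N.≤ 2 -> 1# + # 4 * δ ≤ re s -> ∥ A k S -c ∑ᶜ M(T k S)∥ ≤ rp M δ * wB k δ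
   tail-bound k S M k≤2 σ4 = series-tail M(T-bound k S k≤2)\n M≤n -> tail-mono n M≤n ⨾ ∑W-tail k 0<δ(≤r ⊹ ≤*(<≤ 0<δ)(#-mono(s≤s(s≤s k≤2)))⨾ σ4)M n M≤n
    where
    tail-mono : ∀ n -> M N.≤ n -> ∑ n(\i -> ∥ T k S i ∥)- ∑ M(\i -> ∥ T k S i ∥)≤ ∑ n(W k(re s))- ∑ M(W k(re s))
    tail-mono n M≤n = lin(∑-incl(\i -> W k(re s)i - ∥ T k S i ∥)M≤n(\i -> 0≤-by(T≤W k S i))⊹ e≤(∑-- n(W k(re s))(\i -> ∥ T k S i ∥))⊹ e≤(sym(∑-- M(W k(re s))(\i -> ∥ T k S i ∥))))
     (alg "a-b-(c-d)=e+(a-c)+f-(f+e+(b-d))")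
   rough-tail : ∀ k{S} M -> k N.≤ 2 -> 1# + # 4 * δ ≤ re s -> DPrimes S -> 2 N.≤ M -> Covers M S -> ∥ A k S -c unitAt k ∥ ≤ rp M δ * wB k δ
   rough-tail k{S} M k≤2 σ4 dS 2≤M cov = rs≤(∥-cg(+ˡc(-₁c(head-sum k M dS 2≤M cov))))(tail-bound k S M{{N.>-nonZero(N.<-≤-trans(s≤s z≤n)2≤M)}} k≤2 σ4)

 record Character(q : ℕ): Set where
  field
   c        : ℕ -> ℂ
   c-*      : ∀ m n -> c(m N.* n)~ c m *c c n
   periodic : ∀ n -> c(n N.+ q)~ c n
   c-1      : c 1 ~ 1c
   vanish   : ∀ n -> ¬ Coprime n q -> c n ~ 0c
   a₀       : ℕ
   a₀-cop   : Coprime a₀ q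
   a₀≉1     : ¬(c a₀ ~ 1c)

 module _ {q : ℕ} (1<q : 1 N.< q) (X : Character q) where
  open Character X
  private
   instance
    q≢0 : Nz q
    q≢0 = N.>-nonZero(N.<-trans(s≤s z≤n)1<q)

  opaque
   c-periods : ∀ k n -> c(n N.+ k N.* q)~ c n
   c-periods zero    n = ≡c(E.cong c(N.+-identityʳ n))
   c-periods(suc k)n = trc(≡c(E.cong c(E.trans(E.cong(n N.+_)(N.+-comm q(k N.* q)))(E.sym(N.+-assoc n(k N.* q)q)))))(periodic(n N.+ k N.* q)⊙ c-periods k n)
   c-% : ∀ n -> c n ~ c(n N.% q)
   c-% n = trc(≡c(E.cong c(N.m≡m%n+[m/n]*n n q)))(c-periods(n N./ q)(n N.% q))
   c-≡ : ∀ {m n} -> m N.% q ≡ n N.% q -> c m ~ c n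
   c-≡{m}{n} e = trc(c-% m)(≡c(E.cong c e)⊙ symc(c-% n))
   c-^ : ∀ n k -> c(n N.^ k)~ c n ^c k
   c-^ n zero    = c-1
   c-^ n(suc k)= trc(c-* n(n N.^ k))(*ˡc(c-^ n k))
   ∥c∥≤1 : ∀ n -> ∥ c n ∥ ≤ 1#
   ∥c∥≤1 n = ≮⇒≥ \gt -> let k , big = arch(∑ q(\i -> ∥ c i ∥))(∥ c n ∥ - 1#)(0<-by gt)in
    0<1(lin(≤t(bernoulli k(0≤-by(<≤ gt)))(bounded k)⊹ big)(alg "0-1=a+b(c-1)-(1+b(c-1)+a)"))
    where
    bounded : ∀ k -> ∥ c n ^c k ∥ ≤ ∑ q(\i -> ∥ c i ∥)
    bounded k = rs≤(∥-cg(symc(c-%(n N.^ k))⊙ c-^ n k))(term≤∑ q(\i -> ∥ c i ∥)(n N.^ k N.% q)(N.m%n<n(n N.^ k)q)(\i -> 0≤∥(c i)))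
    bernoulli : ∀ k -> 0# ≤ ∥ c n ∥ - 1# -> 1# + # k *(∥ c n ∥ - 1#)≤ ∥ c n ^c k ∥
    bernoulli zero    p = e≤(alg "1+0(a-1)=1" ∙ sym ∥-1)
    bernoulli(suc k)p = ≤t(lin(0≤*(0≤*(0≤# k)p)p ⊹ *≤(0≤∥(c n))(bernoulli k p))(alg "ab-(1+(1+c)(a-1))=c(a-1)(a-1)+ab-(0+a(1+c(a-1)))"))(e≤(sym(∥-* _ _)))
   inverse-mod : ∀ n -> Coprime n q -> ∃ \m ->(n N.* m)N.% q ≡ 1
   inverse-mod n cop with coprime-Bézout cop
   ... | Bézout.+- x y eq = x , E.trans(E.cong(N._% q)(E.trans(N.*-comm n x)(E.sym eq)))(E.trans(N.[m+kn]%n≡m%n 1 y q)(N.m<n⇒m%n≡m 1<q))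
   ... | Bézout.-+ x y eq with x N.* n in w
   ...   | zero = absurd(N.<⇒≢ 1<q(E.sym(N.m*n≡1⇒n≡1 y q(E.sym eq))))
   ...   | suc w' = x N.* suc w' , E.trans(E.cong(N._% q)(E.trans(E.sym(N.*-assoc n x(suc w')))(E.trans(E.cong(N._* suc w')(E.trans(N.*-comm n x)w))(E.cong suc(E.trans(E.cong(w' N.+_)(N.*-suc w' w'))(E.trans(E.sym(E.trans(N.*-suc w'(suc w'))(E.cong(w' N.+_)(N.*-suc w' w'))))(E.trans(E.cong(w' N.*_)eq)(E.sym(N.*-assoc w' y q)))))))))(E.trans(N.[m+kn]%n≡m%n 1(w' N.* y)q)(N.m<n⇒m%n≡m 1<q))
   ∥c∥≈1 : ∀ n -> Coprime n q -> ∥ c n ∥ ≈ 1#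
   ∥c∥≈1 n cop with inverse-mod n cop
   ... | m , e = ≤-antisym(∥c∥≤1 n)(e≤(sym ∥-1 ∙ ∥-cg(symc c-1 ⊙ c-≡(E.trans(N.m<n⇒m%n≡m 1<q)(E.sym e))⊙ c-* n m)∙ ∥-* _ _)⨾
    *≤(0≤∥ _)(∥c∥≤1 m)⨾ e≤(alg "a1=a"))
   -- Multiplication by a unit permutes the residues.
   ∑-unit : ∀ a -> Coprime a q -> ∀ (f : ℕ -> ℂ)-> ∑ᶜ q(\i -> f((a N.* i)N.% q))~ ∑ᶜ q f
   ∑-unit a cop f with inverse-mod a cop
   ... | b , ab =(∑c-ext q \i -> symc((∑c-single q(σ i)_(N.m%n<n(a N.* i)q)\j _ n -> keepc-no(σ i N.≟ j)\e -> n(E.sym e))⊙ keepc-yes(σ i N.≟ σ i)E.refl))⊙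
    ∑c-swap q q(\i j -> keepc(σ i N.≟ j)(f j))⊙ ∑c-cong q \j j<q ->(∑c-single q(τ j)_(N.m%n<n(b N.* j)q)\i i<q n -> keepc-no(σ i N.≟ j)\e -> n(E.trans(E.sym((inv-pair b a(E.trans(E.cong(N._% q)(N.*-comm b a))ab))i i<q))(E.cong τ e)))⊙
     keepc-yes(σ(τ j)N.≟ j)((inv-pair a b ab)j j<q)
    where
    σ τ : ℕ -> ℕ
    σ i =(a N.* i)N.% q
    τ j =(b N.* j)N.% q
    inv-pair : ∀ a b ->(a N.* b)N.% q ≡ 1 -> ∀ j -> j N.< q ->(a N.*((b N.* j)N.% q))N.% q ≡ j
    inv-pair a b e j j<q = E.trans(E.trans(N.%-distribˡ-* a((b N.* j)N.% q)q)(E.trans(E.cong(\z ->(a N.% q N.* z)N.% q)(N.m%n%n≡m%n(b N.* j)q))(E.sym(N.%-distribˡ-* a(b N.* j)q))))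
     (E.trans(E.cong(N._% q)(E.sym(N.*-assoc a b j)))(E.trans(N.%-distribˡ-*(a N.* b)j q)(E.trans(E.cong(\z ->(z N.*(j N.% q))N.% q)e)
      (E.trans(E.cong(N._% q)(N.*-identityˡ(j N.% q)))(E.trans(N.m%n%n≡m%n j q)(N.m<n⇒m%n≡m j<q))))))
   period-sum : ∑ᶜ q c ~ 0c
   period-sum with em{∑ᶜ q c ~ 0c}
   ... | yes p = p
   ... | no n  = absurd(a₀≉1(lin≈c(*ʳc{invc(∑ᶜ q c)}(algc "(a-1)b=ab-b" ⊙ +ʳc(symc(∑c-* q(c a₀)c)⊙(∑c-ext q \i -> symc(c-* a₀ i)⊙ c-%(a₀ N.* i))⊙ ∑-unit a₀ a₀-cop c)⊙ algc "a-a=0"))(lin≈c(*ˡc{1c -c c a₀}(symc(invc-r n)))(algc "0a-(b-1)ca-(1-b)=(1-b)(ca)-(1-b)1"))))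
   partial-sums : ∀ n -> ∥ ∑ᶜ n(\i -> c(suc i))∥ ≤ # q
   partial-sums n = rs≤(∥-cg(symc(≡c(E.cong(\k -> ∑ᶜ k d)(N.m≡m%n+[m/n]*n n q))⊙ go(n N./ q)(n N.% q))))
    (∥-∑(n N.% q)d ⨾(∑-mono(n N.% q){g = \_ -> 1#} \i _ -> ∥c∥≤1(suc i))⨾ e≤(∑-const(n N.% q)1# ∙ alg "a1=a")⨾ #-mono(N.<⇒≤(N.m%n<n n q)))
    where
    d : ℕ -> ℂ
    d i = c(suc i)
    go : ∀ k r -> ∑ᶜ(r N.+ k N.* q)d ~ ∑ᶜ r d
    go zero    r = ≡c(E.cong(\k -> ∑ᶜ k d)(N.+-identityʳ r))
    go(suc k)r = trc(≡c(E.cong(\k -> ∑ᶜ k d)(E.trans(E.sym(N.+-assoc r q(k N.* q)))(E.trans(E.cong(N._+ k N.* q)(N.+-comm r q))(N.+-assoc q r(k N.* q))))))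
     (∑c-split q(r N.+ k N.* q)d ⊙ +₂c(lin≈c(symc(∑c-1st q c)⊙ +₂c period-sum(periodic 0))(algc "0-a=0+b-(b+a)")⊙ reflc)((∑c-ext(r N.+ k N.* q)\i -> ≡c(E.cong(\k -> c(suc k))(N.+-comm q i))⊙ periodic(suc i))⊙ go k r)⊙ algc "0+a=a")

  balanced : Balanced
  balanced = record{ base = record{ fn = c ; mult = c-* ; unit = c-1 ; bdd = ∥c∥≤1 } ; A = # q ; bounded = partial-sums }

 opaque
  rp→0 : ∀ {δ} -> 0# < δ -> ∀ ε -> 0# < ε -> ∃ \M -> ∀ n -> M N.≤ n -> rp n δ ≤ ε
  rp→0{δ} p ε ε>0 with archimedean(e(inv ε / δ))
  ... | M , q = suc M , λ { n@(suc _)r -> small n(q ⨾ #-mono(trN(n≤1+n M)r)) }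
   where
   small : ∀ n .{{_ : Nz n}} -> e(inv ε / δ)≤ # n -> rp n δ ≤ ε
   small n big = cancel(0<e(δ * lg n))(rs≤(sym(e-inv(δ * lg n)))(rs≤(alg "ab=ba" ∙ inv-r ε>0)
    (≤*(<≤ ε>0)(rs≤(*-/ p)(*≤(<≤ p)(≤-log(0<# n)big))⨾ lin 0≤1(alg "1+ab-ab=1-0")))⨾
    ≤*(<≤ ε>0)(1+x≤e(δ * lg n))))

  pw-of : ∀ n σ -> pw n(cx σ)~ cx(rp n σ)
  pw-of n σ = trc(exp-cong(-₁c(symc(of-* σ(lg n)))⊙ symc(of-neg(σ * lg n))))(exp-of(-(σ * lg n)))

 module RealPoint (χ : Balanced) (s : R) (0<s : 0# < s) where
  open Balanced χ
  open AtOne χ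

  opaque
   real-term : ∀ i -> term 0 fn(cx(1# + s))(suc i)~ F(suc i)*c cx(rp(suc i)s)
   real-term i = trc(*ˡc(pw-of(suc i)(1# + s)⊙ of-cong(rp-+(suc i)1# s ∙ *ʳ(rp-1(suc i)))⊙ of-*(inv(# suc i))(rp(suc i)s)))
    (algc "a1(bc)=abc")
   converging : Sums(term 0 fn(cx(1# + s)))(series(term 0 fn(cx(1# + s))))
   converging = sums(term-bound 0{s = cx(1# + s)} bdd 0<s(e≤(alg "1+#1a=1+a")))
   shift-sum : ∀ n -> ∑ᶜ(suc n)(term 0 fn(cx(1# + s)))~ ∑ᶜ n(\i -> F(suc i)*c cx(rp(suc i)s))
   shift-sum n = trc(∑c-1st n _)(+ˡc(∑c-ext n real-term)⊙ algc "0+a=a")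
   H≡ : ∀ k -> ∑ᶜ k(\i -> F(suc i))~ H k
   H≡ k = symc(∑c-1st k F ⊙ algc "0+a=a")
   L-bound : ∥ series(term 0 fn(cx(1# + s)))∥ ≤ A
   L-bound = Limc-norm converging(1 , λ { (suc n)_ -> e≤(∥-cg(shift-sum n))⨾
    abel-dec n(\k -> rs≤(∥-cg(symc(H≡ k)))(H-bound k))(\i -> <≤(0<rp(suc i)s))(\i -> rp-mono(<≤ 0<s)(n≤1+n(suc i)))⨾ e≤(*ˡ(rp1 s)∙ alg "a1=a") })
   L-small : ℒ ~ 0c -> ∥ series(term 0 fn(cx(1# + s)))∥ ≤ # 2 * A * s
   L-small ℒ≈0 = ≤-by-ε \ε ε>0 -> let N , q = arch(# 2 * A)ε ε>0 in Limc-norm converging(suc N , λ { (suc n)r ->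
    e≤(∥-cg(shift-sum n))⨾ abel-varying{A = \k -> # 2 * A * inv(# suc k)} n H-small ⨾
     ≤t(*-mono(0≤last n)0≤1 ≤r(rs≤(sym(abs-0≤(<≤(0<rp(suc n)s))))(rp≤1(suc n)(<≤ 0<s))))(e≤(alg "2ab1=2ab")⨾ /-≤(0<#s n)(q ⨾
      ≤*(<≤ ε>0)(#-mono(trN(N.s≤s⁻¹ r)(n≤1+n n)))⨾ e≤(alg "(1+a)b=b(1+a)")))
      ⊹ ≤t(∑-mono n{g = \i -> # 2 * A * s *(- inv(# suc(suc i))- - inv(# suc i))} \i _ -> step i)(e≤(∑-* n(# 2 * A * s)_ ∙ *ˡ(∑-tele n(\i -> - inv(# suc i))))⨾ last n)⨾
      e≤(alg "a+2bc=2bc+a") })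
    where
    0≤2A : 0# ≤ # 2 * A
    0≤2A = 0≤*(0≤# 2)0≤A
    0≤last : ∀ n -> 0# ≤ # 2 * A * inv(# suc n)
    0≤last n = 0≤* 0≤2A(<≤(inv⁺(0<#s n)))
    H-small : ∀ k -> ∥ ∑ᶜ k(\i -> F(suc i))∥ ≤ # 2 * A * inv(# suc k)
    H-small k = ≤t(e≤(∥-cg(H≡ k ⊙ lin≈c ℒ≈0(algc "a-b-a=0-b"))))(H-error k)
    last : ∀ n -> # 2 * A * s *(- inv(# suc n)- - inv(# 1))≤ # 2 * A * s
    last n = lin(0≤*(0≤* 0≤2A(<≤ 0<s))(<≤(inv⁺(0<#s n)))⊹ e≤(*ˡ{# 2 * A * s}(sym(inv-uniq{# 1}{1#}(alg "#1(1)=1")))))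
     (alg "2ab-2ab(-c--d)=2abc+2ab1-(0+2abd)")
    step : ∀ i -> # 2 * A * inv(# suc(suc i))* abs(rp(suc(suc i))s - rp(suc i)s)≤ # 2 * A * s *(- inv(# suc(suc i))- - inv(# suc i))
    step i = *≤(0≤last(suc i))(abs-≤(lin(rp-mono{suc i}{suc(suc i)}(<≤ 0<s)(n≤1+n(suc i))⊹ 0≤*(<≤ 0<s)(<≤(inv⁺(0<#s i))))(alg "ab-(c-d)=d+ab-(c+0)"))
     (lin(e≤(sym(alg "a(b(c-d))=ab(c-d)" ∙ *ʳ(inv-r 0<s)∙ alg "1(a-b)=a-b"))⨾ *≤(<≤ 0<s)(rp-step≥(suc i)0<s ⨾ rp-anti(suc i)(lin(<≤ 0<s)(alg "1+a-1=a-0"))⨾ e≤(rp-1(suc i))))(alg "ab--(c-d)=ab-(d-c)")))⨾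
     e≤(alg "2ab(cd)=2ac(db)" ∙ *ˡ(sym(uv i)∙ alg "a-b=-b--a"))
     where
     uv : ∀ i -> inv(# suc i)- inv(# suc(suc i))≈ inv(# suc i)* inv(# suc(suc i))
     uv i = lin≈(+₂(*ˡ{v'}(inv-r(0<#s i)))(*ˡ{u}(sym(inv-r(0<#s(suc i))))))
      (alg "ab-(a-b)=b1+a((1+c)b)-(b(ca)+a1)")
      where
      u v' : R
      u = inv(# suc i)
      v' = inv(# suc(suc i))

 opaque
  -- The inequality 3 + 4 cos t + cos 2t ≥ 0, for the Euler factors.
  three-four-one : ∀ z x -> 0# ≤ x -> nsq z ≈ 1# ⊎ z ~ 0c ->
   nsq(1c -c 1c *c cx x)* nsq(1c -c 1c *c cx x)* nsq(1c -c 1c *c cx x)*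
   (nsq(1c -c z *c cx x)* nsq(1c -c z *c cx x)*(nsq(1c -c z *c cx x)* nsq(1c -c z *c cx x)))*
   nsq(1c -c z *c z *c cx x)≤ e(# 8 *(x * x))
  three-four-one z x 0≤x alt = *-mono(0≤*(0≤* n1 p1)(0≤* n2 n2))(<≤(0<e _))(*-mono(0≤* n1 p1)(0≤*(0≤* pe pe)(0≤* pe pe))
   (*-mono n1 pe'(*-mono p1 pe' b1 b1)b1)(*-mono n2(0≤* pe pe)(*-mono p2 pe b2 b2)(*-mono p2 pe b2 b2)))(bound(z *c z))⨾
   e≤(sym(e-+ _ _ ∙ *ʳ(e-+ _ _ ∙ *₂(e-+ _ _ ∙ *ʳ(e-+ _ _))(e-+ _ _ ∙ *₂(e-+ _ _)(e-+ _ _)))))⨾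
    e-mono(total alt)
   where
   p1 : 0# ≤ nsq(1c -c 1c *c cx x)
   p1 = 0≤nsq(1c -c 1c *c cx x)
   p2 : 0# ≤ nsq(1c -c z *c cx x)
   p2 = 0≤nsq(1c -c z *c cx x)
   n1 : 0# ≤ nsq(1c -c 1c *c cx x)* nsq(1c -c 1c *c cx x)
   n1 = 0≤* p1 p1
   n2 : 0# ≤ nsq(1c -c z *c cx x)* nsq(1c -c z *c cx x)
   n2 = 0≤* p2 p2
   pe' : 0# ≤ e(x * x * nsq 1c - # 2 * x * re 1c)
   pe' = <≤(0<e _)
   bound : ∀ w -> nsq(1c -c w *c cx x)≤ e(x * x * nsq w - # 2 * x * re w)
   bound w = ≤t(e≤(alg "(1+-(ab-c0))(1+-(ab-c0))+(0+-(a0+cb))(0+-(a0+cb))=1+(bb(aa+cc)-2ba)"))(1+x≤e _)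
   pe : 0# ≤ e(x * x * nsq z - # 2 * x * re z)
   pe = <≤(0<e _)
   b1 : nsq(1c -c 1c *c cx x)≤ e(x * x * nsq 1c - # 2 * x * re 1c)
   b1 = bound 1c
   b2 : nsq(1c -c z *c cx x)≤ e(x * x * nsq z - # 2 * x * re z)
   b2 = bound z
   total : nsq z ≈ 1# ⊎ z ~ 0c -> x * x * nsq 1c - # 2 * x * re 1c +(x * x * nsq 1c - # 2 * x * re 1c)+(x * x * nsq 1c - # 2 * x * re 1c)+
    (x * x * nsq z - # 2 * x * re z +(x * x * nsq z - # 2 * x * re z)+(x * x * nsq z - # 2 * x * re z +(x * x * nsq z - # 2 * x * re z)))+(x * x * nsq(z *c z)- # 2 * x * re(z *c z))≤ # 8 *(x * x)
   total(inl n)= lin(0≤*(0≤*(0≤# 4)0≤x)(0≤sq(1# + re z))⊹ e≤(*ˡ{# 4 *(x * x)} n)⊹ e≤(*ˡ{x * x}(nsq-* z z ∙ *₂ n n ∙ alg "1(1)=1"))⊹ e≤(*ˡ{# 2 * x} n))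
    (alg "8(aa)-(aa(1(1)+0(0))-2a1+(aa(1(1)+0(0))-2a1)+(aa(1(1)+0(0))-2a1)+(aa(bb+cc)-2ab+(aa(bb+cc)-2ab)+(aa(bb+cc)-2ab+(aa(bb+cc)-2ab)))+(aad-2a(bb-cc)))=4a((1+b)(1+b))+4(aa)1+aa1+2a1-(0+4(aa)(bb+cc)+aad+2a(bb+cc))")
   total(inr q)= lin(0≤*(0≤# 5)(0≤sq x)⊹ 0≤*(0≤# 6)0≤x ⊹ e≤(*ˡ{# 4 *(x * x)} n0)⊹ e≤(*ˡ{x * x}(nsq-* z z ∙ *₂ n0 n0 ∙ alg "0(0)=0"))
    ⊹ e≤(*ˡ{# 8 * x}(sym(re≈ q)))⊹ e≤(*ˡ{# 2 * x}(sym(re≈(*₂c q q)∙ alg "0(0)-0(0)=0"))))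
    (alg "8(aa)-(aa(1(1)+0(0))-2a1+(aa(1(1)+0(0))-2a1)+(aa(1(1)+0(0))-2a1)+(aab-2ac+(aab-2ac)+(aab-2ac+(aab-2ac)))+(aad-2ae))=5(aa)+6a+4(aa)0+aa0+8ac+2ae-(0+0+4(aa)b+aad+8a0+2a0)")
    where
    n0 : nsq z ≈ 0#
    n0 = trans(nsq-cong q)(alg "0(0)+0(0)=0")

 private
  comb : R -> R -> R -> R
  comb a b c = a * a * a *(b * b *(b * b))* c

  opaque
   comb-mono : ∀ {a b c a' b' c'} -> 0# ≤ a -> 0# ≤ b -> 0# ≤ c -> a ≤ a' -> b ≤ b' -> c ≤ c' -> comb a b c ≤ comb a' b' c'
   comb-mono{a}{b}{c}{a'}{b'}{c'} pa pb pc qa qb qc = go pa pb pc(pa ⨾ qa)(pb ⨾ qb)(0≤* pb pb)(0≤*(pb ⨾ qb)(pb ⨾ qb))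
    where
    go : 0# ≤ a -> 0# ≤ b -> 0# ≤ c -> 0# ≤ a' -> 0# ≤ b' -> 0# ≤ b * b -> 0# ≤ b' * b' -> comb a b c ≤ comb a' b' c'
    go pa pb pc pa' pb' bb bb' = *-mono(0≤*(0≤*(0≤* pa pa)pa)(0≤* bb bb))(pc ⨾ qc)
     (*-mono(0≤*(0≤* pa pa)pa)(0≤* bb' bb')(*-mono(0≤* pa pa)pa'(*-mono pa pa' qa qa)qa)(*-mono bb bb'(*-mono pb pb' qb qb)(*-mono pb pb' qb qb)))qc
   comb-* : ∀ a b c a' b' c' -> comb(a * a')(b * b')(c * c')≈ comb a b c * comb a' b' c'
   comb-* a b c a' b' c' =(alg "ab(ab)(ab)(cd(cd)(cd(cd)))(ef)=aaa(cc(cc))e(bbb(dd(dd))f)")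
   0≤comb : ∀ {a b c} -> 0# ≤ a -> 0# ≤ b -> 0# ≤ c -> 0# ≤ comb a b c
   0≤comb pa pb pc = 0≤*(0≤*(0≤*(0≤* pa pa)pa)(0≤*(0≤* pb pb)(0≤* pb pb)))pc

 module _ (χ χ² : Balanced) (square : ∀ n -> Balanced.fn χ² n ~ Balanced.fn χ n *c Balanced.fn χ n)
  (unimodular : ∀ n -> nsq(Balanced.fn χ n)≈ 1# ⊎ Balanced.fn χ n ~ 0c)(ℒ≈0 : AtOne.ℒ χ ~ 0c)where
  private
   A A₂ q K : R
   A = Balanced.A χ
   A₂ = Balanced.A χ²
   q = inv 2# * inv 2#
   K = e(# 8 * wB 0 1#)*(# 64 *(# 2 * A *(# 2 * A)*(# 2 * A *(# 2 * A))*(# 2 * A *(# 2 * A)*(# 2 * A *(# 2 * A))))*(A₂ * A₂))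

  module _ (s : R) (0<s : 0# < s) (s≤1 : s ≤ 1#) where
   private
    δ : R
    δ = s * inv(# 4)
    opaque
     0<δ : 0# < δ
     0<δ = *-pos 0<s(inv⁺(0<#s 3))
     4δ : # 4 * δ ≈ s
     4δ = trans(alg "4(ab)=a(4b)")(*ˡ(inv-r(0<#s 3))∙ alg "a1=a")
     σ4 : 1# + # 4 * δ ≤ 1# + s
     σ4 = e≤(+ˡ 4δ)
     σ3 : 1# + # 3 * δ ≤ 1# + s
     σ3 = ≤t(lin(<≤ 0<δ)(alg "1+4a-(1+3a)=a-0"))σ4
    module Zζ = Sifted one (cx (1# + s)) δ 0<δ σ3
    module Zχ = Sifted (Balanced.base χ) (cx (1# + s)) δ 0<δ σ3
    module Zχ² = Sifted (Balanced.base χ²) (cx (1# + s)) δ 0<δ σ3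
    x : ℕ -> R
    x p = rp p(1# + s)
    opaque
     nsq-≤ : ∀ {z b} -> ∥ z ∥ ≤ b -> nsq z ≤ b * b
     nsq-≤{z} r = rs≤(∥-sq z)(*-mono(0≤∥ z)(0≤∥ z ⨾ r)r r)
     factor : ∀ S(g : Mult)p -> nsq((1c -c Mult.fn g p *c pw p(cx(1# + s)))*c S)≈ nsq(1c -c Mult.fn g p *c cx(x p))* nsq S
     factor S g p = trans(nsq-*(1c -c Mult.fn g p *c pw p(cx(1# + s)))S)(*ʳ(nsq-cong{1c -c Mult.fn g p *c pw p(cx(1# + s))}{1c -c Mult.fn g p *c cx(x p)}(+ˡc(-₁c(*ˡc(pw-of p(1# + s)))))))
     euler : ∀ S -> comb(nsq(Zζ.E S))(nsq(Zχ.E S))(nsq(Zχ².E S))≤ e(# 8 * sumL S(\p -> x p * x p))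
     euler [] = e≤(solve [](u ⊗ u ⊗ u ⊗(u ⊗ u ⊗(u ⊗ u))⊗ u)e1 ∙ sym(e-cong(alg "8(0)=0")∙ e-0))
      where
      u : Expr
      u = e1 ⊗ e1 ⊕ e0 ⊗ e0
     euler(p ∷ S)= e≤(comb-cong(factor(Zζ.E S)one p)(factor(Zχ.E S)(Balanced.base χ)p)(factor(Zχ².E S)(Balanced.base χ²)p ∙ *ʳ(nsq-cong{1c -c Balanced.fn χ² p *c cx(x p)}{1c -c z *c z *c cx(x p)}(+ˡc(-₁c(*ʳc(square p))))))∙
      comb-*(nsq(1c -c 1c *c cx(x p)))(nsq(1c -c z *c cx(x p)))(nsq(1c -c z *c z *c cx(x p)))(nsq(Zζ.E S))(nsq(Zχ.E S))(nsq(Zχ².E S)))⨾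
      *-mono(0≤comb(0≤nsq(1c -c 1c *c cx(x p)))(0≤nsq(1c -c z *c cx(x p)))(0≤nsq(1c -c z *c z *c cx(x p))))(<≤(0<e _))(three-four-one z(x p)(<≤(0<rp p _))(unimodular p))(euler S)⨾
       e≤(sym(e-+ _ _)∙ e-cong(alg "8(aa)+8b=8(aa+b)"))
      where
      z : ℂ
      z = Balanced.fn χ p
      comb-cong : ∀ {a b c a' b' c'} -> a ≈ a' -> b ≈ b' -> c ≈ c' -> comb a b c ≈ comb a' b' c'
      comb-cong p₁ p₂ p₃ = *₂(*₂(*₂(*₂ p₁ p₁)p₁)(*₂(*₂ p₂ p₂)(*₂ p₂ p₂)))p₃
     x²-sum : ∀ N -> sumL(primes N)(\p -> x p * x p)≤ wB 0 1#
     x²-sum N = e≤(sumL-pr N _)⨾(∑P≤∑ N{g = W 0 2#}(0≤W 0 2#)\p pp -> square-term p{{pr≢0 pp}})⨾ ∑W≤ 0 0<1(e≤(alg "1+#1(1)=2"))(suc N)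
      where
      square-term : ∀ p .{{_ : Nz p}} -> x p * x p ≤ W 0 2# p
      square-term p@(suc _)= ≤t(e≤(sym(rp-+ p(1# + s)(1# + s))))(rp-anti p(lin(<≤ 0<s ⊹ <≤ 0<s)(alg "1+a+(1+a)-2=a+a-(0+0)"))⨾ e≤(alg "a=1a"))
     far : ∃ \N -> rp(suc N)δ * wB 0 δ ≤ inv 2# × 2 N.≤ suc N
     far with rp→0 0<δ(inv 2# / wB 0 δ)(/-pos(inv⁺(0<#s 1))(*-pos 0<1(+-pos 0<1(<≤(inv⁺ 0<δ)))))
     ... | M , r = suc M , ≤*(<≤ w>0)(r(suc(suc M))(trN(n≤1+n M)(n≤1+n(suc M))))⨾ e≤(/-* w>0), s≤s(s≤s z≤n)
      where
      w>0 : 0# < wB 0 δ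
      w>0 = *-pos 0<1(+-pos 0<1(<≤(inv⁺ 0<δ)))
     large : ∀ {z} -> ∥ z -c 1c ∥ ≤ inv 2# -> q ≤ nsq z
     large{z} r = ≤rs(∥-sq z)(*-mono 0≤h(0≤∥ z)half≤' half≤')
      where
      half≤' : inv 2# ≤ ∥ z ∥
      half≤' = lin(∥-rev 1c z ⊹ e≤(∥-sw 1c z)⊹ r ⊹ e≤(sym ∥-1)⊹ e≤ 2h)
       (alg "a-b=a+c+d+b+e+1-(e+c+d+1+2b)")
     ζ-bound : ∥ Zζ.Z 0 ∥ ≤ 1# + inv s
     ζ-bound = series-bound \N -> ≤t(∑-mono N(\n _ -> ∥term∥ 0(cx(1# + s))(Mult.bdd one)n))(∑W0≤ 0<s N)
   opaque
    smallness : comb q q q ≤ K * s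
    smallness with far
    ... | N , r , 2≤N = comb-mono 0≤q 0≤q 0≤q(piece one Zζ.E Zζ.Z(rough-tail one(cx(1# + s))δ 0<δ σ3 0)Zζ.sieved₀)(piece(Balanced.base χ)Zχ.E Zχ.Z(rough-tail(Balanced.base χ)(cx(1# + s))δ 0<δ σ3 0)Zχ.sieved₀)(piece(Balanced.base χ²)Zχ².E Zχ².Z(rough-tail(Balanced.base χ²)(cx(1# + s))δ 0<δ σ3 0)Zχ².sieved₀)⨾
     e≤(comb-*(nsq(Zζ.E S))(nsq(Zχ.E S))(nsq(Zχ².E S))(nsq(Zζ.Z 0))(nsq(Zχ.Z 0))(nsq(Zχ².Z 0)))⨾
     *-mono(0≤comb(0≤nsq(Zζ.E S))(0≤nsq(Zχ.E S))(0≤nsq(Zχ².E S)))(0≤comb(0≤sq(1# + inv s))(0≤sq(# 2 * A * s))(0≤sq A₂))(euler S ⨾ e-mono(*≤(0≤# 8)(x²-sum N)))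
      (comb-mono(0≤nsq(Zζ.Z 0))(0≤nsq(Zχ.Z 0))(0≤nsq(Zχ².Z 0))(nsq-≤ ζ-bound)(nsq-≤(RealPoint.L-small χ s 0<s ℒ≈0))(nsq-≤(RealPoint.L-bound χ² s 0<s)))⨾
     e≤(*ˡ collect ∙ alg "a(b(cc)(ddd(ee)))=a(dddb(cc))(ee)")⨾
      *-mono(0≤*(<≤(0<e _))(0≤*(0≤*(0≤*(0≤* 0≤d2 0≤d2)0≤d2)(0≤sq(# 2 * A *(# 2 * A)*(# 2 * A *(# 2 * A)))))(0≤sq A₂)))(<≤ 0<s)
       (*≤(<≤(0<e _))(≤*(0≤sq A₂)(≤*(0≤sq(# 2 * A *(# 2 * A)*(# 2 * A *(# 2 * A))))(*-mono(0≤* 0≤d2 0≤d2)(0≤# 4)(*-mono 0≤d2(0≤# 4)d2≤ d2≤)d2≤ ⨾ e≤(alg "4(4)4=64")))))(≤rs(alg "1a=a")(≤*(<≤ 0<s)s≤1))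
     where
     S : List ℕ
     S = primes N
     E8 D8 d2 i : R
     E8 = e(# 8 * wB 0 1#)
     D8 = # 2 * A *(# 2 * A)*(# 2 * A *(# 2 * A))*(# 2 * A *(# 2 * A)*(# 2 * A *(# 2 * A)))
     d2 =(s + 1#)*(s + 1#)
     i = inv s
     0≤q : 0# ≤ q
     0≤q = 0≤sq(inv 2#)
     0≤d2 : 0# ≤ d2
     0≤d2 = 0≤sq(s + 1#)
     d2≤ : d2 ≤ # 4
     d2≤ = *-mono(0≤+(<≤ 0<s)0≤1)(0≤# 2)s1≤ s1≤ ⨾ e≤(alg "2(2)=4")
      where
      s1≤ : s + 1# ≤ # 2
      s1≤ = lin s≤1(alg "2-(a+1)=1-a")
     collect : comb((1# + i)*(1# + i))(# 2 * A * s *(# 2 * A * s))(A₂ * A₂)≈ D8 *(A₂ * A₂)*(d2 * d2 * d2 *(s * s))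
     collect = alg "(1+a)(1+a)((1+a)(1+a))((1+a)(1+a))(2bc(2bc)(2bc(2bc))(2bc(2bc)(2bc(2bc))))(dd)=2b(2b)(2b(2b))(2b(2b)(2b(2b)))(dd)((c+ca)(c+ca)((c+ca)(c+ca))((c+ca)(c+ca))(cc))" ∙
      *ˡ(*ʳ(*₂(*₂(*₂ s1 s1)(*₂ s1 s1))(*₂ s1 s1)))
      where
      s1 : s + s * i ≈ s + 1#
      s1 = +ˡ(inv-r 0<s)
     piece : ∀ (g : Mult)(E : List ℕ -> ℂ)(Z : ℕ -> ℂ){A₀ : List ℕ -> ℂ} ->(∀ {S} M -> 0 N.≤ 2 -> 1# + # 4 * δ ≤ 1# + s -> DPrimes S -> 2 N.≤ M -> Covers M S -> ∥ A₀ S -c 1c ∥ ≤ rp M δ * wB 0 δ)->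
      (∀ {S} -> DPrimes S -> A₀ S ~ E S *c Z 0)-> q ≤ nsq(E S)* nsq(Z 0)
     piece g E Z t sv = ≤t(large(t(suc N)z≤n σ4(primes-dp N)2≤N(primes-cover N)⨾ r))(e≤(nsq-cong(sv(primes-dp N))∙ nsq-*(E S)(Z 0)))

  opaque
   complex-nonvanishing : ⊥
   complex-nonvanishing = contradict(min⁺ 0<1(half-pos(/-pos κ>0 K>0)))
    where
    q>0 : 0# < q
    q>0 = *-pos(inv⁺(0<#s 1))(inv⁺(0<#s 1))
    κ>0 : 0# < comb q q q
    κ>0 = *-pos(*-pos(*-pos(*-pos q>0 q>0)q>0)(*-pos(*-pos q>0 q>0)(*-pos q>0 q>0)))q>0
    K>0 : 0# < 1# + abs K
    K>0 = +-pos 0<1(0≤abs K)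
    contradict :(∃ \s -> 0# < s × s ≤ 1# × s ≤ half(comb q q q /(1# + abs K)))-> ⊥
    contradict(s , 0<s , s≤1 , s≤)= half-pos κ>0(lin(smallness s 0<s s≤1 ⊹ ≤*(<≤ 0<s)(abs-ge K)⊹ *≤(<≤ K>0)s≤ ⊹ e≤(*ʳ{h}(*-/{comb q q q} K>0))⊹ <≤ 0<s ⊹ e≤(h+h(comb q q q)))
     (alg "0-a=bc+dc+(1+d)(ef)+a+c+g-(g+bc+(1+d)c+(1+d)ef+0+(a+a))"))

 module _ (χ : Balanced) (values : ∀ n -> Balanced.fn χ n ~ 1c ⊎ Balanced.fn χ n ~ -c 1c ⊎ Balanced.fn χ n ~ 0c) where
  open Balanced χ
  open AtOne χ

  private
   ρ : ℕ -> R
   ρ n = re(fn n)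
   r : ℕ -> R
   r N = ∑(suc N)(\d -> keep(d ∣? N)(ρ d))
   opaque
    comm* : ∀ a b -> a * b ≈ b * a
    comm* a b =(alg "ab=ba")
    im-0 : ∀ n -> im(fn n)≈ 0#
    im-0 n with values n
    ... | inl q        = im≈ q
    ... | inr(inl q)= trans(im≈ q)(alg "-0=0")
    ... | inr(inr q)= im≈ q
    ρ-* : ∀ m n -> ρ(m N.* n)≈ ρ m * ρ n
    ρ-* m n = trans(re≈(mult m n))(+ˡ(-₁(*₂(im-0 m)(im-0 n)))∙ alg "ab-0(0)=ab")
    abs-ρ : ∀ n -> abs(ρ n)≤ 1#
    abs-ρ n = ≤t(abs-re≤(fn n))(bdd n)
    r-pad : ∀ {N X} .{{_ : Nz N}} -> N N.≤ X -> ∑(suc X)(\d -> keep(d ∣? N)(ρ d))≈ r N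
    r-pad{N} N≤X = ∑-pad _(s≤s N≤X)\d N<d _ -> keep-no(d ∣? N)\dv -> N.<⇒≱ N<d(N.∣⇒≤ dv)
    r-1 : r 1 ≈ 1#
    r-1 = trans(+₂(+ˡ(keep-no{x = ρ 0}(0 ∣? 1)λ { (N.divides k q)-> N.0≢1+n(E.sym(E.trans q(N.*-zeroʳ k))) })∙ alg "0+0=0")(keep-yes(1 ∣? 1)(N.1∣ 1)))(alg "0+a=a" ∙ re≈ unit)
    coprime-prime : ∀ {p d} -> Prime p -> ¬(p ∣ d)-> Coprime d p
    coprime-prime pp nd(i∣d , i∣p)with prime⇒irreducible pp i∣p
    ... | inl i≡1 = i≡1
    ... | inr E.refl = absurd(nd i∣d)
    strip : ∀ {p d m} k -> Prime p -> ¬(p ∣ d)-> d ∣ p N.^ k N.* m -> d ∣ m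
    strip{d = d}{m} zero    pp nd dv = E.subst(d ∣_)(N.*-identityˡ m)dv
    strip{p}{d}{m}(suc k)pp nd dv = strip k pp nd(coprime-divisor(coprime-prime pp nd)(E.subst(d ∣_)(N.*-assoc p(p N.^ k)m)dv))
    r-step : ∀ {p m} k -> Prime p -> ¬(p ∣ m)-> .{{_ : Nz m}} -> r(p N.^ suc k N.* m)≈ ρ p * r(p N.^ k N.* m)+ r m
    r-step{p}{m} k pp nd = rfx(E.cong r(N.*-assoc p(p N.^ k)m))∙ ∑-ext(suc X)split ∙ ∑-+(suc X)_ _ ∙ +₂ divisible(r-pad(trN(N.m≤n*m m(p N.^ k))(N.m≤n*m M p)))
     where
     instance
      p≢0 : Nz p
      p≢0 = pr≢0 pp
      pk≢0 : Nz(p N.^ k)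
      pk≢0 = N.m^n≢0 p k
      M≢0 : Nz(p N.^ k N.* m)
      M≢0 = N.m*n≢0(p N.^ k)m
     M X : ℕ
     M = p N.^ k N.* m
     X = p N.* M
     X≡ : p N.^ suc k N.* m ≡ X
     X≡ = N.*-assoc p(p N.^ k)m
     split : ∀ d -> keep(d ∣? X)(ρ d)≈ keep(p ∣? d)(keep(d ∣? X)(ρ d))+ keep(d ∣? m)(ρ d)
     split d with p ∣? d
     ... | yes dv = trans(alg "a=a+0")(+ˡ(sym(keep-no(d ∣? m)\dm -> nd(N.∣-trans dv dm))))
     ... | no ndv with d ∣? X | d ∣? m
     ...   | yes _ | yes _ =(alg "a=0+a")
     ...   | no _  | no _  =(alg "0=0+0")
     ...   | yes a | no b  = absurd(b(strip(suc k)pp ndv(E.subst(d ∣_)(E.sym X≡)a)))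
     ...   | no a  | yes b = absurd(a(E.subst(d ∣_)X≡(N.∣n⇒∣m*n(p N.^ suc k)b)))
     divisible : ∑(suc X)(\d -> keep(p ∣? d)(keep(d ∣? X)(ρ d)))≈ ρ p * r M
     divisible = LR.∑-divisible p X _ ∙ rfx(E.cong(\k -> ∑(suc k)(\j -> keep(p N.* j ∣? X)(ρ(p N.* j))))(E.trans(E.cong(N._/ p)(N.*-comm p M))(N.m*n/n≡m M p)))∙
      (∑-ext(suc M)\j -> scaled j(p N.* j ∣? X)(j ∣? M))∙ ∑-*(suc M)(ρ p)_
      where
      scaled : ∀ j(d : Dec(p N.* j ∣ X))(d' : Dec(j ∣ M))-> keep d(ρ(p N.* j))≈ ρ p * keep d'(ρ j)
      scaled j(yes _)(yes _)= ρ-* p j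
      scaled j(no _)  (no _)  =(alg "0=a0")
      scaled j(yes a)(no b)  = absurd(b(N.*-cancelˡ-∣ p a))
      scaled j(no a)  (yes b)= absurd(a(N.*-monoʳ-∣ p b))
   module _ (a : ℕ -> R) (t : R) (cases : t ≈ 1# ⊎ t ≈ - 1# ⊎ t ≈ 0#) (rec : ∀ k -> a (suc k) ≈ t * a k + a 0) (a≥0 : 0# ≤ a 0) where
    two : t ≈ 1# ⊎ t ≈ - 1# ⊎ t ≈ 0# -> ∀ k ->(0# ≤ a k -> 0# ≤ a(suc(suc k)))×(a 0 ≤ a k -> a 0 ≤ a(suc(suc k)))
    two(inl q)k =(\p -> lin(p ⊹ a≥0 ⊹ a≥0 ⊹ eq)(alg "a-0=b+c+c+a-(0+0+0+(b+c+c))")),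
     (\p -> lin(p ⊹ a≥0 ⊹ a≥0 ⊹ eq)(alg "a-b=c+b+b+a-(b+0+0+(c+b+b))"))
     where
     eq : a k + a 0 + a 0 ≤ a(suc(suc k))
     eq = e≤(sym(rec(suc k)∙ +ʳ(*₂ q(rec k ∙ +ʳ(*ʳ q)))∙ alg "1(1a+b)+b=a+b+b"))
    two(inr(inl q))k =(\p -> p ⨾ eq),(\p -> p ⨾ eq)
     where
     eq : a k ≤ a(suc(suc k))
     eq = e≤(sym(rec(suc k)∙ +ʳ(*₂ q(rec k ∙ +ʳ(*ʳ q)))∙ alg "-1(-1a+b)+b=a"))
    two(inr(inr q))k =(\_ -> a≥0 ⨾ eq),(\_ -> eq)
     where
     eq : a 0 ≤ a(suc(suc k))
     eq = e≤(sym(rec(suc k)∙ +ʳ(*ʳ q)∙ alg "0a+b=b"))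
    first : t ≈ 1# ⊎ t ≈ - 1# ⊎ t ≈ 0# -> 0# ≤ a 1
    first(inl q)= ≤rs(sym(rec 0 ∙ +ʳ(*ʳ q)))(≤rs(alg "a+a=1a+a")(0≤+ a≥0 a≥0))
    first(inr(inl q))= e≤(sym(rec 0 ∙ +ʳ(*ʳ q)∙ alg "-1a+a=0"))
    first(inr(inr q))= ≤rs(sym(rec 0 ∙ +ʳ(*ʳ q)∙ alg "0a+a=a"))a≥0
    nonneg : ∀ k -> 0# ≤ a k
    nonneg zero          = a≥0
    nonneg(suc zero)    = first cases
    nonneg(suc(suc k))= fst(two cases k)(nonneg k)
    even-≥ : ∀ k -> a 0 ≤ a(k N.+ k)
    even-≥ zero    = ≤r
    even-≥(suc k)rewrite N.+-suc k k = snd(two cases(k N.+ k))(even-≥ k)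
   opaque
    ρ-cases : ∀ n -> ρ n ≈ 1# ⊎ ρ n ≈ - 1# ⊎ ρ n ≈ 0#
    ρ-cases n with values n
    ... | inl q        = inl(re≈ q)
    ... | inr(inl q)= inr(inl(re≈ q))
    ... | inr(inr q)= inr(inr(re≈ q))
    at-power : ∀ {p m} -> Prime p -> ¬(p ∣ m)-> .{{_ : Nz m}} -> 0# ≤ r m -> ∀ k -> 0# ≤ r(p N.^ k N.* m)× r m ≤ r(p N.^(k N.+ k)N.* m)
    at-power{p}{m} pp nd 0≤rm k = nonneg a(ρ p)(ρ-cases p)rec 0≤a k , rs≤ a0(even-≥ a(ρ p)(ρ-cases p)rec 0≤a k)
     where
     a : ℕ -> R
     a k = r(p N.^ k N.* m)
     a0 : a 0 ≈ r m
     a0 = rfx(E.cong r(N.*-identityˡ m))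
     0≤a : 0# ≤ a 0
     0≤a = ≤rs(sym a0)0≤rm
     rec : ∀ k -> a(suc k)≈ ρ p * a k + a 0
     rec k = trans(r-step k pp nd)(+ˡ(sym a0))
   module _ (P : ℕ -> Set) (base : P 1) (step : ∀ {p m} k -> Prime p -> ¬ (p ∣ m) -> .{{_ : Nz m}} -> P m -> P (p N.^ k N.* m)) where
    prime-induction : ∀ n .{{_ : Nz n}} -> P n
    prime-induction n = go n(<-wellFounded n)
     where
     go : ∀ n -> Acc N._<_ n -> .{{_ : Nz n}} -> P n
     go(suc zero)_ = base
     go n@(suc(suc _))(acc rec)with prime-factor n(s≤s(s≤s z≤n))
     ... | p , pp , dv with split-power p pp n
     ...   | k , m , eq , nd , nz , m≤n = E.subst P(E.sym eq)(step k pp nd{{nz}}(go m(rec(N.≤∧≢⇒< m≤n λ { E.refl -> nd dv })){{nz}}))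
   opaque
    r-nonneg : ∀ n .{{_ : Nz n}} -> 0# ≤ r n
    r-nonneg = prime-induction(\n -> 0# ≤ r n)(≤rs(sym r-1)0≤1)\k pp nd q -> fst(at-power pp nd q k)
    r-square : ∀ n .{{_ : Nz n}} -> 1# ≤ r(n N.* n)
    r-square = prime-induction(\n -> 1# ≤ r(n N.* n))(e≤(sym r-1))λ {p}{m} k pp nd q ->
     ≤rs(rfx(E.cong r(E.sym(rearrange p m k))))(q ⨾ snd(at-power{p}{m N.* m} pp(\dv -> [ nd , nd ]′(euclidsLemma m m pp dv)){{N.m*n≢0 m m}}(0≤1 ⨾ q)k))
     where
     rearrange : ∀ p m k ->(p N.^ k N.* m)N.*(p N.^ k N.* m)≡ p N.^(k N.+ k)N.*(m N.* m)
     rearrange p m k = E.trans(N.[m*n]*[o*p]≡[m*o]*[n*p](p N.^ k)m(p N.^ k)m)(E.cong(N._*(m N.* m))(E.sym(N.^-distribˡ-+-* p k k)))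

  -- Lambert's series ∑ χ(n) xⁿ/(1-xⁿ) = ∑ r(n) xⁿ with x = g 1 ²; the half powers g n make
  -- the arithmetic-geometric mean inequality available.
  module _ (τ : R) (0<τ : 0# < τ) where
   private
    g x s : ℕ -> R
    g n = e(-(# n * τ))
    x n = g n * g n
    s n = ∑ n x
    L : ℕ -> R
    L i = x(suc i)* inv(s(suc i))
    β : ℕ -> R
    β i = inv(# suc i)- L i
    opaque
     g-+ : ∀ m n -> g(m N.+ n)≈ g m * g n
     g-+ m n = trans(e-cong(-₁(*ʳ(#-+ m n))∙ alg "-((a+b)c)=-(ac)+-(bc)"))(e-+ _ _)
     g-suc : ∀ n -> g(suc n)≈ g 1 * g n
     g-suc n = g-+ 1 n
     g-0 : g 0 ≈ 1#
     g-0 = trans(e-cong(alg "-(0a)=0"))e-0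
     0≤g : ∀ n -> 0# ≤ g n
     0≤g n = <≤(0<e _)
     0≤x : ∀ n -> 0# ≤ x n
     0≤x n = 0≤sq(g n)
     x-0 : x 0 ≈ 1#
     x-0 = trans(*₂ g-0 g-0)(alg "1(1)=1")
     x-+ : ∀ m n -> x(m N.+ n)≈ x m * x n
     x-+ m n = trans(*₂(g-+ m n)(g-+ m n))(alg "ab(ab)=aa(bb)")
     x-suc : ∀ n -> x(suc n)≈ x 1 * x n
     x-suc n = x-+ 1 n
     x-anti : ∀ {m n} -> m N.≤ n -> x n ≤ x m
     x-anti{m}{n} q = *-mono(0≤g n)(0≤g m)ga ga
      where
      ga : g n ≤ g m
      ga = e-mono(≤-neg(≤*(<≤ 0<τ)(#-mono q)))
     x1<1 : x 1 < 1#
     x1<1 = <-respʳ e-0(<-respˡ(e-+ _ _)(e-mono<(lin<(+-pos 0<τ(<≤ 0<τ))(alg "0-(-(#1a)+-(#1a))=a+a-0"))))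
     s≥1 : ∀ i -> 1# ≤ s(suc i)
     s≥1 i = ≤t(e≤(sym x-0))(term≤∑(suc i)x 0(s≤s z≤n)0≤x)
     0<s : ∀ i -> 0# < s(suc i)
     0<s i = <≤tr 0<1(s≥1 i)
     s-geo : ∀ n ->(1# - x 1)* s n ≈ 1# - x n
     s-geo zero    = trans(alg "(1-a)0=1-1")(+ˡ(-₁(sym x-0)))
     s-geo(suc n)= lin≈(+₂(s-geo n)(x-suc n))(alg "1-a-(1-b)(c+d)=1-d+bd-((1-b)c+a)")
     s-shift : ∀ n -> s(suc n)≈ 1# + x 1 * s n
     s-shift n = trans(∑-first n x)(+₂ x-0(∑-ext n x-suc ∙ ∑-* n(x 1)x))
     s≤ : ∀ n ->(1# - x 1)* s n ≤ 1#
     s≤ n = rs≤(sym(s-geo n))(lin(0≤x n)(alg "1-(1-a)=a-0"))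
     am-gm : ∀ i -> # suc i * g i ≤ s(suc i)
     am-gm zero          = e≤(*ˡ g-0 ∙ alg "#1(1)=0+1" ∙ +ˡ(sym x-0))
     am-gm(suc zero)    = lin(0≤sq(1# - g 1)⊹ e≤(sym x-0))(alg "0+a+bb-2b=(1-b)(1-b)+a-(0+1)")
     am-gm(suc(suc i))= ≤rs(+ʳ(sym(s-shift(suc i))))(rs≤(*ˡ(sym gg))(≤rs(+ˡ(sym(*₂ gg gg)))(lin(0≤sq(1# - g 1 *(g 1 * g i))⊹ *≤(0≤x 1)(am-gm i))
      (alg "1+aab+a(ac)(a(ac))-(1+(1+(1+d)))(a(ac))=(1-a(ac))(1-a(ac))+aab-(0+aa((1+d)c))"))))
      where
      gg : g(suc(suc i))≈ g 1 *(g 1 * g i)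
      gg = trans(g-suc(suc i))(*ˡ(g-suc i))
     g-anti : ∀ i -> g(suc i)≤ g i
     g-anti i = e-mono(≤-neg(≤*(<≤ 0<τ)(#-mono(n≤1+n i))))
     nx≤s : ∀ i -> # suc i * x(suc i)≤ s(suc i)
     nx≤s i = *≤(0≤#(suc i))(*-mono(0≤g(suc i))0≤1(g-anti i)g≤1 ⨾ e≤(alg "a1=a"))⨾ am-gm i
      where
      g≤1 : g(suc i)≤ 1#
      g≤1 = ≤rs e-0(e-mono(lin(0≤*(0≤#(suc i))(<≤ 0<τ))(alg "0--((1+a)b)=(1+a)b-0")))
     β-nonneg : ∀ i -> 0# ≤ β i
     β-nonneg i = 0≤-by(≤-/ʳ(0<#s i)(0<s i)(nx≤s i))
      where
      ≤-/ʳ : ∀ {n y z} -> 0# < n -> 0# < z -> n * y ≤ z -> y * inv z ≤ inv n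
      ≤-/ʳ{n}{y}{z} 0<n 0<z q = /-≤ 0<z(cancel 0<n(≤rs(sym(*ʳ(inv-r 0<n)∙ alg "1a=a")∙ alg "abc=a(bc)")q))
     β-dec : ∀ i -> β(suc i)≤ β i
     β-dec i = lin(cancel(*-pos(0<s i)(0<s(suc i)))(cancel(*-pos(0<#s i)(0<#s(suc i)))(rs≤(sym(*ˡ(alg "ab(cd-ef)=cb(ad)-ea(bf)" ∙ +₂(*₂(*ˡ(s-shift(suc i)))(inv-r(0<s i)))(-₁(*₂(*ʳ(x-suc(suc i)))(inv-r(0<s(suc i)))))∙ alg "a(1+bc)1-bac1=a")))(≤rs(sym(alg "ab(cd(e-f))=cd(b(ae)-a(bf))" ∙ *ˡ(+₂(*ˡ(inv-r(0<#s i)))(-₁(*ˡ(inv-r(0<#s(suc i))))))∙ alg "ab((1+(1+c))1-(1+c)1)=ab"))((e≤(alg "ab(cc)=bc(ac)")⨾ *≤(0≤*(0≤#(suc(suc i)))(0≤g(suc i)))(*≤(0≤#(suc i))(g-anti i)))⨾ *-mono(0≤*(0≤#(suc(suc i)))(0≤g(suc i)))(<≤(0<s i))(am-gm(suc i))(am-gm i)⨾ e≤(alg "ab=ba"))))))(alg "a-bc-(d-ef)=a-d-(bc-ef)")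
      where
      n m y z i₁ i₂ j₁ j₂ : R
      n  = # suc i
      m  = # suc(suc i)
      y  = s(suc i)
      z  = s(suc(suc i))
      i₁ = inv n
      i₂ = inv m
      j₁ = inv y
      j₂ = inv z
     β-0 : β 0 ≈ 1# - x 1
     β-0 = +₂(sym(inv-uniq{# 1}(alg "#1(1)=1")))(-₁(*ˡ(sym(inv-uniq{y = 1#}(*ʳ(+ˡ x-0)∙ alg "(0+1)1=1")))∙ alg "a1=a"))
    T : ℕ -> R
    T M = ∑ M(\i -> r(suc i)* x(suc i))
    opaque
     by-divisors : ∀ M -> T M ≈ ∑ M(\i -> ρ(suc i)* ∑(M N./ suc i)(\k -> x(suc i N.* suc k)))
     by-divisors M =(∑-cong M \i i<M -> *ʳ(sym(r-pad{suc i} i<M))∙ comm* _ _ ∙ sym(∑-*(suc M)(x(suc i))_)∙ ∑-ext(suc M)\d -> scale i(d ∣? suc i))∙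
      ∑-swap M(suc M)(\i d -> keep(d ∣? suc i)(ρ d * x(suc i)))∙ ∑-first M _ ∙ +₂(∑-0 M \i _ -> keep-no{x = ρ 0 * x(suc i)}(0 ∣? suc i)λ { (N.divides k q)-> N.1+n≢0(E.trans q(N.*-zeroʳ k)) })(∑-ext M column)∙ alg "0+a=a"
      where
      scale : ∀ i{d}(q : Dec(d ∣ suc i))-> x(suc i)* keep q(ρ d)≈ keep q(ρ d * x(suc i))
      scale i(yes _)= comm* _ _
      scale i(no _)  =(alg "a0=0")
      f : ℕ -> ℕ -> R
      f d zero    = 0#
      f d(suc n)= ρ d * x(suc n)
      at-0 : ∀ {P : Set}(q : Dec P)-> keep q 0# ≈ 0#
      at-0(yes _)= refl
      at-0(no _)  = refl
      column : ∀ i -> ∑ M(\j -> keep(suc i ∣? suc j)(ρ(suc i)* x(suc j)))≈ ρ(suc i)* ∑(M N./ suc i)(\k -> x(suc i N.* suc k))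
      column i =(sym(∑-first M(\n -> keep(suc i ∣? n)(f(suc i)n))∙ +ʳ(at-0(suc i ∣? 0))∙ 0+ _)∙ LR.∑-divisible(suc i)M(f(suc i))∙ ∑-first(M N./ suc i)(\m -> f(suc i)(suc i N.* m))∙ +ʳ(rfx(E.cong(f(suc i))(N.*-zeroʳ i)))∙ 0+ _)∙
       ∑-*(M N./ suc i)(ρ(suc i))(\k -> x(suc i N.* suc k))
       where
       0+ : ∀ y -> 0# + y ≈ y
       0+ y =(alg "0+a=a")
     geometric′ : ∀ d K ->(1# - x d)* ∑ K(\k -> x(d N.* suc k))≈ x d - x(d N.* suc K)
     geometric′ d zero    = trans(alg "(1-a)0=a-a")(+ˡ(-₁(rfx(E.cong x(E.sym(N.*-identityʳ d))))))
     geometric′ d(suc K)= lin≈(+₂(geometric′ d K)(rfx(E.cong x(N.*-suc d(suc K)))∙ x-+ d(d N.* suc K)))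
      (alg "a-b-(1-a)(c+d)=a-d+ad-((1-a)c+b)")
     geometric-≈ : ∀ i K ->(1# - x 1)* ∑ K(\k -> x(suc i N.* suc k))≈ L i - x(suc i N.* suc K)* inv(s(suc i))
     geometric-≈ i K = trans(*ˡ(sym(*ʳ(inv-r(0<s i))∙ alg "1a=a")))
      (alg "(1-a)(bcd)=(1-a)bdc" ∙
      *ʳ(*ʳ(s-geo(suc i))∙ geometric′(suc i)K)∙ alg "(a-b)c=ac-bc")
     lambert : ∀ M ->(1# - x 1)* T M ≤ ∑ M(\i -> ρ(suc i)* L i)+ # M * x M
     lambert M = e≤(*ˡ(by-divisors M)∙ sym(∑-* M(1# - x 1)_))⨾(∑-mono M \i i<M -> each i)⨾ e≤(∑-+ M _(\_ -> x M)∙ +ˡ(∑-const M(x M)))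
      where
      each : ∀ i ->(1# - x 1)*(ρ(suc i)* ∑(M N./ suc i)(\k -> x(suc i N.* suc k)))≤ ρ(suc i)* L i + x M
      each i = ≤t(e≤(alg "(1-a)(bc)=b((1-a)c)" ∙ *ˡ(geometric-≈ i(M N./ suc i))))
       (lin(≤*(0≤*(0≤x(suc i N.* suc(M N./ suc i)))(<≤(inv⁺(0<s i))))(abs-ge⁻(ρ(suc i))⨾ abs-ρ(suc i))⊹(/-≤(0<s i)((x-anti(E.subst(M N.≤_)(N.*-comm(suc(M N./ suc i))(suc i))(N.<⇒≤(E.subst(N._< suc(M N./ suc i)N.* suc i)(E.sym(N.m≡m%n+[m/n]*n M(suc i)))(N.+-monoˡ-<(M N./ suc i N.* suc i)(N.m%n<n M(suc i))))))⨾ e≤(alg "a=a1"))⨾ *≤(0≤x M)(s≥1 i))))(alg "ab+c-a(b-d)=1d+c-(-ad+d)"))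
     squares : ∀ J -> # J * x(J N.* J)≤ T(J N.* J)
     squares J = *≤(0≤# J)≤r ⨾ go J(x(J N.* J))(\j j≤J -> x-anti(N.*-mono-≤ j≤J j≤J))
      where
      go : ∀ n y ->(∀ j -> j N.≤ n -> y ≤ x(j N.* j))-> # n * y ≤ T(n N.* n)
      go zero    y q = e≤(alg "0a=0")
      go(suc n)y q = lin(go n y(\j j≤n -> q j(m≤1+n j≤n))⊹(q(suc n)rfN ⨾ rs≤(alg "1a=a")(≤*(0≤x(suc n N.* suc n))(r-square(suc n)))))(alg "a+bc-(1+d)e=a+bc-(de+e)")⨾
       +-monoˡ'(∑-incl{n N.* n}{n N.+ n N.* suc n} _(trN(N.*-monoʳ-≤ n(n≤1+n n))(N.m≤n+m(n N.* suc n)n))(\i -> 0≤*(r-nonneg(suc i))(0≤x(suc i))))⨾ ≤r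
       where
       +-monoˡ' : ∀ {a b c} -> a ≤ b -> a + c ≤ b + c
       +-monoˡ' q = q ⊹ ≤r
     re-of : ∀ z y -> re(z *c cx y)≈ re z * y
     re-of z y =(alg "ab-c0=ab")
     lambert-sum : ℒ ~ 0c -> ∀ M -> ∑ M(\i -> ρ(suc i)* L i)≤ A *(1# - x 1)+ # 2 * A * inv(# suc M)
     lambert-sum ℒ≈0 M = ≤t(e≤((∑-ext M \i ->(alg "ab=ac+-(a(c-b))"))∙ ∑-+ M _ _ ∙ +ˡ(∑-neg M(\i -> ρ(suc i)* β i))))
      ((e≤((∑-ext M \i -> sym(re-of(fn(suc i))(inv(# suc i))))∙ sym(re-∑ M(\i -> F(suc i)))∙ re≈(lin≈c(+₂c(symc(∑c-1st M F))ℒ≈0)(algc "a-b-c=a+0-(0+c+b)")))⨾ re≤∥ _ ⨾ H-error M)⊹(abs-ge⁻ _ ⨾ rs≤(abs-cong(re-∑ M _ ∙ ∑-ext M \i -> re-of(fn(suc i))(β i)))(abs-re≤(∑ᶜ M(\i -> fn(suc i)*c cx(β i))))⨾ abel-dec M bounded β-nonneg β-dec ⨾ e≤(*ˡ β-0))⨾ e≤(alg "2ab+a(1-c)=a(1-c)+2ab"))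
   opaque
    few-squares : ℒ ~ 0c -> ∀ J -> # J * x(J N.* J)≤ A
    few-squares ℒ≈0 J = cancel(0<-by x1<1)(≤-by-ε \ε 0<ε -> let M , big = arch(# 2 * A + D′ * D′)ε 0<ε; N =(J N.* J)N.+ M in
     *≤(<≤(0<-by x1<1))(squares J ⨾ ∑-incl _(m≤m+n(J N.* J)M)(\i -> 0≤*(r-nonneg(suc i))(0≤x(suc i))))⨾
      lambert N ⨾ lambert-sum ℒ≈0 N ⊹ tail N ⨾ e≤(alg "a(1-b)+2ac+ddc=(1-b)a+(2a+dd)c")⨾
       ≤r ⊹ /-≤(0<#s N)(big ⨾ ≤*(<≤ 0<ε)(#-mono(trN(N.m≤n+m M(J N.* J))(n≤1+n N)))⨾ e≤(comm* _ _)))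
     where
     D′ : R
     D′ = inv(1# - x 1)
     sD : ∀ n -> s n ≤ D′
     sD n = cancel(0<-by x1<1)(≤rs(sym(inv-r(0<-by x1<1)))(s≤ n))
     tail : ∀ N -> # N * x N ≤ D′ * D′ * inv(# suc N)
     tail N = ≤-/(0<#s N)((e≤(alg "a(bb)(1+a)=ab((1+a)b)")⨾ ≤*(0≤*(0≤#(suc N))(0≤g N))(≤*(0≤g N)(#-mono(n≤1+n N))))⨾
      *-mono(0≤*(0≤#(suc N))(0≤g N))(<≤(inv⁺(0<-by x1<1)))(am-gm N ⨾ sD(suc N))(am-gm N ⨾ sD(suc N)))

  opaque
   real-nonvanishing : ℒ ~ 0c -> ⊥
   real-nonvanishing ℒ≈0 with arch(1# + # 2 * A)1# 0<1
   ... | J , big = 0<1(lin(big ⊹ *≤(0≤# 2)(few-squares τ(*-pos(*-pos 0<h 0<h)(inv⁺(0<#s n)))ℒ≈0 J)⊹ *≤(0≤# 2)(*≤(0≤# J)(lin(*≤ 0≤h(≤*(<≤(inv⁺(0<#s n)))(#-mono(n≤1+n n))⨾ e≤(inv-r(0<#s n)))⊹ e≤(*ʳ{h *(# n * j)} 2h)⊹ e≤ 2h)(alg "1+(-(a(bbc))+-(a(bbc)))-b=b1+1(b(ac))+1-(b(ac)+2b(b(ac))+2b)")⨾ 1+x≤e _ ⨾ e≤(e-+ _ _)))⊹ e≤(*ˡ{# J}(sym 2h)))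
    (alg "0-1=a1+2b+2(ac)+a(2d)-(1+2b+2(ac)+2(ad)+a1)"))
    where
    n : ℕ
    n = J N.* J
    j τ X : R
    j = inv(# suc n)
    τ = h * h * j
    X = e(-(# n * τ))* e(-(# n * τ))
    0<h : 0# < h
    0<h = inv⁺(0<#s 1)

 opaque
  square-roots : ∀ z -> z *c z ~ 1c -> z ~ 1c ⊎ z ~ -c 1c
  square-roots z q with em{z ~ 1c}
  ... | yes p = inl p
  ... | no n  = inr(lin≈c(*ʳc{invc(z -c 1c)}{(z -c 1c)*c(z +c 1c)}{0c}(lin≈c q(algc "0-(a-1)(a+1)=1-aa"))⊙ algc "0a=0")
   (lin≈c(*ˡc{z +c 1c}(invc-r{z -c 1c} \e -> n(lin≈c e(algc "1-a=0-(a-1)"))))(algc "0-(a-1)(a+1)b-(-1-a)=(a+1)1-(a+1)((a-1)b)")))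

 module _ {q : ℕ} (1<q : 1 N.< q) (X : Character q) where
  open Character X

  private
   squared : ∀ a -> Coprime a q -> ¬(c a *c c a ~ 1c)-> Character q
   squared a cop n = record
    { c = \n -> c n *c c n
    ; c-* = \m n -> *₂c(c-* m n)(c-* m n)⊙ algc "ab(ab)=aa(bb)"
    ; periodic = \n -> *₂c(periodic n)(periodic n)
    ; c-1 = *₂c c-1 c-1 ⊙ algc "1(1)=1"
    ; vanish = \n nc -> *₂c(vanish n nc)(vanish n nc)⊙ algc "0(0)=0"
    ; a₀ = a ; a₀-cop = cop ; a₀≉1 = n }

  opaque
   unit-or-zero : ∀ n -> nsq(c n)≈ 1# ⊎ c n ~ 0c
   unit-or-zero n with coprime? n q
   ... | yes cop = inl(sym(∥-sq(c n))∙ *₂(∥c∥≈1 1<q X n cop)(∥c∥≈1 1<q X n cop)∙ alg "1(1)=1")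
   ... | no ncop = inr(vanish n ncop)
   nonvanishing : ¬(AtOne.ℒ(balanced 1<q X)~ 0c)
   nonvanishing ℒ≈0 with em{∃ \a -> Coprime a q × ¬(c a *c c a ~ 1c)}
   ... | yes(a , cop , n)= complex-nonvanishing(balanced 1<q X)(balanced 1<q(squared a cop n))(\_ -> reflc)unit-or-zero ℒ≈0
   ... | no  none = real-nonvanishing(balanced 1<q X)values ℒ≈0
    where
    values : ∀ n -> c n ~ 1c ⊎ c n ~ -c 1c ⊎ c n ~ 0c
    values n with coprime? n q
    ... | no ncop = inr(inr(vanish n ncop))
    ... | yes cop with em{c n *c c n ~ 1c}
    ...   | no ne = absurd(none(n , cop , ne))
    ...   | yes e with square-roots(c n)e
    ...     | inl p = inl p
    ...     | inr p = inr(inl p)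
   V-bounded : ∃ \C -> 0# ≤ C ×(∀ N .{{_ : Nz N}} -> ∥ AtOne.V(balanced 1<q X)N ∥ ≤ C)
   V-bounded =(Vbound * inv ∥ ℒ ∥), 0≤*(0≤∥(ℒ *c V 1)⨾ V-bound 1)(<≤(inv⁺ 0<ℒ)), \N -> ≤-/ 0<ℒ(rs≤(∥-* ℒ(V N)∙ alg "ab=ba")(V-bound N))
    where
    open AtOne (balanced 1<q X)
    0<ℒ : 0# < ∥ ℒ ∥
    0<ℒ = ∥∥-pos nonvanishing

 ∇ : ℕ -> R
 ∇ p = - log(1# - inv(# p))

 harm : ℕ -> R
 harm n = ∑ n(\i -> inv(# suc i))

 opaque
  bernoulli : ∀ z w -> 0# ≤ z -> z ≤ 1# -> e(z * w)≤ 1# - z + z * e w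
  bernoulli z w 0≤z z≤1 = lin(*≤ 0≤z(*≤(<≤(0<e(z * w)))(1+x≤e(w - z * w)))⊹ *≤(0≤-by z≤1)(*≤(<≤(0<e(z * w)))(1+x≤e(-(z * w))))⊹ e≤(*ˡ{z}(sym(e-+(z * w)(w - z * w))∙ e-cong(alg "ab+(b-ab)=b")))⊹ e≤(*ˡ{1# - z}(e-inv(z * w))))
   (alg "1-a+ab-c=a(cd)+(1-a)(ce)+ab+(1-a)1-(a(c(1+(f-af)))+(1-a)(c(1+-(af)))+a(cd)+(1-a)(ce))")

  0<1-inv : ∀ {p} -> Prime p -> 0# < 1# - inv(# p)
  0<1-inv{p} pp = <≤tr(inv⁺(0<#s 1))(lin(*≤ 0≤h(prime-inv pp)⊹ e≤(*ʳ{inv(# p)}(sym 2h))⊹ e≤ 2h)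
   (alg "1-a-b=b1+2ba+1-(b(2a)+1a+2b)"))

  0≤∇ : ∀ {p} -> Prime p -> 0# ≤ ∇ p
  0≤∇{p} pp = lin(log-≤{1# - inv(# p)}{0#}(0<1-inv pp)(≤rs(sym e-0)(lin(<≤(inv⁺(0<# p{{pr≢0 pp}})))(alg "1-(1-a)=a-0"))))(alg "-a-0=0-a")

  ∇-factor : ∀ {p z} -> Prime p -> 0# ≤ z -> z ≤ 1# -> e(-(∇ p * z))≤ 1# - inv(# p)* z
  ∇-factor{p}{z} pp 0≤z z≤1 = ≤t(e≤(e-cong(alg "-(-ab)=ba")))(bernoulli z _ 0≤z z≤1 ⨾
   e≤(+ˡ(*ˡ(e-log(0<1-inv pp)))∙ alg "1-a+a(1-b)=1-ba"))

  ∑P-window : ∀ {m n f g} -> m N.≤ n ->(∀ p -> Prime p -> m N.< p -> p N.≤ n -> f p ≤ g p)-> ∑P n f - ∑P m f ≤ ∑P n g - ∑P m g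
  ∑P-window{m}{n}{f}{g} m≤n q with m+o≡n m≤n
  ... | k , E.refl = go k(\p pp a b -> q p pp a b)
   where
   go : ∀ k ->(∀ p -> Prime p -> m N.< p -> p N.≤ m N.+ k -> f p ≤ g p)-> ∑P(m N.+ k)f - ∑P m f ≤ ∑P(m N.+ k)g - ∑P m g
   go zero q rewrite N.+-identityʳ m = e≤(alg "a-a=0" ∙ alg "0=a-a")
   go(suc k)q rewrite N.+-suc m k = lin(go k(\p pp a b -> q p pp a(m≤1+n b))⊹ keep-mono(prime?(suc(m N.+ k))){f(suc(m N.+ k))}{g(suc(m N.+ k))}(\pp -> q _ pp(s≤s(m≤m+n m k))rfN))
    (alg "a+b-c-(d+e-f)=a-c+b-(d-f+e)")

  ∑P-incl : ∀ {m n f} -> m N.≤ n ->(∀ p -> Prime p -> 0# ≤ f p)-> ∑P m f ≤ ∑P n f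
  ∑P-incl{m}{n}{f} m≤n q = ∑-incl _(s≤s m≤n)\p -> keep-≥0(prime? p)(q p)

  floor-exp : ∀ m -> ∃ \N -> # N ≤ e(# m)× e(# m)< # suc N
  floor-exp m with archimedean(e(# m))
  ... | N , q = search N(≤<tr q(lin< 0<1(alg "1+a-a=1-0")))
   where
   search : ∀ N -> e(# m)< # suc N -> ∃ \N -> # N ≤ e(# m)× e(# m)< # suc N
   search N q with ≤∨<(# N)(e(# m))
   ... | inl p = N , p , q
   search zero    q | inr p = absurd(p(<≤(0<e(# m))))
   search(suc N)q | inr p = search N p

 Y : ℕ -> ℕ
 Y m = fst(floor-exp m)

 opaque
  Y-≤ : ∀ m -> # Y m ≤ e(# m)
  Y-≤ m = fst(snd(floor-exp m))

  lg-≤ : ∀ {p m} .{{_ : Nz p}} -> p N.≤ Y m -> lg p ≤ # m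
  lg-≤{p}{m} q = log-≤(0<# p)(#-mono q ⨾ Y-≤ m)

  Y-<lg : ∀ {p m} -> Y m N.< p -> # m ≤ lg p
  Y-<lg{suc p}{m} q = ≤-log(0<#s p)(<≤(snd(snd(floor-exp m)))⨾ #-mono q)

  Y-mono : ∀ {m n} -> m N.≤ n -> Y m N.≤ Y n
  Y-mono{m}{n} q = N.s≤s⁻¹(N.≰⇒> \n≥ -> snd(snd(floor-exp n))(#-mono n≥ ⨾ Y-≤ m ⨾ e-mono(#-mono q)))

  m≤Y : ∀ m -> m N.< Y m ⊎ m ≡ 0
  m≤Y zero    = inr E.refl
  m≤Y m@(suc _)= inl(N.s≤s⁻¹(N.≰⇒> \n≥ -> snd(snd(floor-exp m))(#-mono n≥ ⨾ 1+x≤e(# m))))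

  0<Y : ∀ m -> 0 N.< Y m
  0<Y m = N.s≤s⁻¹(N.≰⇒> \n≥ -> snd(snd(floor-exp m))(#-mono n≥ ⨾ lin(0≤# m)(alg "1+a-#1=a-0")⨾ 1+x≤e(# m)))

 module _ (τ : R) (0<τ : 0# < τ) where
  private
   δ : R
   δ = inv(# 4)* τ
   0<δ : 0# < δ
   0<δ = *-pos(inv⁺(0<#s 3))0<τ
   4δ : # 4 * δ ≈ τ
   4δ = trans(alg "4(ab)=4ab")(*ʳ(inv-r(0<#s 3))∙ alg "1a=a")
   σ4 : 1# + # 4 * δ ≤ 1# + τ
   σ4 = e≤(+ˡ 4δ)
   σ3 : 1# + # 3 * δ ≤ 1# + τ
   σ3 = ≤t(lin(<≤ 0<δ)(alg "1+4a-(1+3a)=a-0"))σ4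
  open Sifted one (cx (1# + τ)) δ 0<δ σ3

  opaque
   zeta-term : ∀ i -> T 0 [] i ~ cx(W 0(1# + τ)i)
   zeta-term zero    = reflc
   zeta-term(suc i)= trc(*ˡc(pw-of(suc i)(1# + τ)))(algc "1ab=ab" ⊙ symc(of-* 1# _))
   zeta-≥ : inv τ ≤ ∥ Z 0 ∥
   zeta-≥ = ≤-by-ε \ε 0<ε -> let n , q = rp→0 0<τ(ε * τ)(*-pos 0<ε 0<τ)in
    ≤t(lin(Limc-≥{x = inv τ *(1# - rp(suc n)τ)}(sums(T-bound 0 [] z≤n))(suc(suc n), \k n≤k -> ∑W0≥ 0<τ n ⨾ ∑-incl(W 0(1# + τ))(trN(n≤1+n(suc n))n≤k)(0≤W 0(1# + τ))⨾ e≤((∑-ext k \i -> sym(re≈(zeta-term i)))∙ sym(re-∑ k(T 0 []))))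
     ⊹ *≤(<≤(inv⁺ 0<τ))(q(suc n)(n≤1+n n))⊹ e≤(*ˡ{ε}(inv-r 0<τ)))
     (alg "a+b-c=a+c(bd)+b1-(c(1-e)+ce+b(dc))"))
     (re≤∥(Z 0)⊹ ≤r)
   E-≥ : ∀ S -> All Prime S -> e(- sumL S(\p -> ∇ p * rp p τ))≤ ∥ E S ∥
   E-≥ [] [] = e≤((e-cong(alg "-0=0")∙ e-0)∙ sym ∥-1)
   E-≥(p ∷ S)(pp ∷ ps)= ≤t(e≤(e-cong(alg "-(ab+c)=-(ab)+-c")∙ e-+ _ _))
    (*-mono(<≤(0<e _))(0≤∥(E S))(∇-factor pp(<≤(0<rp p τ))(rp≤1 p(<≤ 0<τ))⨾ e≤(+ˡ(-₁(*ʳ(sym(rp-1 p{{pr≢0 pp}}))∙ sym(rp-+ p 1# τ)))∙ re≈{cx(1# - rp p(1# + τ))}(of-+ 1#(- rp p(1# + τ))⊙ +ˡc(of-neg _ ⊙ -₁c(symc(pw-of p(1# + τ))⊙ algc "a=1a"))))⨾ re≤∥ _)(E-≥ S ps)⨾ e≤(sym(∥-* _ _)))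
   zeta-≤ : ∀ B ->(∀ N -> ∑P N(\p -> ∇ p * rp p τ)≤ B)-> inv τ ≤ e B
   zeta-≤ B bounded = zeta-≥ ⨾ ≤-by-ε \ε 0<ε -> go ε 0<ε
    where
    go : ∀ ε -> 0# < ε -> ∥ Z 0 ∥ ≤ e B + ε
    go ε 0<ε with rp→0 0<δ((ε * e(- B))/ wB 0 δ)(/-pos(*-pos 0<ε(0<e _))(*-pos 0<1(+-pos 0<1(<≤(inv⁺ 0<δ)))))
    ... | M , q = cancel(0<e(- B))(≤*(0≤∥(Z 0))(e-mono(≤-neg(rs≤(sym(sumL-pr N _))(bounded N)))⨾ E-≥ S(All.map fst(primes-≤ N)))⨾ e≤(sym(∥-* _ _)∙ ∥-cg(symc(sieved₀(primes-dp N))))⨾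
     ∥-rev(A 0 S)1c ⨾ e≤ ∥-1 ⊹ ≤t(rough-tail one(cx(1# + τ))δ 0<δ σ3 0(suc N)z≤n σ4(primes-dp N)(s≤s(s≤s z≤n))(primes-cover N))
      (≤*(<≤ 0<wB)(q(suc N)(trN(n≤1+n M)(n≤1+n N)))⨾ e≤(/-* 0<wB))⨾
      e≤(+ʳ(sym(*-comm'(e(- B))(e B)∙ e-inv B))∙ alg "ab+ca=a(b+c)"))
     where
     0<wB : 0# < wB 0 δ
     0<wB = *-pos 0<1(+-pos 0<1(<≤(inv⁺ 0<δ)))
     *-comm' : ∀ a b -> a * b ≈ b * a
     *-comm' a b =(alg "ab=ba")
     N : ℕ
     N = suc M
     S : List ℕ
     S = primes N

 logpoly : ℕ -> R -> R
 logpoly X t = ∑ X(\i -> inv(# suc i)* t ^ suc i)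

 opaque
  geometric≤ : ∀ {b} -> 0# ≤ b -> ∀ n ->(1# - b)* ∑ n(\i -> b ^ i)≤ 1#
  geometric≤{b} 0≤b n = rs≤(sym(eq n))(lin(0≤^ n 0≤b)(alg "1-(1-a)=a-0"))
   where
   eq : ∀ n ->(1# - b)* ∑ n(\i -> b ^ i)≈ 1# - b ^ n
   eq zero    =(alg "(1-a)0=1-1")
   eq(suc n)= lin≈(eq n)(alg "1-ab-(1-a)(c+b)=1-b-(1-a)c")

  power-diff : ∀ {a b} -> 0# ≤ a -> a ≤ b -> ∀ i -> b ^ suc i - a ^ suc i ≤ # suc i *((b - a)* b ^ i)
  power-diff{a}{b} 0≤a a≤b zero = e≤(alg "a1-b1=#1((a-b)1)")
  power-diff{a}{b} 0≤a a≤b(suc i)= lin(*≤(0≤a ⨾ a≤b)(power-diff 0≤a a≤b i)⊹ *≤(0≤-by a≤b)(^-mono(suc i)0≤a a≤b))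
   (alg "(1+(1+a))((b-c)(bd))-(b(bd)-c(ce))=b((1+a)((b-c)d))+(b-c)(bd)-(b(bd-ce)+(b-c)(ce))")

  logpoly-step : ∀ X{a b} -> 0# ≤ a -> a ≤ b -> b ≤ 1# ->(1# - b)*(logpoly X b - logpoly X a)≤ b - a
  logpoly-step X{a}{b} 0≤a a≤b b≤1 = *≤(0≤-by b≤1)(e≤(sym(∑-- X _ _))⨾(∑-mono X \i _ -> each i)⨾ e≤(∑-* X(b - a)(b ^_)))⨾
   e≤(alg "(1-a)((a-b)c)=(a-b)((1-a)c)")⨾ *≤(0≤-by a≤b)(geometric≤(0≤a ⨾ a≤b)X)⨾ e≤(alg "(a-b)1=a-b")
   where
   each : ∀ i -> inv(# suc i)* b ^ suc i - inv(# suc i)* a ^ suc i ≤(b - a)* b ^ i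
   each i =(e≤(alg "a(bc)-a(de)=a(bc-de)")⨾ *≤(<≤(inv⁺(0<#s i)))(power-diff 0≤a a≤b i))⨾
    e≤(alg "a(bc)=bac" ∙ *ʳ(inv-r(0<#s i))∙ alg "1((a-b)c)=(a-b)c")

  -- The points 1 - e(-jy) divide [0, z] so that each step contributes the same amount.
  logpoly-≤ : ∀ X{z} -> 0# ≤ z -> z < 1# -> logpoly X z ≤ - log(1# - z)
  logpoly-≤ X{z} 0≤z z<1 = ≤-by-ε \ε 0<ε -> let N , p = arch(s * L)ε 0<ε ; M , q = arch L 1# 0<1 in bound(N N.+ M)ε 0<ε(p ⨾ ≤*(<≤ 0<ε)(#-mono(m≤m+n N M)))(q ⨾ e≤(alg "a1=a")⨾ #-mono(N.m≤n+m M N))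
   where
   s L : R
   s = logpoly X z
   L = - log(1# - z)
   0<1-z : 0# < 1# - z
   0<1-z = 0<-by z<1
   module Grid (n : ℕ) where
    y : R
    y = L * inv(# suc n)
    0≤y : 0# ≤ y
    0≤y = 0≤*(lin(log-≤{b = 0#} 0<1-z(≤rs(sym e-0)(lin 0≤z(alg "1-(1-a)=a-0"))))(alg "-a-0=0-a"))(<≤(inv⁺(0<#s n)))
    ny : # suc n * y ≈ L
    ny = trans(alg "a(bc)=acb")(*ʳ(inv-r(0<#s n))∙ alg "1a=a")
    ρ ζ : ℕ -> R
    ρ j = e(-(# j * y))
    ζ j = 1# - ρ j
    ρ-suc : ∀ j -> ρ j ≈ ρ(suc j)* e y
    ρ-suc j = trans(e-cong(alg "-(ab)=-((1+a)b)+b"))(e-+ _ _)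
    ρ≤1 : ∀ j -> ρ j ≤ 1#
    ρ≤1 j = ≤rs e-0(e-mono(lin(0≤*(0≤# j)0≤y)(alg "0--(ab)=ab-0")))
    ρ-dec : ∀ j -> ρ(suc j)≤ ρ j
    ρ-dec j = e-mono(lin 0≤y(alg "-(ab)--((1+a)b)=b-0"))
    step : ∀ j -> logpoly X(ζ(suc j))- logpoly X(ζ j)≤ e y - 1#
    step j = cancel(0<e(-(# suc j * y)))(lin(logpoly-step X{ζ j}{ζ(suc j)}(0≤-by(ρ≤1 j))(lin(ρ-dec j)(alg "1-a-(1-b)=b-a"))(lin(<≤(0<e(-(# suc j * y))))(alg "1-(1-a)=a-0"))⊹ e≤(ρ-suc j))
     (alg "a(b-1)-a(c-d)=1-a-(1-e)+ab-((1-(1-a))(c-d)+e)"))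
    at-0 : logpoly X(ζ 0)≈ 0#
    at-0 = ∑-0 X \i _ -> trans(*ˡ(*ʳ(+ˡ(-₁(e-cong(alg "-(0a)=0")∙ e-0))∙ alg "1-1=0")))(alg "a(0b)=0")
    at-n : z ≈ ζ(suc n)
    at-n = trans(alg "a=1-(1-a)")(+ˡ(-₁(sym(e-cong(-₁ ny ∙ alg "--a=a")∙ e-log 0<1-z))))
    total : s ≤ # suc n *(e y - 1#)
    total = ≤t(e≤((∑-ext X \i -> *ˡ(^-cong(suc i)at-n))∙(alg "a=a-0" ∙ +ˡ(-₁(sym at-0)))∙ sym(∑-tele(suc n)(\j -> logpoly X(ζ j)))))
     ((∑-mono(suc n){g = \_ -> e y - 1#} \j _ -> step j)⨾ e≤(∑-const(suc n)(e y - 1#)))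
   bound : ∀ n ε -> 0# < ε -> s * L ≤ # n * ε -> L ≤ # n -> s ≤ L + ε
   bound n ε 0<ε small big = lin(≤*(0≤-by(/-≤(0<#s n)(big ⨾ lin 0≤1(alg "1(1+a)-a=1-0"))))total ⊹ *≤(0≤#(suc n))(*≤(<≤(0<e y))(1+x≤e(- y))⨾ e≤(e-inv y))⊹ e≤ ny ⊹(e≤(alg "a(bc)=abc")⨾ /-≤(0<#s n)(small ⨾ lin(<≤ 0<ε)(alg "a(1+b)-ba=a-0"))))
    (alg "a+b-c=d(e-1)(1-f)+d1+a+b-(c(1-f)+d(e(1-f))+df+cf)")
    where
    open Grid n

 G : ℕ -> R
 G m = ∑P(Y m)∇

 module Layers (τ : R) (0<τ : 0# < τ) where
  ω : ℕ -> R
  ω i = e(-(# i * τ))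
  𝒜 : ℕ ->(ℕ -> R)-> R
  𝒜 X f = ω X * f X + ∑ X(\i ->(ω i - ω(suc i))* f i)

  opaque
   ω-0 : ω 0 ≈ 1#
   ω-0 = trans(e-cong(alg "-(0a)=0"))e-0
   0<ω : ∀ i -> 0# < ω i
   0<ω i = 0<e _
   ω-suc : ∀ i -> ω(suc i)≈ e(- τ)* ω i
   ω-suc i = trans(e-cong(alg "-((1+a)b)=-b+-(ab)"))(e-+ _ _)
   ω≤1 : ∀ i -> ω i ≤ 1#
   ω≤1 i = ≤rs e-0(e-mono(lin(0≤*(0≤# i)(<≤ 0<τ))(alg "0--(ab)=ab-0")))
   ω-dec : ∀ i -> 0# ≤ ω i - ω(suc i)
   ω-dec i = 0≤-by(e-mono(lin(<≤ 0<τ)(alg "-(ab)--((1+a)b)=b-0")))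
   ω-step : ∀ i -> ω i - ω(suc i)≤ τ
   ω-step i = lin(≤*(<≤(0<ω i))(1+x≤e(- τ))⊹ e≤(sym(ω-suc i))⊹ ≤*(<≤ 0<τ)(ω≤1 i))(alg "a-(b-c)=db+c+1a-((1+-a)b+db+ba)")
   layers : ∀ X -> ∑P(Y(suc X))(\p -> ∇ p * rp p τ)≤ 𝒜 X(\i -> G(suc i))
   layers zero = ≤t(∑P-mono(Y 1)\p pp _ -> *≤(0≤∇ pp)(rp≤1 p(<≤ 0<τ))⨾ e≤(alg "a1=a"))(e≤(alg "a=1a+0" ∙ +ʳ(*ʳ(sym ω-0))))
   layers(suc X)= lin(layers X ⊹ ∑P-window{f = \p -> ∇ p * rp p τ}{g = \p -> ω(suc X)* ∇ p}(Y-mono(n≤1+n(suc X)))window ⊹ e≤(∑P-*(Y(suc(suc X)))(ω(suc X))∇)⊹ e≤(sym(∑P-*(Y(suc X))(ω(suc X))∇)))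
    (alg "ab+(c+(d-a)e)-f=de+c+(g-h)+ab+h-(i+(f-i)+g+ae)")
    where
    window : ∀ p -> Prime p -> Y(suc X)N.< p -> p N.≤ Y(suc(suc X))-> ∇ p * rp p τ ≤ ω(suc X)* ∇ p
    window p pp lo _ = ≤rs(alg "ab=ba")(*≤(0≤∇ pp)(e-mono(≤-neg(≤*(<≤ 0<τ)(Y-<lg lo)⨾ e≤(alg "ab=ba")))))
   𝒜-mono : ∀ X{f g} ->(∀ i -> f i ≤ g i)-> 𝒜 X f ≤ 𝒜 X g
   𝒜-mono X q = *≤(<≤(0<ω X))(q X)⊹ ∑-mono X \i _ -> *≤(ω-dec i)(q i)
   𝒜-+ : ∀ X f g -> 𝒜 X(\i -> f i + g i)≈ 𝒜 X f + 𝒜 X g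
   𝒜-+ X f g = trans(+ˡ((∑-ext X \i ->(alg "(a-b)(c+d)=(a-b)c+(a-b)d"))∙ ∑-+ X _ _))
    (alg "a(b+c)+(d+e)=ab+d+(ac+e)")
   𝒜-const : ∀ X c -> 𝒜 X(\_ -> c)≈ c
   𝒜-const zero    c = trans(+ʳ(*ʳ ω-0))(alg "1a+0=a")
   𝒜-const(suc X)c = lin≈(𝒜-const X c)(alg "a-(ba+(c+(d-b)a))=a-(da+c)")
   𝒜-harm : ∀ X -> 𝒜 X(\i -> harm(suc i))≈ ∑(suc X)(\i -> ω i * inv(# suc i))
   𝒜-harm zero    =(alg "a(0+b)+0=0+ab")
   𝒜-harm(suc X)= lin≈(𝒜-harm X)(alg "a+bc-(b(d+c)+(e+(f-b)d))=a-(fd+e)")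
   harm-≤ : ∀ X -> ∑ X(\i -> ω i * inv(# suc i))≤ e τ *(τ - log τ)
   harm-≤ X = e≤(∑-ext X each ∙ ∑-* X(e τ)_)⨾ *≤(<≤(0<e τ))(logpoly-≤ X(<≤(0<e(- τ)))z<1 ⨾
    lin(≤-log(0<-by z<1)(e≤(e-+ _ _ ∙ *ʳ(e-log 0<τ))⨾ lin(≤*(<≤(0<e(- τ)))(1+x≤e τ)⊹ e≤(e-inv τ))(alg "1-a-ba=ca+1-((1+b)a+ca)")))(alg "a-b--c=c-(b+-a)"))
    where
    z<1 : e(- τ)< 1#
    z<1 = <-respʳ e-0(e-mono<(lin< 0<τ(alg "0--a=a-0")))
    power : ∀ i -> e(- τ)^ i ≈ ω i
    power zero    = sym ω-0
    power(suc i)= trans(*ˡ(power i))(sym(ω-suc i))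
    each : ∀ i -> ω i * inv(# suc i)≈ e τ *(inv(# suc i)*(e(- τ)* e(- τ)^ i))
    each i = sym(alg "a(b(cd))=ac(bd)" ∙ *₂(e-inv τ)(*ˡ(power i))∙ alg "1(ab)=ba")
   bump : ∀ m k{C} -> 0# ≤ C -> 𝒜(m N.+ k)(\i -> keep(i N.<? m)C)≤ # m *(τ * C)
   bump m k{C} 0≤C = e≤(+₂(*ˡ(keep-no(m N.+ k N.<? m)(N.≤⇒≯(m≤m+n m k))))(∑-pad _(m≤m+n m k)\i m≤i _ -> *ˡ(keep-no(i N.<? m)(N.≤⇒≯ m≤i))∙ alg "(a-b)0=0"))⨾
    (≤r ⊹ ∑-mono m{g = \_ -> τ * C} \i _ -> each i(i N.<? m))⨾ e≤(+ˡ(∑-const m(τ * C))∙ alg "a0+b(cd)=b(cd)")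
    where
    each : ∀ i(d : Dec(i N.< m))->(ω i - ω(suc i))* keep d C ≤ τ * C
    each i(yes _)= ≤* 0≤C(ω-step i)
    each i(no _)  = rs≤(alg "0=(a-b)0")(0≤*(<≤ 0<τ)0≤C)

 module _ (γ : R) (γ-≤ : ∀ n -> γ + lg (suc n) ≤ harm (suc n)) (η : R) (0<η : 0# < η) (m₀ : ℕ) where
  private
   C : R
   C = G(suc m₀)+ η
   0≤G : ∀ m -> 0# ≤ G m
   0≤G m = ∑P-nonneg(Y m)\p -> 0≤∇
   0≤C : 0# ≤ C
   0≤C = 0≤+(0≤G(suc m₀))(<≤ 0<η)

  opaque
   capped′ :(∀ m -> m₀ N.≤ m -> G m ≤ γ - η + lg m)-> ∀ i -> G(suc i)≤ harm(suc i)+ - η + keep(i N.<? m₀)C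
   capped′ small i with i N.<? m₀
   ... | yes i< = ≤t(∑P-incl(Y-mono(s≤s(N.<⇒≤ i<)))(\p -> 0≤∇))(lin(∑-nonneg(suc i){\i -> inv(# suc i)} \j _ -> <≤(inv⁺(0<#s j)))(alg "a+-b+(c+b)-c=a-0"))
   ... | no i≮  = ≤t(small(suc i)(m≤1+n(N.≮⇒≥ i≮)))(lin(γ-≤ i)(alg "a+-b+0-(c-b+d)=a-(c+d)"))
   limited :(∀ m -> m₀ N.≤ m -> G m ≤ γ - η + lg m)-> ∀ τ -> 0# < τ -> - log τ ≤ e τ *(τ - log τ)+ - η + # m₀ *(τ * C)
   limited small τ 0<τ = e≤(sym(log-inv 0<τ))⨾ log-≤(inv⁺ 0<τ)(zeta-≤ τ 0<τ _ \N -> ∑P-incl(N≤ N)(\p pp -> 0≤*(0≤∇ pp)(<≤(0<rp p τ)))⨾ layers(m₀ N.+ N)⨾ 𝒜-mono(m₀ N.+ N)(capped′ small)⨾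
    e≤(𝒜-+(m₀ N.+ N)(\i -> harm(suc i)+ - η)_ ∙ +ʳ(𝒜-+(m₀ N.+ N)(\i -> harm(suc i))(\_ -> - η)∙ +₂(𝒜-harm(m₀ N.+ N))(𝒜-const(m₀ N.+ N)(- η))))⨾
     harm-≤(suc(m₀ N.+ N))⊹ ≤r ⊹ bump m₀ N 0≤C)
    where
    open Layers τ 0<τ
    N≤ : ∀ N -> N N.≤ Y(suc(m₀ N.+ N))
    N≤ N with m≤Y(suc(m₀ N.+ N))
    ... | inl q = trN(trN(N.m≤n+m N m₀)(n≤1+n _))(N.<⇒≤ q)
   contradiction : ¬(∀ m -> m₀ N.≤ m -> G m ≤ γ - η + lg m)
   contradiction small with arch(# 7 + # m₀ * C)η 0<η
   ... | N , big = inv⁺(0<#s(suc N))(lin(limited small τ 0<τ ⊹ ≤*(lin(log≤x-1 0<τ ⊹ 0≤1)(alg "a-b-0=a-1+1-(b+0)"))(e-≤ τ<1 ⨾ cancel(0<-by τ<1)(rs≤(sym(inv-r(0<-by τ<1)))(lin(≤*(<≤ 0<τ)2τ≤1)(alg "(1-a)(1+2a)-1=1a-2aa"))))⊹ τℓ ⊹ τℓ ⊹ ≤*(0≤+(0≤# 1)(0≤*(0≤# m₀)0≤C))τ≤x ⊹ /-≤(0<#s(suc N))(big ⨾ lin(<≤ 0<η ⊹ <≤ 0<η)(alg "a(1+(1+b))-ba=a+a-(0+0)"))⊹ τ≤x ⊹ ≤*(<≤ 0<τ)2τ≤1)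
    (alg "0-a=b(c-d)+-e+f(cg)+(1+2c)(c-d)+2a+2a+a(#1+fg)+e+a+1c-(-d+b(c-d)+c(-d)+c(-d)+c(#1+fg)+(7+fg)a+c+2cc)"))
    where
    x τ : R
    x = inv(# suc(suc N))
    τ = x * x
    0<x : 0# < x
    0<x = inv⁺(0<#s(suc N))
    0<τ : 0# < τ
    0<τ = *-pos 0<x 0<x
    2x≤1 : # 2 * x ≤ 1#
    2x≤1 = ≤t(≤*(<≤ 0<x)(#-mono{2}{suc(suc N)}(s≤s(s≤s z≤n))))(e≤(inv-r(0<#s(suc N))))
    τ≤x : τ ≤ x
    τ≤x = ≤t(*≤(<≤ 0<x)(lin(2x≤1 ⊹ <≤ 0<x)(alg "1-a=1+a-(2a+0)")))(e≤(alg "a1=a"))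
    2τ≤1 : # 2 * τ ≤ 1#
    2τ≤1 = ≤t(*≤(0≤# 2)τ≤x)2x≤1
    τ<1 : τ < 1#
    τ<1 q = 0<1(lin(q ⊹ q ⊹ 2τ≤1)(alg "0-1=a+a+1-(1+1+2a)"))
    τℓ : τ * - log τ ≤ # 2 * x
    τℓ = *≤(<≤ 0<τ)-log≤ ⨾ e≤(alg "aa(2(1+(1+b)))=2a((1+(1+b))a)" ∙ *ˡ(inv-r(0<#s(suc N)))∙ alg "2a1=2a")
     where
     -log≤ : - log τ ≤ # 2 * # suc(suc N)
     -log≤ = lin(log≤x-1(0<#s(suc N))⊹ log≤x-1(0<#s(suc N))⊹ e≤(sym(log-inv(0<#s(suc N))))⊹ e≤(sym(log-inv(0<#s(suc N))))⊹ e≤(sym(log-* 0<x 0<x))⊹ 0≤# 2)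
      (alg "2a--b=a-1+(a-1)+c+c+b+2-(d+d+-d+-d+(c+c)+0)")
   euler-infinitely-often : ∃ \m -> m₀ N.≤ m × γ - η + lg m ≤ G m
   euler-infinitely-often with em{∃ \m -> m₀ N.≤ m × γ - η + lg m ≤ G m}
   ... | yes p = p
   ... | no n  = absurd(contradiction \m q -> <≤ \r -> n(m , q , r))

 without :{P : Set} -> Dec P -> R -> R
 without(yes _)x = 0#
 without(no _)  x = x

 coprimeTo : List ℕ -> ℕ -> R
 coprimeTo []      n = 1#
 coprimeTo(p ∷ S)n = without(p ∣? n)(coprimeTo S n)

 opaque
  coprimeTo-* : ∀ {S} p -> Prime p -> DPrimes S -> All(\q -> ¬(q ≡ p))S -> ∀ m -> coprimeTo S(p N.* m)≈ coprimeTo S m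
  coprimeTo-* p pp [] [] m = refl
  coprimeTo-*{q ∷ S} p pp((pq , _)∷ dS)(q≢p ∷ nS)m with q ∣?(p N.* m)| q ∣? m
  ... | yes _ | yes _ = refl
  ... | no _  | no _  = coprimeTo-* p pp dS nS m
  ... | no n  | yes d = absurd(n(N.∣n⇒∣m*n p d))
  ... | yes d | no n with euclidsLemma p m pq d
  ...   | inl d' = absurd(prime∤prime pp pq q≢p d')
  ...   | inr d' = absurd(n d')

  e-∇ : ∀ {p} -> Prime p -> e(- ∇ p)≈ 1# - inv(# p)
  e-∇{p} pp = trans(e-cong(alg "--a=a"))(e-log(0<1-inv pp))

  count-coprime : ∀ {S} N -> DPrimes S -> All(_∣ N)S -> ∑ N(coprimeTo S)≈ # N * e(- sumL S ∇)
  count-coprime{[]} N [] [] = trans(∑-const N 1#)(*ˡ(sym(e-cong(alg "-0=0")∙ e-0)))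
  count-coprime{p ∷ S} N((pp , nS)∷ dS)(N.divides M E.refl ∷ ds)=((∑-ext(M N.* p)\n -> remove(p ∣? n)(coprimeTo S n))∙ ∑--(M N.* p)(coprimeTo S)_ ∙ +₂(count-coprime(M N.* p)dS ds)(-₁(∑-multiples p{{pr≢0 pp}} M(coprimeTo S)∙ ∑-ext M(coprimeTo-* p pp dS nS)∙ count-coprime M dS(quotients nS dS ds))))∙
   +ʳ(*ʳ(#-* M p))∙ lin≈(*ˡ{# M * e(- sumL S ∇)}(inv-r(0<# p{{pr≢0 pp}})))(alg "ab((1-c)d)-(abd-ad)=ad1-ad(bc)")∙ sym(*₂(#-* M p)((e-cong(alg "-(a+b)=-a+-b")∙ e-+ _ _)∙ *ʳ(e-∇ pp)))
   where
   remove : ∀ {P : Set}(d : Dec P)y -> without d y ≈ y - keep d y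
   remove(yes _)y =(alg "0=a-a")
   remove(no _)  y =(alg "a=a-0")
   quotients : ∀ {S} -> All(\q -> ¬(q ≡ p))S -> DPrimes S -> All(_∣ M N.* p)S -> All(_∣ M)S
   quotients [] [] [] = []
   quotients(q≢p ∷ nS)((pq , _)∷ dS)(d ∷ ds)with euclidsLemma M p pq d
   ... | inl d' = d' ∷ quotients nS dS ds
   ... | inr d' = absurd(prime∤prime pp pq q≢p d')

  length-filter : ∀ {P : ℕ -> Set}(P? : ∀ n -> Dec(P n))(f : ℕ -> ℕ)n -> # length(filter P?(applyUpTo f n))≈ ∑ n(\i -> keep(P?(f i))1#)
  length-filter P? f zero    = refl
  length-filter P? f(suc n)= head ∙ sym(∑-first n _)
   where
   head : # length(filter P?(applyUpTo f(suc n)))≈ keep(P?(f 0))1# + ∑ n(\i -> keep(P?(f(suc i)))1#)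
   head with P?(f 0)
   ... | yes _ = +ˡ(length-filter P?(\i -> f(suc i))n)
   ... | no _  = trans(length-filter P?(\i -> f(suc i))n)(alg "a=0+a")

 totient : ℕ -> ℕ
 totient q = length(filter(\k -> coprime? k q)(map suc(upTo q)))

 module _ (q : ℕ) (1<q : 1 N.< q) where
  private
   divisors : List ℕ -> List ℕ
   divisors []      = []
   divisors(p ∷ S)with p ∣? q
   ... | yes _ = p ∷ divisors S
   ... | no _  = divisors S

  opaque
   divisors-∣ : ∀ S -> All(_∣ q)(divisors S)
   divisors-∣ []      = []
   divisors-∣(p ∷ S)with p ∣? q
   ... | yes d = d ∷ divisors-∣ S
   ... | no _  = divisors-∣ S
   divisors-all : ∀ {P : ℕ -> Set}{S} -> All P S -> All P(divisors S)
   divisors-all [] = []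
   divisors-all{S = p ∷ S}(a ∷ as)with p ∣? q
   ... | yes _ = a ∷ divisors-all as
   ... | no _  = divisors-all as
   divisors-distinct : ∀ {S} -> DPrimes S -> DPrimes(divisors S)
   divisors-distinct [] = []
   divisors-distinct{p ∷ S}((pp , n)∷ dS)with p ∣? q
   ... | yes _ =(pp , divisors-all n)∷ divisors-distinct dS
   ... | no _  = divisors-distinct dS
   divisors-sum : ∀ S f -> sumL(divisors S)f ≈ sumL S(\p -> keep(p ∣? q)(f p))
   divisors-sum []      f = refl
   divisors-sum(p ∷ S)f with p ∣? q
   ... | yes _ = +ˡ(divisors-sum S f)
   ... | no _  = trans(divisors-sum S f)(alg "a=0+a")
   coprime-≤ : ∀ n S -> All Prime S -> All(_∣ q)S -> keep(coprime? n q)1# ≤ coprimeTo S n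
   coprime-≤ n S ps ds with coprime? n q
   ... | yes c = e≤(sym(go S ps ds))
    where
    go : ∀ S -> All Prime S -> All(_∣ q)S -> coprimeTo S n ≈ 1#
    go []      []        []       = refl
    go(p ∷ S)(pp ∷ ps)(d ∷ ds)with p ∣? n
    ... | yes d' = absurd(N.<⇒≢(prime>1 pp)(E.sym(c(d' , d))))
    ... | no _   = go S ps ds
   ... | no _ = go S
    where
    go : ∀ S -> 0# ≤ coprimeTo S n
    go []      = 0≤1
    go(p ∷ S)with p ∣? n
    ... | yes _ = ≤r
    ... | no _  = go S
   totient-≤ : ∀ N -> # totient q ≤ # q * e(- ∑P N(\p -> keep(p ∣? q)(∇ p)))
   totient-≤ N = e≤(rfx(E.cong(\l -> # length(filter(\k -> coprime? k q)l))(map-upTo suc q))∙ length-filter(\k -> coprime? k q)suc q ∙ alg "a=0+a" ∙ +ʳ(sym(keep-no(coprime? 0 q)\c -> N.<⇒≢ 1<q(E.sym(c(N._∣0 q , N.∣-refl)))))∙ sym(∑-first q f)∙ +ˡ(keep-no(coprime? q q)\c -> N.<⇒≢ 1<q(E.sym(c(N.∣-refl , N.∣-refl))))∙ alg "a+0=a")⨾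
    (∑-mono q \n _ -> coprime-≤ n(divisors(primes N))(divisors-all(All.map fst(primes-≤ N)))(divisors-∣(primes N)))⨾
     e≤(count-coprime q(divisors-distinct(primes-dp N))(divisors-∣(primes N))∙ *ˡ(e-cong(-₁(divisors-sum(primes N)∇ ∙ sumL-pr N _))))
    where
    f : ℕ -> R
    f n = keep(coprime? n q)1#

 module _ {x w : ℂ} (w-eq : (1c -c x) *c w ~ x) (2x≤1 : # 2 * ∥ x ∥ ≤ 1#) where
  opaque
   ∥w∥ : ∥ w ∥ ≤ # 2 * ∥ x ∥
   ∥w∥ = lin(∥-+ x(x *c w)⊹ ∥-+ x(x *c w)⊹ e≤(∥-cg{w}{x +c x *c w}(lin≈c w-eq(algc "a+ab-b=a-(1-a)b")))⊹ e≤(∥-cg{w}{x +c x *c w}(lin≈c w-eq(algc "a+ab-b=a-(1-a)b")))⊹ e≤(∥-* x w)⊹ e≤(∥-* x w)⊹ ≤*(0≤∥ w)2x≤1)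
    (alg "2a-b=a+c+(a+c)+d+d+ab+ab+1b-(d+d+b+b+c+c+2ab)")
   ∥w-x∥ : ∥ w -c x ∥ ≤ # 2 *(∥ x ∥ * ∥ x ∥)
   ∥w-x∥ = ≤t(e≤(∥-cg{w -c x}{x *c w}(lin≈c w-eq(algc "ab-(b-a)=a-(1-a)b"))∙ ∥-* x w))(*≤(0≤∥ x)∥w∥ ⨾ e≤(alg "a(2a)=2(aa)"))
   ∥w²-x∥ : ∥ w *c(1c +c w)-c x ∥ ≤ # 6 *(∥ x ∥ * ∥ x ∥)
   ∥w²-x∥ = ≤t(e≤(∥-cg(algc "a(1+a)-b=a-b+aa"))⨾ ∥-+(w -c x)(w *c w))(∥w-x∥ ⊹ ≤t(e≤(∥-* w w))(*-mono(0≤∥ w)(0≤∥ w ⨾ ∥w∥)∥w∥ ∥w∥)⨾ e≤(alg "2(aa)+2a(2a)=6(aa)"))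
   ∥1+w∥ : ∥ 1c +c w ∥ ≤ # 2
   ∥1+w∥ = ≤t(∥-+ 1c w)(e≤ ∥-1 ⊹ ≤t ∥w∥ 2x≤1 ⨾ e≤(alg "1+1=2"))

 module _ {x w x' w' : ℂ} (w-eq : (1c -c x) *c w ~ x) (2x≤1 : # 2 * ∥ x ∥ ≤ 1#) (w'-eq : (1c -c x') *c w' ~ x') (2x'≤1 : # 2 * ∥ x' ∥ ≤ 1#) where
  opaque
   ∥w-w'∥ : ∥ w -c w' ∥ ≤ # 4 * ∥ x -c x' ∥
   ∥w-w'∥ = ≤t(e≤(∥-cg{w -c w'}{(x -c x')*c((1c +c w)*c(1c +c w'))}(lin≈c(+₂c(*ʳc{1c +c w'} w-eq)(-₁c(*ˡc{1c +c w} w'-eq)))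
    (algc "(a-b)((1+c)(1+d))-(c-d)=a(1+d)-(1+c)b-((1-a)c(1+d)-(1+c)((1-b)d))"))∙ ∥-* _ _ ∙ *ˡ(∥-* _ _)))
    (*≤(0≤∥(x -c x'))(*-mono(0≤∥(1c +c w))(0≤# 2)(∥1+w∥ w-eq 2x≤1)(∥1+w∥ w'-eq 2x'≤1))⨾ e≤(alg "a(2(2))=4a"))
   ∥w²-w'²∥ : ∥ w *c(1c +c w)-c w' *c(1c +c w')∥ ≤ # 12 * ∥ x -c x' ∥
   ∥w²-w'²∥ = ≤t(e≤(∥-cg(algc "a(1+a)-b(1+b)=(a-b)(1+a+b)")∙ ∥-* _ _))
    (*-mono(0≤∥(w -c w'))(0≤# 3)∥w-w'∥(∥-+(1c +c w)w' ⨾ ∥1+w∥ w-eq 2x≤1 ⊹ ≤t(∥w∥ w'-eq 2x'≤1)2x'≤1 ⨾ e≤(alg "2+1=3"))⨾ e≤(alg "4a3=12a"))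

 opaque
  ∑Pc-+ : ∀ N f g -> ∑Pc N(\p -> f p +c g p)~ ∑Pc N f +c ∑Pc N g
  ∑Pc-+ N f g =(∑c-ext(suc N)\p -> split(prime? p))⊙ ∑c-+(suc N)_ _
   where
   split : ∀ {p}(d : Dec(Prime p))-> keepc d(f p +c g p)~ keepc d(f p)+c keepc d(g p)
   split(yes _)= reflc
   split(no _)  =(algc "0=0+0")

  ∑Pc-* : ∀ N c f -> ∑Pc N(\p -> c *c f p)~ c *c ∑Pc N f
  ∑Pc-* N c f =(∑c-ext(suc N)\p -> split(prime? p))⊙ ∑c-*(suc N)c _
   where
   split : ∀ {p}(d : Dec(Prime p))-> keepc d(c *c f p)~ c *c keepc d(f p)
   split(yes _)= reflc
   split(no _)  =(algc "0=a0")

  ∑Pc-cong : ∀ N{f g} ->(∀ p -> Prime p -> p N.≤ N -> f p ~ g p)-> ∑Pc N f ~ ∑Pc N g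
  ∑Pc-cong N q = ∑c-cong(suc N)\p p<N -> keepc-cong(prime? p)\pp -> q p pp(N.s≤s⁻¹ p<N)

  ∑Pc-of : ∀ N f -> ∑Pc N(\p -> cx(f p))~ cx(∑P N f)
  ∑Pc-of N f =(∑c-ext(suc N)\p -> pull(prime? p))⊙ symc(of-∑(suc N)_)
   where
   pull : ∀ {p}(d : Dec(Prime p))-> keepc d(cx(f p))~ cx(keep d(f p))
   pull(yes _)= reflc
   pull(no _)  = reflc

  ∑Pc-window : ∀ {m n} f g -> m N.≤ n ->(∀ p -> Prime p -> m N.< p -> p N.≤ n -> f p ~ g p)-> ∑Pc n f ~ ∑Pc m f +c(∑Pc n g -c ∑Pc m g)
  ∑Pc-window{m}{n} f g m≤n q with m+o≡n m≤n
  ... | k , E.refl = go k q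
   where
   go : ∀ k ->(∀ p -> Prime p -> m N.< p -> p N.≤ m N.+ k -> f p ~ g p)-> ∑Pc(m N.+ k)f ~ ∑Pc m f +c(∑Pc(m N.+ k)g -c ∑Pc m g)
   go zero q rewrite N.+-identityʳ m =(algc "a=a+(b-b)")
   go(suc k)q rewrite N.+-suc m k = lin≈c(+₂c(go k \p pp a b -> q p pp a(m≤1+n b))(keepc-cong(prime?(suc(m N.+ k)))\pp -> q _ pp(s≤s(m≤m+n m k))rfN))
    (algc "a+(b+c-d)-(e+f)=a+(b-d)+c-(e+f)")

 c₃ : R
 c₃ = wB 2(inv(# 3))

 opaque
  ∑lg/p² : ∀ N -> ∑P N(\p -> lg p *(inv(# p)* inv(# p)))≤ wB 1(inv 2#)
  ∑lg/p² N = ≤t(∑P≤∑ N{g = W 1 2#}(0≤W 1 2#)\p pp -> e≤(W2-term p{{pr≢0 pp}}))(W2-bound(suc N))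

  ∑lg²/p² : ∀ N -> ∑P N(\p -> lg p * lg p *(inv(# p)* inv(# p)))≤ c₃
  ∑lg²/p² N =(∑P≤∑ N{g = W 2 2#}(0≤W 2 2#)\p pp -> e≤(each p{{pr≢0 pp}}))⨾ ∑W≤ 2(inv⁺(0<#s 2))(e≤(+ˡ(inv-r(0<#s 2))∙ alg "1+1=2"))(suc N)
   where
   each : ∀ n .{{_ : Nz n}} -> lg n * lg n *(inv(# n)* inv(# n))≈ W 2 2# n
   each n@(suc _)= trans(alg "aa(bb)=a(a(bb))" ∙ *ˡ(W2-term n))(alg "a(a1b)=a(a1)b")

 module Ideal (s : R) (0<s : 0# < s) where
  X :(ℕ -> ℂ)-> ℕ -> ℂ
  X θ p = θ p *c cx(rp p(1# + s))

  opaque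
   rp-split : ∀ p .{{_ : Nz p}} -> rp p(1# + s)≈ inv(# p)* rp p s
   rp-split p = trans(rp-+ p 1# s)(*ʳ(rp-1 p))
   rp≤inv : ∀ {p} -> Prime p -> rp p(1# + s)≤ inv(# p)
   rp≤inv{p} pp = rs≤(sym(rp-split p{{pr≢0 pp}}))(*≤(<≤(inv⁺(0<# p{{pr≢0 pp}})))(rp≤1 p(<≤ 0<s))⨾ e≤(alg "a1=a"))

  module Phase (θ : ℕ -> ℂ) (unit : ∀ p -> ∥ θ p ∥ ≈ 1#) where
   open Local (X θ) public
   opaque
    ∥X∥ : ∀ p -> ∥ X θ p ∥ ≈ rp p(1# + s)
    ∥X∥ p = trans(∥-* _ _)(*₂(unit p)(∥-of(<≤(0<rp p _)))∙ alg "1a=a")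
    2X≤1 : ∀ {p} -> Prime p -> # 2 * ∥ X θ p ∥ ≤ 1#
    2X≤1{p} pp = ≤t(*≤(0≤# 2)(rs≤(sym(∥X∥ p))(rp≤inv pp)))(prime-inv pp)
    X-eq : ∀ {p} -> Prime p ->(1c -c X θ p)*c u p ~ X θ p
    X-eq{p} pp = u-eq p \q -> 0<1(lin(q ⊹ q ⊹ 2X≤1 pp)(alg "0-1=a+a+1-(1+1+2a)"))
    ∥X∥² : ∀ {p} -> Prime p -> ∥ X θ p ∥ * ∥ X θ p ∥ ≤ inv(# p)* inv(# p)
    ∥X∥²{p} pp = *-mono(0≤∥ _)(<≤(inv⁺(0<# p{{pr≢0 pp}})))X≤ X≤
     where
     X≤ : ∥ X θ p ∥ ≤ inv(# p)
     X≤ = rs≤(sym(∥X∥ p))(rp≤inv pp)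
    S₁-primes : ∀ n -> S₁(primes n)~ ∑Pc n(\p -> cx(lg p)*c u p)
    S₁-primes zero    =(algc "0=0+0")
    S₁-primes(suc n)with prime?(suc n)
    ... | yes _ = +ʳc(S₁-primes n)
    ... | no _  = trc(S₁-primes n)(algc "a=a+0")
    S₂-primes : ∀ n -> S₂(primes n)~ ∑Pc n(\p -> cx(lg p)*c cx(lg p)*c(u p *c(1c +c u p)))
    S₂-primes zero    =(algc "0=0+0")
    S₂-primes(suc n)with prime?(suc n)
    ... | yes _ = +ʳc(S₂-primes n)
    ... | no _  = trc(S₂-primes n)(algc "a=a+0")
    ∥of-lg*∥ : ∀ p z -> ∥ cx(lg p)*c z ∥ ≈ lg p * ∥ z ∥
    ∥of-lg*∥ p z = trans(∥-* _ _)(*ʳ(∥-of(0≤lg p)))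
    ∥of-lg²*∥ : ∀ p z -> ∥ cx(lg p)*c cx(lg p)*c z ∥ ≈ lg p * lg p * ∥ z ∥
    ∥of-lg²*∥ p z = trans(∥-* _ _)(*ʳ(∥-* _ _ ∙ *₂(∥-of(0≤lg p))(∥-of(0≤lg p))))
   module Prefixes {C : R} (prefix : ∀ n -> ∥ ∑Pc n (\p -> cx (lg p) *c (θ p *c cx (inv (# p)))) ∥ ≤ C) where
    opaque
     from-zero : ∀ {f : ℕ -> ℂ} ->(∀ n -> ∥ ∑Pc n f ∥ ≤ C)-> ∀ n -> ∥ ∑ᶜ n(\p -> keepc(prime? p)(f p))∥ ≤ C
     from-zero q zero    = ≤t(e≤ ∥-0)(0≤∥ _ ⨾ q 0)
     from-zero q(suc n)= q n
     pull : ∀ {p}{z w : ℂ}(d : Dec(Prime p))-> keepc d(z *c w)~ keepc d z *c w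
     pull(yes _)= reflc
     pull{w = w}(no _)  =(algc "0=0a")
     rp-dec : ∀ i -> rp(suc i)s ≤ rp i s
     rp-dec zero      = e≤(rp1 s ∙ sym(e-cong(-₁(*ˡ log-0)∙ alg "-(a0)=0")∙ e-0))
     rp-dec i@(suc _)= rp-mono(<≤ 0<s)(n≤1+n i)
     prefix-X : ∀ n -> ∥ ∑Pc n(\p -> cx(lg p)*c X θ p)∥ ≤ C
     prefix-X n = ≤t(e≤(∥-cg(∑c-ext(suc n)\p ->(keepc-cong(prime? p)\pp -> *ˡc{cx(lg p)}(*ˡc{θ p}(of-cong(rp-split p{{pr≢0 pp}})⊙ of-*(inv(# p))(rp p s)))⊙
      algc "a(b(cd))=a(bc)d")⊙ pull(prime? p))))
      (abel-dec(suc n)(from-zero prefix)(\i -> <≤(0<rp i s))rp-dec ⨾ e≤(*ˡ(e-cong(-₁(*ˡ log-0)∙ alg "-(a0)=0")∙ e-0)∙ alg "a1=a"))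
     prefix₁ : ∀ n -> ∥ ∑Pc n(\p -> cx(lg p)*c u p)∥ ≤ C + # 2 * wB 1(inv 2#)
     prefix₁ n = ≤t(e≤(∥-cg((∑Pc-cong n \p _ _ ->(algc "ab=ac+a(b-c)"))⊙ ∑Pc-+ n _ _)))
      (∥-+ _ _ ⨾ prefix-X n ⊹ ≤t(∑Pc-norm n _)((∑P-mono n \p pp _ -> e≤(∥of-lg*∥ p _)⨾ *≤(0≤lg p)(∥w-x∥(X-eq pp)(2X≤1 pp)⨾ *≤(0≤# 2)(∥X∥² pp))⨾ e≤(alg "a(2(bb))=2(a(bb))"))⨾
       e≤(∑P-* n(# 2)_)⨾ *≤(0≤# 2)(∑lg/p² n)))
     prefix₂ : ∀ n -> ∥ ∑Pc n(\p -> cx(lg p)*c cx(lg p)*c(u p *c(1c +c u p)))∥ ≤ # 2 * C * lg(suc n)+ # 6 * c₃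
     prefix₂ n = e≤(∥-cg((∑Pc-cong n \p _ _ ->(algc "aa(b(1+b))=aca+aa(b(1+b)-c)"))⊙ ∑Pc-+ n _ _))⨾
      ∥-+ _ _ ⨾(e≤(∥-cg(∑c-ext(suc n)\p -> pull(prime? p)))⨾ abel(suc n)(from-zero prefix-X)⨾ e≤(*ˡ(+₂(abs-0≤(0≤lg(suc n)))((∑-ext(suc n)\i -> abs-0≤(lg-inc i))∙ ∑-tele(suc n)lg ∙ +ˡ(-₁ log-0)))∙ alg "a(b+(b-0))=2ab"))⊹ ≤t(∑Pc-norm n _)((∑P-mono n \p pp _ -> e≤(∥of-lg²*∥ p _)⨾ *≤(0≤*(0≤lg p)(0≤lg p))(∥w²-x∥(X-eq pp)(2X≤1 pp)⨾ *≤(0≤# 6)(∥X∥² pp))⨾ e≤(alg "aa(6(bb))=6(aa(bb))"))⨾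
       e≤(∑P-* n(# 6)_)⨾ *≤(0≤# 6)(∑lg²/p² n))
      where
      lg-inc : ∀ i -> 0# ≤ lg(suc i)- lg i
      lg-inc zero      = 0≤-by(rs≤(sym log-0)(0≤lg 1))
      lg-inc i@(suc _)= 0≤-by(lg-mono(n≤1+n i))

 choose :{P : Set} -> Dec P -> ℂ -> ℂ -> ℂ
 choose(yes _)z w = z
 choose(no _)  z w = w

 Y≢0 : ∀ m -> Nz(Y m)
 Y≢0 m = N.>-nonZero(0<Y m)

 opaque
  choose-yes : ∀ {P : Set}(d : Dec P){z w} -> P -> choose d z w ≡ z
  choose-yes(yes _)_ = E.refl
  choose-yes(no n)  p = absurd(n p)

  choose-no : ∀ {P : Set}(d : Dec P){z w} -> ¬ P -> choose d z w ≡ w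
  choose-no(yes p)n = absurd(n p)
  choose-no(no _)  _ = E.refl

  choose-unit : ∀ {P : Set}(d : Dec P){z w} -> ∥ z ∥ ≈ 1# -> ∥ w ∥ ≈ 1# -> ∥ choose d z w ∥ ≈ 1#
  choose-unit(yes _)p q = p
  choose-unit(no _)  p q = q

  reach : ∀ {f : ℕ -> R}{a b t j} -> 0# ≤ j -> 0# ≤ t -> a N.≤ b ->(∀ p -> Prime p -> a N.< p -> f p ≤ j)-> t ≤ ∑P b f - ∑P a f ->
   ∃ \n -> a N.≤ n × n N.≤ b × t ≤ ∑P n f - ∑P a f × ∑P n f - ∑P a f ≤ t + j
  reach{f}{a}{b}{t}{j} 0≤j 0≤t a≤b jump big with m+o≡n a≤b
  ... | k , E.refl = go k big
   where
   go : ∀ k -> t ≤ ∑P(a N.+ k)f - ∑P a f -> ∃ \n -> a N.≤ n × n N.≤ a N.+ k × t ≤ ∑P n f - ∑P a f × ∑P n f - ∑P a f ≤ t + j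
   go zero    big rewrite N.+-identityʳ a = a , rfN , rfN , big , lin(0≤+ 0≤t 0≤j)(alg "a+b-(c-c)=a+b-0")
   go(suc k)big with ≤∨< t(∑P(a N.+ k)f - ∑P a f)
   ... | inl q = let n , p₁ , p₂ , p₃ = go k q in n , p₁ , trN p₂(N.+-monoʳ-≤ a(n≤1+n k)), p₃
   ... | inr q rewrite N.+-suc a k = suc(a N.+ k), m≤1+n(m≤m+n a k), rfN , big , lin(<≤ q ⊹ step(prime?(suc(a N.+ k)))\pp -> jump _ pp(s≤s(m≤m+n a k)))
    (alg "a+b-(c+d-e)=a+b-(c-e+d)")
    where
    step : ∀ {p}(d : Dec(Prime p))->(Prime p -> f p ≤ j)-> keep d(f p)≤ j
    step(yes pp)q = q pp
    step(no _)   q = 0≤j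

  ∑Pc-tail : ∀ {m n} f -> m N.≤ n -> ∥ ∑Pc n f -c ∑Pc m f ∥ ≤ ∑P n(\p -> ∥ f p ∥)- ∑P m(\p -> ∥ f p ∥)
  ∑Pc-tail{m}{n} f m≤n = ∑-tail _(s≤s m≤n)⨾ e≤(+₂(∑-ext(suc n)\p -> sized(prime? p))(-₁(∑-ext(suc m)\p -> sized(prime? p))))
   where
   sized : ∀ {p}(d : Dec(Prime p))-> ∥ keepc d(f p)∥ ≈ keep d ∥ f p ∥
   sized(yes _)= refl
   sized(no _)  = ∥-0

  lgY≥ : ∀ m -> # m ≤ lg(Y m)+ 1#
  lgY≥ m = ≤t(Y-<lg{m = m}(N.n<1+n(Y m)))(lg-step≤(Y m){{Y≢0 m}} ⨾ ≤r ⊹ ≤t(inv-anti 0<1(e≤(alg "1=#1")⨾ #-mono(0<Y m)))(e≤(sym(inv-uniq(alg "1(1)=1")))))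
 cₘ : R
 cₘ = # 2 + c₂ + # 4 * lg 2

 opaque
  mertens-window : ∀ x g -> # g - cₘ ≤ ∑lg/p(Y(x N.+ g))- ∑lg/p(Y x)
  mertens-window x g = lin(lgY≥(x N.+ g)⊹ e≤(sym(#-+ x g))⊹ mertens-≥(Y(x N.+ g)){{Y≢0(x N.+ g)}} ⊹ mertens-≤(Y x){{Y≢0 x}} ⊹ lg-≤{Y x}{x}{{Y≢0 x}} rfN)
   (alg "a-b-(c-(2+d+4e))=f+1+g+(a+(1+d))+(h+4e)+i-(g+(i+c)+f+b+h)")

  ∑lg/p-≤ : ∀ m -> ∑lg/p(Y m)≤ # m + # 4 * lg 2
  ∑lg/p-≤ m = ≤t(mertens-≤(Y m){{Y≢0 m}})(lg-≤{Y m}{m}{{Y≢0 m}} rfN ⊹ ≤r)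

 module Select (θ⁰ : ℕ -> ℂ) (unit⁰ : ∀ p -> ∥ θ⁰ p ∥ ≈ 1#) (C : R) (prefix : ∀ n -> ∥ ∑Pc n (\p -> cx (lg p) *c (θ⁰ p *c cx (inv (# p)))) ∥ ≤ C)
  (m g : ℕ)(s : R)(0<s : 0# < s)(s-small : s * #(m N.+ g N.+ g N.+ g)≤ h)(M : R)(0≤M : 0# ≤ M)where

  C₁ : R
  C₁ = C + # 2 * wB 1(inv 2#)

  module _ (room : # 2 * (M + # 2 + # 3 * C₁) + cₘ ≤ # g) (turn : # 1 + # 6 * C * (# (m N.+ g N.+ g N.+ g) + 1#) + # 30 * c₃ + # 2 * # (m N.+ g) + # 3 * C₁ * # (m N.+ g N.+ g) ≤ # g * M) (3C₁≤M : # 3 * C₁ < M) where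
   open Ideal s 0<s
   private
    a b c d : ℕ
    a = Y m
    b = Y(m N.+ g)
    c = Y(m N.+ g N.+ g)
    d = Y(m N.+ g N.+ g N.+ g)
    f : ℕ -> R
    f p = lg p * rp p(1# + s)
    j err : R
    j = # 2 * e(-(# m * h))
    err = # 2 * e(- # m)*(#(m N.+ g N.+ g N.+ g)+ # 4 * lg 2)
    module P⁰ = Phase θ⁰ unit⁰
    module D⁰ = P⁰.Prefixes prefix
    opaque
     a≤b : a N.≤ b
     a≤b = Y-mono(m≤m+n m g)
     b≤c : b N.≤ c
     b≤c = Y-mono(m≤m+n(m N.+ g)g)
     c≤d : c N.≤ d
     c≤d = Y-mono(m≤m+n(m N.+ g N.+ g)g)
     0≤j : 0# ≤ j
     0≤j = 0≤*(0≤# 2)(<≤(0<e _))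
     e-m≤1 : ∀ {x} -> 0# ≤ x -> e(- x)≤ 1#
     e-m≤1{x} q = ≤rs e-0(e-mono(lin q(alg "0--a=a-0")))
     j≤2 : j ≤ # 2
     j≤2 = ≤t(*≤(0≤# 2)(e-m≤1(0≤*(0≤# m)0≤h)))(e≤(alg "2(1)=2"))
     0≤f : ∀ p -> 0# ≤ f p
     0≤f p = 0≤*(0≤lg p)(<≤(0<rp p _))
     inv-p : ∀ p .{{_ : Nz p}} -> inv(# p)≈ e(- lg p)
     inv-p p = trans(sym(rp-1 p))(e-cong(alg "-(1a)=-a"))
     inv-p≤ : ∀ p -> Prime p -> a N.< p -> inv(# p)≤ e(- # m)
     inv-p≤ p pp q = rs≤(sym(inv-p p{{pr≢0 pp}}))(e-mono(≤-neg(Y-<lg q)))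
     jump : ∀ p -> Prime p -> a N.< p -> f p ≤ j
     jump p pp q = ≤t(*≤(0≤lg p)(rp≤inv pp))(e≤(*ˡ(inv-p p{{pr≢0 pp}}))⨾
      ≤*(<≤(0<e _))(lin(*≤(0≤# 2)(1+x≤e(lg p * h))⊹ 0≤# 2 ⊹ e≤(*ˡ{lg p}(sym 2h)))(alg "2a-b=2a+2+b(2c)-(2(1+bc)+0+b1)"))⨾ e≤(alg "2ab=2(ab)" ∙ *ˡ(sym(e-+ _ _)∙ e-cong(lin≈(*ˡ{lg p} 2h)(alg "-(ab)-(ab+-a)=a1-a(2b)"))))⨾
       *≤(0≤# 2)(e-mono(≤-neg(≤* 0≤h(Y-<lg q)))))
     f-window : ∀ x -> x N.+ g N.≤ m N.+ g N.+ g N.+ g -> h *(# g - cₘ)≤ ∑P(Y(x N.+ g))f - ∑P(Y x)f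
     f-window x x≤ = *≤ 0≤h(mertens-window x g)⨾ lin(∑P-window{f = \p -> h *(lg p * inv(# p))}{g = f}(Y-mono(m≤m+n x g))each ⊹ e≤(sym(∑P-*(Y(x N.+ g))h(\p -> lg p * inv(# p))))⊹ e≤(∑P-*(Y x)h(\p -> lg p * inv(# p))))
      (alg "a-b-c(d-e)=a-b+f+ce-(f-g+cd+g)")⨾ ≤r
      where
      each : ∀ p -> Prime p -> Y x N.< p -> p N.≤ Y(x N.+ g)-> h *(lg p * inv(# p))≤ f p
      each p pp _ p≤ = ≤t(≤*(0≤*(0≤lg p)(<≤(inv⁺(0<# p{{pr≢0 pp}}))))(lin(1+x≤e(-(s * lg p))⊹ *≤(<≤ 0<s)(lg-≤{p}{x N.+ g}{{pr≢0 pp}} p≤ ⨾ #-mono x≤)⊹ s-small ⊹ e≤ 2h)(alg "a-b=a+cd+b+1-(1+-(ce)+ce+cd+2b)")))(e≤(alg "a(bc)=b(ca)" ∙ *ˡ(sym(rp-split p{{pr≢0 pp}}))))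
     h2 : ∀ y -> h *(# 2 * y)≈ y
     h2 y = trans(alg "a(2b)=2ab")(*ʳ 2h ∙ alg "1a=a")
     0≤C₁ : 0# ≤ C₁
     0≤C₁ = ≤t(0≤∥ _)(D⁰.prefix₁ 0)
     enough : ∀ x -> x N.+ g N.≤ m N.+ g N.+ g N.+ g -> M + # 2 + # 3 * C₁ ≤ ∑P(Y(x N.+ g))f - ∑P(Y x)f
     enough x q = ≤t(rs≤(h2 _)(*≤ 0≤h(lin room(alg "a-b-2(c+2+3d)=a-(2(c+2+3d)+b)"))))(f-window x q)
    first : ∃ \n -> a N.≤ n × n N.≤ b × M ≤ ∑P n f - ∑P a f × ∑P n f - ∑P a f ≤ M + j
    first = reach 0≤j 0≤M a≤b jump(lin(0≤+(0≤# 2)(0≤*(0≤# 3)0≤C₁))(alg "a+2+3b-a=2+3b-0")⨾ enough m(trN(m≤m+n(m N.+ g)g)(m≤m+n _ g)))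
    n₁ : ℕ
    n₁ = fst first
    F₁ : R
    F₁ = ∑P n₁ f - ∑P a f
    V⁰ Q⁰ : ℕ -> ℂ
    V⁰ n = ∑Pc n(\p -> cx(lg p)*c P⁰.u p)
    Q⁰ n = ∑Pc n(\p -> cx(lg p)*c cx(lg p)*c(P⁰.u p *c(1c +c P⁰.u p)))
    ℛ total : ℂ
    ℛ = V⁰ a +c(V⁰ c -c V⁰ n₁)
    total = ℛ +c cx F₁
    r : R
    r = ∥ total ∥
    opaque
     a≤n₁ : a N.≤ n₁
     a≤n₁ = fst(snd first)
     n₁≤b : n₁ N.≤ b
     n₁≤b = fst(snd(snd first))
     M≤F₁ : M ≤ F₁
     M≤F₁ = fst(snd(snd(snd first)))
     F₁≤ : F₁ ≤ M + # 2
     F₁≤ = ≤t(snd(snd(snd(snd first))))(≤r ⊹ j≤2)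
     n₁≤c : n₁ N.≤ c
     n₁≤c = trN n₁≤b b≤c
     ∥ℛ∥ : ∥ ℛ ∥ ≤ # 3 * C₁
     ∥ℛ∥ = ≤t(∥-+ _ _)(D⁰.prefix₁ a ⊹ ≤t(∥-- _ _)(D⁰.prefix₁ c ⊹ D⁰.prefix₁ n₁)⨾ e≤(alg "a+(a+a)=3a"))
     r≤ : r ≤ M + # 2 + # 3 * C₁
     r≤ = ≤t(∥-+ ℛ(cx F₁))(∥ℛ∥ ⊹ ≤t(e≤(∥-of(0≤M ⨾ M≤F₁)))F₁≤ ⨾ e≤(alg "3a+(b+2)=b+2+3a"))
     re-total : M - # 3 * C₁ ≤ re total
     re-total = lin(M≤F₁ ⊹ abs-ge⁻(re ℛ)⊹ abs-re≤ ℛ ⊹ ∥ℛ∥)(alg "a+b-(c-3d)=b+e+f+3d-(c+-a+e+f)")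
     0<re : 0# < re total
     0<re = <≤tr(0<-by 3C₁≤M)re-total
     0<r : 0# < r
     0<r = <≤tr 0<re(re≤∥ total)
    second : ∃ \n -> c N.≤ n × n N.≤ d × r ≤ ∑P n f - ∑P c f × ∑P n f - ∑P c f ≤ r + j
    second = reach 0≤j(<≤ 0<r)c≤d(\p pp q -> jump p pp(N.≤-<-trans(trN a≤b b≤c)q))(r≤ ⨾ enough(m N.+ g N.+ g)rfN)
    n₂ : ℕ
    n₂ = fst second
    F₂ : R
    F₂ = ∑P n₂ f - ∑P c f
    z : ℂ
    z = -c(total *c cx(inv r))
   N : ℕ
   N = n₂
   θ : ℕ -> ℂ
   θ p = choose(p N.≤? a)(θ⁰ p)(choose(p N.≤? n₁)1c(choose(p N.≤? c)(θ⁰ p)z))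
   private opaque
    c≤n₂ : c N.≤ n₂
    c≤n₂ = fst(snd second)
    n₂≤d : n₂ N.≤ d
    n₂≤d = fst(snd(snd second))
    r≤F₂ : r ≤ F₂
    r≤F₂ = fst(snd(snd(snd second)))
    F₂≤ : F₂ ≤ r + j
    F₂≤ = snd(snd(snd(snd second)))
    ∥z∥ : ∥ z ∥ ≈ 1#
    ∥z∥ = trans(∥-neg _)(∥-* _ _ ∙ *ˡ(∥-of(<≤(inv⁺ 0<r)))∙ inv-r 0<r)
    cancelled : total +c z *c cx F₂ ~ z *c cx(F₂ - r)
    cancelled = trc(lin≈c(*ˡc{total}(symc(symc(of-* r(inv r))⊙ of-cong(inv-r 0<r))))(algc "-(ab)(c-d)-(a+-(ab)c)=a(db)-a1"))
     (*ˡc(symc(of-+ F₂(- r)⊙ +ˡc(of-neg r))))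
    re-z : re z * r ≈ - re total
    re-z = trans(alg "-(ab-c0)d=-(a(db))")(-₁(*ˡ(inv-r 0<r)∙ alg "a1=a"))
    z≤0 : re z ≤ 0#
    z≤0 = ≮⇒≥ \p -> 0<re(lin(<≤(*-pos p 0<r)⊹ e≤ re-z)(alg "0-a=bc+-a-(0+bc)"))
    θ-1 : ∀ {p} -> a N.< p -> p N.≤ n₁ -> θ p ≡ 1c
    θ-1{p} q r = E.trans(choose-no(p N.≤? a)(N.<⇒≱ q))(choose-yes(p N.≤? n₁)r)
    θ-gap : ∀ {p} -> n₁ N.< p -> p N.≤ c -> θ p ≡ θ⁰ p
    θ-gap{p} q r = E.trans(choose-no(p N.≤? a)(N.<⇒≱(N.≤-<-trans a≤n₁ q)))(E.trans(choose-no(p N.≤? n₁)(N.<⇒≱ q))(choose-yes(p N.≤? c)r))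
    θ-z : ∀ {p} -> c N.< p -> θ p ≡ z
    θ-z{p} q = E.trans(choose-no(p N.≤? a)(N.<⇒≱(N.≤-<-trans(trN a≤b b≤c)q)))(E.trans(choose-no(p N.≤? n₁)(N.<⇒≱(N.≤-<-trans n₁≤c q)))(choose-no(p N.≤? c)(N.<⇒≱ q)))
   opaque
    θ-unit : ∀ p -> ∥ θ p ∥ ≈ 1#
    θ-unit p = choose-unit(p N.≤? a)(unit⁰ p)(choose-unit(p N.≤? n₁)∥-1(choose-unit(p N.≤? c)(unit⁰ p)∥z∥))
    θ-low : ∀ {p} -> p N.≤ Y m -> θ p ≡ θ⁰ p
    θ-low{p} q = choose-yes(p N.≤? a)q
    Ym≤N : Y m N.≤ N
    Ym≤N = trN(trN a≤n₁ n₁≤c)c≤n₂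
    N≤ : N N.≤ Y(m N.+ g N.+ g N.+ g)
    N≤ = n₂≤d
   module Constant (w : ℂ) (unit : ∀ (p : ℕ) -> ∥ w ∥ ≈ 1#) where
    open Phase (\_ -> w) unit
    private
     v₁ v₂ : ℕ -> ℂ
     v₁ p = cx(lg p)*c u p
     v₂ p = cx(lg p)*c cx(lg p)*c(u p *c(1c +c u p))
     e₁ e₂ : ℕ -> ℂ
     e₁ p = cx(lg p)*c(u p -c X(\_ -> w)p)
     e₂ p = cx(lg p)*c cx(lg p)*c(u p *c(1c +c u p)-c X(\_ -> w)p)
    opaque
     split₁ : ∀ n -> ∑Pc n v₁ ~ w *c cx(∑P n f)+c ∑Pc n e₁
     split₁ n = trc(∑Pc-cong n \p _ _ -> algc "ab=c(ad)+a(b-cd)" ⊙ +ʳc(*ˡc(symc(of-*(lg p)(rp p(1# + s))))))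
      (∑Pc-+ n(\p -> w *c cx(f p))e₁ ⊙ +ʳc(∑Pc-* n w(\p -> cx(f p))⊙ *ˡc(∑Pc-of n f)))
     split₂ : ∀ n -> ∑Pc n v₂ ~ w *c cx(∑P n(\p -> lg p * f p))+c ∑Pc n e₂
     split₂ n = trc(∑Pc-cong n \p _ _ -> algc "aa(b(1+b))=c(a(ad))+aa(b(1+b)-cd)" ⊙
      +ʳc(*ˡc(symc(of-*(lg p)(f p)⊙ *ˡc(of-*(lg p)(rp p(1# + s)))))))
      (∑Pc-+ n(\p -> w *c cx(lg p * f p))e₂ ⊙ +ʳc(∑Pc-* n w(\p -> cx(lg p * f p))⊙ *ˡc(∑Pc-of n(\p -> lg p * f p))))
     difference : ∀ x y -> cx y -c cx x ~ cx(y - x)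
     difference x y = symc(of-+ y(- x)⊙ +ˡc(of-neg x))
     window₁ : ∀ {x y} -> a N.≤ x -> x N.≤ y -> y N.≤ d -> ∥(∑Pc y v₁ -c ∑Pc x v₁)-c w *c cx(∑P y f - ∑P x f)∥ ≤ err
     window₁{x}{y} a≤x x≤y y≤d = e≤(∥-cg(lin≈c(+₂c(+₂c(split₁ y)(-₁c(split₁ x)))(*ˡc{w}(difference(∑P x f)(∑P y f))))
      (algc "a-b-(c-d-ef)=eg+a+-(eh+b)+ef-(c+-d+e(g-h))")))⨾
      ∑Pc-tail e₁ x≤y ⨾ ∑P-window{f = \p -> ∥ e₁ p ∥}{g = bound} x≤y each ⨾ lin(∑P-nonneg x{bound} \p pp -> 0≤bound p pp)(alg "a-(a-b)=b-0")⨾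
       ∑P-incl y≤d 0≤bound ⨾ e≤(∑P-* d(# 2 * e(- # m))(\p -> lg p * inv(# p)))⨾ *≤ 0≤2e(∑lg/p-≤(m N.+ g N.+ g N.+ g))
      where
      bound : ℕ -> R
      bound p = # 2 * e(- # m)*(lg p * inv(# p))
      0≤2e : 0# ≤ # 2 * e(- # m)
      0≤2e = 0≤*(0≤# 2)(<≤(0<e _))
      0≤bound : ∀ p -> Prime p -> 0# ≤ bound p
      0≤bound p pp = 0≤* 0≤2e(0≤*(0≤lg p)(<≤(inv⁺(0<# p{{pr≢0 pp}}))))
      each : ∀ p -> Prime p -> x N.< p -> p N.≤ y -> ∥ e₁ p ∥ ≤ bound p
      each p pp q _ = ≤t(e≤(∥of-lg*∥ p _))(*≤(0≤lg p)(∥w-x∥(X-eq pp)(2X≤1 pp)⨾ *≤(0≤# 2)(∥X∥² pp ⨾ ≤*(<≤(inv⁺(0<# p{{pr≢0 pp}})))(inv-p≤ p pp(N.≤-<-trans a≤x q))))⨾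
       e≤(alg "a(2(bc))=2b(ac)"))
     window₂ : ∀ {x y} -> x N.≤ y -> re(∑Pc y v₂ -c ∑Pc x v₂)≤ re w *(∑P y(\p -> lg p * f p)- ∑P x(\p -> lg p * f p))+ # 6 * c₃
     window₂{x}{y} x≤y = ≤t(e≤(re≈(+₂c(split₂ y)(-₁c(split₂ x)))∙
      alg "ab-c0+d-(ae-c0+f)=a(b-e)+(d-f)"))
      (≤r ⊹ ≤t(re≤∥(∑Pc y e₂ -c ∑Pc x e₂))(∑Pc-tail e₂ x≤y ⨾ lin(∑P-nonneg x{\p -> ∥ e₂ p ∥} \p _ -> 0≤∥ _)(alg "a-(a-b)=b-0")⨾
       (∑P-mono y \p pp _ -> e≤(∥of-lg²*∥ p _)⨾ *≤(0≤*(0≤lg p)(0≤lg p))(∥w²-x∥(X-eq pp)(2X≤1 pp)⨾ *≤(0≤# 6)(∥X∥² pp))⨾ e≤(alg "aa(6(bb))=6(aa(bb))"))⨾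
        e≤(∑P-* y(# 6)_)⨾ *≤(0≤# 6)(∑lg²/p² y)))
   private
    module Pθ = Phase θ θ-unit
    module P¹ = Phase (\_ -> 1c) (\_ -> ∥-1)
    module Pᶻ = Phase (\_ -> z) (\_ -> ∥z∥)
    opaque
     assemble : ∀ (φ : ℂ -> ℕ -> ℂ)-> ∑Pc n₂(\p -> φ(θ p)p)~ ∑Pc a(\p -> φ(θ⁰ p)p)+c(∑Pc n₁(φ 1c)-c ∑Pc a(φ 1c))+c(∑Pc c(\p -> φ(θ⁰ p)p)-c ∑Pc n₁(\p -> φ(θ⁰ p)p))+c(∑Pc n₂(φ z)-c ∑Pc c(φ z))
     assemble φ = trc(∑Pc-window(\p -> φ(θ p)p)(φ z)c≤n₂ \p _ q _ -> ≡c(E.cong(\t -> φ t p)(θ-z q)))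
      (+ʳc((∑Pc-window(\p -> φ(θ p)p)(\p -> φ(θ⁰ p)p)n₁≤c \p _ q r -> ≡c(E.cong(\t -> φ t p)(θ-gap q r)))⊙
       +ʳc((∑Pc-window(\p -> φ(θ p)p)(φ 1c)a≤n₁ \p _ q r -> ≡c(E.cong(\t -> φ t p)(θ-1 q r)))⊙
        +ʳc(∑Pc-cong a \p _ q -> ≡c(E.cong(\t -> φ t p)(θ-low q))))))
   opaque
    S₁-small : ∥ Pθ.S₁(primes N)∥ ≤ j + # 2 * err
    S₁-small = e≤(∥-cg((Pθ.S₁-primes n₂ ⊙ assemble(\t p -> cx(lg p)*c(t *c cx(rp p(1# + s))*c invc(1c -c t *c cx(rp p(1# + s))))))⊙ algc "a+(b-c)+(d-e)+(f-g)=a+(d-e)+h+ij+(b-c-1h)+(f-g-ij)" ⊙ +ʳc(+ʳc cancelled)))⨾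
     ∥-+ _ _ ⨾ ≤t(∥-+ _ _)(≤t(e≤(∥-* _ _ ∙ *₂ ∥z∥(∥-of(0≤-by r≤F₂))))(e≤(alg "1(a-b)=a-b")⨾ lin F₂≤(alg "a-(b-c)=c+a-b"))⊹ Constant.window₁ 1c(\_ -> ∥-1)rfN a≤n₁(trN n₁≤c c≤d))⊹ Constant.window₁ z(\_ -> ∥z∥)(trN a≤b b≤c)c≤n₂ n₂≤d ⨾
      e≤(alg "a+b+b=a+2b")
     where
     V¹ Vᶻ : ℕ -> ℂ
     V¹ n = ∑Pc n(\p -> cx(lg p)*c P¹.u p)
     Vᶻ n = ∑Pc n(\p -> cx(lg p)*c Pᶻ.u p)
    S₂-negative : re(Pθ.S₂(primes N))≤ - 1#
    S₂-negative = e≤(re≈(Pθ.S₂-primes n₂ ⊙ assemble(\t p -> cx(lg p)*c cx(lg p)*c(t *c cx(rp p(1# + s))*c invc(1c -c t *c cx(rp p(1# + s)))*c(1c +c t *c cx(rp p(1# + s))*c invc(1c -c t *c cx(rp p(1# + s)))))))∙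
     alg "a+(b-c)+(d-e)+(f-g)=a+d+-e+(b-c)+(f-g)")⨾
     lin(≤t(re≤∥ _)(Q≤(trN(trN a≤b b≤c)c≤d))⊹ ≤t(re≤∥ _)(Q≤ c≤d)⊹ ≤t(abs-ge⁻ _)(abs-re≤ _ ⨾ Q≤(trN n₁≤c c≤d))⊹ Constant.window₂ 1c(\_ -> ∥-1)a≤n₁ ⊹ Constant.window₂ z(\_ -> ∥z∥)c≤n₂
      ⊹((∑P-window{f = \p -> lg p * f p}{g = \p -> #(m N.+ g)* f p} a≤n₁ \p pp _ q -> ≤*(0≤f p)(lg-≤{p}{m N.+ g}{{pr≢0 pp}}(trN q n₁≤b)))⨾ e≤(+₂(∑P-* n₁(#(m N.+ g))f)(-₁(∑P-* a(#(m N.+ g))f))∙ alg "ab-ac=a(b-c)"))⊹(lin(*≤(lin z≤0(alg "-a-0=0-a"))(*≤(0≤#(m N.+ g N.+ g))r≤F₂ ⨾ e≤(alg "a(b-c)=ab-ac" ∙ +₂(sym(∑P-* n₂(#(m N.+ g N.+ g))f))(-₁(sym(∑P-* c(#(m N.+ g N.+ g))f))))⨾ ∑P-window{f = \p -> #(m N.+ g N.+ g)* f p}{g = \p -> lg p * f p} c≤n₂ \p pp q _ -> ≤*(0≤f p)(Y-<lg{m = m N.+ g N.+ g} q))⊹ e≤(*ˡ{#(m N.+ g N.+ g)} re-z))(alg "-(ab)-c(d-e)=-c(d-e)+a(-b)-(-c(af)+a(cf))"))⊹ *≤(0≤#(m N.+ g))F₁≤ ⊹ *≤(0≤#(m N.+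 g N.+ g))re-total ⊹ turn ⊹ e≤(*ʳ{M}(sym(#-+(m N.+ g)g))))
      (solve(re(Q⁰ a)∷ re(Q⁰ c)∷ re(Q⁰ n₁)∷ re(Q¹ n₁ -c Q¹ a)∷ re(Qᶻ n₂ -c Qᶻ c)∷ #(m N.+ g)∷ #(m N.+ g N.+ g)∷ # g ∷ M ∷ L n₁ - L a ∷ re z ∷ L n₂ - L c ∷ F₁ ∷ re total ∷ C ∷ C₁ ∷ c₃ ∷ #(m N.+ g N.+ g N.+ g)∷ [])
       (⊝ e1 ⊖(x0 ⊕ x1 ⊕ ⊝ x2 ⊕ x3 ⊕ x4))
       (Qb ⊕ Qb ⊕ Qb ⊕(e1 ⊗ x9 ⊕ n# 6 ⊗ y16)⊕(y10 ⊗ y11 ⊕ n# 6 ⊗ y16)⊕ x5 ⊗ y12 ⊕ ⊝(x6 ⊗ y13)⊕ x5 ⊗(x8 ⊕ n# 2)⊕ x6 ⊗ y13 ⊕ x7 ⊗ x8 ⊕ x6 ⊗ x8 ⊖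
        (x0 ⊕ x1 ⊕ ⊝ x2 ⊕ x3 ⊕ x4 ⊕ x9 ⊕ y10 ⊗ y11 ⊕ x5 ⊗ y12 ⊕ x6 ⊗(x8 ⊖ n# 3 ⊗ y15)⊕(n# 1 ⊕ n# 6 ⊗ y14 ⊗(y17 ⊕ e1)⊕ n# 30 ⊗ y16 ⊕ n# 2 ⊗ x5 ⊕ n# 3 ⊗ y15 ⊗ x6)⊕(x5 ⊕ x7)⊗ x8)))
     where
     y10 y11 y12 y13 y14 y15 y16 y17 Qb : Expr
     y10 = v 10
     y11 = v 11
     y12 = v 12
     y13 = v 13
     y14 = v 14
     y15 = v 15
     y16 = v 16
     y17 = v 17
     Qb = n# 2 ⊗ y14 ⊗(y17 ⊕ e1)⊕ n# 6 ⊗ y16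
     Q¹ Qᶻ : ℕ -> ℂ
     Q¹ n = ∑Pc n(\p -> cx(lg p)*c cx(lg p)*c(P¹.u p *c(1c +c P¹.u p)))
     Qᶻ n = ∑Pc n(\p -> cx(lg p)*c cx(lg p)*c(Pᶻ.u p *c(1c +c Pᶻ.u p)))
     L : ℕ -> R
     L n = ∑P n(\p -> lg p * f p)
     Q≤ : ∀ {n} -> n N.≤ d -> ∥ Q⁰ n ∥ ≤ # 2 * C *(#(m N.+ g N.+ g N.+ g)+ 1#)+ # 6 * c₃
     Q≤{n} n≤d = ≤t(D⁰.prefix₂ n)(_⊹_{c = # 6 * c₃}{# 6 * c₃}(*≤{# 2 * C}(0≤*(0≤# 2)(0≤∥ _ ⨾ prefix 0))(lg-mono(s≤s n≤d)⨾ lg-step≤ d{{Y≢0 _}} ⨾ lg-≤{d}{m N.+ g N.+ g N.+ g}{{Y≢0 _}} rfN ⊹ ≤t(inv-anti 0<1(e≤(alg "1=#1")⨾ #-mono(0<Y(m N.+ g N.+ g N.+ g))))(e≤(sym(inv-uniq(alg "1(1)=1"))))))≤r)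

 opaque
  pw-mk : ∀ n σ t -> pw n(mk σ t)~ cx(rp n σ)*c χ n t
  pw-mk n σ t = trc(pw-cong n{mk σ t}{mk 0# t +c cx σ}(mk≈(alg "a=0+a")(alg "a=a+0")))(pw-+ n(mk 0# t)(cx σ)⊙ algc "ab=ba" ⊙
   *ʳc(exp-cong(-₁c(symc(of-* σ(lg n)))⊙ symc(of-neg(σ * lg n)))⊙ exp-of(-(σ * lg n))))

  ^-+ : ∀ x a b -> x ^(a N.+ b)≈ x ^ a * x ^ b
  ^-+ x zero    b =(alg "a=1a")
  ^-+ x(suc a)b = trans(*ˡ(^-+ x a b))(alg "a(bc)=abc")

 module _ (N : ℕ) (0<N : 0 N.< N) (g : Mult) (δ : R) (0<δ : 0# < δ) (k : ℕ) (k≤2 : k N.≤ 2) where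
  open Mult g
  private
   σ : R
   σ = 1# + # 5 * δ
   S : List ℕ
   S = primes N
   big : ∀ j -> j N.≤ 5 -> 1# + # j * δ ≤ σ
   big j j≤5 = ≤r ⊹ ≤*(<≤ 0<δ)(#-mono j≤5)
   σ3 : 1# + # 3 * δ ≤ σ
   σ3 = big 3(s≤s(s≤s(s≤s z≤n)))
   coef : ℕ -> ℂ
   coef n = sift S fn n *c cx(lg n ^ k * rp n σ)
   add : ∀ n -> Dec(2 N.≤ n)-> Dec(Any(_∣ n)S)-> Poly' -> Poly'
   add n(yes _)(no _)P =(n , coef n)∷ P
   add n _       _      P = P

  poly : ℕ -> Poly'
  poly zero    = []
  poly(suc n)= add n(2 N.≤? n)(Any.any?(\p -> p ∣? n)S)(poly n)

  private
   Entry : ℕ -> ℕ × ℂ -> Set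
   Entry X(n , _)= 2 N.≤ n × n N.< X × All(\p -> ¬(p ∣ n))S
   entries : ∀ X -> All(Entry X)(poly X)
   entries zero    = []
   entries(suc n)= go(2 N.≤? n)(Any.any?(\p -> p ∣? n)S)
    where
    old : All(Entry(suc n))(poly n)
    old = All.map(\(x , y , z)-> x , m≤1+n y , z)(entries n)
    go : ∀ d d' -> All(Entry(suc n))(add n d d'(poly n))
    go(yes q)(no a)  =(q , rfN , ¬Any⇒All¬ S a)∷ old
    go(yes q)(yes _)= old
    go(no _)  _       = old

  poly-within : ∀ X -> Within X(poly X)
  poly-within X = All.map(\(x , y , _)-> N.>-nonZero(N.<-trans(s≤s z≤n)x), N.<⇒≤ y)(entries X)

  poly-distinct : ∀ X -> Distinct(poly X)
  poly-distinct zero    = []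
  poly-distinct(suc n)= go(2 N.≤? n)(Any.any?(\p -> p ∣? n)S)
   where
   go : ∀ d d' -> Distinct(add n d d'(poly n))
   go(yes q)(no a)  = All.map(\(_ , y , _)-> λ { E.refl -> N.<-irrefl E.refl y })(entries n)∷ poly-distinct n
   go(yes q)(yes _)= poly-distinct n
   go(no _)  _       = poly-distinct n

  poly-rough : ∀ X -> All(\p -> Rough p(poly X))S
  poly-rough X = All.tabulate \p∈S -> All.map(\(_ , _ , a)-> All.lookup a p∈S)(entries X)

  opaque
   0≤lr : ∀ n -> 0# ≤ lg n ^ k * rp n σ
   0≤lr n = 0≤*(0≤^ k(0≤lg n))(<≤(0<rp n σ))
   ∥coef∥ : ∀ n -> ∥ coef n ∥ ≤ lg n ^ k * rp n σ
   ∥coef∥ n = ≤t(e≤(∥-* _ _ ∙ *ˡ(∥-of(0≤lr n))))(≤*(0≤lr n)(Sifted.sift-bdd g(mk σ 0#)δ 0<δ σ3 S n)⨾ e≤(alg "1(ab)=ab"))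
   W-pos : ∀ j τ n -> 2 N.≤ n -> W j τ n ≈ lg n ^ j * rp n τ
   W-pos j τ(suc n)_ = refl
   ℓ₁-poly : ∀ X -> ℓ₁(poly X)≤ wB k δ
   ℓ₁-poly X = go X ⨾ ∑W≤ k 0<δ(big(suc k)(s≤s(trN k≤2(s≤s(s≤s z≤n)))))X
    where
    go : ∀ X -> ℓ₁(poly X)≤ ∑ X(W k σ)
    go zero    = ≤r
    go(suc n)= step(2 N.≤? n)(Any.any?(\p -> p ∣? n)S)
     where
     skip : ℓ₁(poly n)≤ ∑ n(W k σ)+ W k σ n
     skip = lin(go n ⊹ 0≤W k σ n)(alg "a+b-c=a+b-(c+0)")
     step : ∀ d d' -> ℓ₁(add n d d'(poly n))≤ ∑ n(W k σ)+ W k σ n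
     step(yes q)(no a)  = lin(go n ⊹ ∥coef∥ n ⊹ e≤(sym(W-pos k σ n q)))(alg "a+b-(c+d)=a+ef+b-(d+c+ef)")
     step(yes q)(yes _)= skip
     step(no _)  _       = skip
   nsq-coef : ∀ n -> 2 N.≤ n -> nsq(coef n)≤ W(k N.+ k)2# n
   nsq-coef n q = rs≤(∥-sq(coef n))(*-mono(0≤∥ _)(0≤lr n)(∥coef∥ n)(∥coef∥ n)⨾ e≤(alg "ab(ab)=aa(bb)" ∙ *₂(sym(^-+(lg n)k k))(sym(rp-+ n σ σ)))⨾
    *≤(0≤^(k N.+ k)(0≤lg n))(rp-anti n(lin(0≤*(0≤# 10)(<≤ 0<δ))(alg "1+5a+(1+5a)-2=10a-0")))⨾ e≤(sym(W-pos(k N.+ k)2# n q)))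
   ℓ₂-poly : ∀ X -> suc N N.≤ X -> ℓ₂(poly X)≤ rp(suc N)(inv(# 6))* wB(k N.+ k)(inv(# 6))
   ℓ₂-poly X N<X with m+o≡n N<X
   ... | j , E.refl = go j ⨾ ∑W-tail(k N.+ k)(inv⁺(0<#s 5))(≤r ⊹ ≤*(<≤(inv⁺(0<#s 5)))(#-mono{suc(suc(k N.+ k))}{6}(s≤s(s≤s(N.+-mono-≤ k≤2 k≤2))))⨾ e≤(+ˡ(inv-r(0<#s 5))∙ alg "1+1=2"))(suc N)(suc N N.+ j)(m≤m+n(suc N)j)
    where
    empty : ∀ n -> n N.≤ suc N -> poly n ≡ []
    empty zero    _   = E.refl
    empty(suc n)n≤N = E.trans(E.cong(add n(2 N.≤? n)(Any.any?(\p -> p ∣? n)S))(empty n(N.<⇒≤ n≤N)))(drop-it(2 N.≤? n)(Any.any?(\p -> p ∣? n)S))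
     where
     drop-it : ∀ d d' -> add n d d' [] ≡ []
     drop-it(yes q)(yes _)= E.refl
     drop-it(no _)  _       = E.refl
     drop-it(yes q)(no a)with primes-cover N n q n≤N
     ... | p , p∈S , p∣n = absurd(a(Any.map(λ { E.refl -> p∣n })p∈S))
    w : ℕ -> R
    w = W(k N.+ k)2#
    go : ∀ j -> ℓ₂(poly(suc N N.+ j))≤ ∑(suc N N.+ j)w - ∑(suc N)w
    go zero rewrite N.+-identityʳ N = e≤(rfx(E.cong ℓ₂(empty(suc N)rfN))∙ alg "0=a-a")
    go(suc j)rewrite N.+-suc N j = step(2 N.≤? n)(Any.any?(\p -> p ∣? n)S)
     where
     n : ℕ
     n = suc N N.+ j
     skip : ℓ₂(poly n)≤ ∑ n w + w n - ∑(suc N)w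
     skip = lin(go j ⊹ 0≤W(k N.+ k)2# n)(alg "a+b-c-d=a-c+b-(d+0)")
     step : ∀ d d' -> ℓ₂(add n d d'(poly n))≤ ∑ n w + w n - ∑(suc N)w
     step(yes q)(no a)  = lin(go j ⊹ nsq-coef n q)(alg "a+b-c-(d+e)=a-c+b-(e+d)")
     step(yes q)(yes _)= skip
     step(no _)  _       = skip

  module At (t : R) where
   open Sifted g (mk σ t) δ 0<δ σ3
   opaque
    val-poly : ∀ X -> 2 N.≤ X -> ∑ᶜ X(T k S)~ unitAt k +c val(poly X)t
    val-poly(suc zero)(s≤s())
    val-poly(suc(suc zero))_ = +ˡc(*₂c(*₂c(sift-1 fn(primes-dp N)⊙ unit)(at1 k))(pw1(mk σ t))⊙ algc "1a1=a")⊙ algc "0+0+a=a+0"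
     where
     at1 : ∀ k -> cx(lg 1 ^ k)~ unitAt k
     at1 zero    = reflc
     at1(suc k)= of-cong(*ʳ lg-1 ∙ alg "0a=0")
    val-poly(suc n@(suc(suc _)))_ = step(val-poly n(s≤s(s≤s z≤n)))(2 N.≤? n)(Any.any?(\p -> p ∣? n)S)
     where
     step : ∑ᶜ n(T k S)~ unitAt k +c val(poly n)t -> ∀ d d' -> ∑ᶜ n(T k S)+c T k S n ~ unitAt k +c val(add n d d'(poly n))t
     step IH(yes q)(no a)= trc(+₂c IH(*ˡc(pw-mk n σ t)))(algc "a+b+cd(ef)=a+(c(de)f+b)" ⊙
      +ˡc(+ʳc(*ʳc(*ˡc(symc(of-*(lg n ^ k)(rp n σ)))))))
     step IH(yes q)(yes a)= let p , p∈S , d = find a in trc(+₂c IH(*ʳc(*ʳc(sift-0{S}{fn} p∈S d))⊙ algc "0ab=0"))(algc "a+b+0=a+b")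
     step IH(no n≱2)_ = absurd(n≱2(s≤s(s≤s z≤n)))
    rough-≈ : ∀ X -> 2 N.≤ X -> ∥ A k S -c unitAt k ∥ ≤ ∥ val(poly X)t ∥ + rp X δ * wB k δ
    rough-≈ X 2≤X = ≤t(e≤(∥-cg(lin≈c(val-poly X 2≤X)(algc "a+(b-c)-(b-d)=d+a-c"))))
     (∥-+ _ _ ⨾ ≤r ⊹ tail-bound g(mk σ t)δ 0<δ σ3 k S X{{N.>-nonZero(N.<-≤-trans(s≤s z≤n)2≤X)}} k≤2(big 4(s≤s(s≤s(s≤s(s≤s z≤n))))))

 module _ (N : ℕ) (0<N : 0 N.< N) (g : Mult) (δ : R) (0<δ : 0# < δ) (θ : ℕ -> ℂ) (unit : ∀ p -> ∥ θ p ∥ ≈ 1#)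
  (X : ℕ)(N<X : suc N N.≤ X)(E : R)(0<E : 0# < E)(H : R)(∑1/p≤H : ∑P N(\p -> inv(# p))≤ H)
  (K : ℕ).{{K≢0 : Nz K}}(K-large : # 8 *(inv E * inv E * H)≤ # K)where
  private
   S : List ℕ
   S = primes N
   i B : R
   i = inv E
   B = i * i
   ψ : ℕ -> ℂ
   ψ p = conj(θ p)
   unitψ : ∀ p -> ∥ ψ p ∥ ≈ 1#
   unitψ p = trans(∥-conj(θ p))(unit p)
   P₀ P₁ P₂ Pᵍ : Poly'
   P₀ = poly N 0<N one δ 0<δ 0 z≤n X
   P₁ = poly N 0<N one δ 0<δ 1(s≤s z≤n)X
   P₂ = poly N 0<N one δ 0<δ 2(s≤s(s≤s z≤n))X
   Pᵍ = poly N 0<N g δ 0<δ 0 z≤n X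
   Rs : List Poly'
   Rs = P₀ ∷ P₁ ∷ P₂ ∷ Pᵍ ∷ []
   c : ℕ -> R
   c p = B * rp p 1#
   b : ℕ -> R
   b k = wB k(inv(# 6))
   Valid : Poly' -> Set
   Valid P = Within X P × Distinct P × All(\p -> Rough p P)S

  ℓ₂-bound ℓ₁²-bound : R
  ℓ₂-bound  = rp(suc N)(inv(# 6))*(# 2 * b 0 + b 2 + b 4)
  ℓ₁²-bound = # 2 *(wB 0 δ * wB 0 δ)+ wB 1 δ * wB 1 δ + wB 2 δ * wB 2 δ

  height-bound : R
  height-bound = # 8 * # height X K S * # K ^ length S *(1# + # 4 *(B * H)+ B * ℓ₁²-bound)

  closeness : ℕ -> R -> R
  closeness p t = ∥ χ p t -c θ p ∥

  record Close(t : R): Set where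
   field
    Δ-small : ∑P N(\p -> inv(# p)* closeness p t)≤ E *(H + 1#)
    val₀ : ∥ val P₀ t ∥ ≤ E
    val₁ : ∥ val P₁ t ∥ ≤ E
    val₂ : ∥ val P₂ t ∥ ≤ E
    valᵍ : ∥ val Pᵍ t ∥ ≤ E

  module _ (ℓ₂-small : # 4 * (B * ℓ₂-bound) ≤ 1#) (t₀ : R) where
   private opaque
    0<i : 0# < i
    0<i = inv⁺ 0<E
    0<B : 0# < B
    0<B = *-pos 0<i 0<i
    Ei : E * i ≈ 1#
    Ei = inv-r 0<E
    valid : All Valid Rs
    valid = each one 0 z≤n ∷ each one 1(s≤s z≤n)∷ each one 2(s≤s(s≤s z≤n))∷ each g 0 z≤n ∷ []
     where
     each : ∀ g k k≤2 -> Valid(poly N 0<N g δ 0<δ k k≤2 X)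
     each g k k≤2 = poly-within N 0<N g δ 0<δ k k≤2 X , poly-distinct N 0<N g δ 0<δ k k≤2 X , poly-rough N 0<N g δ 0<δ k k≤2 X
    0≤c : ∀ p -> 0# ≤ c p
    0≤c p = 0≤*(<≤ 0<B)(<≤(0<rp p 1#))
    rp₁ : ∀ {p} -> Prime p -> rp p 1# ≈ inv(# p)
    rp₁{p} pp = rp-1 p{{pr≢0 pp}}
    0≤inv : ∀ {p} -> Prime p -> 0# ≤ inv(# p)
    0≤inv{p} pp = <≤(inv⁺(0<# p{{pr≢0 pp}}))

    ∑c : sumL S c ≤ B * H
    ∑c = ≤t(e≤(sumL-pr N c ∙ ∑P-* N B(\p -> rp p 1#)))(*≤(<≤ 0<B)((∑P-mono N \p pp _ -> e≤(rp₁ pp))⨾ ∑1/p≤H))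
    small : # 2 * inv(# K)* sumL S c + B * sumL Rs ℓ₂ ≤ inv 2#
    small = cancel(0<#s 3)(lin(*≤(0≤*(0≤# 8)0≤k)∑c ⊹ *≤ 0≤k K-large ⊹ e≤(alg "ab=ba" ∙ inv-r(0<# K))⊹ *≤(0≤# 4)(*≤(<≤ 0<B)(lin(ℓ₂-poly N 0<N one δ 0<δ 0 z≤n X N<X ⊹ ℓ₂-poly N 0<N one δ 0<δ 1(s≤s z≤n)X N<X ⊹ ℓ₂-poly N 0<N one δ 0<δ 2(s≤s(s≤s z≤n))X N<X ⊹ ℓ₂-poly N 0<N g δ 0<δ 0 z≤n X N<X)(alg "a(2b+c+d)-(e+(f+(g+(h+0))))=ab+ac+ad+ab-(e+f+g+h)")))⊹ ℓ₂-small ⊹ e≤(*ˡ{# 2}(sym 2h)))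
     (alg "4a-4(2bc+de)=8b(df)+bg+1+4(dh)+1+2(2a)-(8bc+b(8(df))+bg+4(de)+4(dh)+2(1))"))
     where
     0≤k : 0# ≤(inv(# K))
     0≤k = <≤(inv⁺(0<# K))
     ρ : R
     ρ = rp(suc N)(inv(# 6))
    ℓ₁² : sumL Rs(\P -> ℓ₁ P * ℓ₁ P)≤ ℓ₁²-bound
    ℓ₁² = lin(sq one 0 z≤n ⊹ sq one 1(s≤s z≤n)⊹ sq one 2(s≤s(s≤s z≤n))⊹ sq g 0 z≤n)
     (alg "2(aa)+bb+cc-(dd+(ee+(ff+(gg+0))))=aa+bb+cc+aa-(dd+ee+ff+gg)")
     where
     0≤ℓ₁ : ∀ P -> 0# ≤ ℓ₁ P
     0≤ℓ₁ []            = ≤r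
     0≤ℓ₁((n , z)∷ P)= 0≤+(0≤∥ z)(0≤ℓ₁ P)
     sq : ∀ g k k≤2 -> ℓ₁(poly N 0<N g δ 0<δ k k≤2 X)* ℓ₁(poly N 0<N g δ 0<δ k k≤2 X)≤ wB k δ * wB k δ
     sq g k k≤2 = *-mono(0≤ℓ₁(poly N 0<N g δ 0<δ k k≤2 X))(0≤ℓ₁(poly N 0<N g δ 0<δ k k≤2 X)⨾ ℓ₁-poly N 0<N g δ 0<δ k k≤2 X)(ℓ₁-poly N 0<N g δ 0<δ k k≤2 X)(ℓ₁-poly N 0<N g δ 0<δ k k≤2 X)
    X≢0 : Nz X
    X≢0 = N.>-nonZero(N.<-≤-trans(s≤s z≤n)N<X)
    found : ∃ \t -> t₀ ≤ t × t ≤ t₀ + 1# + # 8 * # height X K S * # K ^ length S *(1# + # 4 * sumL S c + B * sumL Rs(\P -> ℓ₁ P * ℓ₁ P))×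
     sumL S(\p -> c p * nsq(1c -c ψ p *c χ p t))+ B * sumL Rs(\P -> nsq(val P t))≤ 1#
    found = resonance ψ unitψ K{{K≢0}}(primes-dp N)c 0≤c B(<≤ 0<B)Rs X{{X≢0}} valid small t₀
    norm-small : ∀ {z} -> B * nsq z ≤ 1# -> ∥ z ∥ ≤ E
    norm-small{z} q = sq-≤(<≤ 0<E)(rs≤(sym(∥-sq z))(lin(*≤(0≤sq E)q ⊹ e≤(*ˡ{nsq z}(sym(*₂ Ei Ei))))
     (alg "aa-b=aa1+b(ac(ac))-(aa(ccb)+b(1(1)))")))
   opaque
    chosen : ∃ \t -> t₀ ≤ t × t ≤ t₀ + 1# + height-bound × Close t
    chosen with found
    ... | t , t₀≤t , t≤ , small-sum = t , t₀≤t , t≤ ⨾ ≤r ⊹ *≤(0≤*(0≤*(0≤# 8)(0≤#(height X K S)))(0≤^(length S)(0≤# K)))(≤r ⊹ *≤(0≤# 4)∑c ⊹ *≤(<≤ 0<B)ℓ₁²),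
     record{ Δ-small = Δ ; val₀ = norm-small(part(lin(0≤nsq(val P₁ t)⊹ 0≤nsq(val P₂ t)⊹ 0≤nsq(val Pᵍ t))(alg "a+(b+(c+(d+0)))-a=b+c+d-(0+0+0)"))); val₁ = norm-small(part(lin(0≤nsq(val P₀ t)⊹ 0≤nsq(val P₂ t)⊹ 0≤nsq(val Pᵍ t))(alg "a+(b+(c+(d+0)))-b=a+c+d-(0+0+0)"))); val₂ = norm-small(part(lin(0≤nsq(val P₀ t)⊹ 0≤nsq(val P₁ t)⊹ 0≤nsq(val Pᵍ t))(alg "a+(b+(c+(d+0)))-c=a+b+d-(0+0+0)"))); valᵍ = norm-small(part(lin(0≤nsq(val P₀ t)⊹ 0≤nsq(val P₁ t)⊹ 0≤nsq(val P₂ t))(alg "a+(b+(c+(d+0)))-d=a+b+c-(0+0+0)"))) }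
     where
     D′ V : R
     D′ = sumL S(\p -> c p * nsq(1c -c ψ p *c χ p t))
     V = sumL Rs(\P -> nsq(val P t))
     part : ∀ {w} -> w ≤ V -> B * w ≤ 1#
     part{w} q = lin(*≤(<≤ 0<B)q ⊹(sumL-nonneg S \p -> 0≤*(0≤c p)(0≤nsq(1c -c ψ p *c χ p t)))⊹ small-sum)(alg "1-ab=ac+d+1-(ab+0+(d+ac))")
     n₀ n₁ n₂ nᵍ : R
     n₀ = nsq(val P₀ t)
     n₁ = nsq(val P₁ t)
     n₂ = nsq(val P₂ t)
     nᵍ = nsq(val Pᵍ t)
     a : ℕ -> R
     a p = closeness p t
     a² : ∀ p -> a p * a p ≈ nsq(1c -c ψ p *c χ p t)
     a² p = trans(∥-sq(χ p t -c θ p))(alg "a=1a" ∙ *ʳ{nsq(χ p t -c θ p)}(sym(sym(∥-sq(ψ p))∙ *₂(unitψ p)(unitψ p)∙ alg "1(1)=1"))∙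
      sym(nsq-*(ψ p)(χ p t -c θ p))∙ nsq-cong{ψ p *c(χ p t -c θ p)}{ -c(1c -c ψ p *c χ p t)}(lin≈c(symc(*-conj(θ p)⊙ of-cong(sym(∥-sq(θ p))∙ *₂(unit p)(unit p)∙ alg "1(1)=1")))(algc "-(1-ab)-a(b-c)=ca-1"))∙ alg "-a(-a)+-b(-b)=aa+bb")
     squares : B * ∑P N(\p -> inv(# p)*(a p * a p))≤ 1#
     squares = e≤(sym(∑P-* N B _)∙(∑P-cong' \p pp -> *ˡ(*₂(sym(rp₁ pp))(a² p))∙ alg "a(bc)=abc")∙ sym(sumL-pr N _))⨾
      lin(0≤*(<≤ 0<B)(sumL-nonneg Rs \P -> 0≤nsq(val P t))⊹ small-sum)(alg "1-a=bc+1-(0+(a+bc))")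
      where
      ∑P-cong' : ∀ {f g} ->(∀ p -> Prime p -> f p ≈ g p)-> ∑P N f ≈ ∑P N g
      ∑P-cong' q = ≤-antisym(∑P-mono N \p pp _ -> e≤(q p pp))(∑P-mono N \p pp _ -> e≤(sym(q p pp)))
     -- 2a ≤ E + a²/E
     Δ : ∑P N(\p -> inv(# p)* a p)≤ E *(H + 1#)
     Δ =(∑P-mono N{g = \p -> E * inv(# p)+ i *(inv(# p)*(a p * a p))} \p pp _ -> each p pp)⨾ e≤(∑P-+ N _ _ ∙ +₂(∑P-* N E _)(∑P-* N i _))⨾
      lin(*≤(<≤ 0<E)∑1/p≤H ⊹ *≤(<≤ 0<E)squares ⊹ e≤(*ʳ{i * ∑P N(\p -> inv(# p)*(a p * a p))}(sym Ei)))
       (alg "a(b+1)-(ac+de)=ab+a1+ad(de)-(ac+a(dde)+1(de))")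
      where
      each : ∀ p -> Prime p -> inv(# p)* a p ≤ E * inv(# p)+ i *(inv(# p)*(a p * a p))
      each p pp = ≤t(*≤(0≤inv pp)(lin(0≤*(<≤ 0<i)(0≤sq(a p - E))⊹ 0≤∥(χ p t -c θ p)⊹ e≤(*ʳ{E - a p - a p} Ei))(alg "a+b(cc)-c=b((c-a)(c-a))+c+1(a-c-c)-(0+0+ab(a-c-c))")))
       (e≤(alg "a(b+c(dd))=ba+c(a(dd))"))

 module Point (N : ℕ) (g : Mult) (δ : R) (0<δ : 0# < δ) (θ : ℕ -> ℂ) (unit : ∀ p -> ∥ θ p ∥ ≈ 1#) (t : R) where
  s σ : R
  s = # 5 * δ
  σ = 1# + s
  0<s : 0# < s
  0<s = *-pos(0<#s 4)0<δ
  c : ℂ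
  c = mk σ t
  σ3 : 1# + # 3 * δ ≤ σ
  σ3 = lin(0≤*(0≤# 2)(<≤ 0<δ))(alg "1+5a-(1+3a)=2a-0")
  module Zζ = Sifted one c δ 0<δ σ3
  module Zg = Sifted g c δ 0<δ σ3
  open Ideal s 0<s
  module Pθ = Phase θ unit
  S : List ℕ
  S = primes N

  a : ℕ -> R
  a p = ∥ χ p t -c θ p ∥

  private opaque
   inv≥0 : ∀ {p} -> Prime p -> 0# ≤ inv(# p)
   inv≥0{p} pp = <≤(inv⁺(0<# p{{pr≢0 pp}}))
   ∥x∥≤ : ∀ p -> ∥ pw p c ∥ ≤ rp p σ
   ∥x∥≤ p = e≤(∥pw∥ p c)
   ∥1x∥ : ∀ {p} -> Prime p -> ∥ 1c *c pw p c ∥ ≤ inv(# p)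
   ∥1x∥{p} pp = ≤t(e≤(∥-cg(algc "1a=a")∙ ∥pw∥ p c))(rp≤inv pp)
   x-diff : ∀ {p} -> Prime p -> ∥ 1c *c pw p c -c X θ p ∥ ≤ inv(# p)* a p
   x-diff{p} pp = ≤t(e≤(∥-cg(+ʳc(*ˡc(pw-mk p σ t))⊙ algc "1(ab)-cd=a(b-c)+c(a-d)")∙
    ∥-cg(lin≈c(reflc{0c})(algc "a(b-c)-(a(b-c)+c(a-a))=0-0"))∙ ∥-* _ _ ∙ *ʳ(∥-of(<≤(0<rp p σ)))))
    (≤*(0≤∥ _)(rp≤inv pp))
   2x≤1 : ∀ {p} -> Prime p -> # 2 * ∥ 1c *c pw p c ∥ ≤ 1#
   2x≤1 pp = ≤t(*≤(0≤# 2)(∥1x∥ pp))(prime-inv pp)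
   x-eq : ∀ {p} -> Prime p ->(1c -c 1c *c pw p c)*c Zζ.u p ~ 1c *c pw p c
   x-eq{p} pp = Zζ.u-eq p(Zζ.x<1 p pp)

  module _ (Λ : R) (0≤Λ : 0# ≤ Λ) (lg≤Λ : ∀ p -> Prime p -> p N.≤ N -> lg p ≤ Λ) where
   private
    Fine : ℕ -> Set
    Fine p = Prime p × lg p ≤ Λ
    fine : All Fine S
    fine = All.map(λ {p}(pp , p≤)-> pp , lg≤Λ p pp p≤)(primes-≤ N)
   opaque
    diff₁ : ∀ S -> All Fine S -> ∥ Zζ.S₁ S -c Pθ.S₁ S ∥ ≤ # 4 * Λ * sumL S(\p -> inv(# p)* a p)
    diff₁ [] [] = e≤((∥-cg(algc "0-0=0")∙ ∥-0)∙ alg "0=4a0")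
    diff₁(p ∷ S)((pp , p≤)∷ ps)= ≤t(e≤(∥-cg(algc "a+bc-(d+be)=a-d+b(c-e)")))
     (∥-+ _ _ ⨾ diff₁ S ps ⊹ ≤t(e≤(∥-* _ _ ∙ *ʳ(∥-of(0≤lg p))))(*-mono(0≤lg p)(0≤*(0≤# 4)(0≤*(inv≥0 pp)(0≤∥(χ p t -c θ p))))p≤
      (∥w-w'∥(x-eq pp)(2x≤1 pp)(Pθ.X-eq pp)(Pθ.2X≤1 pp)⨾ *≤(0≤# 4)(x-diff pp)))⨾ e≤(alg "4ab+a(4(cd))=4a(cd+b)"))
    diff₂ : ∀ S -> All Fine S -> ∥ Zζ.S₂ S -c Pθ.S₂ S ∥ ≤ # 12 *(Λ * Λ)* sumL S(\p -> inv(# p)* a p)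
    diff₂ [] [] = e≤((∥-cg(algc "0-0=0")∙ ∥-0)∙ alg "0=12(aa)0")
    diff₂(p ∷ S)((pp , p≤)∷ ps)= ≤t(e≤(∥-cg(algc "a+bb(c(1+c))-(d+bb(e(1+e)))=a-d+bb(c(1+c)-e(1+e))")))
     (∥-+ _ _ ⨾ diff₂ S ps ⊹ ≤t(e≤(Pθ.∥of-lg²*∥ p _))(*-mono(0≤*(0≤lg p)(0≤lg p))(0≤*(0≤# 12)(0≤*(inv≥0 pp)(0≤∥(χ p t -c θ p))))(*-mono(0≤lg p)(0≤lg p ⨾ p≤)p≤ p≤)
      (∥w²-w'²∥(x-eq pp)(2x≤1 pp)(Pθ.X-eq pp)(Pθ.2X≤1 pp)⨾ *≤(0≤# 12)(x-diff pp)))⨾ e≤(alg "12(aa)b+aa(12(cd))=12(aa)(cd+b)"))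
    E-≤ : ∀ S -> All Prime S -> ∥ Zζ.E S ∥ ≤ e(sumL S(\p -> inv(# p)))
    E-≤ [] [] = e≤(∥-1 ∙ sym e-0)
    E-≤(p ∷ S)(pp ∷ ps)= ≤t(e≤(∥-* _ _))(*-mono(0≤∥ _)(<≤(0<e _))(∥-- _ _ ⨾ e≤ ∥-1 ⊹ ∥1x∥ pp ⨾ 1+x≤e(inv(# p)))(E-≤ S ps)⨾ e≤(sym(e-+ _ _)))
   module _ (H : R) (∑1/p≤H : ∑P N (\p -> inv (# p)) ≤ H) (Δ : R) (Δ-bound : ∑P N (\p -> inv (# p) * a p) ≤ Δ)
    (η : R)(A₀≈ : ∥ Zζ.A 0 S -c 1c ∥ ≤ η)(A₁≈ : ∥ Zζ.A 1 S -c 0c ∥ ≤ η)(A₂≈ : ∥ Zζ.A 2 S -c 0c ∥ ≤ η)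
    (μ : R)(S₁≤ : ∥ Pθ.S₁ S ∥ ≤ μ)(S₂≤ : re(Pθ.S₂ S)≤ - 1#)
    (ν ω r : R)(0<r : 0# < r)(c₁ : μ + # 4 * Λ * Δ ≤ ν)(c₂ : # 12 *(Λ * Λ)* Δ ≤ h)(c₃ : η ≤ h)(c₄ : η + # 2 * ν ≤ ω)(c₅ : η + # 2 * ν * ω + # 2 *(ν * ν)≤ h * h * h)
    (c₆ : # 3 * r * wB 3 δ * e H ≤ h * h * h * h)(c₇ : ω ≤ h * h * h * half r)(c₈ : # 3 * r ≤ δ)where
    private
     E z₀ z₁ z₂ A₀ A₁ A₂ S₁ S₂ : ℂ
     E = Zζ.E S
     z₀ = Zζ.Z 0
     z₁ = Zζ.Z 1
     z₂ = Zζ.Z 2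
     A₀ = Zζ.A 0 S
     A₁ = Zζ.A 1 S
     A₂ = Zζ.A 2 S
     S₁ = Zζ.S₁ S
     S₂ = Zζ.S₂ S
     opaque
      Δ-list : sumL S(\p -> inv(# p)* a p)≤ Δ
      Δ-list = rs≤(sym(sumL-pr N _))Δ-bound

      ∥S₁∥ : ∥ S₁ ∥ ≤ ν
      ∥S₁∥ = ≤t(∥-rev S₁(Pθ.S₁ S))(S₁≤ ⊹ ≤t(diff₁ S fine)(*≤(0≤*(0≤# 4)0≤Λ)Δ-list)⨾ c₁)

      ∥A₀∥≤ : ∥ A₀ ∥ ≤ # 2
      ∥A₀∥≤ = ≤t(∥-rev A₀ 1c)(e≤ ∥-1 ⊹ ≤t A₀≈(c₃ ⨾ lin(0≤h ⊹ e≤ 2h)(alg "1-a=a+1-(0+2a)"))⨾ e≤(alg "1+1=2"))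
      zero-norm : ∀ {z} -> ∥ z -c 0c ∥ ≤ η -> ∥ z ∥ ≤ η
      zero-norm{z} = rs≤(∥-cg(algc "a-0=a"))
      ∥Ez₁∥ : ∥ E *c z₁ ∥ ≤ ω
      ∥Ez₁∥ = ≤t(e≤(∥-cg(symc(+₂c(Zζ.sieved₁(primes-dp N))(*ˡc(Zζ.sieved₀(primes-dp N)))⊙ algc "a(b-cd)+c(ad)=ab"))))(∥-+ _ _ ⨾ zero-norm A₁≈ ⊹ ≤t(e≤(∥-* _ _))(*-mono(0≤∥ S₁)(0≤# 2)∥S₁∥ ∥A₀∥≤)⨾ rs≤(alg "a+2b=a+b2")c₄)
      0<h³ : 0# < h * h * h
      0<h³ = *-pos(*-pos(inv⁺(0<#s 1))(inv⁺(0<#s 1)))(inv⁺(0<#s 1))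
      h³≤ : h * h * h ≤ ∥ E ∥ * ∥ z₂ ∥
      h³≤ = ≤rs(∥-* E z₂)(lin(*-mono 0≤h(0≤∥ A₀)(lin(abs-ge⁻(re(Pθ.S₂ S))⊹ abs-re≤(Pθ.S₂ S)⊹ ∥-rev(Pθ.S₂ S)S₂ ⊹ e≤(∥-sw(Pθ.S₂ S)S₂)⊹ ≤t(diff₂ S fine)(*≤(0≤*(0≤# 12)(0≤* 0≤Λ 0≤Λ))Δ-list ⨾ c₂)⊹ S₂≤ ⊹ e≤ 2h)(alg "a-b=c+d+(a+e)+f+b+-1+1-(-g+c+d+e+f+g+2b)"))(lin(e≤(sym ∥-1)⊹ ∥-rev 1c A₀ ⊹ e≤(∥-sw 1c A₀)⊹ A₀≈ ⊹ c₃ ⊹ e≤ 2h)(alg "a-b=c+(a+d)+e+f+b+1-(1+c+d+e+f+2b)"))⊹ ≤t(e≤(sym(∥-* S₂ A₀)∙ ∥-cg(*ˡc(Zζ.sieved₀(primes-dp N))⊙ symc(+₂c(+ʳc(+ˡc(-₁c(Zζ.sieved₂(primes-dp N)))))(*ˡc(Zζ.sieved₀(primes-dp N)))⊙ algc "ab-a(b-2cd+(cc-e)f)-2c(ad)+cc(af)=e(af)"))))(∥-+ _ _ ⨾ ≤t(∥-- _ _)(∥-- _ _ ⊹ ≤r)⊹ ≤r)⊹ zero-norm A₂≈ ⊹ ≤t(e≤(∥-* _ _ ∙ *ʳ(∥-* _ _ ∙ *ʳ(∥-cg(symc(of-# 2))∙ ∥-of(0≤# 2)))))(*-mono(0≤*(0≤#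 2)(0≤∥ S₁))(0≤∥ _ ⨾ ∥Ez₁∥)(*≤(0≤# 2)∥S₁∥)∥Ez₁∥)⊹ ≤t(e≤(∥-* _ _ ∙ *ʳ(∥-* _ _)))(*-mono(0≤*(0≤∥ S₁)(0≤∥ S₁))(0≤# 2)(*-mono(0≤∥ S₁)(0≤∥ _ ⨾ ∥S₁∥)∥S₁∥ ∥S₁∥)∥A₀∥≤)⊹ c₅ ⊹ e≤(*ˡ{h * h} 2h))(alg "a-bbb=cd+(a+e+f+g)+h+2ij+ii2+bbb+bb1-(bb+cd+e+f+g+(h+2ij+2(ii))+bb(2b))"))
      0<E : 0# < ∥ E ∥
      0<E q = 0<h³(h³≤ ⨾ ≤*(0≤∥ z₂)q ⨾ e≤(alg "0a=0"))
      0<z₂ : 0# < ∥ z₂ ∥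
      0<z₂ q = 0<h³(h³≤ ⨾ *≤(0≤∥ E)q ⨾ e≤(alg "a0=0"))
      d≉0 : ¬(-c z₂ ~ 0c)
      d≉0 q = 0<z₂(e≤(sym(∥-neg z₂)∙ ∥-cg q ∙ ∥-0))
      start : ∥ z₁ ∥ ≤ ∥ -c z₂ ∥ * half r
      start = cancel 0<E(e≤(sym(∥-* E z₁))⨾ ∥Ez₁∥ ⨾ c₇ ⨾ ≤*(<≤(half-pos 0<r))h³≤ ⨾ e≤(alg "abc=a(bc)" ∙ *ˡ(*ʳ(sym(∥-neg z₂)))))
      near : ∀ s s' -> ∥ s -c c ∥ ≤ r -> ∥ s' -c c ∥ ≤ r -> ∥ D(Mult.fn one)(Mult.bdd one)1 s -c D(Mult.fn one)(Mult.bdd one)1 s' -c(-c z₂)*c(s -c s')∥ ≤ half(∥ -c z₂ ∥ * ∥ s -c s' ∥)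
      near s s' p q = ≤t(e≤(∥-cg(algc "a-b--cd=a-b+dc")))
       (series-diff(Mult.fn one)(Mult.bdd one)1{c}{s}{s'}{r}{δ} 0<δ(lin c₈(alg "1+5a-3b-(1+4a)=a-3b"))p q ⨾ e≤(alg "3abc=3acb")⨾ ≤*(0≤∥ _)(cancel(0<e H)(rs≤(alg "3abc=c(3ab)")c₆ ⨾ e≤(alg "aaaa=a(aaa)")⨾ *≤ 0≤h(h³≤ ⨾ ≤*(0≤∥ z₂)(E-≤ S(All.map fst(primes-≤ N))⨾ e-mono(rs≤(sym(sumL-pr N _))∑1/p≤H)))⨾ e≤(alg "a(bc)=b(ac)")))⨾
        e≤(alg "abc=bca" ∙ *ʳ{h}(*ʳ(sym(∥-neg z₂)))))
    opaque
     critical : ∃ \ρ -> ∥ ρ -c c ∥ ≤ r × D(Mult.fn one)(Mult.bdd one)1 ρ ~ 0c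
     critical = newton(D(Mult.fn one)(Mult.bdd one)1)c(-c z₂)r d≉0 near start

  open Mult g using (fn; bdd)

  opaque
   near-L : ∀ r -> 0# ≤ r -> # 3 * r ≤ δ -> r * wB 1 δ + # 3 * r * r * wB 2 δ ≤ 1# -> ∀ ρ -> ∥ ρ -c c ∥ ≤ r -> ∥ D fn bdd 0 c ∥ ≤ ∥ D fn bdd 0 ρ ∥ + 1#
   near-L r 0≤r 3r≤δ small ρ q = lin(∥-rev L Lρ ⊹ e≤(∥-sw L Lρ)⊹ ≤t(e≤(∥-cg(algc "a-b=a-b+(c-d)e-(c-d)e")))(∥-- _ _)
    ⊹ series-diff fn bdd 0{c}{ρ}{c}{r}{δ} 0<δ(lin(3r≤δ ⊹ <≤ 0<δ)(alg "1+5a-3b-(1+3a)=a+a-(3b+0)"))q(e≤(∥-cg(algc "a-a=0")∙ ∥-0)⨾ 0≤r)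
    ⊹ ≤*(0≤*(0≤^ 2(<≤(inv⁺ 0<δ)))(0≤+ 0≤1(<≤(inv⁺ 0<δ))))(*≤(0≤*(0≤# 3)0≤r)q)⊹ ≤t(e≤(∥-* _ _))(*-mono(0≤∥ _)(0≤∥ L' ⨾ L'≤)q L'≤)⊹ small)
    (alg "a+1-b=a+c+d+(e+f)+3ghi+3ggi+gj+1-(b+c+d+e+3ghi+f+(gj+3ggi))")
    where
    L Lρ L' : ℂ
    L = D fn bdd 0 c
    Lρ = D fn bdd 0 ρ
    L' = D fn bdd 1 c
    L'≤ : ∥ L' ∥ ≤ wB 1 δ
    L'≤ = series-bound(term-bound 1{s = c} bdd 0<δ(lin(<≤ 0<δ)(alg "1+3a-(1+2a)=a-0")⨾ σ3))

  pick :{P : Set} -> Dec P -> R -> R -> R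
  pick(yes _)x y = x
  pick(no _)  x y = y

  module _ (m : ℕ) (Ym≤N : Y m N.≤ N) (q : ℕ) (phase : ∀ p -> Prime p -> p N.≤ Y m -> ¬ (p ∣ q) -> fn p *c θ p ~ 1c) (vanish : ∀ p -> Prime p -> p ∣ q -> fn p ~ 0c) where
   private
    low : ℕ -> R
    low p = - ∇ p + keep(p ∣? q)(∇ p)+ # 2 *(inv(# p)* a p)+ # 2 * s *(lg p * inv(# p))
    w : ℕ -> R
    w p = pick(p N.≤? Y m)(low p)(inv(# p))
    opaque
     extra : ∀ {p} -> Prime p -> 0# ≤ # 2 *(inv(# p)* a p)+ # 2 * s *(lg p * inv(# p))
     extra{p} pp = 0≤+(0≤*(0≤# 2)(0≤*(inv≥0 pp)(0≤∥(χ p t -c θ p))))(0≤*(0≤*(0≤# 2)(<≤ 0<s))(0≤*(0≤lg p)(inv≥0 pp)))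
     low-factor : ∀ {p} -> Prime p -> p N.≤ Y m ->(d : Dec(p ∣ q))-> ∥ 1c -c fn p *c pw p c ∥ ≤ e(- ∇ p + keep d(∇ p)+ # 2 *(inv(# p)* a p)+ # 2 * s *(lg p * inv(# p)))
     low-factor{p} pp p≤(yes d)= ≤t(e≤(∥-cg(+ˡc(-₁c(*ʳc(vanish p pp d)))⊙ algc "1-0a=1")∙ ∥-1))(rs≤ e-0(e-mono(lin(extra pp)
      (alg "-a+a+2(bc)+2d(eb)-0=2(bc)+2d(eb)-0"))))
     low-factor{p} pp p≤(no nd)=(e≤(∥-cg(+ˡc(-₁c(*ˡc(pw-mk p σ t)))⊙ lin≈c(*ˡc{cx(rp p σ)}(symc(phase p pp p≤ nd)))(algc "1-a-ba(c-d)-(1-b(ac))=a(bd)-a1")))⨾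
      ∥-- _ _)⨾(e≤(∥-cg(symc(of-+ 1#(- rp p σ)⊙ +ˡc(of-neg(rp p σ))))∙ ∥-of(0≤-by(rp≤inv pp ⨾ lin(<≤(0<1-inv pp))(alg "1-a=1-a-0"))))⨾ lin(*≤(inv≥0 pp)(1+x≤e(-(s * lg p)))⊹ e≤(sym(rp-split p{{pr≢0 pp}})))(alg "1-a+a(bc)-(1-d)=ae+d-(a(1+-(bc))+ae)"))⊹(e≤(∥-* _ _ ∙ *ʳ(∥-* _ _ ∙ *ˡ(∥-of(<≤(0<rp p σ)))))⨾ ≤*(0≤∥ _)(*-mono(0≤∥(fn p))(inv≥0 pp)(bdd p)(rp≤inv pp)⨾ e≤(alg "1a=a")))⨾ lin(≤*(0≤+(0≤*(inv≥0 pp)(0≤∥(χ p t -c θ p)))(0≤*(<≤ 0<s)(0≤*(0≤lg p)(inv≥0 pp))))(prime-inv pp))(alg "(1-a)(1+(2(ab)+2c(da)))-(1-a+a(cd)+ab)=1(ab+c(da))-2a(ab+c(da))")⨾ *-mono(<≤(0<1-inv pp))(<≤(0<e _))≤r(1+x≤e _)⨾ e≤(*ʳ(sym(e-cong(alg "--a=a")∙ e-log(0<1-inv pp)))∙ sym(e-+ _ _)∙ e-cong(alg "-a+(2(bc)+2d(eb))=-a+0+2(bc)+2d(eb)"))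
      where
      i : R
      i = inv(# p)
     factor : ∀ {p} -> Prime p -> ∥ 1c -c fn p *c pw p c ∥ ≤ e(w p)
     factor{p} pp with p N.≤? Y m
     ... | yes p≤ = low-factor pp p≤(p ∣? q)
     ... | no _   = ≤t(∥-- _ _)(e≤ ∥-1 ⊹ ≤t(e≤(∥-* _ _))(*-mono(0≤∥(fn p))(inv≥0 pp)(bdd p)(∥x∥≤ p ⨾ rp≤inv pp)⨾ e≤(alg "1a=a"))⨾ 1+x≤e(inv(# p)))
     product : ∀ S -> All Prime S -> ∥ Zg.E S ∥ ≤ e(sumL S w)
     product [] [] = e≤(∥-1 ∙ sym e-0)
     product(p ∷ S)(pp ∷ ps)= ≤t(e≤(∥-* _ _))(*-mono(0≤∥ _)(<≤(0<e _))(factor pp)(product S ps)⨾ e≤(sym(e-+ _ _)))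
   exponent : R -> R
   exponent Δ = - G m + ∑P(Y m)(\p -> keep(p ∣? q)(∇ p))+ # 2 * Δ + # 2 * s * ∑lg/p(Y m)+(∑P N(\p -> inv(# p))- ∑P(Y m)(\p -> inv(# p)))
   opaque
    Eg-≤ : ∀ Δ -> ∑P N(\p -> inv(# p)* a p)≤ Δ -> ∥ Zg.E S ∥ ≤ e(exponent Δ)
    Eg-≤ Δ bound = product S(All.map fst(primes-≤ N))⨾ e-mono(e≤(sumL-pr N w)⨾ lin(∑P-window{f = w}{g = I} Ym≤N(\p _ q _ -> pick-no(p N.≤? Y m)(N.<⇒≱ q))⊹ ∑P-mono(Y m){w}{low}(\p _ r -> pick-yes(p N.≤? Y m)r)⊹ e≤(∑P-+(Y m)_ _ ∙ +₂(∑P-+(Y m)_ _ ∙ +₂(∑P-+(Y m)(\p -> - ∇ p)A ∙ +ʳ(≤-antisym(∑P-mono(Y m)\p _ _ -> e≤(alg "-a=-1a"))(∑P-mono(Y m)\p _ _ -> e≤(alg "-1a=-a"))∙ ∑P-*(Y m)(- 1#)∇ ∙ alg "-1a=-a"))(∑P-*(Y m)(# 2)B))(∑P-*(Y m)(# 2 * s)C))⊹ *≤(0≤# 2)((∑P-incl{f = B} Ym≤N \p pp -> 0≤*(inv≥0 pp)(0≤∥(χ p t -c θ p)))⨾ bound))(alg "-a+b+2c+2de+(f-g)-h=f-g+i+(-a+b+2j+2de)+2c-(h-k+k+i+2j)"))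
     where
     pick-no : ∀ {P : Set}(d : Dec P){x y} -> ¬ P -> pick d x y ≤ y
     pick-no(yes p)n = absurd(n p)
     pick-no(no _)  n = ≤r
     pick-yes : ∀ {P : Set}(d : Dec P){x y} -> P -> pick d x y ≤ x
     pick-yes(yes _)p = ≤r
     pick-yes(no n)  p = absurd(n p)
     I A B C : ℕ -> R
     I p = inv(# p)
     A p = keep(p ∣? q)(∇ p)
     B p = I p * a p
     C p = lg p * I p
    L-lower : ∀ Δ η -> ∑P N(\p -> inv(# p)* a p)≤ Δ -> ∥ Zg.A 0 S -c 1c ∥ ≤ η ->(1# - η)* e(- exponent Δ)≤ ∥ D fn bdd 0 c ∥
    L-lower Δ η bound A₀≈ = cancel(0<e(exponent Δ))(e≤(alg "a((1-b)c)=ac(1-b)" ∙ *ʳ(e-inv _)∙ alg "1(1-a)=1-a")⨾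
     lin(e≤(sym ∥-1)⊹ ∥-rev 1c(Zg.A 0 S)⊹ e≤(∥-sw 1c(Zg.A 0 S))⊹ A₀≈)(alg "a-(1-b)=c+(a+d)+e+b-(1+c+d+e)")⨾
      e≤(∥-cg(Zg.sieved₀(primes-dp N))∙ ∥-* _ _)⨾ ≤*(0≤∥ _)(Eg-≤ Δ bound))

 opaque
  x≤e : ∀ x -> x ≤ e x
  x≤e x = lin(1+x≤e x ⊹ 0≤1)(alg "a-b=a+1-(1+b+0)")

  1≤e : ∀ {x} -> 0# ≤ x -> 1# ≤ e x
  1≤e q = rs≤ e-0(e-mono q)

  x+e≤ : ∀ {x z} -> 0# ≤ x -> 0# ≤ z -> x + e z ≤ e(x + z)
  x+e≤{x}{z} p q = lin(≤*(<≤(0<e z))(1+x≤e x)⊹ *≤ p(1≤e q)⊹ e≤(sym(e-+ x z)))(alg "a-(b+c)=dc+bc+a-((1+b)c+b1+dc)")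

  #^-≤ : ∀ p .{{_ : Nz p}} K -> #(p N.^ K)≤ e(# K * lg p)
  #^-≤ p zero    = ≤t(e≤(alg "#1=1"))(1≤e(0≤*(0≤# 0)(0≤lg p)))
  #^-≤ p{{i}}(suc K)= ≤t(e≤(#-* p(p N.^ K)))(*-mono(0≤# p)(<≤(0<e _))(e≤(sym(e-log(0<# p{{i}}))))(#^-≤ p{{i}} K)⨾ e≤(sym(e-+ _ _)∙ e-cong(alg "a+ba=(1+b)a")))

  height-≤ : ∀ X K S .{{_ : Nz X}} -> All Prime S -> # height X K S ≤ e(lg X + # K * sumL S lg)
  height-≤ X K []{{i}} [] = e≤(sym(e-log(0<# X{{i}}))∙ e-cong(alg "a=a+b0"))
  height-≤ X K(p ∷ S){{i}}(pp ∷ ps)= ≤t(e≤(#-*(p N.^ K)(height X K S)))(*-mono(0≤#(p N.^ K))(<≤(0<e _))(#^-≤ p{{pr≢0 pp}} K)(height-≤ X K S{{i}} ps)⨾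
   e≤(sym(e-+ _ _)∙ e-cong(alg "ab+(c+ad)=c+a(b+d)")))

  power-≤ : ∀ K l -> # K ^ l ≤ e(# l * # K)
  power-≤ K zero    = 1≤e(0≤*(0≤# 0)(0≤# K))
  power-≤ K(suc l)= ≤t(*-mono(0≤# K)(<≤(0<e _))(x≤e(# K))(power-≤ K l))(e≤(sym(e-+ _ _)∙ e-cong(alg "a+ba=(1+b)a")))

  length-primes : ∀ N -> length(primes N)N.≤ N
  length-primes zero    = z≤n
  length-primes(suc N)with prime?(suc N)
  ... | yes _ = s≤s(length-primes N)
  ... | no _  = m≤1+n(length-primes N)

 module Powers (y : R) (0≤y : 0# ≤ y) (U : R) (1≤U : 1# ≤ U) (tiny : # 10000 * (U * U) * e (- y) ≤ 1#) where
  w w⁻ : R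
  w = e(- y)
  w⁻ = e y
  P V : ℕ -> R
  P i = e(-(# i * y))
  V i = e(# i * y)

  opaque
   0<w : 0# < w
   0<w = 0<e _
   0<P : ∀ i -> 0# < P i
   0<P i = 0<e _
   P-+ : ∀ i j -> P(i N.+ j)≈ P i * P j
   P-+ i j = trans(e-cong(-₁(*ʳ(#-+ i j))∙ alg "-((a+b)c)=-(ac)+-(bc)"))(e-+ _ _)
   V-+ : ∀ i j -> V(i N.+ j)≈ V i * V j
   V-+ i j = trans(e-cong(*ʳ(#-+ i j)∙ alg "(a+b)c=ac+bc"))(e-+ _ _)
   V-mono : ∀ {i j} -> i N.≤ j -> V i ≤ V j
   V-mono q = e-mono(≤* 0≤y(#-mono q))
   P-anti : ∀ {i j} -> i N.≤ j -> P j ≤ P i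
   P-anti q = e-mono(≤-neg(≤* 0≤y(#-mono q)))
   P-0 : P 0 ≈ 1#
   P-0 = trans(e-cong(alg "-(0a)=0"))e-0
   P-1 : P 1 ≈ w
   P-1 = e-cong(alg "-(#1a)=-a")
   V-1 : V 1 ≈ w⁻
   V-1 = e-cong(alg "#1a=a")
   VP : ∀ i -> V i * P i ≈ 1#
   VP i = e-inv(# i * y)
   P≤1 : ∀ i -> P i ≤ 1#
   P≤1 i = ≤rs P-0(P-anti{0}{i} z≤n)
   1≤UU : 1# ≤ U * U
   1≤UU = rs≤(alg "1(1)=1")(*-mono 0≤1(0≤1 ⨾ 1≤U)1≤U 1≤U)
   0≤U : 0# ≤ U
   0≤U = ≤t 0≤1 1≤U
   U≤UU : U ≤ U * U
   U≤UU = rs≤(alg "a1=a")(*≤ 0≤U 1≤U)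
   absorb : ∀ i{b} -> b ≤ # 10000 *(U * U)-> b * P(suc i)≤ P i
   absorb i{b} q = ≤t(e≤(*ˡ(P-+ 1 i ∙ *ʳ P-1)∙ alg "a(bc)=abc"))(≤*(<≤(0<P i))(≤*(<≤ 0<w)q ⨾ tiny)⨾ e≤(alg "1a=a"))
   raise : ∀ i{b} -> b ≤ # 10000 *(U * U)-> b * V i ≤ V(suc i)
   raise i{b} q = cancel(0<P(suc i))(e≤(alg "a(bc)=bac")⨾ ≤*(<≤(0<e _))(absorb i q)⨾ e≤(alg "ab=ba" ∙ VP i ∙ sym(alg "ab=ba" ∙ VP(suc i))))
   scaled : ∀ k -> k N.≤ 10000 -> # k *(U * U)≤ # 10000 *(U * U)
   scaled k q = ≤*(0≤1 ⨾ 1≤UU)(#-mono q)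
   const≤ : ∀ k -> k N.≤ 10000 -> # k ≤ # 10000 *(U * U)
   const≤ k q = ≤t(rs≤(alg "a1=a")(*≤(0≤# k)1≤UU))(scaled k q)
   inv-w : inv w ≈ w⁻
   inv-w = sym(inv-uniq(alg "ab=ba" ∙ e-inv y))
   inv-P : ∀ i -> inv(P i)≈ V i
   inv-P i = sym(inv-uniq(alg "ab=ba" ∙ VP i))
   inv^ : ∀ k -> inv w ^ k ≈ V k
   inv^ zero    = sym(e-cong(alg "0a=0")∙ e-0)
   inv^(suc k)= trans(*₂(inv-w ∙ sym V-1)(inv^ k))(sym(V-+ 1 k))
   wB≤ : ∀ k -> wB k w ≤ # 2 * V(suc k)
   wB≤ k = ≤t(e≤(*₂(inv^ k)(+ˡ inv-w)))(*≤(<≤(0<e _))(lin(1≤e 0≤y ⊹ ≤r{w⁻})(alg "2a-(1+a)=a+a-(1+a)"))⨾ e≤(alg "a(2b)=2(ba)" ∙ *ˡ(*ʳ(sym V-1)∙ sym(V-+ 1 k))))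
   P*wB : ∀ i k -> P(i N.+ suc k)* wB k w ≤ # 2 * P i
   P*wB i k = ≤t(*≤(<≤(0<P(i N.+ suc k)))(wB≤ k))(e≤(*ʳ(P-+ i(suc k))∙ alg "ab(2c)=2a(cb)" ∙ *ˡ(VP(suc k))∙ alg "2a1=2a"))
   0≤wB : ∀ k -> 0# ≤ wB k w
   0≤wB k = 0≤*(0≤^ k(<≤(inv⁺ 0<w)))(0≤+ 0≤1(<≤(inv⁺ 0<w)))
   absorbU : ∀ i k -> k N.≤ 10000 -> # k * U * P(suc i)≤ P i
   absorbU i k q = absorb i(*≤(0≤# k)U≤UU ⨾ scaled k q)
   absorbUU : ∀ i k -> k N.≤ 10000 -> # k *(U * U)* P(suc i)≤ P i
   absorbUU i k q = absorb i(scaled k q)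
   absorb# : ∀ i k -> k N.≤ 10000 -> # k * P(suc i)≤ P i
   absorb# i k q = absorb i(const≤ k q)
   raiseU : ∀ i k -> k N.≤ 10000 -> # k * U * V i ≤ V(suc i)
   raiseU i k q = raise i(*≤(0≤# k)U≤UU ⨾ scaled k q)
   1≤V : ∀ i -> 1# ≤ V i
   1≤V i = 1≤e(0≤*(0≤# i)0≤y)
   P≤h⁴ : P 1 ≤ h * h * h * h
   P≤h⁴ = cancel(0<#s 15)(absorb# 0 16(bN 16 10000 _)⨾ e≤(P-0 ∙ sym(alg "16(aaaa)=2a(2a)(2a(2a))" ∙ *₂(*₂ 2h 2h)(*₂ 2h 2h)∙ alg "1(1)(1(1))=1")))
   h≤1 : h ≤ 1#
   h≤1 = lin(0≤h ⊹ e≤ 2h)(alg "1-a=a+1-(0+2a)")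
   P≤h³ : P 1 ≤ h * h * h
   P≤h³ = ≤t P≤h⁴(*≤(0≤*(0≤* 0≤h 0≤h)0≤h)h≤1 ⨾ e≤(alg "aaa1=aaa"))
   P≤h : P 1 ≤ h
   P≤h = ≤t P≤h³(*-mono(0≤* 0≤h 0≤h)0≤1(*≤ 0≤h h≤1 ⨾ e≤(alg "a1=a"))h≤1 ⨾ e≤(alg "a1=a"))

 module AtScale (q : ℕ) (g : Mult) (θ⁰ : ℕ -> ℂ) (unit⁰ : ∀ p -> ∥ θ⁰ p ∥ ≈ 1#) (C : R) (prefix : ∀ n -> ∥ ∑Pc n (\p -> cx (lg p) *c (θ⁰ p *c cx (inv (# p)))) ∥ ≤ C)
  (phase⁰ : ∀ p -> Prime p -> ¬(p ∣ q)-> Mult.fn g p *c θ⁰ p ~ 1c)(vanish : ∀ p -> Prime p -> p ∣ q -> Mult.fn g p ~ 0c)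
  (m gap : ℕ)(y : R)(0≤y : 0# ≤ y)(U : R)(1≤U : 1# ≤ U)(tiny : # 10000 *(U * U)* e(- y)≤ 1#)
  (Λ≤U : #(m N.+ gap N.+ gap N.+ gap)≤ U)(y≤U : y + 1# ≤ U)(lg2≤U : # 4 * lg 2 ≤ U)(t₀ : R)(0≤t₀ : 0# ≤ t₀)(t₀≤U : t₀ + # 20 ≤ U)(b≤U : # 2 * wB 0(inv(# 6))+ wB 2(inv(# 6))+ wB 4(inv(# 6))≤ U)
  (y₂₀ : # 20 * y ≤ # m * h)(y₄₂ : # 42 * y ≤ inv(# 6)* # m)
  (M : R)(0≤M : 0# ≤ M)(room : # 2 *(M + # 2 + # 3 *(C + # 2 * wB 1(inv 2#)))+ cₘ ≤ # gap)
  (turn : # 1 + # 6 * C *(#(m N.+ gap N.+ gap N.+ gap)+ 1#)+ # 30 * c₃ + # 2 * #(m N.+ gap)+ # 3 *(C + # 2 * wB 1(inv 2#))* #(m N.+ gap N.+ gap)≤ # gap * M)(3C₁<M : # 3 *(C + # 2 * wB 1(inv 2#))< M)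
  (∑1/p≤y : ∑P(Y(m N.+ gap N.+ gap N.+ gap))(\p -> inv(# p))≤ y)where
  open Powers y 0≤y U 1≤U tiny
  open Mult g using (fn; bdd)

  top : ℕ
  top = m N.+ gap N.+ gap N.+ gap
  Λ : R
  Λ = # top

  private
   s : R
   s = # 5 * w
   0<s : 0# < s
   0<s = *-pos(0<#s 4)0<w
   opaque
    Uw : ∀ k -> k N.≤ 10000 -> # k * U * w ≤ 1#
    Uw k q = ≤t(e≤(*ˡ(sym P-1)))(absorbU 0 k q ⨾ P≤1 0)
    0≤Λ : 0# ≤ Λ
    0≤Λ = 0≤# top
    s-small : s * Λ ≤ h
    s-small = ≤t(*≤(<≤ 0<s)Λ≤U)(lin(*≤ 0≤h(Uw 10(bN 10 10000 _))⊹ e≤(*ʳ{# 5 * U * w}(sym 2h)))(alg "a-5bc=a1+2a(5cb)-(a(10cb)+1(5cb))")⨾ ≤r)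
   module Sel = Select θ⁰ unit⁰ C prefix m gap s 0<s s-small M 0≤M
   N : ℕ
   N = Sel.N room turn 3C₁<M
   θ : ℕ -> ℂ
   θ = Sel.θ room turn 3C₁<M
   Ym≤N : Y m N.≤ N
   Ym≤N = Sel.Ym≤N room turn 3C₁<M
   N≤ : N N.≤ Y top
   N≤ = Sel.N≤ room turn 3C₁<M
   θ-unit : ∀ p -> ∥ θ p ∥ ≈ 1#
   θ-unit = Sel.θ-unit room turn 3C₁<M
   0<N : 0 N.< N
   0<N = N.<-≤-trans(0<Y m)Ym≤N
   E : R
   E = P 20
   opaque
    inv≥0 : ∀ {p} -> Prime p -> 0# ≤ inv(# p)
    inv≥0{p} pp = <≤(inv⁺(0<# p{{pr≢0 pp}}))
    ∑≤y : ∑P N(\p -> inv(# p))≤ y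
    ∑≤y = ≤t(∑P-incl N≤ \p -> inv≥0)∑1/p≤y
    lg≤Λ : ∀ p -> Prime p -> p N.≤ N -> lg p ≤ Λ
    lg≤Λ p pp p≤ = lg-≤{p}{top}{{pr≢0 pp}}(trN p≤ N≤)
    y≤ : y ≤ U
    y≤ = ≤t(lin 0≤1(alg "a+1-a=1-0"))y≤U
    ceil-X : ∃ \n -> V 3 < # n × # n ≤ V 3 + 1#
    ceil-X = ceiling(V 3)(<≤(0<e _))
   nX X : ℕ
   nX = fst ceil-X
   X = suc(Y nX)
   opaque
    wV : ∀ i -> w * V(suc i)≈ V i
    wV i = trans(*ˡ(V-+ 1 i ∙ *ʳ V-1))(alg "a(bc)=bac" ∙ *ʳ(e-inv y)∙ alg "1a=a")
    tail : ∀ k -> k N.≤ 2 -> rp X w * wB k w ≤ P 20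
    tail k k≤2 = ≤t(*-mono(<≤(0<rp X w))(0≤*(0≤# 2)(<≤(0<e _)))(e-mono(≤-neg((*≤(0≤# 24)y≤ ⨾ lin(*≤(0≤*(0≤# 24)0≤U)(1≤V 1))(alg "24ab-24a=24ab-24a1")⨾ raiseU 1 24(bN 24 10000 _))⨾ e≤(sym(wV 2))⨾ *≤(<≤ 0<w)(<≤(fst(snd ceil-X))⨾ Y-<lg{X}{nX}(N.n<1+n(Y nX))))))(wB≤ k ⨾ *≤(0≤# 2)(V-mono{suc k}{3}(s≤s k≤2))))
     (e≤(*ʳ(P-+ 21 3)∙ alg "ab(2c)=2a(cb)" ∙ *ˡ(VP 3)∙ alg "2a1=2a")⨾ absorb# 20 2(bN 2 10000 _))
    N<X : suc N N.≤ X
    N<X = s≤s(trN N≤(Y-mono(#-cancel-≤(Λ≤U ⨾(lin(*≤ 0≤U(1≤V 0))(alg "#1ab-a=ab-a1")⨾ raiseU 0 1(bN 1 10000 _))⨾ V-mono{1}{3}(s≤s z≤n)⨾ <≤(fst(snd ceil-X))))))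
    2≤X : 2 N.≤ X
    2≤X = s≤s(0<Y nX)
    0≤B : 0# ≤ inv E * inv E
    0≤B = 0≤sq(inv E)
    B≈ : inv E * inv E ≈ V 40
    B≈ = trans(*₂(inv-P 20)(inv-P 20))(sym(V-+ 20 20))
    ceil-K : ∃ \n -> # 8 *(inv E * inv E * y)< # n × # n ≤ # 8 *(inv E * inv E * y)+ 1#
    ceil-K = ceiling _(0≤*(0≤# 8)(0≤* 0≤B 0≤y))
   K : ℕ
   K = fst ceil-K
   opaque
    K≢0 : Nz K
    K≢0 = N.≢-nonZero \K≡0 -> fst(snd ceil-K)(rs≤(rfx(E.cong #_(E.sym K≡0)))(0≤*(0≤# 8)(0≤* 0≤B 0≤y)))
    ℓ₂-small : # 4 *(inv E * inv E *(rp(suc N)(inv(# 6))*(# 2 * wB 0(inv(# 6))+ wB 2(inv(# 6))+ wB 4(inv(# 6)))))≤ 1#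
    ℓ₂-small = ≤t(*≤(0≤# 4)(*≤ 0≤B(*-mono(<≤(0<rp(suc N)(inv(# 6))))0≤U(e-mono(≤-neg(y₄₂ ⨾ *≤(<≤(inv⁺(0<#s 5)))(Y-<lg{suc N}{m}(s≤s Ym≤N)))))b≤U)⨾ e≤(*ʳ B≈)))
     (e≤(*ˡ(*ˡ(*ʳ(P-+ 40 2)))∙ alg "4(a(bcd))=4dc(ab)" ∙ *ˡ(VP 40)∙ alg "4ab1=4ab")⨾ absorbU 1 4(bN 4 10000 _)⨾ P≤1 1)
    choice : ∃ \t -> t₀ ≤ t × t ≤ t₀ + 1# + height-bound N 0<N g w 0<w θ θ-unit X N<X E(0<P 20)y ∑≤y K{{K≢0}}(<≤(fst(snd ceil-K)))× Close N 0<N g w 0<w θ θ-unit X N<X E(0<P 20)y ∑≤y K{{K≢0}}(<≤(fst(snd ceil-K)))t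
    choice = chosen N 0<N g w 0<w θ θ-unit X N<X E(0<P 20)y ∑≤y K{{K≢0}}(<≤(fst(snd ceil-K)))ℓ₂-small t₀
   instance
    K-nonzero : Nz K
    K-nonzero = K≢0
   t : R
   t = fst choice
   open Close (snd (snd (snd choice)))
   module Pt = Point N g w 0<w θ θ-unit t
   Δ η r μ : R
   Δ = E *(y + 1#)
   η = # 2 * P 20
   r = P 8
   μ = # 2 * e(-(# m * h))+ # 2 *(# 2 * e(- # m)*(Λ + # 4 * lg 2))
   opaque
    approx : ∀ {A U val : ℂ} k -> k N.≤ 2 -> ∥ A -c U ∥ ≤ ∥ val ∥ + rp X w * wB k w -> ∥ val ∥ ≤ E -> ∥ A -c U ∥ ≤ η
    approx k k≤2 p q = ≤t p(q ⊹ tail k k≤2 ⨾ e≤(alg "a+a=2a"))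
    A₀≈ : ∥ Pt.Zζ.A 0(primes N)-c 1c ∥ ≤ η
    A₀≈ = approx 0 z≤n(At.rough-≈ N 0<N one w 0<w 0 z≤n t X 2≤X)val₀
    A₁≈ : ∥ Pt.Zζ.A 1(primes N)-c 0c ∥ ≤ η
    A₁≈ = approx 1(s≤s z≤n)(At.rough-≈ N 0<N one w 0<w 1(s≤s z≤n)t X 2≤X)val₁
    A₂≈ : ∥ Pt.Zζ.A 2(primes N)-c 0c ∥ ≤ η
    A₂≈ = approx 2(s≤s(s≤s z≤n))(At.rough-≈ N 0<N one w 0<w 2(s≤s(s≤s z≤n))t X 2≤X)val₂
    Aᵍ≈ : ∥ Pt.Zg.A 0(primes N)-c 1c ∥ ≤ η
    Aᵍ≈ = approx 0 z≤n(At.rough-≈ N 0<N g w 0<w 0 z≤n t X 2≤X)valᵍ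
    0<r : 0# < r
    0<r = 0<P 8

    Δ≤ : Δ ≤ P 20 * U
    Δ≤ = *≤(<≤(0<P 20))y≤U
    k₁ : μ + # 4 * Λ * Δ ≤ P 17
    k₁ = *≤(0≤# 2)e₁ ⊹ *≤(0≤# 2)(*-mono(0≤*(0≤# 2)(<≤(0<e _)))(0≤+ 0≤U 0≤U)(*≤(0≤# 2)(e-mono(≤-neg(*≤(0≤# m)h≤1 ⨾ e≤(alg "a1=a")))⨾ e₁))(Λ≤U ⊹ lg2≤U))⊹ *-mono(0≤*(0≤# 4)0≤Λ)(0≤*(<≤(0<P 20))0≤U)(*≤(0≤# 4)Λ≤U)Δ≤ ⨾
     lin(≤*(<≤(0<P 20))U≤UU ⊹ ≤*(<≤(0<P 20))U≤UU ⊹ ≤*(<≤(0<P 20))(U≤UU ⊹ U≤UU ⊹ U≤UU ⊹ U≤UU ⊹ U≤UU ⊹ U≤UU ⊹ U≤UU ⊹ U≤UU)⊹ ≤*(<≤(0<P 20))(1≤U ⊹ 1≤U))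
      (alg "14(aa)b-(2b+2(2b(a+a))+4a(ba))=aab+aab+(aa+aa+aa+aa+aa+aa+aa+aa)b+(a+a)b-(ab+ab+(a+a+a+a+a+a+a+a)b+(1+1)b)")⨾
      absorbUU 19 14(bN 14 10000 _)⨾ P-anti{17}{19}(bN 17 19 _)
     where
     e₁ : e(-(# m * h))≤ P 20
     e₁ = e-mono(≤-neg y₂₀)
    k₂ : # 12 *(Λ * Λ)* Δ ≤ h
    k₂ = ≤t(*-mono(0≤*(0≤# 12)(0≤sq Λ))(0≤*(<≤(0<P 20))0≤U)(*≤(0≤# 12)(*-mono 0≤Λ 0≤U Λ≤U Λ≤U))Δ≤)(e≤(alg "12(aa)(ba)=a(12(aa)b)")⨾
     *≤ 0≤U(absorbUU 19 12(bN 12 10000 _))⨾ e≤(alg "ab=#1ab")⨾ absorbU 18 1(bN 1 10000 _)⨾ P-anti{1}{18}(s≤s z≤n)⨾ P≤h)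
    k₃ : η ≤ h
    k₃ = ≤t(absorb# 19 2(bN 2 10000 _))(P-anti{1}{19}(s≤s z≤n)⨾ P≤h)
    k₈ : # 3 * r ≤ w
    k₈ = ≤t(absorb# 7 3(bN 3 10000 _))(P-anti{1}{7}(s≤s z≤n)⨾ e≤ P-1)
    k₉ : r * wB 1 w + # 3 * r * r * wB 2 w ≤ 1#
    k₉ = ≤t(P*wB 6 1 ⊹ ≤t(e≤(alg "3aab=3a(ab)"))(*-mono(0≤*(0≤# 3)(<≤(0<P 8)))(0≤*(0≤# 2)(<≤(0<P 5)))(*≤(0≤# 3)(P≤1 8)⨾ e≤(alg "3(1)=3"))(P*wB 5 2)))
     (*≤(0≤# 2)(P-anti{5}{6}(bN 5 6 _))⊹ ≤r ⨾ e≤(alg "2a+3(2a)=8a")⨾ absorb# 4 8(bN 8 10000 _)⨾ P≤1 4)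
    crit : ∃ \ρ -> ∥ ρ -c Pt.c ∥ ≤ r × D(Mult.fn one)(Mult.bdd one)1 ρ ~ 0c
    crit = Pt.critical Λ 0≤Λ lg≤Λ y ∑≤y Δ Δ-small η A₀≈ A₁≈ A₂≈ μ(Sel.S₁-small room turn 3C₁<M)(Sel.S₂-negative room turn 3C₁<M)(P 17)(P 15)r 0<r k₁ k₂ k₃(*≤(0≤# 2)(P-anti{17}{20}(bN 17 20 _))⊹ ≤r ⨾ e≤(alg "2a+2a=4a")⨾ absorb# 16 4(bN 4 10000 _)⨾ P-anti{15}{16}(bN 15 16 _))(*≤(0≤# 2)(P-anti{17}{20}(bN 17 20 _))⊹ *≤(0≤*(0≤# 2)(<≤(0<P 17)))(P≤1 15)⊹ *≤(0≤# 2)(*≤(<≤(0<P 17))(P≤1 17))⨾ e≤(alg "2a+2a1+2(a1)=6a")⨾ absorb# 16 6(bN 6 10000 _)⨾ P-anti{1}{16}(s≤s z≤n)⨾ P≤h³)(e≤(alg "3abc=3c(ab)")⨾ *≤(0≤*(0≤# 3)(<≤(0<e y)))(P*wB 4 3)⨾ e≤(*ˡ(*ˡ(P-+ 3 1 ∙ *ˡ P-1))∙ alg "3a(2(bc))=6b(ac)" ∙ *ˡ(e-inv y)∙ alg "6a1=6a")⨾ absorb# 2 6(bN 6 10000 _)⨾ P-anti{1}{2}(s≤s z≤n)⨾ P≤h⁴)(P-anti{9}{15}(bN 9 15 _)⨾ e≤(P-+ 1 8)⨾ ≤*(<≤(0<P 8))P≤h⁴ ⨾ e≤(alg "aaaa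b=aaa(ba)"))k₈

  ρ : ℂ
  ρ = fst crit

  opaque
   critical-ρ : D(Mult.fn one)(Mult.bdd one)1 ρ ~ 0c
   critical-ρ = snd(snd crit)

  private opaque
   close-ρ : ∥ ρ -c Pt.c ∥ ≤ r
   close-ρ = fst(snd crit)
   X≢0 : Nz X
   X≢0 = _
   L : R
   L = e Λ
   1≤L : 1# ≤ L
   1≤L = 1≤e 0≤Λ
   0≤L : 0# ≤ L
   0≤L = ≤t 0≤1 1≤L
   N≤L : # N ≤ L
   N≤L = ≤t(#-mono N≤)(Y-≤ top)
   0≤V : ∀ i -> 0# ≤ V i
   0≤V i = <≤(0<e _)
   K≤ : # K ≤ V 41
   K≤ = ≤t(snd(snd ceil-K))(*≤(0≤# 8)(e≤(*ʳ B≈)⨾ *≤(0≤V 40)y≤)⊹ ≤t 1≤U(e≤(alg "a=1a")⨾ ≤* 0≤U(1≤V 40))⨾ e≤(alg "8(ab)+ab=9ba")⨾ raiseU 40 9(bN 9 10000 _))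
   wB²≤ : ∀ k -> k N.≤ 2 -> wB k w * wB k w ≤ # 4 * V 6
   wB²≤ k q = *-mono(0≤wB k)(0≤*(0≤# 2)(0≤V 3))k≤ k≤ ⨾ e≤(alg "2a(2a)=4(aa)" ∙ *ˡ(sym(V-+ 3 3)))
    where
    k≤ : wB k w ≤ # 2 * V 3
    k≤ = ≤t(wB≤ k)(*≤(0≤# 2)(V-mono{suc k}{3}(s≤s q)))
   Z : R
   Z = # 8 +(V 3 + # 2 + V 41 *(U * L))+ L * V 41 + V 47
   0≤VL : ∀ i -> 0# ≤ V i * L
   0≤VL i = 0≤*(0≤V i)0≤L
   0≤Z : 0# ≤ Z
   0≤Z = 0≤+(0≤+(0≤+(0≤# 8)(0≤+(0≤+(0≤V 3)(0≤# 2))(0≤*(0≤V 41)(0≤* 0≤U 0≤L))))(0≤* 0≤L(0≤V 41)))(0≤V 47)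
   height-bound≤ : # 8 * # height X K(primes N)* # K ^ length(primes N)*(1# + # 4 *(inv E * inv E * y)+ inv E * inv E *(# 2 *(wB 0 w * wB 0 w)+ wB 1 w * wB 1 w + wB 2 w * wB 2 w))≤ e Z
   height-bound≤ = ≤t(*-mono(0≤*(0≤*(0≤# 8)(0≤#(height X K(primes N))))(0≤^(length(primes N))(0≤# K)))(<≤(0<e _))(*-mono(0≤*(0≤# 8)(0≤#(height X K(primes N))))(<≤(0<e _))(*-mono(0≤# 8)(<≤(0<e _))(x≤e(# 8))(height-≤ X K(primes N){{X≢0}}(All.map fst(primes-≤ N))⨾ e-mono((lg-step≤(Y nX){{Y≢0 nX}} ⨾ ≤t(lg-≤{Y nX}{nX}{{Y≢0 nX}} rfN)(snd(snd ceil-X))⊹ ≤t(inv-anti 0<1(e≤(alg "1=#1")⨾ #-mono(0<Y nX)))(e≤(sym(inv-uniq(alg "1(1)=1"))))⨾ e≤(alg "a+1+1=a+2"))⊹ *-mono(0≤# K)(0≤* 0≤U 0≤L)K≤(e≤(sumL-pr N lg)⨾ chebyshev N ⨾ *-mono(0≤*(0≤# 4)(0≤lg 2))0≤L lg2≤U N≤L))))(power-≤ K(length(primes N))⨾ e-mono(*-mono(0≤#(length(primes N)))(0≤V 41)(#-mono(length-primes N)⨾ N≤L)K≤)))((lin(≤t 1≤U(e≤(alg "a=a1")⨾ *≤ 0≤U(1≤V 46))⊹ *≤(0≤# 4)(*-mono 0≤B 0≤U(e≤ B≈ ⨾ V-mono{40}{46}(bN 40 46 _))y≤)⊹ *-mono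 0≤B(0≤*(0≤# 16)(0≤V 6))(e≤ B≈)(*≤(0≤# 2)(wB²≤ 0 z≤n)⊹ wB²≤ 1(s≤s z≤n)⊹ wB²≤ 2(s≤s(s≤s z≤n))⨾ e≤(alg "2(4a)+4a+4a=16a"))⊹ e≤(*ˡ{# 16}(sym(V-+ 40 6)))⊹ *≤(0≤# 16)(≤*(0≤V 46)1≤U))(alg "21ab-(1+4c+de)=ab+4(ba)+f(16g)+16b+16(ab)-(1+4c+de+16(fg)+16(1b))")⨾ raiseU 46 21(bN 21 10000 _))⨾ x≤e(V 47)))
    (e≤(sym(e-+ _ _ ∙ *ʳ(e-+ _ _ ∙ *ʳ(e-+ _ _)))))
   exponent≤ : t₀ + # 2 + Z ≤ e(Λ + # 48 * y)
   exponent≤ = lin(t₀≤U ⊹ ≤t(e≤(alg "a=a1"))(*≤ 0≤U(1≤VL 47))⊹ V≤VL 3(bN 3 47 _)⊹ ≤*(0≤* 0≤U 0≤L)(V-mono{41}{47}(bN 41 47 _))⊹ *≤ 0≤L(V-mono{41}{47}(bN 41 47 _))⊹ V≤VL 47 rfN ⊹ ≤*(0≤VL 47)(1≤U ⊹ 1≤U ⊹ 1≤U)⊹ 0≤# 8)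
    (alg "5abc-(d+2+(8+(e+2+f(ac))+cf+b))=a+a(bc)+bc+b(ac)+cb+bc+(a+a+a)(bc)+8-(d+20+a+e+f(ac)+cf+b+(1+1+1)(bc)+0)")⨾
    ≤* 0≤L(raiseU 47 5(bN 5 10000 _))⨾ e≤(sym(e-+ _ _)∙ e-cong(alg "48a+b=b+48a"))
    where
    1≤VL : ∀ i -> 1# ≤ V i * L
    1≤VL i = rs≤(alg "1(1)=1")(*-mono 0≤1 0≤L(1≤V i)1≤L)
    V≤VL : ∀ i -> i N.≤ 47 -> V i ≤ V 47 * L
    V≤VL i q = ≤t(V-mono q)(e≤(alg "a=a1")⨾ *≤(0≤V 47)1≤L)

  opaque
   re-ρ : 1# < re ρ
   re-ρ = lin<(lin<(*-pos(0<#s 3)0<w)(alg "4a-0=4a-0")⊹<(≤t(re≤∥(Pt.c -c ρ))(e≤(∥-sw Pt.c ρ)⨾ close-ρ)⊹ k₈ ⊹ <≤ 0<r ⊹ <≤ 0<r))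
    (alg "a-1=4b+(c+b+c+c)-(0+(1+5b-a+3c+0+0))")
   im-ρ≥ : t₀ - 1# ≤ im ρ
   im-ρ≥ = lin(fst(snd choice)⊹ ≤t(abs-ge _)(abs-im≤(Pt.c -c ρ)⨾ e≤(∥-sw Pt.c ρ)⨾ close-ρ ⨾ P≤1 8))(alg "a-(b-1)=c+1-(b+(c-a))")
   im-ρ≤ : im ρ ≤ e(e(Λ + # 48 * y))
   im-ρ≤ = lin(≤t(abs-ge _)(abs-im≤(ρ -c Pt.c)⨾ close-ρ ⨾ P≤1 8)⊹ fst(snd(snd choice))⊹ height-bound≤)(alg "a+2+b-c=1+(a+1+d)+b-(c-e+e+d)")⨾
    x+e≤(0≤+ 0≤t₀(0≤# 2))0≤Z ⨾ e-mono exponent≤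

  tail-sum : R
  tail-sum = ∑P N(\p -> inv(# p))- ∑P(Y m)(\p -> inv(# p))

  opaque
   tail-sum≤ : # m * tail-sum ≤ Λ - # m + cₘ
   tail-sum≤ = ≤t(e≤(alg "a(b-c)=ab-ac" ∙ +₂(sym(∑P-* N(# m)_))(-₁(sym(∑P-*(Y m)(# m)_)))))
    ((∑P-window{f = \p -> # m * inv(# p)}{g = \p -> lg p * inv(# p)} Ym≤N \p pp q _ -> ≤*(inv≥0 pp)(Y-<lg{p}{m} q))⨾
     lin(≤t(∑P-incl N≤ \p pp -> 0≤*(0≤lg p)(inv≥0 pp))(∑lg/p-≤ top)⊹ mertens-≥(Y m){{Y≢0 m}} ⊹ lgY≥ m)(alg "a-b+(2+c+4d)-(e-f)=a+4d+(f+(1+c))+(g+1)-(e+g+b)"))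
   L-ρ :(1# - # 2 * P 20)* e(G m - ∑P(Y m)(\p -> keep(p ∣? q)(∇ p))- P 19 - # 20 * U * w - tail-sum)≤ ∥ D fn bdd 0 ρ ∥ + 1#
   L-ρ = *≤(0≤-by(absorb# 19 2(bN 2 10000 _)⨾ P≤1 19))(e-mono(lin((*≤(0≤# 2)Δ≤ ⨾ e≤(alg "2(ab)=2ba")⨾ absorbU 19 2(bN 2 10000 _))⊹(*≤(0≤*(0≤# 2)(<≤ 0<s))(∑lg/p-≤ m ⨾(#-mono(trN(m≤m+n m gap)(trN(m≤m+n(m N.+ gap)gap)(m≤m+n(m N.+ gap N.+ gap)gap)))⨾ Λ≤U)⊹ lg2≤U)⨾ e≤(alg "2(5a)(b+b)=20ba")))(alg "-(-a+b+2c+2de+(f-g))-(a-b-h-20ij-(f-g))=h+20ij-(2c+2de)")))⨾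
    Pt.L-lower m Ym≤N q phase vanish Δ η Δ-small Aᵍ≈ ⨾ Pt.near-L r(<≤ 0<r)k₈ k₉ ρ close-ρ
    where
    phase : ∀ p -> Prime p -> p N.≤ Y m -> ¬(p ∣ q)-> fn p *c θ p ~ 1c
    phase p pp p≤ nd = trc(*ˡc(≡c(Sel.θ-low room turn 3C₁<M p≤)))(phase⁰ p pp nd)
   found : ∃ \ρ -> 1# < re ρ × D(Mult.fn one)(Mult.bdd one)1 ρ ~ 0c × t₀ - 1# ≤ im ρ × im ρ ≤ e(e(Λ + # 48 * y))×
    ∃ \τ -> # m * τ ≤ Λ - # m + cₘ ×(1# - # 2 * P 20)* e(G m - ∑P(Y m)(\p -> keep(p ∣? q)(∇ p))- P 19 - # 20 * U * w - τ)≤ ∥ D fn bdd 0 ρ ∥ + 1#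
   found = ρ , re-ρ , critical-ρ , im-ρ≥ , im-ρ≤ , tail-sum , tail-sum≤ , L-ρ

 opaque
  ∑1/p-bound : ∀ b N .{{_ : Nz b}} -> Y b N.≤ N -> ∑P N(\p -> inv(# p))≤ ∑P(Y b)(\p -> inv(# p))+ inv(# b)* ∑lg/p N
  ∑1/p-bound b N{{i}} Yb≤N = lin(∑P-window{f = \p -> inv(# p)}{g = \p -> inv(# b)*(lg p * inv(# p))} Yb≤N(\p pp q _ -> each p pp q)⊹ e≤(∑P-* N(inv(# b))_)⊹ ∑P-nonneg(Y b){\p -> inv(# b)*(lg p * inv(# p))}(\p pp -> 0≤* 0≤b(0≤*(0≤lg p)(0≤p pp))))
   (alg "a+bc-d=e-f+bc+f-(d-a+e+0)")
   where
   0≤b : 0# ≤ inv(# b)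
   0≤b = <≤(inv⁺(0<# b{{i}}))
   0≤p : ∀ {p} -> Prime p -> 0# ≤ inv(# p)
   0≤p{p} pp = <≤(inv⁺(0<# p{{pr≢0 pp}}))
   each : ∀ p -> Prime p -> Y b N.< p -> inv(# p)≤ inv(# b)*(lg p * inv(# p))
   each p pp q = e≤(alg "a=1a" ∙ *ʳ(sym(alg "ab=ba" ∙ inv-r(0<# b{{i}}))))⨾
    ≤*(0≤p pp)(*≤ 0≤b(Y-<lg{p}{b} q))⨾ e≤(alg "abc=a(bc)")

  -- x² e(-x) ≤ 27/x
  decay : ∀ {d x} -> 0# ≤ d -> 0# < x -> # 27 * d ≤ x -> d *(x * x)* e(- x)≤ 1#
  decay{d}{x} 0≤d 0<x q = cancel 0<x(e≤(alg "a(b(aa)c)=b(a(a(a1))c)")⨾ *≤ 0≤d(e≤(*ˡ(e-cong(-₁(alg "a=1a" ∙ *ʳ(sym third)))))⨾ power-bound 3(<≤ 0<x)(inv⁺(0<#s 2))⨾ e≤(*₂ three(*₂ three(*ʳ three))∙ alg "3(3(3(1)))=27"))⨾ e≤(alg "a27=27a")⨾ q ⨾ e≤(alg "a=a1"))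
   where
   third : # 3 * inv(# 3)≈ 1#
   third = inv-r(0<#s 2)
   three : inv(inv(# 3))≈ # 3
   three = sym(inv-uniq(alg "a3=3a" ∙ third))

 module _ {q : ℕ} (1<q : 1 N.< q) (Ch : Character q) (γ : R) (γ-≤ : ∀ n -> γ + lg (suc n) ≤ harm (suc n)) where
  open Character Ch
  open AtOne (balanced 1<q Ch) using (F; V)

  private
   g : Mult
   g = Balanced.base(balanced 1<q Ch)
   θ⁰ : ℕ -> ℂ
   θ⁰ p = choose(em{∥ c p ∥ ≈ 1#})(conj(c p))1c
   Cᵥ C : R
   Cᵥ = fst(V-bounded 1<q Ch)
   C = Cᵥ + ∑lg/p q
   opaque
    unit⁰ : ∀ p -> ∥ θ⁰ p ∥ ≈ 1#
    unit⁰ p with em{∥ c p ∥ ≈ 1#}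
    ... | yes e = trans(∥-conj(c p))e
    ... | no _  = ∥-1
    prime-coprime : ∀ {p} -> Prime p -> ¬(p ∣ q)-> Coprime p q
    prime-coprime pp nd(i∣p , i∣q)with prime⇒irreducible pp i∣p
    ... | inl i≡1 = i≡1
    ... | inr E.refl = absurd(nd i∣q)
    vanish⁰ : ∀ p -> Prime p -> p ∣ q -> c p ~ 0c
    vanish⁰ p pp d = vanish p \cop -> N.<⇒≢(prime>1 pp)(E.sym(cop(N.∣-refl , d)))
    θ⁰-divides : ∀ p -> Prime p -> p ∣ q -> θ⁰ p ≡ 1c
    θ⁰-divides p pp d = choose-no(em{∥ c p ∥ ≈ 1#})\e -> 0<1(e≤(sym e ∙ ∥-cg(vanish⁰ p pp d)∙ ∥-0))
    θ⁰-coprime : ∀ p -> Prime p -> ¬(p ∣ q)-> θ⁰ p ≡ conj(c p)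
    θ⁰-coprime p pp nd = choose-yes(em{∥ c p ∥ ≈ 1#})(∥c∥≈1 1<q Ch p(prime-coprime pp nd))
    phase⁰ : ∀ p -> Prime p -> ¬(p ∣ q)-> c p *c θ⁰ p ~ 1c
    phase⁰ p pp nd = *ˡc(≡c(θ⁰-coprime p pp nd))⊙ *-conj(c p)⊙ of-cong(sym(∥-sq(c p))∙ *₂ unit unit ∙ alg "1(1)=1")
     where
     unit : ∥ c p ∥ ≈ 1#
     unit = ∥c∥≈1 1<q Ch p(prime-coprime pp nd)
    0≤lg/p : ∀ p -> Prime p -> 0# ≤ lg p * inv(# p)
    0≤lg/p p pp = 0≤*(0≤lg p)(<≤(inv⁺(0<# p{{pr≢0 pp}})))
    keep-≤ : ∀ {P : Set}(d : Dec P){x} -> 0# ≤ x -> keep d x ≤ x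
    keep-≤(yes _)q = ≤r
    keep-≤(no _)  q = q
    few-divisors : ∀ n -> ∑P n(\p -> keep(p ∣? q)(lg p * inv(# p)))≤ ∑lg/p q
    few-divisors n with N.≤-total n q
    ... | inl n≤q = ≤t(∑P-mono n \p pp _ -> keep-≤(p ∣? q)(0≤lg/p p pp))(∑P-incl n≤q 0≤lg/p)
    ... | inr q≤n = lin(∑P-window{f = \p -> keep(p ∣? q)(lg p * inv(# p))}{g = \_ -> 0#} q≤n \p pp q<p _ -> e≤(keep-no(p ∣? q)\d -> N.<⇒≱ q<p(N.∣⇒≤{{N.>-nonZero(N.<-trans(s≤s z≤n)1<q)}} d)))
     (alg "a+(b-c)-d=b-c-(d-a)")⨾
     (∑P-mono q \p pp _ -> keep-≤(p ∣? q)(0≤lg/p p pp))⊹ e≤(+₂(zero-sum n)(-₁(zero-sum q))∙ alg "0-0=0")⨾ e≤(alg "a+0=a")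
     where
     zero-sum : ∀ n -> ∑P n(\_ -> 0#)≈ 0#
     zero-sum n = ∑-0(suc n)\p _ -> always-0(prime? p)
      where
      always-0 : ∀ {P : Set}(d : Dec P)-> keep d 0# ≈ 0#
      always-0(yes _)= refl
      always-0(no _)  = refl
    V≤ : ∀ n -> ∥ V n ∥ ≤ Cᵥ
    V≤ zero      = ≤t(e≤(∥-cg(algc "0+0=0")∙ ∥-0))(fst(snd(V-bounded 1<q Ch)))
    V≤ n@(suc _)= snd(snd(V-bounded 1<q Ch))n
    prefix : ∀ n -> ∥ ∑Pc n(\p -> cx(lg p)*c(θ⁰ p *c cx(inv(# p))))∥ ≤ C
    prefix n = e≤(∥-cg((∑Pc-cong n \p pp _ -> split p pp(p ∣? q))⊙ ∑Pc-+ n _ _))⨾ ∥-+ _ _ ⨾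
     ≤t(e≤(∥-cg conj-V ∙ ∥-conj(V n)))(V≤ n)⊹ ≤t(e≤(∥-cg(∑Pc-of n _)))(e≤(∥-of(∑P-nonneg n \p pp -> keep-≥0(p ∣? q)\_ -> 0≤lg/p p pp))⨾ few-divisors n)
     where
     F≈ : ∀ p -> Prime p -> F p ~ c p *c cx(inv(# p))
     F≈(suc p)_ = reflc
     F≈ zero pp = absurd(N.<⇒≱(prime>1 pp)z≤n)
     split : ∀ p -> Prime p ->(d : Dec(p ∣ q))-> cx(lg p)*c(θ⁰ p *c cx(inv(# p)))~ conj(cx(lg p)*c F p)+c cx(keep d(lg p * inv(# p)))
     split p pp(yes d)= trc(*ˡc(*ʳc(≡c(θ⁰-divides p pp d))))(symc(+₂c(conj-cong(*ˡc(F≈ p pp ⊙ *ʳc(vanish⁰ p pp d))))(of-*(lg p)(inv(# p)))⊙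
      +ʳc(conj-cong(algc "a(0b)=0")⊙ conj-of 0#)⊙ algc "0+ab=a(1b)"))
     split p pp(no nd)= trc(*ˡc(*ʳc(≡c(θ⁰-coprime p pp nd))))(symc(+ʳc(conj-*(cx(lg p))(F p)⊙ *₂c(conj-of(lg p))(conj-cong(F≈ p pp)⊙ conj-*(c p)(cx(inv(# p)))⊙ *ˡc(conj-of(inv(# p)))))⊙
      algc "a(bc)+0=a(bc)"))
     conj-V : ∑Pc n(\p -> conj(cx(lg p)*c F p))~ conj(V n)
     conj-V = symc(conj-∑(suc n)_ ⊙ ∑c-ext(suc n)\p -> pull(prime? p))
      where
      pull : ∀ {p}{z : ℂ}(d : Dec(Prime p))-> conj(keepc d z)~ keepc d(conj z)
      pull(yes _)= reflc
      pull(no _)  = conj-of 0#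

  module _ (n : ℕ) {{n≢0 : Nz n}} (t₀ : R) (0≤t₀ : 0# ≤ t₀) where
   module _ where
    K₀ b : ℕ
    K₀ = 1000 N.* n
    b = 8 N.* K₀
    j κ : R
    j = inv(# n)
    κ = inv(# K₀)
    C₁ M U₀ Cb : R
    C₁ = C + # 2 * wB 1(inv 2#)
    M = # 1 + # 6 * C *(# 2 * # n + # 4)+ # 30 * c₃ + # 2 *(# 2 * # n + # 1)+ # 3 * C₁ *(# 2 * # n + # 2)
    bs : R
    bs = # 2 * wB 0(inv(# 6))+ wB 2(inv(# 6))+ wB 4(inv(# 6))
    U₀ = # 5 + # 4 * lg 2 +(t₀ + # 20)+ bs + # n
    Cb = ∑P(Y b)(\p -> inv(# p))
    enough : ∃ \G -> # 2 *(M + # 2 + # 3 * C₁)+ cₘ ≤ # G * 1#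
    enough = arch _ 1# 0<1
    G₀ : ℕ
    G₀ = suc(fst enough)
    instance
     K₀≢0 : Nz K₀
     K₀≢0 = N.m*n≢0 1000 n
     b≢0 : Nz b
     b≢0 = N.m*n≢0 8 K₀
    opaque
     0<n : 0# < # n
     0<n = 0<# n
     0<j : 0# < j
     0<j = inv⁺ 0<n
     0<κ : 0# < κ
     0<κ = inv⁺(0<# K₀)
     jn : j * # n ≈ 1#
     jn = trans(alg "ab=ba")(inv-r 0<n)
     j≤1 : j ≤ 1#
     j≤1 = lin(*≤(<≤ 0<j)(e≤(alg "1=#1")⨾ #-mono(N.>-nonZero⁻¹ n))⊹ e≤ jn)(alg "1-a=ab+1-(a1+ab)")
     κ-eq : # 1000 * κ ≈ j
     κ-eq = inv-uniq(alg "a(1000b)=1000ab" ∙ *ʳ(sym(#-* 1000 n))∙ inv-r(0<# K₀))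
     κ≤1 : κ ≤ 1#
     κ≤1 = ≤t(lin(0≤*(0≤# 999)(<≤ 0<κ))(alg "1000a-a=999a-0"))(e≤ κ-eq ⨾ j≤1)
     0≤lg2 : 0# ≤ lg 2
     0≤lg2 = 0≤lg 2
     0≤wB6 : ∀ k -> 0# ≤ wB k(inv(# 6))
     0≤wB6 k = 0≤*(0≤^ k(<≤(inv⁺(inv⁺(0<#s 5)))))(0≤+ 0≤1(<≤(inv⁺(inv⁺(0<#s 5)))))
     0≤bs : 0# ≤ bs
     0≤bs = 0≤+(0≤+(0≤*(0≤# 2)(0≤wB6 0))(0≤wB6 2))(0≤wB6 4)
     0≤C : 0# ≤ C
     0≤C = ≤t(0≤∥ _)(prefix 0)
     0≤c₃ : 0# ≤ c₃
     0≤c₃ = ≤t(∑P-nonneg 0{\p -> lg p * lg p *(inv(# p)* inv(# p))}(\p pp -> 0≤*(0≤*(0≤lg p)(0≤lg p))(0≤*(<≤(inv⁺(0<# p{{pr≢0 pp}})))(<≤(inv⁺(0<# p{{pr≢0 pp}}))))))(∑lg²/p² 0)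
     0≤C₁ : 0# ≤ C₁
     0≤C₁ = 0≤+ 0≤C(0≤*(0≤# 2)(∑P-nonneg 0{\p -> lg p *(inv(# p)* inv(# p))}(\p pp -> 0≤*(0≤lg p)(0≤*(<≤(inv⁺(0<# p{{pr≢0 pp}})))(<≤(inv⁺(0<# p{{pr≢0 pp}})))))⨾ ∑lg/p² 0))
     0≤2n : ∀ k -> 0# ≤ # 2 * # n + # k
     0≤2n k = 0≤+(0≤*(0≤# 2)(0≤# n))(0≤# k)
     3C₁<M : # 3 * C₁ < M
     3C₁<M = lin<(0<1 ⊹<(0≤*(0≤*(0≤# 6)0≤C)(0≤2n 4)⊹ 0≤*(0≤# 30)0≤c₃ ⊹ 0≤*(0≤# 2)(0≤2n 1)⊹ 0≤*(0≤*(0≤# 3)0≤C₁)(0≤2n 1)))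
      (solve(C ∷(# n)∷ c₃ ∷ C₁ ∷ [])((((((n# 1)⊕(((n# 6)⊗ x0)⊗(((n# 2)⊗ x1)⊕(n# 4))))⊕((n# 30)⊗ x2))⊕((n# 2)⊗(((n# 2)⊗ x1)⊕(n# 1))))⊕(((n# 3)⊗ x3)⊗(((n# 2)⊗ x1)⊕(n# 2))))⊖((n# 3)⊗ x3))((e1 ⊕((((((n# 6)⊗ x0)⊗(((n# 2)⊗ x1)⊕(n# 4)))⊕((n# 30)⊗ x2))⊕((n# 2)⊗(((n# 2)⊗ x1)⊕(n# 1))))⊕(((n# 3)⊗ x3)⊗(((n# 2)⊗ x1)⊕(n# 1)))))⊖(e0 ⊕(((e0 ⊕ e0)⊕ e0)⊕ e0))))
     0≤M : 0# ≤ M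
     0≤M = ≤t(0≤*(0≤# 3)0≤C₁)(<≤ 3C₁<M)
     0≤U₀ : 0# ≤ U₀
     0≤U₀ = 0≤+(0≤+(0≤+(0≤+(0≤# 5)(0≤*(0≤# 4)0≤lg2))(0≤+ 0≤t₀(0≤# 20)))0≤bs)(0≤# n)
   module _ (m : ℕ) (b≤m : b N.≤ m) (nG≤m : n N.* G₀ N.≤ m) (κ-large₁ : # 2 * (Cb + lg 2) ≤ κ * # m) (κ-large₂ : # 27 * (# 10000 * (U₀ * U₀) * (# K₀ * # K₀)) ≤ κ * # m) (κ-large₃ : cₘ ≤ κ * # m) where
    private
     gap′ : ℕ
     gap′ = m N./ n
     top : ℕ
     top = m N.+ gap′ N.+ gap′ N.+ gap′
     y U : R
     y = κ * # m
     U = U₀ * # m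
     opaque
      0<m : 0 N.< m
      0<m = N.<-≤-trans(N.>-nonZero⁻¹ b)b≤m
      1≤m : 1# ≤ # m
      1≤m = ≤t(e≤(alg "1=#1"))(#-mono 0<m)
      0≤m : 0# ≤ # m
      0≤m = 0≤# m
      0<y : 0# < y
      0<y = *-pos 0<κ(<≤tr 0<1 1≤m)
      1000y : # 1000 * y ≈ j * # m
      1000y = trans(alg "1000(ab)=1000ab")(*ʳ κ-eq)
      1000y≤m : # 1000 * y ≤ # m
      1000y≤m = ≤t(e≤ 1000y)(≤* 0≤m j≤1 ⨾ e≤(alg "1a=a"))
      by-1000 : ∀ {x} k -> k N.≤ 1000 -> # 1000 * y ≤ x -> # k * y ≤ x
      by-1000 k q p = ≤t(≤*(<≤ 0<y)(#-mono q))p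
      gap-m : # gap′ ≤ j * # m
      gap-m = cancel 0<n(e≤(alg "ab=ba" ∙ sym(#-* gap′ n))⨾ #-mono(N.m/n*n≤m m n)⨾ e≤(sym(alg "a(bc)=bac" ∙ *ʳ jn ∙ alg "1a=a")))
      top-eq : # top ≈ # m + # 3 * # gap′
      top-eq = trans(#-+(m N.+ gap′ N.+ gap′)gap′)(+ʳ(#-+(m N.+ gap′)gap′ ∙ +ʳ(#-+ m gap′))∙ alg "a+b+b+b=a+3b")
      Λ≤4m : # top ≤ # 4 * # m
      Λ≤4m = ≤t(e≤ top-eq)(lin(*≤(0≤# 3)(gap-m ⨾ ≤* 0≤m j≤1 ⨾ e≤(alg "1a=a")))(alg "4a-(a+3b)=3a-3b"))
      part : ∀ {x} -> 0# ≤ x -> x ≤ U₀ -> x ≤ U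
      part p q = ≤t(q ⨾ e≤(alg "a=a1"))(*≤ 0≤U₀ 1≤m)
      5m≤U : # 5 * # m ≤ U
      5m≤U = ≤* 0≤m(lin(0≤*(0≤# 4)0≤lg2 ⊹ 0≤+ 0≤t₀(0≤# 20)⊹ 0≤bs ⊹ 0≤# n)(alg "5+4a+(b+20)+c+d-5=4a+(b+20)+c+d-(0+0+0+0)"))
      1≤U : 1# ≤ U
      1≤U = ≤t(lin(1≤m ⊹ 0≤m ⊹ 0≤m ⊹ 0≤m ⊹ 0≤m)(alg "5a-1=a+a+a+a+a-(1+0+0+0+0)"))5m≤U
      Λ≤U : # top ≤ U
      Λ≤U = ≤t Λ≤4m(lin 0≤m(alg "5a-4a=a-0")⨾ 5m≤U)
      y≤U : y + 1# ≤ U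
      y≤U = ≤t(lin(by-1000 1(bN 1 1000 _)1000y≤m ⊹ 1≤m ⊹ 0≤m ⊹ 0≤m ⊹ 0≤m)(alg "5a-(ba+1)=a+a+a+a+a-(#1(ba)+1+0+0+0)"))5m≤U
      lg2≤U : # 4 * lg 2 ≤ U
      lg2≤U = part(0≤*(0≤# 4)0≤lg2)(lin(0≤# 5 ⊹ 0≤+ 0≤t₀(0≤# 20)⊹ 0≤bs ⊹ 0≤# n)(alg "5+4a+(b+20)+c+d-4a=5+(b+20)+c+d-(0+0+0+0)"))
      t₀≤U : t₀ + # 20 ≤ U
      t₀≤U = part(0≤+ 0≤t₀(0≤# 20))(lin(0≤# 5 ⊹ 0≤*(0≤# 4)0≤lg2 ⊹ 0≤bs ⊹ 0≤# n)(alg "5+4a+(b+20)+c+d-(b+20)=5+4a+c+d-(0+0+0+0)"))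
      b≤U : bs ≤ U
      b≤U = part 0≤bs(lin(0≤# 5 ⊹ 0≤*(0≤# 4)0≤lg2 ⊹ 0≤+ 0≤t₀(0≤# 20)⊹ 0≤# n)(alg "5+4a+(b+20)+c+d-c=5+4a+(b+20)+d-(0+0+0+0)"))
      n≤U : # n ≤ U
      n≤U = part(0≤# n)(lin(0≤# 5 ⊹ 0≤*(0≤# 4)0≤lg2 ⊹ 0≤+ 0≤t₀(0≤# 20)⊹ 0≤bs)(alg "5+4a+(b+20)+c+d-d=5+4a+(b+20)+c-(0+0+0+0)"))
      tiny : # 10000 *(U * U)* e(- y)≤ 1#
      tiny = ≤t(e≤(*ʳ(sym(alg "10000(aa)(bb)(cd(cd))=10000(ad(ad))(bc(bc))" ∙ *ˡ(*₂(inv-r(0<# K₀))(inv-r(0<# K₀)))∙ alg "10000(ab(ab))(1(1))=10000(ab(ab))"))))(decay(0≤*(0≤*(0≤# 10000)(0≤sq U₀))(0≤sq(# K₀)))0<y κ-large₂)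
      y₂₀ : # 20 * y ≤ # m * h
      y₂₀ = lin(≤* 0≤h(by-1000 40(bN 40 1000 _)1000y≤m)⊹ e≤(*ʳ{# 20 * y}(sym 2h)))(alg "ab-20c=ab+2b(20c)-(40cb+1(20c))")
      y₄₂ : # 42 * y ≤ inv(# 6)* # m
      y₄₂ = cancel(0<#s 5)(e≤(alg "6(42a)=252a")⨾ by-1000 252(bN 252 1000 _)1000y≤m ⨾ e≤(sym(alg "6(ab)=6ab" ∙ *ʳ(inv-r(0<#s 5))∙ alg "1a=a")))
      G₀≤gap : G₀ N.≤ gap′
      G₀≤gap = E.subst(N._≤ gap′)(E.trans(E.cong(N._/ n)(N.*-comm n G₀))(N.m*n/n≡m G₀ n))(N./-monoˡ-≤ n nG≤m)
      room : # 2 *(M + # 2 + # 3 * C₁)+ cₘ ≤ # gap′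
      room = ≤t(snd enough)(e≤(alg "a1=a")⨾ #-mono(trN(n≤1+n _)G₀≤gap))
      1≤gap : 1# ≤ # gap′
      1≤gap = ≤t(e≤(alg "1=#1"))(#-mono(trN(s≤s z≤n)G₀≤gap))
      m≤2n : # m ≤ # 2 * # n * # gap′
      m≤2n = ≤t(#-mono(N.<⇒≤(E.subst(N._< suc gap′ N.* n)(E.sym(N.m≡m%n+[m/n]*n m n))(N.+-monoˡ-<(gap′ N.* n)(N.m%n<n m n)))))(e≤(#-*(suc gap′)n)⨾ lin(≤*(0≤# n)1≤gap)(alg "2ab-(1+b)a=ba-1a"))
      turn : # 1 + # 6 * C *(# top + 1#)+ # 30 * c₃ + # 2 * #(m N.+ gap′)+ # 3 * C₁ * #(m N.+ gap′ N.+ gap′)≤ # gap′ * M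
      turn = lin(1≤gap ⊹ *≤(0≤*(0≤# 6)0≤C)(e≤ top-eq ⊹ 1≤gap)⊹ *≤(0≤*(0≤# 6)0≤C)m≤2n ⊹ *≤(0≤*(0≤# 30)0≤c₃)1≤gap ⊹ *≤(0≤# 2)(e≤(#-+ m gap′))⊹ *≤(0≤# 2)m≤2n ⊹ *≤(0≤*(0≤# 3)0≤C₁)(e≤(#-+(m N.+ gap′)gap′ ∙ +ʳ(#-+ m gap′)))⊹ *≤(0≤*(0≤# 3)0≤C₁)m≤2n)
       (solve(C ∷ # top ∷ c₃ ∷ #(m N.+ gap′)∷ C₁ ∷ #(m N.+ gap′ N.+ gap′)∷ # gap′ ∷ # n ∷ # m ∷ [])
        (x6 ⊗(n# 1 ⊕ n# 6 ⊗ x0 ⊗(n# 2 ⊗ x7 ⊕ n# 4)⊕ n# 30 ⊗ x2 ⊕ n# 2 ⊗(n# 2 ⊗ x7 ⊕ n# 1)⊕ n# 3 ⊗ x4 ⊗(n# 2 ⊗ x7 ⊕ n# 2))⊖(n# 1 ⊕ n# 6 ⊗ x0 ⊗(x1 ⊕ e1)⊕ n# 30 ⊗ x2 ⊕ n# 2 ⊗ x3 ⊕ n# 3 ⊗ x4 ⊗ x5))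
        (x6 ⊕ n# 6 ⊗ x0 ⊗(x8 ⊕ n# 3 ⊗ x6 ⊕ x6)⊕ n# 6 ⊗ x0 ⊗(n# 2 ⊗ x7 ⊗ x6)⊕ n# 30 ⊗ x2 ⊗ x6 ⊕ n# 2 ⊗(x8 ⊕ x6)⊕ n# 2 ⊗(n# 2 ⊗ x7 ⊗ x6)⊕ n# 3 ⊗ x4 ⊗(x8 ⊕ x6 ⊕ x6)⊕ n# 3 ⊗ x4 ⊗(n# 2 ⊗ x7 ⊗ x6)⊖
         (e1 ⊕ n# 6 ⊗ x0 ⊗(x1 ⊕ e1)⊕ n# 6 ⊗ x0 ⊗ x8 ⊕ n# 30 ⊗ x2 ⊗ e1 ⊕ n# 2 ⊗ x3 ⊕ n# 2 ⊗ x8 ⊕ n# 3 ⊗ x4 ⊗ x5 ⊕ n# 3 ⊗ x4 ⊗ x8)))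
      ∑1/p≤y : ∑P(Y top)(\p -> inv(# p))≤ y
      ∑1/p≤y = cancel(0<#s 7)(lin(*≤(0≤# 8)(∑1/p-bound b(Y top)(Y-mono(trN b≤m(trN(m≤m+n m gap′)(trN(m≤m+n(m N.+ gap′)gap′)(m≤m+n(m N.+ gap′ N.+ gap′)gap′)))))⨾ ≤r ⊹ *≤(<≤(inv⁺(0<# b)))(∑lg/p-≤ top ⨾ Λ≤4m ⊹ ≤r))
       ⊹ e≤(*ʳ{# 4 * # m + # 4 * lg 2}(inv-uniq(alg "a(8b)=8ab" ∙ *ʳ(sym(#-* 8 K₀))∙ inv-r(0<# b))))⊹ ≤*(0≤*(0≤# 4)0≤lg2)κ≤1 ⊹ *≤(0≤# 4)κ-large₁ ⊹ 0≤*(0≤# 4)0≤lg2)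
       (alg "8(ab)-8c=8(d+e(4b+4f))+a(4b+4f)+1(4f)+4(ab)+4f-(8c+8e(4b+4f)+a(4f)+4(2(d+f))+0)"))
    private
     O = AtScale.found q g θ⁰ unit⁰ C prefix phase⁰ vanish⁰ m gap′ y(<≤ 0<y)U 1≤U tiny Λ≤U y≤U lg2≤U t₀ 0≤t₀ t₀≤U b≤U y₂₀ y₄₂ M 0≤M room turn 3C₁<M ∑1/p≤y
    module Outcome' where
     ρ = fst O
     re-ρ = fst(snd O)
     critical-ρ = fst(snd(snd O))
     im-ρ≥ = fst(snd(snd(snd O)))
     im-ρ≤ = fst(snd(snd(snd(snd O))))
     tail-sum = fst(snd(snd(snd(snd(snd O)))))
     tail-sum≤ = fst(snd(snd(snd(snd(snd(snd O))))))
     L-ρ = snd(snd(snd(snd(snd(snd(snd O))))))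
    private
     module Outcome = Outcome'
     open Powers y (<≤ 0<y) U 1≤U tiny
     ℓ a D₀ : R
     ℓ = ∥ D c(Mult.bdd g)0 Outcome.ρ ∥
     a = e γ *(# totient q * inv(# q))
     D₀ = ∑P(Y m)(\p -> keep(p ∣? q)(∇ p))
     opaque
      Λ≤ : # top ≤ # m + # 3 *(j * # m)
      Λ≤ = ≤t(e≤ top-eq)(≤r ⊹ *≤(0≤# 3)gap-m)
      n-scale : ∀ {x} -> # n * x ≤ 1# -> x ≤ j
      n-scale{x} q = cancel 0<n(q ⨾ e≤(sym jn ∙ alg "ab=ba"))
      4w≤j : # 4 * w ≤ j
      4w≤j = n-scale((≤*(0≤*(0≤# 4)(<≤ 0<w))n≤U ⨾ e≤(alg "a(4b)=4ab" ∙ *ˡ(sym P-1)))⨾ absorbU 0 4(bN 4 10000 _)⨾ P≤1 0)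
      P≤w : ∀ i -> P(suc i)≤ w
      P≤w i = ≤t(P-anti{1}{suc i}(s≤s z≤n))(e≤ P-1)
      factor : e(- j)≤ 1# - # 2 * P 20
      factor = cancel(+-pos 0<1(<≤ 0<j))(≤*(<≤(0<e(- j)))(1+x≤e j)⨾ e≤(e-inv j)⨾ lin(*≤(0≤# 2)(*≤(<≤(0<P 20))j≤1)⊹ *≤(0≤# 4)(P≤w 19)⊹ 4w≤j)
       (alg "(1+a)(1-2b)-1=2(b1)+4c+a-(2(ba)+4b+4c)"))
      0≤a : 0# ≤ a
      0≤a = 0≤*(<≤(0<e γ))(0≤*(0≤#(totient q))(<≤(inv⁺(0<# q{{N.>-nonZero(N.<-trans(s≤s z≤n)1<q)}}))))
      lower : γ - j + lg m ≤ G m -> a * # m * e(-(# 8 * j))≤ ℓ + 1#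
      lower G≥ = ≤t(≤*(<≤(0<e _))(≤* 0≤m(*≤(<≤(0<e γ))(/-≤(0<# q{{N.>-nonZero(N.<-trans(s≤s z≤n)1<q)}})(totient-≤ q 1<q(Y m)⨾ e≤(alg "ab=ba")))))⨾ e≤(*ʳ(*ˡ(sym(e-log(0<# m{{N.>-nonZero 0<m}}))))∙ *ʳ(*ʳ(sym(e-+ γ(- D₀)))∙ sym(e-+ _ _))∙ sym(e-+ _ _)∙ e-cong(alg "a+-b+c+-(8d)=-d+(a+-b+c-7d)")∙ e-+ _ _))
       (*-mono(<≤(0<e(- j)))(<≤(0<e _))factor(e-mono(lin(G≥ ⊹ P≤w 18 ⊹(lin(0≤*(0≤# 3)(<≤ 0<w))(alg "4a-a=3a-0")⨾ 4w≤j)⊹(n-scale((≤*(0≤*(0≤*(0≤# 20)0≤U)(<≤ 0<w))n≤U ⨾ e≤(alg "a(20ab)=20(aa)b" ∙ *ˡ(sym P-1)))⨾ absorbUU 0 20(bN 20 10000 _)⨾ P≤1 0))⊹(cancel(<≤tr 0<1 1≤m)(Outcome.tail-sum≤ ⨾ lin(Λ≤ ⊹ κ-large₃ ⊹ 0≤*(0≤# 999)(<≤ 0<y)⊹ e≤ 1000y)(alg "a(4b)-(c-a+d)=a+3(ba)+ea+999(ea)+ba-(c+d+0+1000(ea))"))))(alg "a-b-c-20de-f-(g+-b+h-7i)=a+e+i+i+4i-(g-i+h+c+e+20de+f)")))⨾ Outcome.L-ρ)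
      main : γ - j + lg m ≤ G m -> 1# ≤ a * e(-(# 9 * j))* j * # m ⊎ a ≤ 0# -> a * # m * e(-(# 9 * j))≤ ℓ
      main G≥(inr a≤0)= ≤t(≤*(<≤(0<e _))(≤* 0≤m a≤0))(e≤(alg "0ab=0")⨾ 0≤∥ _)
      main G≥(inl big)= lin(lower G≥ ⊹ big ⊹ *≤(0≤*(0≤* 0≤a 0≤m)(<≤(0<e(-(# 9 * j)))))(1+x≤e j)⊹ e≤(*ˡ{a * # m}(sym(e-+ _ _)∙ e-cong(alg "-(9a)+a=-(8a)"))))
       (alg "a-bcd=a+1+bdec+bcdf+bcg-(bcg+1+bcd(1+e)+bc(df))")
    opaque
     outcome : γ - j + lg m ≤ G m -> e(e 1#)≤ t₀ - 1# -> 1# ≤ a * e(-(# 9 * j))* j * # m ⊎ a ≤ 0# -> a * e(-(# 13 * j))* log(log(im Outcome.ρ))≤ ℓ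
     outcome G≥ t₀≥ big = *≤(0≤* 0≤a(<≤(0<e _)))(log-≤(<≤tr(0<e 1#)(≤-log 0<im im≥))(log-≤ 0<im Outcome.im-ρ≤)⨾ lin(Λ≤ ⊹ by-1000 48(bN 48 1000 _)(e≤ 1000y))(alg "(1+4a)b-(c+48d)=b+3(ab)+ab-(c+48d)")⨾ ≤* 0≤m(1+x≤e(# 4 * j)))⨾ e≤(alg "ab(cd)=ad(bc)" ∙ *ˡ(sym(e-+ _ _)∙ e-cong(alg "-(13a)+4a=-(9a)")))⨾ main G≥ big
      where
      im≥ : e(e 1#)≤ im Outcome.ρ
      im≥ = ≤t t₀≥ Outcome.im-ρ≥
      0<im : 0# < im Outcome.ρ
      0<im = <≤tr(0<e _)im≥

  opaque
   large-values : ∀ ε -> 0# < ε -> ∀ T -> ∃ \ρ -> 1# < re ρ × D(Mult.fn one)(Mult.bdd one)1 ρ ~ 0c × T ≤ im ρ × e(e 1#)≤ im ρ ×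
    e γ *(# totient q * inv(# q))* e(- ε)* log(log(im ρ))≤ ∥ D c(Mult.bdd g)0 ρ ∥
   large-values ε 0<ε T with arch(# 13)ε 0<ε
   ... | N₀ , N₀-big = Outcome.ρ , Outcome.re-ρ , Outcome.critical-ρ , lin(abs-ge T ⊹ <≤(0<e(e 1#)))(alg "a+b+1-1-c=a+b-(c+0)")⨾ Outcome.im-ρ≥ , ee≤ ⨾ Outcome.im-ρ≥ ,
    ≤*(log-0≤(1≤e 0≤1 ⨾ ≤-log(<≤tr(0<e _)im≥)im≥))(*≤(0≤*(<≤(0<e γ))(0≤*(0≤#(totient q))(<≤(inv⁺(0<# q{{N.>-nonZero(N.<-trans(s≤s z≤n)1<q)}})))))(e-mono(≤-neg(/-≤(0<#s N₀)(N₀-big ⨾ lin(<≤ 0<ε)(alg "a(1+b)-ba=a-0"))))))⨾ outcome n t₀ 0≤t₀ m b≤m nG≤m k₁ k₂ k₃(snd(snd found))ee≤ absorbs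
    where
    n : ℕ
    n = suc N₀
    t₀ : R
    t₀ = abs T + e(e 1#)+ 1#
    0≤t₀ : 0# ≤ t₀
    0≤t₀ = 0≤+(0≤+(0≤abs T)(<≤(0<e _)))0≤1
    K' G' : ℕ
    K' = 1000 N.* n
    G' = suc(fst(enough n t₀ 0≤t₀))
    j' κ' a : R
    j' = inv(# n)
    κ' = inv(# K')
    a = e γ *(# totient q * inv(# q))
    grows : ∀ x -> ∃ \N -> ∀ m -> N N.≤ m -> x ≤ κ' * # m
    grows x = let N , p = arch x κ'(0<κ n t₀ 0≤t₀)in N , \m N≤m -> ≤t p(e≤(alg "ab=ba")⨾ *≤(<≤(0<κ n t₀ 0≤t₀))(#-mono N≤m))
    g₁ : ∃ \N -> ∀ m -> N N.≤ m -> # 2 *(Cb n t₀ 0≤t₀ + lg 2)≤ κ' * # m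
    g₁ = grows _
    g₂ : ∃ \N -> ∀ m -> N N.≤ m -> # 27 *(# 10000 *(U₀ n t₀ 0≤t₀ * U₀ n t₀ 0≤t₀)*(# K' * # K'))≤ κ' * # m
    g₂ = grows _
    g₃ : ∃ \N -> ∀ m -> N N.≤ m -> cₘ ≤ κ' * # m
    g₃ = grows _
    g₄ : ∃ \N -> ∀ m -> N N.≤ m -> inv(a * e(-(# 9 * j'))* j')≤ κ' * # m
    g₄ = grows _
    m₀ : ℕ
    m₀ =(8 N.* K' N.+ n N.* G')N.+((fst g₁ N.+ fst g₂)N.+(fst g₃ N.+ fst g₄))
    found : ∃ \m -> m₀ N.≤ m × γ - j' + lg m ≤ G m
    found = euler-infinitely-often γ γ-≤ j'(0<j n t₀ 0≤t₀)m₀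
    m : ℕ
    m = fst found
    m₀≤m : m₀ N.≤ m
    m₀≤m = fst(snd found)
    left : ∀ {x y} -> x N.+ y N.≤ m -> x N.≤ m
    left{x}{y} q = trN(m≤m+n x y)q
    right : ∀ {x y} -> x N.+ y N.≤ m -> y N.≤ m
    right{x}{y} q = trN(N.m≤n+m y x)q
    b≤m : 8 N.* K' N.≤ m
    b≤m = left{8 N.* K'}(left{8 N.* K' N.+ n N.* G'} m₀≤m)
    nG≤m : n N.* G' N.≤ m
    nG≤m = right{8 N.* K'}(left{8 N.* K' N.+ n N.* G'} m₀≤m)
    rest :(fst g₁ N.+ fst g₂)N.+(fst g₃ N.+ fst g₄)N.≤ m
    rest = right{8 N.* K' N.+ n N.* G'} m₀≤m
    k₁ : # 2 *(Cb n t₀ 0≤t₀ + lg 2)≤ κ' * # m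
    k₁ = snd g₁ m(left{fst g₁}(left{fst g₁ N.+ fst g₂} rest))
    k₂ : # 27 *(# 10000 *(U₀ n t₀ 0≤t₀ * U₀ n t₀ 0≤t₀)*(# K' * # K'))≤ κ' * # m
    k₂ = snd g₂ m(right{fst g₁}(left{fst g₁ N.+ fst g₂} rest))
    k₃ : cₘ ≤ κ' * # m
    k₃ = snd g₃ m(left{fst g₃}(right{fst g₁ N.+ fst g₂} rest))
    module Outcome = Outcome' n t₀ 0≤t₀ m b≤m nG≤m k₁ k₂ k₃
    ee≤ : e(e 1#)≤ t₀ - 1#
    ee≤ = lin(0≤abs T)(alg "a+b+1-1-b=a-0")
    im≥ : e(e 1#)≤ im Outcome.ρ
    im≥ = ≤t ee≤ Outcome.im-ρ≥
    absorbs : 1# ≤ a * e(-(# 9 * j'))* j' * # m ⊎ a ≤ 0#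
    absorbs = go(≤∨< a 0#)
     where
     pos' : 0# < a -> 0# < a * e(-(# 9 * j'))* j'
     pos' 0<a = *-pos{a * e(-(# 9 * j'))}{j'}(*-pos{a}{e(-(# 9 * j'))} 0<a(0<e(-(# 9 * j'))))(inv⁺(0<#s N₀))
     go : a ≤ 0# ⊎ 0# < a -> 1# ≤ a * e(-(# 9 * j'))* j' * # m ⊎ a ≤ 0#
     go(inl a≤0)= inr a≤0
     go(inr 0<a)= inl(e≤(sym(inv-r(pos' 0<a)))⨾ *≤(<≤(pos' 0<a))(snd g₄ m(right{fst g₃}(right{fst g₁ N.+ fst g₂} rest))⨾ ≤*(0≤# m)(κ≤1 n t₀ 0≤t₀)⨾ e≤(alg "1a=a")))

 opaque
  sixth : ∀ x -> # 6 *(x * inv(# 6))≈ x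
  sixth x = trans(alg "6(ab)=ab6")(/-*(0<#s 5))

  D-limit : ∀ (a : ℕ -> ℂ)(bdd : ∀ n -> ∥ a n ∥ ≤ 1#){s} -> 1# < re s -> Sums(\n -> a(suc n)*c pw(suc n)s)(D a bdd 0 s)
  D-limit a bdd{s} 1<σ = Limc-ext(\N -> ∑c-1st N(term 0 a s)⊙ algc "0+a=a" ⊙ ∑c-ext N \n ->(algc "a1b=ab"))
   (Limc-sub suc(\n -> n≤1+n n)(sums(term-bound 0{a}{re s - 1#}{s} bdd(0<-by 1<σ)(e≤(alg "1+#1(a-1)=a")))))

  D-cong : ∀ k(a : ℕ -> ℂ)(bdd : ∀ n -> ∥ a n ∥ ≤ 1#){s s'} -> 1# < re s -> s ~ s' -> D a bdd k s ~ D a bdd k s'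
  D-cong k a bdd{s}{s'} 1<σ p = series-cong(term-bound k{a}{(re s - 1#)/ # suc k}{s} bdd(/-pos(0<-by 1<σ)(0<#s k))(e≤(+ˡ(*-/(0<#s k))∙ alg "1+(a-1)=a")))each
   where
   each : ∀ n -> term k a s n ~ term k a s' n
   each zero    = reflc
   each(suc n)= *ˡc(pw-cong(suc n)p)

  stationary : ∀ (a : ℕ -> ℂ)(bdd : ∀ n -> ∥ a n ∥ ≤ 1#){s} -> 1# < re s -> D a bdd 1 s ~ 0c -> ∀ ε -> 0# < ε ->
   ∃ \δ -> 0# < δ ×(∀ s' -> ∥ s' -c s ∥ ≤ δ -> 1# < re s' × ∥ D a bdd 0 s' -c D a bdd 0 s ∥ ≤ ε * ∥ s' -c s ∥)
  stationary a bdd{s} 1<σ crit ε 0<ε = ρ , 0<ρ , \s' close -> right s' close , e≤(∥-cg(algc "a-b=a-b+(c-d)0" ⊙ +ˡc(*ˡc(symc crit))))⨾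
   series-diff a bdd 0{s}{s'}{s}{ρ}{x} 0<x(lin(ρ≤x ⊹ ρ≤x ⊹ ρ≤x ⊹ e≤(sixth(re s - 1#)))(alg "a-3b-(1+3c)=c+c+c+(a-1)-(b+b+b+6c)"))close(rs≤(sym(∥-cg(algc "a-a=0")∙ ∥-0))(<≤ 0<ρ))⨾
    e≤(alg "3abc=a(3c)b")⨾ ≤*(0≤∥(s' -c s))(≤*(<≤ 0<B)(snd(snd(snd m)))⨾ e≤(/-* 0<B))
   where
   x : R
   x =(re s - 1#)* inv(# 6)
   0<x : 0# < x
   0<x = *-pos(0<-by 1<σ)(inv⁺(0<#s 5))
   0<B : 0# < # 3 * wB 2 x
   0<B = *-pos(0<#s 2)(*-pos(*-pos(inv⁺ 0<x)(*-pos(inv⁺ 0<x)0<1))(+-pos 0<1(<≤(inv⁺ 0<x))))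
   m : ∃ \ρ -> 0# < ρ × ρ ≤ x × ρ ≤ ε /(# 3 * wB 2 x)
   m = min⁺ 0<x(/-pos 0<ε 0<B)
   ρ : R
   ρ = fst m
   0<ρ : 0# < ρ
   0<ρ = fst(snd m)
   ρ≤x : ρ ≤ x
   ρ≤x = fst(snd(snd m))
   right : ∀ s' -> ∥ s' -c s ∥ ≤ ρ -> 1# < re s'
   right s' close = lin<(+-pos 0<x(0≤-by((abs-ge⁻(re(s' -c s))⨾ abs-re≤(s' -c s))⨾ close ⨾ ρ≤x))⊹< e≤(sixth(re s - 1#))⊹< 0≤*(0≤# 4)(<≤ 0<x))
    (alg "a-1=b+(b--(a-c))+(c-1)+4b-(0+6b+0)")

  harm-lg-decreasing : ∀ n -> harm(suc(suc n))- lg(suc(suc n))≤ harm(suc n)- lg(suc n)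
  harm-lg-decreasing n = lin(lg-step≥(suc n))(alg "a-b-(a+c-d)=d-(b+c)")

  limit-≤ : ∀ {f : ℕ -> R}{γ : R} ->(∀ n -> f(suc n)≤ f n)-> Limc(\n -> cx(f n))(cx γ)-> ∀ n -> γ ≤ f n
  limit-≤{f}{γ} dec lim n = ≤-by-ε \ε 0<ε -> let N , near = evt lim ε 0<ε ; k = n N.+ N in
   lin(≤t(abs-ge⁻(f k + - γ))(abs-re≤(cx(f k)-c cx γ)⨾ near k(N.m≤n+m N n))⊹ anti n N)(alg "a+b-c=b+a-(-(d+-c)+d)")
   where
   anti : ∀ n k -> f(n N.+ k)≤ f n
   anti n zero    = e≤(rfx(E.cong f(N.+-identityʳ n)))
   anti n(suc k)= ≤t(e≤(rfx(E.cong f(N.+-suc n k))))(dec(n N.+ k)⨾ anti n k)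

  infimum : ∀ (P : R -> Set)a b -> P a ->(∀ x -> P x -> b ≤ x)-> ∃ \m ->(∀ x -> P x -> m ≤ x)×(∀ l ->(∀ x -> P x -> l ≤ x)-> l ≤ m)
  infimum P a b Pa low = -(fst S),(\x Px -> lin((fst(snd S))(- x)(x , Px , refl))(alg "a--b=b--a")), \l q -> lin((snd(snd S))(- l)(λ { y(x , Px , y≈)-> rs≤(sym y≈)(≤-neg(q x Px)) }))(alg "-a-b=-b-a")
   where
   S : ∃(IsSup \y -> ∃ \x -> P x × y ≈ - x)
   S = supremum(\y -> ∃ \x -> P x × y ≈ - x)(- a)(- b)(a , Pa , refl)λ { y(x , Px , y≈)-> rs≤(sym y≈)(≤-neg(low x Px)) }

  -- Letting ε → 0 in e^{-ε} ≥ 1 - ε.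
  ≤-by-e : ∀ {x y} -> 0# ≤ x ->(∀ ε -> 0# < ε -> x * e(- ε)≤ y)-> x ≤ y
  ≤-by-e{x}{y} 0≤x f = ≤-by-ε \ε 0<ε -> let 0<1+x = +-pos 0<1 0≤x ; δ = ε /(1# + x); 0<δ = /-pos 0<ε 0<1+x in
   lin(f δ 0<δ ⊹ *≤ 0≤x(1+x≤e(- δ))⊹ <≤ 0<δ ⊹ e≤(*-/{ε} 0<1+x))(alg "a+b-c=a+cd+e+b-(cd+c(1+-e)+0+(1+c)e)")

module Rationals where
 open import Data.Rational using (ℚ; 0ℚ; 1ℚ; ½; _+_; _*_; -_; _-_; ∣_∣; _<_; _≤_)
 open Solver Q.+-*-commutativeRing

 opaque
  linℚ : ∀ {a b c d} -> a ≤ b -> d - c ≡ b - a -> c ≤ d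
  linℚ{a}{b}{c}{d} p q = E.subst₂ _≤_(alg! "a+(b-a)=b" a c)(E.trans(alg! "a+(b-c)=a-c+b" b c a)(E.trans(E.cong(_+ c)(E.sym q))(alg! "a-b+b=a" d c)))(Q.+-monoˡ-≤(c - a)p)

  linℚ< : ∀ {a b c d} -> a < b -> d - c ≡ b - a -> c < d
  linℚ<{a}{b}{c}{d} p q = E.subst₂ _<_(alg! "a+(b-a)=b" a c)(E.trans(alg! "a+(b-c)=a-c+b" b c a)(E.trans(E.cong(_+ c)(E.sym q))(alg! "a-b+b=a" d c)))(Q.+-monoˡ-<(c - a)p)

  nonneg*ℚ : ∀ {a b} -> 0ℚ ≤ a -> 0ℚ ≤ b -> 0ℚ ≤ a * b
  nonneg*ℚ{a}{b} p q = E.subst(_≤ a * b)(Q.*-zeroˡ b)(Q.*-monoʳ-≤-nonNeg b{{Q.nonNegative q}} p)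

  pos*ℚ : ∀ {a b} -> 0ℚ < a -> 0ℚ < b -> 0ℚ < a * b
  pos*ℚ{a}{b} p q = E.subst(_< a * b)(Q.*-zeroˡ b)(Q.*-monoˡ-<-pos b{{Q.positive q}} p)

  0<½ : 0ℚ < ½
  0<½ = Q.positive⁻¹ ½

  ½+½ : ∀ e -> ½ * e + ½ * e ≡ e
  ½+½ e = E.trans(alg! "ab+ab=(a+a)b" ½ e)(E.trans(E.cong(_* e){x = ½ + ½}{y = 1ℚ} E.refl)(Q.*-identityˡ e))

  halfℚ : ∀ {e} -> 0ℚ < e -> 0ℚ < ½ * e
  halfℚ p = pos*ℚ 0<½ p

  half<ℚ : ∀ {e} -> 0ℚ < e -> ½ * e < e
  half<ℚ{e} p = linℚ<(halfℚ p)(E.trans(E.cong(_- ½ * e)(E.sym(½+½ e)))(alg! "ab+ab-ab=ab-0" ½ e))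

  recip : ∀ {b} -> 0ℚ < b -> ∃ \r -> 0ℚ < r × b * r ≡ 1ℚ
  recip{b} p = Q.1/_ b{{b≢0}} , Q.positive⁻¹ _{{Q.1/pos⇒pos b{{Q.positive p}}}} , Q.*-inverseʳ b{{b≢0}}
   where
   b≢0 : Q.NonZero b
   b≢0 = Q.pos⇒nonZero b{{Q.positive p}}

  abs≤ℚ : ∀ {x e} -> x ≤ e -> - x ≤ e -> ∣ x ∣ ≤ e
  abs≤ℚ{x} p q with Q.∣p∣≡p∨∣p∣≡-p x
  ... | inl r = E.subst(_≤ _)(E.sym r)p
  ... | inr r = E.subst(_≤ _)(E.sym r)q

  ≤abs : ∀ x -> x ≤ ∣ x ∣
  ≤abs x with Q.≤-total 0ℚ x
  ... | inl p = Q.≤-reflexive(E.sym(Q.0≤p⇒∣p∣≡p p))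
  ... | inr p = Q.≤-trans p(Q.0≤∣p∣ x)

  neg≤abs : ∀ x -> - x ≤ ∣ x ∣
  neg≤abs x = E.subst(- x ≤_)(Q.∣-p∣≡∣p∣ x)(≤abs(- x))

  -- The sum of the two nonnegative products (B - x)(η + d) and (B + x)(η - d).
  product≤ : ∀ {x d B η} -> x ≤ B -> - x ≤ B -> d ≤ η -> - d ≤ η -> x * d ≤ B * η
  product≤{x}{d}{B}{η} p p' q q' = linℚ(Q.*-monoˡ-≤-nonNeg ½(Q.+-mono-≤(nonneg*ℚ{B - x}{η + d}(linℚ p(alg! "a-b-0=a-b" B x))(linℚ q'(alg! "a+b-0=a--b" η d)))(nonneg*ℚ{B + x}{η - d}(linℚ p'(alg! "a+b-0=a--b" B x))(linℚ q(alg! "a-b-0=a-b" η d)))))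
   (E.trans(E.sym(½+½(B * η - x * d)))(alg! "a(bc-de)+a(bc-de)=a((b-d)(c+e)+(b+d)(c-e))-a(0+0)" ½ B η x d))

  over-1 : ∀ n ->(Z.+ n)Q./ 1 ≡ fromℕ n
  over-1 zero    = E.refl
  over-1(suc n)= E.trans(Q.toℚᵘ-injective(Qu.≃-trans(Q.toℚᵘ-fromℚᵘ(Qu.mkℚᵘ(Z.+ suc n)0))(Qu.≃-sym(Qu.≃-trans(Q.toℚᵘ-homo-+ 1ℚ((Z.+ n)Q./ 1))(Qu.≃-trans(Qu.+-congʳ(Q.toℚᵘ 1ℚ)(Q.toℚᵘ-fromℚᵘ(Qu.mkℚᵘ(Z.+ n)0)))
   (Qu.*≡*(E.cong(\k ->(Z.+ 1 Z.+ k)Z.* Z.+ 1)(Z.*-identityʳ(Z.+ n)))))))))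
   (E.cong(1ℚ +_)(over-1 n))

  times-inverse : ∀ a n ->(a Q./ suc n)* fromℕ(suc n)≡ a Q./ 1
  times-inverse a n = E.trans(E.cong((a Q./ suc n)*_)(E.sym(over-1(suc n))))(Q.toℚᵘ-injective(Qu.≃-trans(Q.toℚᵘ-homo-*(a Q./ suc n)((Z.+ suc n)Q./ 1))
   (Qu.≃-trans(Qu.*-cong(Q.toℚᵘ-fromℚᵘ(Qu.mkℚᵘ a n))(Q.toℚᵘ-fromℚᵘ(Qu.mkℚᵘ(Z.+ suc n)0)))(Qu.≃-trans(Qu.*≡*(Z.*-assoc a(Z.+ suc n)(Z.+ 1)`then`(E.cong(a Z.*_)(Z.*-comm(Z.+ suc n)(Z.+ 1))`then`(E.cong(a Z.*_)(E.cong Z.+_(E.cong suc(E.trans(N.+-identityʳ n)(E.sym(N.*-identityʳ n)))))))))(Qu.≃-sym(Q.toℚᵘ-fromℚᵘ(Qu.mkℚᵘ a 0)))))))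
   where
   _`then`_ : ∀ {a b c : ℤ} -> a ≡ b -> b ≡ c -> a ≡ c
   _`then`_ = E.trans

  archℚ : ∀ x -> ∃ \n -> x ≤ fromℕ n
  archℚ x@(Q.mkℚ(Z.+ a)d _)= a , E.subst(x ≤_)(over-1 a)(Q.toℚᵘ-cancel-≤(Qu.≤-respʳ-≃(Qu.≃-sym(Q.toℚᵘ-fromℚᵘ(Qu.mkℚᵘ(Z.+ a)0)))(Qu.*≤*(Z.*-monoˡ-≤-nonNeg(Z.+ a)(Z.+≤+(s≤s z≤n))))))
  archℚ x@(Q.mkℚ Z.-[1+ a ] d _)= 0 , Q.toℚᵘ-cancel-≤(Qu.*≤* Z.-≤+)

  archε : ∀ c{e} -> 0ℚ < e -> ∃ \n -> c ≤ fromℕ n * e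
  archε c{e} p with recip p
  ... | r , 0<r , er with archℚ(c * r)
  ...   | n , q = n , linℚ(Q.*-monoʳ-≤-nonNeg e{{Q.nonNegative(Q.<⇒≤ p)}} q)(E.cong(\z -> fromℕ n * e - z)(E.trans(E.sym(Q.*-identityʳ c))(E.trans(E.cong(c *_)(E.sym er))(alg! "a(bc)=acb" c e r))))

module RealOrder where
 open import Data.Rational using (ℚ; 0ℚ; 1ℚ; ½; _+_; _*_; -_; _-_; ∣_∣; _<_; _≤_)
 open Rationals
 open D using (ℝ; mkℝ; seq; cauchy; _≈ʳ_; _<ʳ_; _≤ʳ_; ι)
 open Solver Q.+-*-commutativeRing

 Ev :(ℕ -> Set)-> Set
 Ev P = ∃ \N -> ∀ n -> N N.≤ n -> P n

 ev-map : ∀ {P Q : ℕ -> Set} ->(∀ n -> P n -> Q n)-> Ev P -> Ev Q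
 ev-map f(N , p)= N , \n q -> f n(p n q)

 ev-and : ∀ {P Q : ℕ -> Set} -> Ev P -> Ev Q -> Ev(\n -> P n × Q n)
 ev-and(M , p)(N , q)= M N.⊔ N , \n r -> p n(trN(N.m≤m⊔n M N)r), q n(trN(N.m≤n⊔m M N)r)

 ev-here : ∀ {P : ℕ -> Set} -> Ev P -> ∃ P
 ev-here(N , p)= N , p N rfN

 -- Wrapped, so that the two numbers can be inferred.
 infix 4 _⊑_ _≋_
 record _⊑_(x y : ℝ): Set where
  constructor mk⊑
  field at : ∀ ε -> 0ℚ < ε -> Ev \n -> seq x n ≤ seq y n + ε
 open _⊑_ public

 record _≋_(x y : ℝ): Set where
  constructor mk≋
  field un≋ : x ≈ʳ y
 open _≋_ public

 opaque
  near : ∀ x ε -> 0ℚ < ε -> ∃ \N -> ∀ m n -> N N.≤ m -> N N.≤ n -> seq x m ≤ seq x n + ε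
  near x ε p with cauchy x ε p
  ... | N , q = N , \m n a b -> linℚ(Q.≤-trans(≤abs(seq x m - seq x n))(Q.<⇒≤(q m n a b)))(alg! "a+b-c=b-(c-a)" (seq x n)ε(seq x m))

  ≈⇒⊑ : ∀ {x y} -> x ≋ y -> x ⊑ y
  ≈⇒⊑{x}{y}(mk≋ e)= mk⊑ \ε p -> ev-map(\n q -> linℚ(Q.≤-trans(≤abs _)(Q.<⇒≤ q))(alg! "a+b-c=b-(c-a)" (seq y n)ε(seq x n)))(e ε p)

  ≈⇒⊒ : ∀ {x y} -> x ≋ y -> y ⊑ x
  ≈⇒⊒{x}{y}(mk≋ e)= mk⊑ \ε p -> ev-map(\n q -> linℚ(Q.≤-trans(neg≤abs _)(Q.<⇒≤ q))(alg! "a+b-c=b--(a-c)" (seq x n)ε(seq y n)))(e ε p)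

  ⊑-antisym : ∀ {x y} -> x ⊑ y -> y ⊑ x -> x ≋ y
  ⊑-antisym{x}{y} p q = mk≋ \ε ε>0 -> ev-map(\n(a , b)-> Q.≤-<-trans(abs≤ℚ(linℚ a(alg! "ab-(c-d)=d+ab-c" ½ ε(seq x n)(seq y n)))(linℚ b(alg! "ab--(c-d)=c+ab-d" ½ ε(seq x n)(seq y n))))(half<ℚ ε>0))(ev-and(at p(½ * ε)(halfℚ ε>0))(at q(½ * ε)(halfℚ ε>0)))

  ⊑-trans : ∀ {x y z} -> x ⊑ y -> y ⊑ z -> x ⊑ z
  ⊑-trans{x}{y}{z} p q = mk⊑ \ε ε>0 -> ev-map(\n(a , b)-> linℚ(Q.+-mono-≤ a b)(E.trans(E.cong(\e -> seq z n + e - seq x n)(E.sym(½+½ ε)))(alg! "a+(bc+bc)-d=e+bc+(a+bc)-(d+e)" (seq z n)½ ε(seq x n)(seq y n))))(ev-and(at p(½ * ε)(halfℚ ε>0))(at q(½ * ε)(halfℚ ε>0)))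

  <ʳ⇒⋢ : ∀ {x y} -> x <ʳ y -> ¬(y ⊑ x)
  <ʳ⇒⋢{x}{y}(ε , ε>0 , N , p)q with ev-here(ev-and(N , p)(at q(½ * ε)(halfℚ ε>0)))
  ... | n , a , b = Q.<-irrefl E.refl(Q.<-≤-trans(halfℚ ε>0)(linℚ(Q.+-mono-≤ a b)(E.trans(alg! "0-ab=ab-(ab+ab)" ½ ε)(E.trans(E.cong(\z -> ½ * ε - z)(½+½ ε))(alg! "ab-b=c+(d+ab)-(d+b+c)" ½ ε(seq y n)(seq x n))))))

  <ʳ⇒⊑ : ∀ {x y} -> x <ʳ y -> x ⊑ y
  <ʳ⇒⊑{x}{y}(ε , ε>0 , N , p)= mk⊑ \η η>0 -> N , \n q -> linℚ(Q.+-mono-≤(p n q)(Q.<⇒≤(Q.+-mono-< ε>0 η>0)))(alg! "a+b-c=a+(d+b)-(c+d+(0+0))" (seq y n)η(seq x n)ε)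

  ≤ʳ⇒⊑ : ∀ {x y} -> x ≤ʳ y -> x ⊑ y
  ≤ʳ⇒⊑{x}{y} x≤y = mk⊑ go
   where
   go : ∀ ε -> 0ℚ < ε -> Ev \n -> seq x n ≤ seq y n + ε
   go ε ε>0 with near x(½ *(½ *(½ * ε)))(halfℚ(halfℚ(halfℚ ε>0)))| near y(½ *(½ *(½ * ε)))(halfℚ(halfℚ(halfℚ ε>0)))
   ... | M , nx | N , ny with seq x(M N.⊔ N)Q.≤? seq y(M N.⊔ N)+ ½ * ε
   ...   | yes p = M N.⊔ N , \n q -> linℚ(Q.+-mono-≤(Q.+-mono-≤(Q.+-mono-≤(nx n K(trN(N.m≤m⊔n M N)q)(N.m≤m⊔n M N))p)(ny K n(N.m≤n⊔m M N)(trN(N.m≤n⊔m M N)q)))(Q.<⇒≤(Q.+-mono-< t>0 t>0)))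
    (E.trans(E.cong(\e -> seq y n + e - seq x n)(E.sym(½+½ ε)))(E.trans(E.cong(\e -> seq y n +(e + ½ * ε)- seq x n)(E.sym(E.trans(E.cong₂ _+_(½+½(½ *(½ * ε)))(½+½(½ *(½ * ε))))(½+½(½ * ε)))))(alg! "a+(b(b(bc))+b(b(bc))+(b(b(bc))+b(b(bc)))+bc)-d=e+b(b(bc))+(f+bc)+(a+b(b(bc)))+(b(b(bc))+b(b(bc)))-(d+e+f+(0+0))" (seq y n)½ ε(seq x n)(seq x K)(seq y K))))
    where
    K : ℕ
    K = M N.⊔ N
    t>0 : 0ℚ < ½ *(½ *(½ * ε))
    t>0 = halfℚ(halfℚ(halfℚ ε>0))
   ...   | no np = absurd(x≤y(½ *(½ * ε), halfℚ(halfℚ ε>0), K , \n q -> linℚ(Q.+-mono-≤(Q.+-mono-≤(nx K n(N.m≤m⊔n M N)(trN(N.m≤m⊔n M N)q))(Q.<⇒≤(Q.≰⇒> np)))(ny n K(trN(N.m≤n⊔m M N)q)(N.m≤n⊔m M N)))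
    (E.trans(E.cong(\e -> seq x n -(seq y n + e))(E.sym 2t))(E.trans(alg! "a-(b+(c(c(cd))+c(c(cd))))=a+c(c(cd))+e+(f+c(c(cd)))-(e+(f+(c(c(cd))+c(c(cd))+(c(c(cd))+c(c(cd)))))+b)" (seq x n)(seq y n)½ ε(seq x K)(seq y K))
     (E.cong(\e -> seq x n + ½ *(½ *(½ * ε))+ seq x K +(seq y K + ½ *(½ *(½ * ε)))-(seq x K +(seq y K + e)+ seq y n))(E.trans(E.cong₂ _+_ 2t 2t)(½+½(½ * ε))))))))
    where
    K : ℕ
    K = M N.⊔ N
    2t : ½ *(½ *(½ * ε))+ ½ *(½ *(½ * ε))≡ ½ *(½ * ε)
    2t = ½+½(½ *(½ * ε))

  ⊑⇒≤ʳ : ∀ {x y} -> x ⊑ y -> x ≤ʳ y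
  ⊑⇒≤ʳ{x}{y} p q = <ʳ⇒⋢{y}{x} q p

  pointwise : ∀ {x y} ->(∀ n -> seq x n ≡ seq y n)-> x ≋ y
  pointwise{x}{y} e = ⊑-antisym(mk⊑ \ε p -> 0 , \n _ -> linℚ(Q.<⇒≤ p)(E.trans(E.cong(\z -> seq y n + ε - z)(e n))(alg! "a+b-a=b-0" (seq y n)ε)))(mk⊑ \ε p -> 0 , \n _ -> linℚ(Q.<⇒≤ p)(E.trans(E.cong(\z -> z + ε - seq y n)(e n))(alg! "a+b-a=b-0" (seq y n)ε)))

  bounded : ∀ x -> ∃ \B -> 0ℚ < B × Ev \n -> seq x n ≤ B × - seq x n ≤ B
  bounded x with near x 1ℚ(Q.positive⁻¹ 1ℚ)
  ... | N , q = ∣ seq x N ∣ + 1ℚ , Q.+-mono-≤-<(Q.0≤∣p∣(seq x N))(Q.positive⁻¹ 1ℚ), N , \n r -> Q.≤-trans(q n N r rfN)(Q.+-monoˡ-≤ 1ℚ(≤abs(seq x N))),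
   linℚ(Q.+-mono-≤(q N n rfN r)(neg≤abs(seq x N)))(alg! "a+b--c=c+b+a-(d+-d)" (∣ seq x N ∣)1ℚ(seq x n)(seq x N))

  +-mono⊑ : ∀ {x y z w} -> x ⊑ y -> z ⊑ w ->(x D.+ʳ z)⊑(y D.+ʳ w)
  +-mono⊑{x}{y}{z}{w} p q = mk⊑ \ε ε>0 -> ev-map(\n(a , b)-> linℚ(Q.+-mono-≤ a b)(E.trans(E.cong(\e -> seq y n + seq w n + e -(seq x n + seq z n))(E.sym(½+½ ε)))(alg! "a+b+(cd+cd)-(e+f)=a+cd+(b+cd)-(e+f)" (seq y n)(seq w n)½ ε(seq x n)(seq z n))))(ev-and(at p(½ * ε)(halfℚ ε>0))(at q(½ * ε)(halfℚ ε>0)))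

  neg-anti : ∀ {x y} -> x ⊑ y ->(D.-ʳ y)⊑(D.-ʳ x)
  neg-anti{x}{y} p = mk⊑ \ε ε>0 -> ev-map(\n a -> linℚ a(alg! "-a+b--c=c+b-a" (seq x n)ε(seq y n)))(at p ε ε>0)

  *-cong⊑ : ∀ {x y z w} -> x ≋ y -> z ≋ w ->(x D.*ʳ z)⊑(y D.*ʳ w)
  *-cong⊑{x}{y}{z}{w} p q = mk⊑ go
   where
   go : ∀ ε -> 0ℚ < ε -> Ev \n -> seq x n * seq z n ≤ seq y n * seq w n + ε
   go ε ε>0 with bounded x | bounded w
   ... | A , A>0 , bx | B , B>0 , bw with recip(Q.+-mono-< A>0 B>0)
   ...   | r , r>0 , eq = ev-map(\n(((a₁ , a₂),(b₁ , b₂)),((x≤ , x≥),(z≤ , z≥)))-> linℚ(Q.+-mono-≤(product≤{seq x n}{seq z n - seq w n} a₁ a₂(linℚ z≤(alg! "ab-(c-d)=d+ab-c" ε r(seq z n)(seq w n)))(linℚ z≥(alg! "ab--(c-d)=c+ab-d" ε r(seq z n)(seq w n))))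
    (product≤{seq w n}{seq x n - seq y n} b₁ b₂(linℚ x≤(alg! "ab-(c-d)=d+ab-c" ε r(seq x n)(seq y n)))(linℚ x≥(alg! "ab--(c-d)=c+ab-d" ε r(seq x n)(seq y n)))))
    (E.trans(E.cong(\e -> seq y n * seq w n + e - seq x n * seq z n)(E.trans(E.sym(Q.*-identityʳ ε))(E.trans(E.cong(ε *_)(E.sym eq))(alg! "a((b+c)d)=b(ad)+c(ad)" ε A B r))))
     (alg! "ab+(c(de)+f(de))-gh=c(de)+f(de)-(g(h-b)+b(g-a))" (seq y n)(seq w n)A ε r B(seq x n)(seq z n))))
    (ev-and(ev-and bx bw)(ev-and(ev-and(at(≈⇒⊑ p)(ε * r)εr>0)(at(≈⇒⊒ p)(ε * r)εr>0))(ev-and(at(≈⇒⊑ q)(ε * r)εr>0)(at(≈⇒⊒ q)(ε * r)εr>0))))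
    where
    εr>0 : 0ℚ < ε * r
    εr>0 = pos*ℚ ε>0 r>0

 opaque
  ≋-refl : ∀ {x} -> x ≋ x
  ≋-refl{x} = pointwise{x}{x} \_ -> E.refl

  ≋-sym : ∀ {x y} -> x ≋ y -> y ≋ x
  ≋-sym{x}{y} p = ⊑-antisym{y}{x}(≈⇒⊒ p)(≈⇒⊑ p)

  ≋-trans : ∀ {x y z} -> x ≋ y -> y ≋ z -> x ≋ z
  ≋-trans{x}{y}{z} p q = ⊑-antisym{x}{z}(⊑-trans(≈⇒⊑ p)(≈⇒⊑ q))(⊑-trans(≈⇒⊒ q)(≈⇒⊒ p))

  +ʳ-cong : ∀ {x y z w} -> x ≋ y -> z ≋ w -> x D.+ʳ z ≋ y D.+ʳ w
  +ʳ-cong{x}{y}{z}{w} p q = ⊑-antisym{x D.+ʳ z}{y D.+ʳ w}(+-mono⊑{x}{y}{z}{w}(≈⇒⊑ p)(≈⇒⊑ q))(+-mono⊑{y}{x}{w}{z}(≈⇒⊒ p)(≈⇒⊒ q))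

  -ʳ-cong : ∀ {x y} -> x ≋ y -> D.-ʳ x ≋ D.-ʳ y
  -ʳ-cong{x}{y} p = ⊑-antisym{D.-ʳ x}{D.-ʳ y}(neg-anti{y}{x}(≈⇒⊒ p))(neg-anti{x}{y}(≈⇒⊑ p))

  *ʳ-cong : ∀ {x y z w} -> x ≋ y -> z ≋ w -> x D.*ʳ z ≋ y D.*ʳ w
  *ʳ-cong{x}{y}{z}{w} p q = ⊑-antisym{x D.*ʳ z}{y D.*ʳ w}(*-cong⊑{x}{y}{z}{w} p q)(*-cong⊑{y}{x}{w}{z}(≋-sym p)(≋-sym q))

  +ʳ-assoc : ∀ x y z ->(x D.+ʳ y)D.+ʳ z ≋ x D.+ʳ(y D.+ʳ z)
  +ʳ-assoc x y z = pointwise{(x D.+ʳ y)D.+ʳ z}{x D.+ʳ(y D.+ʳ z)} \n -> Q.+-assoc(seq x n)(seq y n)(seq z n)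

  +ʳ-identityˡ : ∀ x -> D.0ʳ D.+ʳ x ≋ x
  +ʳ-identityˡ x = pointwise{D.0ʳ D.+ʳ x}{x} \n -> Q.+-identityˡ(seq x n)

  +ʳ-comm : ∀ x y -> x D.+ʳ y ≋ y D.+ʳ x
  +ʳ-comm x y = pointwise{x D.+ʳ y}{y D.+ʳ x} \n -> Q.+-comm(seq x n)(seq y n)

  -ʳ-inverseˡ : ∀ x ->(D.-ʳ x)D.+ʳ x ≋ D.0ʳ
  -ʳ-inverseˡ x = pointwise{(D.-ʳ x)D.+ʳ x}{D.0ʳ} \n -> Q.+-inverseˡ(seq x n)

  *ʳ-assoc : ∀ x y z ->(x D.*ʳ y)D.*ʳ z ≋ x D.*ʳ(y D.*ʳ z)
  *ʳ-assoc x y z = pointwise{(x D.*ʳ y)D.*ʳ z}{x D.*ʳ(y D.*ʳ z)} \n -> Q.*-assoc(seq x n)(seq y n)(seq z n)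

  *ʳ-comm : ∀ x y -> x D.*ʳ y ≋ y D.*ʳ x
  *ʳ-comm x y = pointwise{x D.*ʳ y}{y D.*ʳ x} \n -> Q.*-comm(seq x n)(seq y n)

  *ʳ-identityˡ : ∀ x -> D.1ʳ D.*ʳ x ≋ x
  *ʳ-identityˡ x = pointwise{D.1ʳ D.*ʳ x}{x} \n -> Q.*-identityˡ(seq x n)

  *ʳ-zeroˡ : ∀ x -> D.0ʳ D.*ʳ x ≋ D.0ʳ
  *ʳ-zeroˡ x = pointwise{D.0ʳ D.*ʳ x}{D.0ʳ} \n -> Q.*-zeroˡ(seq x n)

  *ʳ-distribˡ : ∀ x y z -> x D.*ʳ(y D.+ʳ z)≋ x D.*ʳ y D.+ʳ x D.*ʳ z
  *ʳ-distribˡ x y z = pointwise{x D.*ʳ(y D.+ʳ z)}{x D.*ʳ y D.+ʳ x D.*ʳ z} \n -> Q.*-distribˡ-+(seq x n)(seq y n)(seq z n)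

  *ʳ-distribʳ : ∀ x y z ->(y D.+ʳ z)D.*ʳ x ≋ y D.*ʳ x D.+ʳ z D.*ʳ x
  *ʳ-distribʳ x y z = pointwise{(y D.+ʳ z)D.*ʳ x}{y D.*ʳ x D.+ʳ z D.*ʳ x} \n -> Q.*-distribʳ-+(seq x n)(seq y n)(seq z n)

 -- A data type: metavariables of a record type such as ℝ are η-expanded, which exposes the Cauchy moduli to unification.
 data Real : Set where
  real : ℝ -> Real

 un : Real -> ℝ
 un(real x)= x

 infix 4 _≃_ _≼_
 record _≃_(x y : Real): Set where
  constructor mk≃
  field un≃ : un x ≋ un y
 open _≃_ public

 record _≼_(x y : Real): Set where
  constructor mk≼
  field un≼ : un x ⊑ un y
 open _≼_ public

 infixl 6 _⊞_
 infixl 7 _⊠_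
 infix  8 ⊟_
 _⊞_ _⊠_ : Real -> Real -> Real
 real x ⊞ real y = real(x D.+ʳ y)
 real x ⊠ real y = real(x D.*ʳ y)
 ⊟_ : Real -> Real
 ⊟ real x = real(D.-ʳ x)
 𝟘 𝟙 : Real
 𝟘 = real D.0ʳ
 𝟙 = real D.1ʳ

 opaque
  ≃-refl : ∀ {x} -> x ≃ x
  ≃-refl{real x} = mk≃(≋-refl{x})

  ≃-sym : ∀ {x y} -> x ≃ y -> y ≃ x
  ≃-sym{real x}{real y}(mk≃ p)= mk≃(≋-sym{x}{y} p)

  ≃-trans : ∀ {x y z} -> x ≃ y -> y ≃ z -> x ≃ z
  ≃-trans{real x}{real y}{real z}(mk≃ p)(mk≃ q)= mk≃(≋-trans{x}{y}{z} p q)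

  ⊞-comm : ∀ x y -> x ⊞ y ≃ y ⊞ x
  ⊞-comm(real x)(real y)= mk≃(+ʳ-comm x y)

  ⊠-comm : ∀ x y -> x ⊠ y ≃ y ⊠ x
  ⊠-comm(real x)(real y)= mk≃(*ʳ-comm x y)

  ⊞-identityˡ : ∀ x -> 𝟘 ⊞ x ≃ x
  ⊞-identityˡ(real x)= mk≃(+ʳ-identityˡ x)

  ⊠-identityˡ : ∀ x -> 𝟙 ⊠ x ≃ x
  ⊠-identityˡ(real x)= mk≃(*ʳ-identityˡ x)

  ⊟-inverseˡ : ∀ x -> ⊟ x ⊞ x ≃ 𝟘
  ⊟-inverseˡ(real x)= mk≃(-ʳ-inverseˡ x)

  ⊠-cong : ∀ {x y z w} -> x ≃ y -> z ≃ w -> x ⊠ z ≃ y ⊠ w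
  ⊠-cong{real x}{real y}{real z}{real w}(mk≃ p)(mk≃ q)= mk≃(*ʳ-cong{x}{y}{z}{w} p q)

  ⊠-zeroˡ : ∀ x -> 𝟘 ⊠ x ≃ 𝟘
  ⊠-zeroˡ(real x)= mk≃(*ʳ-zeroˡ x)

  Real-isCommutativeRing : IsCommutativeRing _≃_ _⊞_ _⊠_ ⊟_ 𝟘 𝟙
  Real-isCommutativeRing = record
   { isRing = record
    { +-isAbelianGroup = record
     { isGroup = record
      { isMonoid = record
       { isSemigroup = record
        { isMagma = record{ isEquivalence = record{ refl = ≃-refl ; sym = ≃-sym ; trans = ≃-trans } ; ∙-cong = λ { {real x}{real y}{real z}{real w}(mk≃ p)(mk≃ q)-> mk≃(+ʳ-cong{x}{y}{z}{w} p q) } }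
        ; assoc = λ { (real x)(real y)(real z)-> mk≃(+ʳ-assoc x y z) } }
       ; identity = ⊞-identityˡ , \x -> ≃-trans(⊞-comm x 𝟘)(⊞-identityˡ x) }
      ; inverse = ⊟-inverseˡ , \x -> ≃-trans(⊞-comm x(⊟ x))(⊟-inverseˡ x)
      ; ⁻¹-cong = λ { {real x}{real y}(mk≃ p)-> mk≃(-ʳ-cong{x}{y} p) } }
     ; comm = ⊞-comm }
    ; *-cong = ⊠-cong
    ; *-assoc = λ { (real x)(real y)(real z)-> mk≃(*ʳ-assoc x y z) }
    ; *-identity = ⊠-identityˡ , \x -> ≃-trans(⊠-comm x 𝟙)(⊠-identityˡ x)
    ; distrib =(λ { (real x)(real y)(real z)-> mk≃(*ʳ-distribˡ x y z) }),(λ { (real x)(real y)(real z)-> mk≃(*ʳ-distribʳ x y z) }) }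
   ; *-comm = ⊠-comm }

 Real-ring : CommutativeRing 0ℓ 0ℓ
 Real-ring = record{ isCommutativeRing = Real-isCommutativeRing }

 -- The diagonal n ↦ s n (M n) of rational approximations, where s n varies by at most δ n from M n on.
 module Diagonal (s : ℕ -> ℕ -> ℚ) (δ : ℕ -> ℚ) (M : ℕ -> ℕ) (stable : ∀ k m n -> M k N.≤ m -> M k N.≤ n -> s k m ≤ s k n + δ k) where
  d : ℕ -> ℚ
  d k = s k(M k)

  Close : ℚ -> Set
  Close t = ∃ \N -> ∀ m n -> N N.≤ m -> N N.≤ n -> δ m ≤ t × Ev \i -> s m i ≤ s n i +(t + t)

  opaque
   d-close : ∀ t -> Close t -> ∃ \N -> ∀ m n -> N N.≤ m -> N N.≤ n -> d m ≤ d n +(t + t +(t + t))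
   d-close t(N , p)= N , \m n a b -> go m n(fst(p m n a b))(fst(p n n b b))(ev-here(ev-and(ev-and(M m , \_ r -> r)(M n , \_ r -> r))(snd(p m n a b))))
    where
    go : ∀ m n -> δ m ≤ t -> δ n ≤ t ->(∃ \i ->(M m N.≤ i × M n N.≤ i)× s m i ≤ s n i +(t + t))-> d m ≤ d n +(t + t +(t + t))
    go m n δm δn(i ,(x , y), z)= linℚ(Q.+-mono-≤(Q.+-mono-≤(stable m(M m)i rfN x)z)(Q.+-mono-≤(stable n i(M n)y rfN)(Q.+-mono-≤ δm δn)))
     (alg! "a+(b+b+(b+b))-c=d+e+(f+(b+b))+(a+g+(b+b))-(c+d+(f+(e+g)))" (d n)t(d m)(s m i)(δ m)(s n i)(δ n))
   d-cauchy :(∀ e -> 0ℚ < e -> ∃ \t ->(t + t +(t + t)≡ ½ * e)× Close t)-> D.Cauchy d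
   d-cauchy quarter e e>0 = fst D , \m n a b -> Q.≤-<-trans(go m n(snd D m n a b)(snd D n m b a))(half<ℚ e>0)
    where
    t : ℚ
    t = fst(quarter e e>0)
    D : ∃ \N -> ∀ m n -> N N.≤ m -> N N.≤ n -> d m ≤ d n +(t + t +(t + t))
    D = d-close t(snd(snd(quarter e e>0)))
    go : ∀ m n -> d m ≤ d n +(t + t +(t + t))-> d n ≤ d m +(t + t +(t + t))-> ∣ d m - d n ∣ ≤ ½ * e
    go m n p q = E.subst(∣ d m - d n ∣ ≤_)(fst(snd(quarter e e>0)))(abs≤ℚ{d m - d n}{t + t +(t + t)}(linℚ p(alg! "a+a+(a+a)-(b-c)=c+(a+a+(a+a))-b" t(d m)(d n)))(linℚ q(alg! "a+a+(a+a)--(b-c)=b+(a+a+(a+a))-c" t(d m)(d n))))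
   both : ∀ t -> Close t ->(∀ n -> ∃ \K -> ∀ i j -> K N.≤ i -> K N.≤ j -> s n i ≤ s n j + t)->
    ∃ \N -> ∀ n -> N N.≤ n ->(Ev \i -> s n i ≤ d i +(t + t +(t + t)))×(Ev \i -> d i ≤ s n i +(t + t +(t + t)))
   both t(N , p)st = N , \n N≤n -> let K = fst(st n)in
    (N N.⊔ K , \i r -> let i≥N = trN(N.m≤m⊔n N K)r ; i≥K = trN(N.m≤n⊔m N K)r in
     up n i(snd(st n))i≥K(fst(p i i i≥N i≥N))(ev-here(ev-and(ev-and(M i , \_ r -> r)(K , \_ r -> r))(snd(p n i N≤n i≥N))))),
    (N N.⊔ K , \i r -> let i≥N = trN(N.m≤m⊔n N K)r ; i≥K = trN(N.m≤n⊔m N K)r in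
     down n i(snd(st n))i≥K(fst(p i i i≥N i≥N))(ev-here(ev-and(ev-and(M i , \_ r -> r)(K , \_ r -> r))(snd(p i n i≥N N≤n)))))
    where
    up : ∀ n i{K} ->(∀ i j -> K N.≤ i -> K N.≤ j -> s n i ≤ s n j + t)-> K N.≤ i -> δ i ≤ t ->(∃ \j ->(M i N.≤ j × K N.≤ j)× s n j ≤ s i j +(t + t))-> s n i ≤ d i +(t + t +(t + t))
    up n i st' i≥K δi(j ,(x , y), z)= linℚ(Q.+-mono-≤(Q.+-mono-≤(st' i j i≥K y)z)(Q.+-mono-≤(stable i j(M i)x rfN)δi))
     (alg! "a+(b+b+(b+b))-c=d+b+(e+(b+b))+(a+f+b)-(c+d+(e+f))" (d i)t(s n i)(s n j)(s i j)(δ i))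
    down : ∀ n i{K} ->(∀ i j -> K N.≤ i -> K N.≤ j -> s n i ≤ s n j + t)-> K N.≤ i -> δ i ≤ t ->(∃ \j ->(M i N.≤ j × K N.≤ j)× s i j ≤ s n j +(t + t))-> d i ≤ s n i +(t + t +(t + t))
    down n i st' i≥K δi(j ,(x , y), z)= linℚ(Q.+-mono-≤(Q.+-mono-≤(stable i(M i)j rfN x)z)(Q.+-mono-≤(st' j i y i≥K)δi))
     (alg! "a+(b+b+(b+b))-c=d+e+(f+(b+b))+(a+b+b)-(c+d+(f+e))" (s n i)t(d i)(s i j)(δ i)(s n j))

 module _ (em : ExcludedMiddle 0ℓ) where
  infix 4 _≺_
  _≺_ : ℝ -> ℝ -> Set
  x ≺ y = ¬(y ⊑ x)

  opaque
   ≺⇒<ʳ : ∀ {x y} -> x ≺ y -> x <ʳ y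
   ≺⇒<ʳ{x}{y} n with em{x <ʳ y}
   ... | yes p = p
   ... | no np = absurd(n(≤ʳ⇒⊑ np))
   ⊑-total : ∀ x y -> x ⊑ y ⊎ y ⊑ x
   ⊑-total x y with em{x ⊑ y}
   ... | yes p = inl p
   ... | no np = inr(<ʳ⇒⊑(≺⇒<ʳ{y}{x} np))
   sign : ∀ x -> D.0ʳ ⊑ x -> D.0ʳ <ʳ x ⊎ x ≋ D.0ʳ
   sign x p with em{D.0ʳ <ʳ x}
   ... | yes q = inl q
   ... | no nq = inr(⊑-antisym(≤ʳ⇒⊑ nq)p)
   0≼-* : ∀ {x y} -> 𝟘 ≼ x -> 𝟘 ≼ y -> 𝟘 ≼ x ⊠ y
   0≼-*{real x}{real y}(mk≼ p)(mk≼ q)= go(sign x p)(sign y q)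
    where
    0≤-from : ∀ {ε z} -> 0ℚ < ε -> 0ℚ + ε ≤ z -> 0ℚ ≤ z
    0≤-from{ε}{z} p q = Q.≤-trans(Q.<⇒≤ p)(E.subst(_≤ z)(Q.+-identityˡ ε)q)
    final : ∀ n e -> 0ℚ < e -> 0ℚ ≤ seq x n -> 0ℚ ≤ seq y n -> 0ℚ ≤ seq x n * seq y n + e
    final n e e>0 u w = Q.+-mono-≤(nonneg*ℚ u w)(Q.<⇒≤ e>0)
    zero≼ : ∀ {a} -> a ≃ 𝟘 -> 𝟘 ≼ a
    zero≼{real a}(mk≃ e)= mk≼(≈⇒⊒{a}{D.0ʳ} e)
    go : D.0ʳ <ʳ x ⊎ x ≋ D.0ʳ -> D.0ʳ <ʳ y ⊎ y ≋ D.0ʳ -> 𝟘 ≼ real x ⊠ real y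
    go(inr e)_ = zero≼(≃-trans(⊠-cong{real x}{𝟘}{real y}(mk≃ e)≃-refl)(⊠-zeroˡ(real y)))
    go(inl p)(inr e)= zero≼(≃-trans(⊠-comm(real x)(real y))(≃-trans(⊠-cong{real y}{𝟘}{real x}(mk≃ e)≃-refl)(⊠-zeroˡ(real x))))
    go(inl(ε , ε>0 , M , a))(inl(η , η>0 , N , b))= mk≼(mk⊑ \e e>0 -> ev-map(\n(u , w)-> final n e e>0(0≤-from ε>0 u)(0≤-from η>0 w))(ev-and(M , a)(N , b)))
   1⋢0 : ¬(D.1ʳ ⊑ D.0ʳ)
   1⋢0 p with ev-here(at p ½ 0<½)
   ... | _ , q = from-no(1ℚ Q.≤? 0ℚ + ½)q
   inverse⁺ : ∀ x -> D.0ʳ <ʳ x -> ∃ \y -> real x ⊠ y ≃ 𝟙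
   inverse⁺ x(ε , ε>0 , N , a)with recip ε>0
   ... | E , E>0 , εE = real(mkℝ ρ ρ-cauchy), mk≃(⊑-antisym{x D.*ʳ mkℝ ρ ρ-cauchy}{D.1ʳ}(mk⊑ \e e>0 -> N , \n q -> linℚ(Q.<⇒≤ e>0)(E.trans(E.cong(\z -> 1ℚ + e - z)(inv-eq n q))(alg! "1+a-1=a-0" e)))(mk⊑ \e e>0 -> N , \n q -> linℚ(Q.<⇒≤ e>0)(E.trans(E.cong(\z -> z + e - 1ℚ)(inv-eq n q))(alg! "1+a-1=a-0" e))))
    where
    big : ∀ n -> N N.≤ n -> ε ≤ seq x n
    big n q = E.subst(_≤ seq x n)(Q.+-identityˡ ε)(a n q)
    ρ : ℕ -> ℚ
    ρ n with N N.≤? n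
    ... | yes q = fst(recip(Q.<-≤-trans ε>0(big n q)))
    ... | no _  = 0ℚ
    inv-eq : ∀ n -> N N.≤ n -> seq x n * ρ n ≡ 1ℚ
    inv-eq n q with N N.≤? n
    ... | yes q' = snd(snd(recip(Q.<-≤-trans ε>0(big n q'))))
    ... | no nq  = absurd(nq q)
    ρ≥0 : ∀ n -> 0ℚ ≤ ρ n
    ρ≥0 n with N N.≤? n
    ... | yes q = Q.<⇒≤(fst(snd(recip(Q.<-≤-trans ε>0(big n q)))))
    ... | no _  = Q.≤-refl
    ρ≤E : ∀ n -> N N.≤ n -> ρ n ≤ E
    ρ≤E n q = linℚ(nonneg*ℚ(nonneg*ℚ(Q.<⇒≤ E>0)(ρ≥0 n))(linℚ(big n q)(alg! "a-b-0=a-b" (seq x n)ε)))(E.trans(E.cong₂ _-_(E.trans(E.sym(Q.*-identityʳ E))(E.cong(E *_)(E.sym(inv-eq n q))))(E.trans(E.sym(Q.*-identityʳ(ρ n)))(E.cong(ρ n *_)(E.sym εE))))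
     (alg! "a(bc)-c(da)=ac(b-d)-0" E(seq x n)(ρ n)ε))
    ρ-diff : ∀ m n -> N N.≤ m -> N N.≤ n -> ρ m - ρ n ≡(seq x n - seq x m)*(ρ m * ρ n)
    ρ-diff m n p q = E.trans(E.cong₂ _-_(E.trans(E.sym(Q.*-identityʳ(ρ m)))(E.cong(ρ m *_)(E.sym(inv-eq n q))))(E.trans(E.sym(Q.*-identityʳ(ρ n)))(E.cong(ρ n *_)(E.sym(inv-eq m p)))))(alg! "a(bc)-c(da)=(b-d)(ac)" (ρ m)(seq x n)(ρ n)(seq x m))
    ρ-cauchy : D.Cauchy ρ
    ρ-cauchy e e>0 with cauchy x(e *(ε * ε))(pos*ℚ e>0(pos*ℚ ε>0 ε>0))
    ... | K , close = N N.⊔ K , \m n p q -> let pm = trN(N.m≤m⊔n N K)p ; pn = trN(N.m≤m⊔n N K)q in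
     E.subst(_< e)(E.sym(E.trans(E.cong ∣_∣(ρ-diff m n pm pn))(E.trans(Q.∣p*q∣≡∣p∣*∣q∣(seq x n - seq x m)(ρ m * ρ n))(E.cong(∣ seq x n - seq x m ∣ *_)(Q.0≤p⇒∣p∣≡p(nonneg*ℚ(ρ≥0 m)(ρ≥0 n)))))))
      (Q.≤-<-trans(Q.*-monoˡ-≤-nonNeg ∣ seq x n - seq x m ∣{{Q.nonNegative(Q.0≤∣p∣(seq x n - seq x m))}}(Q.≤-trans(Q.*-monoʳ-≤-nonNeg(ρ n){{Q.nonNegative(ρ≥0 n)}}(ρ≤E m pm))(Q.*-monoˡ-≤-nonNeg E{{Q.nonNegative(Q.<⇒≤ E>0)}}(ρ≤E n pn))))
       (E.subst(∣ seq x n - seq x m ∣ *(E * E)<_)(E.trans(alg! "a(bb)(cc)=a(bc(bc))" e ε E)(E.trans(E.cong(\z -> e *(z * z))εE)(E.trans(E.cong(e *_)(Q.*-identityʳ 1ℚ))(Q.*-identityʳ e))))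
        (Q.*-monoˡ-<-pos(E * E){{Q.positive(pos*ℚ E>0 E>0)}}(close n m(trN(N.m≤n⊔m N K)q)(trN(N.m≤n⊔m N K)p)))))
   neg-≼ : ∀ {x y} -> x ≼ y -> ⊟ y ≼ ⊟ x
   neg-≼{real x}{real y}(mk≼ p)= mk≼(neg-anti{x}{y} p)
   ≃⇒≼ : ∀ {x y} -> x ≃ y -> x ≼ y
   ≃⇒≼{real x}{real y}(mk≃ p)= mk≼(≈⇒⊑{x}{y} p)
   ≼-trans : ∀ {x y z} -> x ≼ y -> y ≼ z -> x ≼ z
   ≼-trans{real x}{real y}{real z}(mk≼ p)(mk≼ q)= mk≼(⊑-trans{x}{y}{z} p q)
   ≼-total : ∀ x y -> x ≼ y ⊎ y ≼ x
   ≼-total(real x)(real y)with ⊑-total x y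
   ... | inl p = inl(mk≼ p)
   ... | inr p = inr(mk≼ p)
   0≼⊟0 : 𝟘 ≼ ⊟ 𝟘
   0≼⊟0 = mk≼(mk⊑ \ε ε>0 -> 0 , \n _ -> linℚ(Q.<⇒≤ ε>0)(alg! "-0+a-0=a-0" ε))
   inverseᴿ : ∀ x -> ¬(x ≃ 𝟘)-> ∃ \y -> x ⊠ y ≃ 𝟙
   inverseᴿ(real x)x≉0 = go em
    where
    move : ∀ x y -> ⊟ x ⊠ y ≃ x ⊠ ⊟ y
    move x y = Solver.alg! Real-ring "-ab=a(-b)" x y
    back : ∀ x -> ⊟ x ≃ 𝟘 -> x ≃ 𝟘
    back x e = ≃-trans(Solver.alg! Real-ring "a=0--a" x)(≃-trans(CommutativeRing.+-congˡ Real-ring(CommutativeRing.-‿cong Real-ring e))(Solver.alg! Real-ring "0-0=0"))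
    negative : D.0ʳ <ʳ D.-ʳ x ⊎ D.-ʳ x ≋ D.0ʳ -> ∃ \y -> real x ⊠ y ≃ 𝟙
    negative(inl q)= let y , e = inverse⁺(D.-ʳ x)q in ⊟ y , ≃-trans(≃-sym(move(real x)y))e
    negative(inr e)= absurd(x≉0(back(real x)(mk≃ e)))
    go : Dec(D.0ʳ <ʳ x)-> ∃ \y -> real x ⊠ y ≃ 𝟙
    go(yes p)= inverse⁺ x p
    go(no np)= negative(sign(D.-ʳ x)(un≼(≼-trans 0≼⊟0(neg-≼{real x}{𝟘}(mk≼(≤ʳ⇒⊑ np))))))
   from-ι : ∀ n -> Solver.fromℕ Real-ring n ≃ real(ι(fromℕ n))
   from-ι zero    = ≃-refl
   from-ι(suc n)= ≃-trans(CommutativeRing.+-congˡ Real-ring(from-ι n))(mk≃(pointwise{D.1ʳ D.+ʳ ι(fromℕ n)}{ι(1ℚ + fromℕ n)} \_ -> E.refl))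
   archᴿ : ∀ x -> ∃ \n -> x ≼ Solver.fromℕ Real-ring n
   archᴿ(real x)with bounded x
   ... | B , _ , N , b with archℚ B
   ...   | n , B≤n = n , ≼-trans(mk≼{real x}{real(ι(fromℕ n))}(mk⊑ \ε ε>0 -> N , \i q -> Q.≤-trans(fst(b i q))(Q.≤-trans B≤n(linℚ(Q.<⇒≤ ε>0)(alg! "a+b-a=b-0" (fromℕ n)ε)))))(≃⇒≼(≃-sym(from-ι n)))
   0≤fromℕ : ∀ n -> 0ℚ ≤ fromℕ n
   0≤fromℕ zero    = Q.≤-refl
   0≤fromℕ(suc n)= Q.+-mono-≤(Q.<⇒≤(Q.positive⁻¹ 1ℚ))(0≤fromℕ n)
   fromℕ-mono : ∀ {m n} -> m N.≤ n -> fromℕ m ≤ fromℕ n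
   fromℕ-mono{n = n} z≤n = 0≤fromℕ n
   fromℕ-mono(s≤s p)= Q.+-monoʳ-≤ 1ℚ(fromℕ-mono p)
   0<suc : ∀ n -> 0ℚ < fromℕ(suc n)
   0<suc n = Q.+-mono-<-≤(Q.positive⁻¹ 1ℚ)(0≤fromℕ n)
   vanishing : Σ(ℕ -> ℚ)\δ ->(∀ k -> 0ℚ < δ k)×(∀ e -> 0ℚ < e -> Ev \k -> δ k ≤ e)
   vanishing =(\k -> fst(recip(0<suc k))),(\k -> fst(snd(recip(0<suc k)))), \e e>0 -> let n , q = archε 1ℚ e>0 in n , \k n≤k -> small e e>0 n q k n≤k
    where
    small : ∀ e -> 0ℚ < e -> ∀ n -> 1ℚ ≤ fromℕ n * e -> ∀ k -> n N.≤ k -> fst(recip(0<suc k))≤ e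
    small e e>0 n q k n≤k with recip(0<suc k)
    ... | r , r>0 , eq = E.subst₂ _≤_(Q.*-identityʳ r)(E.trans(alg! "a(bc)=bac" r(fromℕ(suc k))e)(E.trans(E.cong(_* e)eq)(Q.*-identityˡ e)))
     (Q.*-monoˡ-≤-nonNeg r{{Q.nonNegative(Q.<⇒≤ r>0)}}(Q.≤-trans q(Q.*-monoʳ-≤-nonNeg e{{Q.nonNegative(Q.<⇒≤ e>0)}}(fromℕ-mono(m≤1+n n≤k)))))
   eighth : ∀ e -> 0ℚ < e -> ∃ \t -> 0ℚ < t × t + t +(t + t)≡ ½ * e
   eighth e e>0 = ½ *(½ *(½ * e)), halfℚ(halfℚ(halfℚ e>0)), E.trans(E.cong₂ _+_(½+½(½ *(½ * e)))(½+½(½ *(½ * e))))(½+½(½ * e))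
   ι≻0 : ∀ e -> 0ℚ < e -> ¬(real(ι e)≼ 𝟘)
   ι≻0 e e>0(mk≼ p)with ev-here(at p(½ * e)(halfℚ e>0))
   ... | _ , q = Q.<-irrefl E.refl(Q.<-≤-trans(half<ℚ e>0)(E.subst(e ≤_)(Q.+-identityˡ(½ * e))q))

  difference : ∀ x y z -> x ⊞ ⊟ y ≼ real(ι z)-> ∀ ε -> 0ℚ < ε -> Ev \n -> seq(un x)n ≤ seq(un y)n +(z + ε)
  difference(real x)(real y)z(mk≼ p)ε ε>0 = ev-map(\n q -> linℚ q(alg! "a+(b+c)-d=b+c-(d+-a)" (seq y n)z ε(seq x n)))(at p ε ε>0)

  below : ∀ x e z ->(Ev \i -> seq(un x)i ≤ seq(un z)i + e)->(ε : Real)->(Ev \i -> 0ℚ + e ≤ seq(un ε)i)-> x ⊞ ⊟ z ≼ ε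
  below(real x)e(real z)ev(real ε)big = mk≼(mk⊑ \η η>0 -> ev-map(\n(p , q)-> linℚ(Q.+-mono-≤(Q.+-mono-≤ p q)(Q.<⇒≤ η>0))(alg! "a+b-(c+-d)=d+e+a+b-(c+(0+e)+0)" (seq ε n)η(seq x n)(seq z n)e))(ev-and ev big))

  module Completeness (f : ℕ -> Real) (hyp : ∀ ε -> ¬ (ε ≼ 𝟘) -> ∃ \N -> ∀ m n -> N N.≤ m -> N N.≤ n -> f m ⊞ ⊟ f n ≼ ε) where
   δ : ℕ -> ℚ
   δ = fst vanishing
   module Di = Diagonal (\k -> seq (un (f k))) δ (\k -> fst (near (un (f k)) (δ k) (fst (snd vanishing) k))) (\k -> snd (near (un (f k)) (δ k) (fst (snd vanishing) k)))
   opaque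
    close : ∀ t -> 0ℚ < t -> Di.Close t
    close t t>0 = go(hyp(real(ι t))(ι≻0 t t>0))(snd(snd vanishing)t t>0)
     where
     go :(∃ \N -> ∀ m n -> N N.≤ m -> N N.≤ n -> f m ⊞ ⊟ f n ≼ real(ι t))->(Ev \k -> δ k ≤ t)-> Di.Close t
     go(N , p)(K , q)= N N.⊔ K , \m n a b -> q m(trN(N.m≤n⊔m N K)a), difference(f m)(f n)t(p m n(trN(N.m≤m⊔n N K)a)(trN(N.m≤m⊔n N K)b))t t>0
   l : Real
   l = real(mkℝ Di.d(Di.d-cauchy \e e>0 -> let t , t>0 , 4t = eighth e e>0 in t , 4t , close t t>0))
   opaque
    limit : ∀ ε -> ¬(ε ≼ 𝟘)-> ∃ \N -> ∀ n -> N N.≤ n -> f n ⊞ ⊟ l ≼ ε × l ⊞ ⊟ f n ≼ ε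
    limit(real ε)ε≻0 = go(≺⇒<ʳ{D.0ʳ}{ε}(\p -> ε≻0(mk≼ p)))
     where
     module _ (e : ℚ) (e>0 : 0ℚ < e) (big : Ev \i -> 0ℚ + e ≤ seq ε i) where
      t : ℚ
      t = fst(eighth e e>0)
      4t≤e : ∀ x -> x +(t + t +(t + t))≤ x + e
      4t≤e x = Q.+-monoʳ-≤ x(E.subst(_≤ e)(E.sym(snd(snd(eighth e e>0))))(Q.<⇒≤(half<ℚ e>0)))
      limit′ : ∃ \N -> ∀ n -> N N.≤ n -> f n ⊞ ⊟ l ≼ real ε × l ⊞ ⊟ f n ≼ real ε
      limit′ = let N , p = Di.both t(close t(fst(snd(eighth e e>0))))(\n -> near(un(f n))t(fst(snd(eighth e e>0))))in
       N , \n q -> below(f n)e l(ev-map(\i r -> Q.≤-trans r(4t≤e(Di.d i)))(fst(p n q)))(real ε)big , below l e(f n)(ev-map(\i r -> Q.≤-trans r(4t≤e(seq(un(f n))i)))(snd(p n q)))(real ε)big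
     go : D.0ʳ <ʳ ε -> ∃ \N -> ∀ n -> N N.≤ n -> f n ⊞ ⊟ l ≼ real ε × l ⊞ ⊟ f n ≼ real ε
     go(e , e>0 , big)= limit′ e e>0 big

  𝓡 : Reals
  𝓡 = record
   { em = em ; ring = Real-ring ; _≤_ = _≼_
   ; e≤ = ≃⇒≼ ; ≤t = ≼-trans
   ; ≤-antisym = λ { {real x}{real y}(mk≼ p)(mk≼ q)-> mk≃(⊑-antisym{x}{y} p q) }
   ; ≤-total = ≼-total
   ; +-monoʳ = λ { {real x}{real y}(real z)(mk≼ p)-> mk≼(+-mono⊑{x}{y}{z}{z} p(≈⇒⊑{z}{z}(≋-refl{z}))) }
   ; 0≤* = 0≼-* ; 1≰0 = λ { (mk≼ p)-> 1⋢0 p }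
   ; inverse = inverseᴿ ; archimedean = archᴿ ; complete = \f hyp -> Completeness.l f hyp , Completeness.limit f hyp }

module Translation (em : ExcludedMiddle 0ℓ) where
 open RealOrder using (Real; real; un; mk≃; un≃; mk≼; un≼; mk≋; un≋; ≤ʳ⇒⊑; ⊑⇒≤ʳ; <ʳ⇒⋢; ≺⇒<ʳ; from-ι; pointwise; ≃-refl)
 𝓡 : Reals
 𝓡 = RealOrder.𝓡 em
 open Reals 𝓡 hiding (em)
 open Theory 𝓡

 opaque
  eq : ∀ x y -> x D.≈ʳ y -> real x ≈ real y
  eq x y p = mk≃(mk≋ p)

  eq⁻ : ∀ x y -> real x ≈ real y -> x D.≈ʳ y
  eq⁻ x y p = un≋(un≃ p)

  lt : ∀ x y -> x D.<ʳ y -> real x < real y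
  lt x y p q = <ʳ⇒⋢{x}{y} p(un≼ q)

  lt⁻ : ∀ x y -> real x < real y -> x D.<ʳ y
  lt⁻ x y p = ≺⇒<ʳ em{x}{y} \q -> p(mk≼ q)

  le : ∀ x y -> x D.≤ʳ y -> real x ≤ real y
  le x y p = mk≼(≤ʳ⇒⊑ p)

  le⁻ : ∀ x y -> real x ≤ real y -> x D.≤ʳ y
  le⁻ x y p = ⊑⇒≤ʳ(un≼ p)

  real-un : ∀ x -> real(un x)≈ x
  real-un(real x)= ≃-refl

 toℂ : D.ℂ -> ℂ
 toℂ z = mk(real(D.re z))(real(D.im z))

 fromℂ : ℂ -> D.ℂ
 fromℂ z = un(re z)D.+i un(im z)

 opaque
  to-from : ∀ z -> toℂ(fromℂ z)~ z
  to-from z = mk≈(real-un(re z))(real-un(im z))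

  eqc : ∀ z w -> z D.≈ᶜ w -> toℂ z ~ toℂ w
  eqc z w(p , q)= mk≈(eq _ _ p)(eq _ _ q)

  eqc⁻ : ∀ z w -> toℂ z ~ toℂ w -> z D.≈ᶜ w
  eqc⁻ z w(mk≈ p q)= eq⁻ _ _ p , eq⁻ _ _ q

  to-+ : ∀ z w -> toℂ(z D.+ᶜ w)~ toℂ z +c toℂ w
  to-+ z w = mk≈ ≃-refl ≃-refl

  to-- : ∀ z w -> toℂ(z D.-ᶜ w)~ toℂ z -c toℂ w
  to-- z w = mk≈ ≃-refl ≃-refl

  to-neg : ∀ z -> toℂ(D.-ᶜ z)~ -c toℂ z
  to-neg z = mk≈ ≃-refl ≃-refl

  to-* : ∀ z w -> toℂ(z D.*ᶜ w)~ toℂ z *c toℂ w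
  to-* z w = mk≈ ≃-refl ≃-refl

  to-of : ∀ x -> toℂ(D.ofℝ x)~ cx(real x)
  to-of x = mk≈ ≃-refl ≃-refl

  to-∣∣² : ∀ z -> real D.∣ z ∣² ≈ ∥ toℂ z ∥ * ∥ toℂ z ∥
  to-∣∣² z = trans(≃-refl{real D.∣ z ∣²})(sym(∥-sq(toℂ z)))

  limit⇒ : ∀ f l -> f D.⟶ l -> Limc(\n -> toℂ(f n))(toℂ l)
  limit⇒ f l lim = record{ evt = λ { (real ε)0<ε -> let N , near = lim ε(lt⁻ D.0ʳ ε 0<ε)in N , \n N≤n ->
   sq-≤(<≤ 0<ε)(rs≤(to-∣∣²(f n D.-ᶜ l)∙ *₂(∥-cg(to--(f n)l))(∥-cg(to--(f n)l)))(<≤(lt D.∣ f n D.-ᶜ l ∣²(ε D.*ʳ ε)(near n N≤n)))) } }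

  limit⇐ : ∀ f l -> Limc(\n -> toℂ(f n))(toℂ l)-> f D.⟶ l
  limit⇐ f l lim ε 0<ε = let N , near = evt lim(half(real ε))(half-pos ε>0)in N , \n N≤n ->
   lt⁻ D.∣ f n D.-ᶜ l ∣²(ε D.*ʳ ε)(≤<tr(e≤(to-∣∣²(f n D.-ᶜ l)∙ *₂(∥-cg(to--(f n)l))(∥-cg(to--(f n)l)))⨾ *-mono(0≤∥ _)(<≤(half-pos ε>0))(near n N≤n)(near n N≤n))(<-respʳ(*₂(h+h(real ε))(h+h(real ε)))(lin<(*-pos(half-pos ε>0)(half-pos ε>0)⊹< 0≤*(0≤# 2)(0≤sq(half(real ε))))(alg "(a+a)(a+a)-aa=aa+2(aa)-(0+0)"))))
   where
   ε>0 : 0# < real ε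
   ε>0 = lt D.0ʳ ε 0<ε

  to-∑ : ∀ a n -> toℂ(D.partialSum a n)~ ∑ᶜ n(\i -> toℂ(a i))
  to-∑ a zero    = mk≈ ≃-refl ≃-refl
  to-∑ a(suc n)= trc(to-+(D.partialSum a n)(a n))(+ʳc(to-∑ a n))

  sum⇒ : ∀ a s -> D.HasSum a s -> Sums(\i -> toℂ(a i))(toℂ s)
  sum⇒ a s p = Limc-ext(to-∑ a)(limit⇒(D.partialSum a)s p)

  sum⇐ : ∀ a s -> Sums(\i -> toℂ(a i))(toℂ s)-> D.HasSum a s
  sum⇐ a s p = limit⇐(D.partialSum a)s(Limc-ext(\n -> symc(to-∑ a n))p)

 open Rationals using (over-1; times-inverse)

 opaque
  to-# : ∀ n -> real(D.fromℕʳ n)≈ # n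
  to-# n = trans(rfx(E.cong(\p -> real(D.ι p))(over-1 n)))(sym(from-ι em n))

  ι-* : ∀ p q -> real(D.ι p)* real(D.ι q)≈ real(D.ι(p Q.* q))
  ι-* p q = mk≃(pointwise{D.ι p D.*ʳ D.ι q}{D.ι(p Q.* q)} \_ -> E.refl)

  ι-/ : ∀ a n .{{_ : Nz n}} -> real(D.ι(Z.+ a Q./ n))≈ # a * inv(# n)
  ι-/ a(suc n)= trans(alg! "a=a1" (real(D.ι(Z.+ a Q./ suc n))))(*ˡ(sym(inv-r{# suc n}(0<#s n)))∙ alg! "a((1+b)c)=a(1+b)c" (real(D.ι(Z.+ a Q./ suc n)))(# n)(inv(# suc n))∙
   *ʳ(*ˡ(from-ι em(suc n))∙ ι-*(Z.+ a Q./ suc n)_ ∙ rfx(E.cong(\p -> real(D.ι p))(times-inverse(Z.+ a)n))∙ to-# a))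

 open import Data.Nat using (_!)

 opaque
  factorial⁻¹ : ∀ n -> real(D.invFactorial n)≈ inv(#(n !))
  factorial⁻¹ n = trans(ι-/ 1(n !){{n N.!≢0}})(alg "#1a=a")

  factorial⁻¹-suc : ∀ n -> real(D.invFactorial(suc n))≈ real(D.invFactorial n)* inv(# suc n)
  factorial⁻¹-suc n = trans(factorial⁻¹(suc n))(sym(inv-uniq(*ʳ(#-*(suc n)(n !))∙ alg "(1+a)b(cd)=(1+a)d(bc)" ∙
   *₂(inv-r(0<#s n))(inv-r(0<#(n !){{n N.!≢0}}))∙ alg "1(1)=1"))∙ *ʳ(sym(factorial⁻¹ n)))

  regroup : ∀ z p f i -> z *c p *c(f *c i)~ p *c f *c(z *c i)
  regroup z p f i =(algc "ab(cd)=bc(ad)")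

  to-1* : ∀ p f -> p ≡ D.1ᶜ -> real f ≈ 1# -> toℂ(p D.*ᶜ D.ofℝ f)~ 1c
  to-1* p f q r = trc(to-* p(D.ofℝ f))(*₂c(≡c(E.cong toℂ q)⊙ to-of D.1ʳ)(to-of f ⊙ of-cong r)⊙ algc "1(1)=1")

  pow-0 : ∀ z -> z D.^ᶜ zero ≡ D.1ᶜ
  pow-0 z = E.refl
  to-eterm-0 : ∀ z -> toℂ((z D.^ᶜ zero)D.*ᶜ D.ofℝ(D.invFactorial zero))~ 1c
  to-eterm-0 z = to-1*(z D.^ᶜ zero)(D.invFactorial zero)(pow-0 z)(factorial⁻¹ zero ∙ alg "a=#1a" ∙ inv-r(0<#s 0))

  to-eterm : ∀ z n -> toℂ((z D.^ᶜ n)D.*ᶜ D.ofℝ(D.invFactorial n))~ eterm(toℂ z)n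
  to-eterm-suc : ∀ z n f i g p p⁺ -> p⁺ ≡ z D.*ᶜ p -> real g ≈ real f * i -> toℂ(p D.*ᶜ D.ofℝ f)~ eterm(toℂ z)n -> toℂ(p⁺ D.*ᶜ D.ofℝ g)~ eterm(toℂ z)n *c(toℂ z *c cx i)
  to-eterm-suc z n f i g p _ E.refl q r = trc(to-*(z D.*ᶜ p)(D.ofℝ g))(*₂c(to-* z p)(to-of g ⊙ of-cong q ⊙ of-*(real f)i)⊙
   regroup(toℂ z)(toℂ p)(cx(real f))(cx i)⊙ *ʳc(*ˡc(symc(to-of f))⊙ symc(to-* p(D.ofℝ f))⊙ r))
  to-eterm z zero    = to-eterm-0 z
  to-eterm z(suc n)= to-eterm-suc z n(D.invFactorial n)(inv(# suc n))(D.invFactorial(suc n))(z D.^ᶜ n)(z D.^ᶜ suc n)E.refl(factorial⁻¹-suc n)(to-eterm z n)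

  exp⇒ : ∀ z w -> D.IsExp z w -> toℂ w ~ exp(toℂ z)
  exp⇒ z w p = Lim-un(Limc-ext(\n -> ∑c-ext n(to-eterm z))(sum⇒ _ w p))(exp-sums(toℂ z))

  exp⇐ : ∀ z w -> toℂ w ~ exp(toℂ z)-> D.IsExp z w
  exp⇐ z w p = sum⇐ _ w(Limc-ext(\n -> ∑c-ext n(\i -> symc(to-eterm z i)))(Limc-resp(symc p)(exp-sums(toℂ z))))

  expʳ⇒ : ∀ x y -> D.IsExpʳ x y -> real y ≈ e(real x)
  expʳ⇒ x y p = re≈(symc(to-of y)⊙ exp⇒(D.ofℝ x)(D.ofℝ y)p ⊙ exp-cong(to-of x)⊙ exp-of(real x))

  log⇒ : ∀ x y -> D.IsLog x y -> real y ≈ log(real x)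
  log⇒ x y p = trans(sym(log-e(real y)))(log-cong(0<e(real y))(sym(expʳ⇒ y x p)))

  log⇐ : ∀ x y -> 0# < real x -> real y ≈ log(real x)-> D.IsLog x y
  log⇐ x y 0<x p = exp⇐(D.ofℝ y)(D.ofℝ x)(to-of x ⊙ of-cong(sym(e-log 0<x)∙ e-cong(sym p))⊙ symc(exp-of(real y))⊙ exp-cong(symc(to-of y)))

  log-fromℕ⇒ : ∀ n y -> D.IsLog(D.fromℕʳ(suc n))y -> real y ≈ lg(suc n)
  log-fromℕ⇒ n y p = trans(log⇒(D.fromℕʳ(suc n))y p)(log-cong(<-respʳ(sym(to-#(suc n)))(0<#s n))(to-#(suc n)))

  exponent : ∀ s y m -> real y ≈ lg m -> toℂ(D.-ᶜ(s D.*ᶜ D.ofℝ y))~ -c(toℂ s *c cx(lg m))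
  exponent s y m p = trc(to-neg(s D.*ᶜ D.ofℝ y))(-₁c(to-* s(D.ofℝ y)⊙ *ˡc(to-of y ⊙ of-cong p)))

  pw⇐ : ∀ n s w -> toℂ w ~ pw(suc n)(toℂ s)-> D.IsNegPow(suc n)s w
  pw⇐ n s w p = un(lg(suc n)), log⇐(D.fromℕʳ(suc n))(un(lg(suc n)))(<-respʳ(sym(to-#(suc n)))(0<#s n))(real-un(lg(suc n))∙ log-cong(0<#s n)(sym(to-#(suc n)))),
   exp⇐(D.-ᶜ(s D.*ᶜ D.ofℝ(un(lg(suc n)))))w(p ⊙ exp-cong(symc(exponent s(un(lg(suc n)))(suc n)(real-un(lg(suc n))))))

 module _ (a : ℕ -> D.ℂ) (c : ℕ -> ℂ) (to-c : ∀ n -> toℂ (a n) ~ c n) (bdd : ∀ n -> ∥ c n ∥ ≤ 1#) where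
  opaque
   dirichlet⇐ : ∀ s z -> 1# < real(D.re s)-> toℂ z ~ D c bdd 0(toℂ s)-> D.IsDirichletSum a s z
   dirichlet⇐ s z 1<σ q = p ,(\n -> pw⇐ n s(p n)(to-from(pw(suc n)(toℂ s)))),
    sum⇐(\n -> a(suc n)D.*ᶜ p n)z(Limc-resp(symc q)(Limc-ext(\N -> ∑c-ext N \n -> symc(to-*(a(suc n))(p n)⊙ *₂c(to-c(suc n))(to-from(pw(suc n)(toℂ s)))))(D-limit c bdd 1<σ)))
    where
    p : ℕ -> D.ℂ
    p n = fromℂ(pw(suc n)(toℂ s))

module Limsup (em : ExcludedMiddle 0ℓ) where
 open RealOrder using (Real; real; un; mk≃; ≃-refl)
 open Translation em
 open Reals 𝓡 hiding (em)
 open Theory 𝓡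

 trivial : D.DirichletCharacter 1
 trivial = record
  { χ = \_ -> D.1ᶜ ; periodic = \_ -> eqc⁻ D.1ᶜ D.1ᶜ reflc
  ; mult = \_ _ -> eqc⁻ D.1ᶜ(D.1ᶜ D.*ᶜ D.1ᶜ)(symc(to-* D.1ᶜ D.1ᶜ ⊙ *₂c(to-of D.1ʳ)(to-of D.1ʳ)⊙ algc "1(1)=1" ⊙ symc(to-of D.1ʳ)))
  ; one = eqc⁻ D.1ᶜ D.1ᶜ reflc
  ; vanish = \n ncop -> absurd(ncop \(_ , d∣1)-> N.∣1⇒≡1 d∣1) }

 module _ {q : ℕ} (1<q : 1 N.< q) (X : D.DirichletCharacter q) where
  χ' : Z.ℤ -> ℂ
  χ' n = toℂ(D.χ X n)

  opaque
   χ-shift : ∀ n k -> χ'(n Z.+ Z.+(k N.* q))~ χ' n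
   χ-shift n zero    = ≡c(E.cong χ'(Z.+-identityʳ n))
   χ-shift n(suc k)= trc(≡c(E.cong χ'(E.trans(E.cong(\m -> n Z.+ Z.+ m)(N.+-comm q(k N.* q)))(E.sym(Z.+-assoc n(Z.+(k N.* q))(Z.+ q))))))
    (eqc(D.χ X(n Z.+ Z.+(k N.* q)Z.+ Z.+ q))(D.χ X(n Z.+ Z.+(k N.* q)))(D.periodic X(n Z.+ Z.+(k N.* q)))⊙ χ-shift n k)
   χ-negative : ∀ k -> χ'(Z.+(suc k N.* q N.∸ suc k))~ χ' Z.-[1+ k ]
   χ-negative k = trc(≡c(E.cong χ'(E.sym(Z.⊖-≥(N.m≤m*n(suc k)q{{N.>-nonZero(N.<-trans(s≤s z≤n)1<q)}})))))(χ-shift Z.-[1+ k ](suc k))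
   coprime-negative : ∀ k -> Coprime(suc k)q -> Coprime(suc k N.* q N.∸ suc k)q
   coprime-negative k cop{d}(d∣ , d∣q)= cop(N.∣m+n∣m⇒∣n(E.subst(d ∣_)(E.sym(N.m∸n+n≡m(N.m≤m*n(suc k)q{{N.>-nonZero(N.<-trans(s≤s z≤n)1<q)}})))(N.∣n⇒∣m*n(suc k)d∣q))d∣ , d∣q)
   nontrivial : D.Primitive X -> ∃ \n -> Coprime n q × ¬(χ'(Z.+ n)~ 1c)
   nontrivial prim = go em
    where
    go : Dec(∃ \n -> Coprime n q × ¬(χ'(Z.+ n)~ 1c))-> ∃ \n -> Coprime n q × ¬(χ'(Z.+ n)~ 1c)
    go(yes p)= p
    go(no np)= absurd(prim 1(N.1∣ q)1<q trivial \n cop -> eqc⁻(D.χ X n)D.1ᶜ(on-integers n cop ⊙ symc(to-of D.1ʳ)))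
     where
     on-naturals : ∀ n -> Coprime n q -> Dec(χ'(Z.+ n)~ 1c)-> χ'(Z.+ n)~ 1c
     on-naturals n cop(yes p)= p
     on-naturals n cop(no p)  = absurd(np(n , cop , p))
     on-integers : ∀ n -> Z.Coprime n(Z.+ q)-> χ' n ~ 1c
     on-integers(Z.+ n)     cop = on-naturals n cop em
     on-integers Z.-[1+ k ] cop = trc(symc(χ-negative k))(on-naturals _(coprime-negative k cop)em)

  character : D.Primitive X -> Character q
  character prim = record
   { c = \n -> χ'(Z.+ n)
   ; c-* = \m n -> ≡c(E.cong χ'(Z.pos-* m n))⊙ eqc _(D.χ X(Z.+ m)D.*ᶜ D.χ X(Z.+ n))(D.mult X(Z.+ m)(Z.+ n))⊙ to-*(D.χ X(Z.+ m))(D.χ X(Z.+ n))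
   ; periodic = \n -> eqc(D.χ X(Z.+(n N.+ q)))(D.χ X(Z.+ n))(D.periodic X(Z.+ n))
   ; c-1 = eqc(D.χ X(Z.+ 1))D.1ᶜ(D.one X)⊙ to-of D.1ʳ
   ; vanish = \n ncop -> eqc(D.χ X(Z.+ n))D.0ᶜ(D.vanish X(Z.+ n)ncop)⊙ to-of D.0ʳ
   ; a₀ = fst(nontrivial prim); a₀-cop = fst(snd(nontrivial prim)); a₀≉1 = snd(snd(nontrivial prim)) }

 opaque
  to-*ʳ : ∀ x y{x' y'} -> real x ≈ x' -> real y ≈ y' -> real(x D.*ʳ y)≈ x' * y'
  to-*ʳ x y p r = *₂{real x}{_}{real y} p r

  to-harmonic : ∀ n -> real(D.harmonic n)≈ harm n
  to-harmonic zero    = ≃-refl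
  to-harmonic(suc n)= trans(≃-refl{real(D.harmonic(suc n))})(+₂(to-harmonic n)(ι-/ 1(suc n)∙ alg "#1a=a"))

  euler-constant : ∀ γ -> D.IsEulerConstant γ -> ∀ n -> real γ + lg(suc n)≤ harm(suc n)
  euler-constant γ(ℓ , logs , lim)n = lin(limit-≤{\n -> harm(suc n)- lg(suc n)}{real γ} harm-lg-decreasing
   (Limc-ext(\n -> to-of(D.harmonic(suc n)D.-ʳ ℓ n)⊙ of-cong(+₂(to-harmonic(suc n))(-₁(log-fromℕ⇒ n(ℓ n)(logs n)))))(Limc-resp(to-of γ)(limit⇒(\n -> D.ofℝ(D.harmonic(suc n)D.-ʳ ℓ n))(D.ofℝ γ)lim)))n)
   (alg "a-(b+c)=a-c-b")

  zeta⇐ : ∀ s z -> 1# < real(D.re s)-> toℂ z ~ D(Mult.fn one)(Mult.bdd one)0(toℂ s)-> D.Zeta s z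
  zeta⇐ s z 1<σ p = lt⁻ D.1ʳ(D.re s)1<σ , dirichlet⇐(\_ -> D.1ᶜ)(\_ -> 1c)(\_ -> to-of D.1ʳ)(Mult.bdd one)s z 1<σ p

  square-bound : ∀ z h ε -> 0# ≤ real ε -> ∥ toℂ z ∥ ≤ real ε * ∥ toℂ h ∥ -> D.∣ z ∣² D.≤ʳ(ε D.*ʳ ε)D.*ʳ D.∣ h ∣²
  square-bound z h ε 0≤ε p = le⁻ D.∣ z ∣²((ε D.*ʳ ε)D.*ʳ D.∣ h ∣²)(e≤(to-∣∣² z)⨾ *-mono(0≤∥ _)(0≤* 0≤ε(0≤∥ _))p p ⨾
   e≤(alg "ab(ab)=aa(bb)" ∙ *ˡ{real ε * real ε}(sym(to-∣∣² h))))

  increment : ∀ z w h -> toℂ(z D.-ᶜ w D.-ᶜ D.0ᶜ D.*ᶜ h)~ toℂ z -c toℂ w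
  increment z w h = trc(to--(z D.-ᶜ w)(D.0ᶜ D.*ᶜ h))(+₂c(to-- z w)(-₁c(to-* D.0ᶜ h ⊙ *ʳc(to-of D.0ʳ)))⊙ algc "a-b-0c=a-b")

  critical⇐ : ∀ s -> 1# < real(D.re s)-> D(Mult.fn one)(Mult.bdd one)1(toℂ s)~ 0c -> D.CriticalPoint s
  critical⇐ s 1<σ crit = ζ s , zeta⇐ s(ζ s)1<σ(to-from _), \ε 0<ε -> choose′ ε(lt D.0ʳ ε 0<ε)(stationary(Mult.fn one)(Mult.bdd one){toℂ s} 1<σ crit(real ε)(lt D.0ʳ ε 0<ε))
   where
   ζ : D.ℂ -> D.ℂ
   ζ s = fromℂ(D(Mult.fn one)(Mult.bdd one)0(toℂ s))
   choose′ : ∀ ε -> 0# < real ε ->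
    (∃ \δ -> 0# < δ ×(∀ s' -> ∥ s' -c toℂ s ∥ ≤ δ -> 1# < re s' × ∥ D(Mult.fn one)(Mult.bdd one)0 s' -c D(Mult.fn one)(Mult.bdd one)0(toℂ s)∥ ≤ real ε * ∥ s' -c toℂ s ∥))->
    ∃ \δ -> D.0ʳ D.<ʳ δ ×(∀ h -> D.∣ h ∣² D.<ʳ δ D.*ʳ δ -> ∃ \w -> D.Zeta(s D.+ᶜ h)w × D.∣(w D.-ᶜ ζ s)D.-ᶜ D.0ᶜ D.*ᶜ h ∣² D.≤ʳ(ε D.*ʳ ε)D.*ʳ D.∣ h ∣²)
   choose′ ε 0<ε(real δ , 0<δ , near)= δ , lt⁻ D.0ʳ δ 0<δ , \h h< -> let
    shift : toℂ(s D.+ᶜ h)-c toℂ s ~ toℂ h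
    shift = trc(+ʳc(to-+ s h))(algc "a+b-a=b")
    close : ∥ toℂ(s D.+ᶜ h)-c toℂ s ∥ ≤ real δ
    close = ≤t(e≤(∥-cg shift))(sq-≤(<≤ 0<δ)(rs≤(to-∣∣² h)(<≤(lt D.∣ h ∣²(δ D.*ʳ δ)h<))))
    right , small = near(toℂ(s D.+ᶜ h))close
    in ζ(s D.+ᶜ h), zeta⇐(s D.+ᶜ h)(ζ(s D.+ᶜ h))right(to-from _),
     square-bound((ζ(s D.+ᶜ h)D.-ᶜ ζ s)D.-ᶜ D.0ᶜ D.*ᶜ h)h ε(<≤ 0<ε)(e≤(∥-cg(increment(ζ(s D.+ᶜ h))(ζ s)h ⊙ +₂c(to-from _)(-₁c(to-from _))))⨾ small ⨾ *≤(<≤ 0<ε)(e≤(∥-cg shift)))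

 -- A quantity with values near or above the positive number E at arbitrarily large heights.
 module _ (V : D.ℝ -> D.ℝ -> Set) (E : D.ℝ) (0≤E : 0# ≤ real E)
  (large : ∀ ε -> 0# < ε -> ∀ T -> ∃ \t -> ∃ \y -> T D.<ʳ t × V t y × real E * e(- ε)≤ real y)where
  opaque
   bound≥E : ∀ u -> D.EventualUpperBound V(D.fin u)-> real E ≤ real u
   bound≥E u(T , p)= ≤-by-e 0≤E \ε 0<ε -> let t , y , T<t , val , q = large ε 0<ε T in ≤t q(le y u(p t y T<t val))
   bound≢-∞ : ¬ D.EventualUpperBound V D.-∞
   bound≢-∞(T , p)= let t , y , T<t , val , _ = large 1# 0<1 T in p t y T<t val
   limsup : ∃ \L -> D.IsLimsup V L × D.fin E D.≤̄ L
   limsup = go em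
    where
    go : Dec(∃ \u -> D.EventualUpperBound V(D.fin u))-> ∃ \L -> D.IsLimsup V L × D.fin E D.≤̄ L
    go(no np)= D.+∞ ,(lower , greatest), tt
     where
     lower : ∀ u -> D.EventualUpperBound V u -> D.+∞ D.≤̄ u
     lower D.-∞      p = bound≢-∞ p
     lower D.+∞      p = tt
     lower(D.fin u)p = np(u , p)
     greatest : ∀ l ->(∀ u -> D.EventualUpperBound V u -> l D.≤̄ u)-> l D.≤̄ D.+∞
     greatest D.-∞      _ = tt
     greatest D.+∞      _ = tt
     greatest(D.fin l)_ = tt
    go(yes(u₀ , p₀))= finite(infimum(\x -> D.EventualUpperBound V(D.fin(un x)))(real u₀)(real E)p₀ λ { (real x)p -> bound≥E x p })
     where
     finite :(∃ \m ->(∀ x -> D.EventualUpperBound V(D.fin(un x))-> m ≤ x)×(∀ l ->(∀ x -> D.EventualUpperBound V(D.fin(un x))-> l ≤ x)-> l ≤ m))-> ∃ \L -> D.IsLimsup V L × D.fin E D.≤̄ L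
     finite(real m , low , great)= D.fin m ,(lower , greatest), le⁻ E m(great(real E)λ { (real x)p -> bound≥E x p })
      where
      lower : ∀ u -> D.EventualUpperBound V u -> D.fin m D.≤̄ u
      lower D.-∞      p = bound≢-∞ p
      lower D.+∞      p = tt
      lower(D.fin u)p = le⁻ m u(low(real u)p)
      greatest : ∀ l ->(∀ u -> D.EventualUpperBound V u -> l D.≤̄ u)-> l D.≤̄ D.fin m
      greatest D.-∞      q = tt
      greatest D.+∞      q = q(D.fin u₀)p₀
      greatest(D.fin l)q = le⁻ l m(great(real l)λ { (real x)p -> le l x(q(D.fin x)p) })

 module _ {q : ℕ} (1<q : 1 N.< q) (X : D.DirichletCharacter q) (prim : D.Primitive X) where
  open Character (character 1<q X prim) using (c)
  bound : ∀ n -> ∥ c n ∥ ≤ 1#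
  bound = Mult.bdd(Balanced.base(balanced 1<q(character 1<q X prim)))

  opaque
   ratio⇐ : ∀ s y -> 1# < real(D.re s)-> e(e 1#)≤ real(D.im s)-> real y ≈ ∥ D c bound 0(toℂ s)∥ / log(log(real(D.im s)))-> D.IsRatio X s y
   ratio⇐ s y 1<σ ee≤ p = z , un ∥ D c bound 0(toℂ s)∥ , un(log(real(D.im s))), un(log(log(real(D.im s)))),
    (lt⁻ D.1ʳ(D.re s)1<σ , dirichlet⇐(\n -> D.χ X(Z.+ n))c(\_ -> reflc)bound s z 1<σ(to-from _)),
    (le⁻ D.0ʳ(un ∥ D c bound 0(toℂ s)∥)(≤rs(sym(real-un _))(0≤∥ _)), eq⁻ _ D.∣ z ∣²(sq(un ∥ D c bound 0(toℂ s)∥)(real-un _))),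
    log⇐(D.im s)(un(log(real(D.im s))))(<≤tr(0<e _)ee≤)(real-un _),
    log⇐(un(log(real(D.im s))))(un(log(log(real(D.im s)))))(<-respʳ(sym(real-un _))0<log)(real-un _ ∙ log-cong 0<log(sym(real-un _))),
    (\ℓℓ≈0 -> <⇒≉ 0<loglog(sym(real-un _)∙ eq _ D.0ʳ ℓℓ≈0)),
    eq⁻ _(un ∥ D c bound 0(toℂ s)∥)(product y(un(log(log(real(D.im s)))))p(real-un _))
    where
    z : D.ℂ
    z = fromℂ(D c bound 0(toℂ s))
    log≥ : e 1# ≤ log(real(D.im s))
    log≥ = ≤-log(<≤tr(0<e _)ee≤)ee≤
    0<log : 0# < log(real(D.im s))
    0<log = <≤tr(0<e 1#)log≥
    0<loglog : 0# < log(log(real(D.im s)))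
    0<loglog = <≤tr 0<1(≤-log 0<log log≥)
    sq : ∀ r -> real r ≈ ∥ D c bound 0(toℂ s)∥ -> real(r D.*ʳ r)≈ real D.∣ z ∣²
    sq r q = trans(*₂{real r}{_}{real r} q q)(*₂(∥-cg(symc(to-from _)))(∥-cg(symc(to-from _)))∙ sym(to-∣∣² z))
    product : ∀ y ℓℓ -> real y ≈ ∥ D c bound 0(toℂ s)∥ / log(log(real(D.im s)))-> real ℓℓ ≈ log(log(real(D.im s)))-> real(y D.*ʳ ℓℓ)≈ real(un ∥ D c bound 0(toℂ s)∥)
    product y ℓℓ q r = trans(*₂{real y}{_}{real ℓℓ} q r)(/-* 0<loglog ∙ sym(real-un _))
   large-ratio : ∀ γ ->(∀ n -> γ + lg(suc n)≤ harm(suc n))-> ∀ ε -> 0# < ε -> ∀ T -> ∃ \t -> ∃ \y -> T D.<ʳ t × D.CriticalRatio X t y × e γ *(# totient q * inv(# q))* e(- ε)≤ real y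
   large-ratio γ γ-≤ ε 0<ε T = go(large-values 1<q(character 1<q X prim)γ γ-≤ ε 0<ε(real T + 1#))
    where
    go :(∃ \ρ -> 1# < re ρ × D(Mult.fn one)(Mult.bdd one)1 ρ ~ 0c × real T + 1# ≤ im ρ × e(e 1#)≤ im ρ × e γ *(# totient q * inv(# q))* e(- ε)* log(log(im ρ))≤ ∥ D c bound 0 ρ ∥)->
     ∃ \t -> ∃ \y -> T D.<ʳ t × D.CriticalRatio X t y × e γ *(# totient q * inv(# q))* e(- ε)≤ real y
    go(ρ , 1<σ , crit , T<t , ee≤ , big)= D.im s , y , lt⁻ T(D.im s)(<≤tr(lin< 0<1(alg! "a+1-a=1-0" (real T)))(≤rs(sym im≈')T<t)),
     (s , critical⇐ s 1<s(D-cong 1(Mult.fn one)(Mult.bdd one)1<s(to-from ρ)⊙ crit), lt⁻ D.1ʳ(D.re s)1<s , eq⁻(D.im s)(D.im s)refl , ratio⇐ s y 1<s ee≤s(real-un _)),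
     ≤rs(sym(real-un _))(≤-/(<≤tr 0<1(≤-log(<≤tr(0<e 1#)log≥)log≥))((*≤(0≤*(0≤*(<≤(0<e γ))(0≤*(0≤#(totient q))(<≤(inv⁺(0<# q{{N.>-nonZero(N.<-trans(s≤s z≤n)1<q)}})))))(<≤(0<e(- ε)))))(e≤(log-cong(<≤tr(0<e 1#)log≥)(log-cong(<≤tr(0<e _)ee≤s)im≈')))⨾ big ⨾ e≤(∥-cg(symc(D-cong 0 c bound 1<s(to-from ρ))))))
     where
     s : D.ℂ
     s = fromℂ ρ
     im≈' : real(D.im s)≈ im ρ
     im≈' = im≈(to-from ρ)
     1<s : 1# < real(D.re s)
     1<s = <-respʳ(sym(re≈(to-from ρ)))1<σ
     ee≤s : e(e 1#)≤ real(D.im s)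
     ee≤s = ≤rs(sym im≈')ee≤
     y : D.ℝ
     y = un(∥ D c bound 0(toℂ s)∥ / log(log(real(D.im s))))
     log≥ : e 1# ≤ log(real(D.im s))
     log≥ = ≤-log(<≤tr(0<e _)ee≤s)ee≤s
   limsup≥ : ∀ γ eγ r -> D.IsEulerConstant γ -> D.IsExpʳ γ eγ -> real r ≈ # totient q * inv(# q)-> ∃ \L -> D.IsLimsup(D.CriticalRatio X)L × D.fin(eγ D.*ʳ r)D.≤̄ L
   limsup≥ γ eγ r isγ iseγ density = limsup(D.CriticalRatio X)(eγ D.*ʳ r)(≤rs(sym value)(0≤*(<≤(0<e(real γ)))(0≤*(0≤#(totient q))(<≤(inv⁺(0<# q{{N.>-nonZero(N.<-trans(s≤s z≤n)1<q)}}))))))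
    \ε 0<ε T -> let t , y , T<t , val , big = large-ratio(real γ)(euler-constant γ isγ)ε 0<ε T in t , y , T<t , val , e≤(*ʳ value)⨾ big
    where
    value : real(eγ D.*ʳ r)≈ e(real γ)*(# totient q * inv(# q))
    value = to-*ʳ eγ r(expʳ⇒ γ eγ iseγ)density

 opaque
  φ≡totient : ∀ q -> D.φ q ≡ totient q
  φ≡totient q = E.refl

  density : ∀ q .{{_ : Nz q}} k -> k ≡ totient q -> real(D.ι(Z.+ k Q./ q))≈ # totient q * inv(# q)
  density q k E.refl = ι-/ k q

module _ (em : ExcludedMiddle 0ℓ) {q : ℕ} (2<q : 2 N.< q) (X : D.DirichletCharacter q) (prim : D.Primitive X) where
 open Limsup em
 open Translation em
 critical-limsup : .{{_ : Nz q}} -> ∀ γ eγ -> D.IsEulerConstant γ -> D.IsExpʳ γ eγ -> ∃ \L -> D.IsLimsup(D.CriticalRatio X)L × D.fin(eγ D.*ʳ D.ι(Z.+ D.φ q Q./ q))D.≤̄ L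
 critical-limsup γ eγ isγ iseγ = limsup≥(N.<-trans(N.n<1+n 1)2<q)X prim γ eγ(D.ι(Z.+ D.φ q Q./ q))isγ iseγ(density q(D.φ q)(φ≡totient q))

open import Defs
open import Data.Integer using (+_)
open import Data.Nat using (NonZero; _<_)
open import Data.Product using (∃-syntax)
open import Data.Rational using (_/_)

theorem2 : ExcludedMiddle 0ℓ →
    (q : ℕ) .{{_ : NonZero q}} → 2 < q →
    (X : DirichletCharacter q) → Primitive X →
    (C₀ eC₀ : ℝ) → IsEulerConstant C₀ → IsExpʳ C₀ eC₀ →
    ∃[ L ] IsLimsup (CriticalRatio X) L × fin (eC₀ *ʳ ι (+ φ q / q)) ≤̄ L
theorem2 em q 2<q X prim = critical-limsup em 2<q X prim
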